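{- Neither of the implications $\mathrm{CCC}_3\to\mathrm{CCC}_2$ and $\mathrm{CCC}_2\to\mathrm{CCC}_1$ (both provable in $\mathsf{ZF}$) is reversible in $\mathsf{ZF}+\mathsf{DC}$. That is: (1) it is consistent with $\mathsf{ZF}+\mathsf{DC}$ that there exists a notion of forcing which satisfies $\mathrm{CCC}_1$ but not $\mathrm{CCC}_2$; and (2) it is consistent with $\mathsf{ZF}+\mathsf{DC}$ that there exists a notion of forcing which satisfies $\mathrm{CCC}_2$ but not $\mathrm{CCC}_3$.
   Context: Consistency statements are relative to the consistency of $\mathsf{ZFC}$ (equivalently, of $\mathsf{ZF}$). $\mathsf{DC}$ is the Principle of Dependent Choice. A notion of forcing (or forcing) is a preordered set $\mathbb P$ with a maximum $\mathbf 1_{\mathbb P}$. Conditions $p,q\in\mathbb P$ are compatible if they have a common extension (some $r\le p,q$), and incompatible otherwise. A set $A\subseteq\mathbb P$ is an antichain if any two distinct elements of $A$ are incompatible; it is a maximal antichain if it is maximal under inclusion among antichains. A set $D\subseteq\mathbb P$ is predense if every $p\in\mathbb P$ is compatible with some $q\in D$. $\mathrm{CCC}_1$: every maximal antichain in $\mathbb P$ is countable. $\mathrm{CCC}_2$: every antichain in $\mathbb P$ is countable. $\mathrm{CCC}_3$: every predense subset of $\mathbb P$ contains a countable predense subset. $\mathrm{CCC}_i\to\mathrm{CCC}_j$ means that every notion of forcing satisfying $\mathrm{CCC}_i$ satisfies $\mathrm{CCC}_j$. -}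

module Defs where

open import Data.Nat using (ℕ; zero; suc; _+_)
open import Data.Fin using (Fin; zero; suc; lift) renaming (_↑ʳ_ to infixr 40 _↑ʳ_)
open import Data.Fin.Patterns using (0F; 1F; 2F; 3F; 4F)
open import Data.List using (List; []; _∷_; map)
open import Data.List.Membership.Propositional using (_∈_)
open import Data.Vec.Functional using () renaming (_∷_ to _◂_)
open import Function using (id)
open import Level using (0ℓ)
open import Relation.Nullary using (¬_)
open import Relation.Unary using (Pred; _∪_; ｛_｝)

private
  variable
    m n : ℕ

infix  30 _∈′_ _≐_
infix  25 ¬′_
infixr 20 _∧′_
infixr 15 _∨′_
infixr 10 _⇒′_
infix   8 _⇔′_
infixr  5 ∀′_ ∃′_ ∀′∈[_]_ ∃′∈[_]_

-- First-order formulas over {∈} with equality.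
-- Free variables are de Bruijn indices: in the body of a quantifier 0F is
-- the bound variable, and a variable x from outside k binders is k ↑ʳ x.
data Formula (n : ℕ) : Set where
  _∈′_ _≐_ : Fin n → Fin n → Formula n
  ⊥′       : Formula n
  _⇒′_     : Formula n → Formula n → Formula n
  ∀′_      : Formula (suc n) → Formula n

Sentence : Set
Sentence = Formula 0

-- The logic is classical, so the other connectives are abbreviations.
¬′_ : Formula n → Formula n
¬′ φ = φ ⇒′ ⊥′

_∧′_ _∨′_ _⇔′_ : Formula n → Formula n → Formula n
φ ∧′ ψ = ¬′ (φ ⇒′ ¬′ ψ)
φ ∨′ ψ = ¬′ φ ⇒′ ψ
φ ⇔′ ψ = (φ ⇒′ ψ) ∧′ (ψ ⇒′ φ)

∃′_ : Formula (suc n) → Formula n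
∃′ φ = ¬′ (∀′ ¬′ φ)

∀′∈[_]_ ∃′∈[_]_ : Fin n → Formula (suc n) → Formula n
∀′∈[ x ] φ = ∀′ (0F ∈′ 1 ↑ʳ x ⇒′ φ)
∃′∈[ x ] φ = ∃′ (0F ∈′ 1 ↑ʳ x ∧′ φ)

-- The only terms are variables, so renaming is also substitution.
rename : (Fin m → Fin n) → Formula m → Formula n
rename ρ (x ∈′ y) = ρ x ∈′ ρ y
rename ρ (x ≐ y)  = ρ x ≐ ρ y
rename ρ ⊥′       = ⊥′
rename ρ (φ ⇒′ ψ) = rename ρ φ ⇒′ rename ρ ψ
rename ρ (∀′ φ)   = ∀′ rename (lift 1 ρ) φ

weaken : Formula n → Formula (suc n)
weaken = rename suc

_[_] : Formula (suc n) → Fin n → Formula n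
φ [ x ] = rename (x ◂ id) φ

closure : ∀ n → Formula n → Sentence
closure zero    φ = φ
closure (suc n) φ = closure n (∀′ φ)

Theory : Set₁
Theory = Pred Sentence 0ℓ

infix 4 _∣_⊢_ _proves_

data _∣_⊢_ (T : Theory) {n : ℕ} (Γ : List (Formula n)) : Formula n → Set where
  axiom : ∀ {σ} → T σ → T ∣ Γ ⊢ rename (λ ()) σ
  hyp   : ∀ {φ} → φ ∈ Γ → T ∣ Γ ⊢ φ
  ⇒I    : ∀ {φ ψ} → T ∣ φ ∷ Γ ⊢ ψ → T ∣ Γ ⊢ φ ⇒′ ψ
  ⇒E    : ∀ {φ ψ} → T ∣ Γ ⊢ φ ⇒′ ψ → T ∣ Γ ⊢ φ → T ∣ Γ ⊢ ψ
  raa   : ∀ {φ} → T ∣ ¬′ φ ∷ Γ ⊢ ⊥′ → T ∣ Γ ⊢ φ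
  ∀I    : ∀ {φ} → T ∣ map weaken Γ ⊢ φ → T ∣ Γ ⊢ ∀′ φ
  ∀E    : ∀ {φ} → T ∣ Γ ⊢ ∀′ φ → (x : Fin n) → T ∣ Γ ⊢ φ [ x ]
  ≐I    : ∀ {x} → T ∣ Γ ⊢ x ≐ x
  ≐E    : ∀ (φ : Formula (suc n)) {x y} →
          T ∣ Γ ⊢ x ≐ y → T ∣ Γ ⊢ φ [ x ] → T ∣ Γ ⊢ φ [ y ]
  -- Structures are nonempty; this is not derivable when n = 0, where ∀E has
  -- no variable to instantiate with.
  inhabited : T ∣ Γ ⊢ ∃′ 0F ≐ 0F

_proves_ : Theory → Sentence → Set
T proves σ = T ∣ [] ⊢ σ

Consistent : Theory → Set
Consistent T = ¬ (T proves ⊥′)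

_⊆′_ : Fin n → Fin n → Formula n
x ⊆′ y = ∀′∈[ x ] 0F ∈′ 1 ↑ʳ y

infix 30 _⊆′_

IsEmpty : Fin n → Formula n
IsEmpty x = ∀′ ¬′ 0F ∈′ 1 ↑ʳ x

-- p = {x , y}
IsPair : (p x y : Fin n) → Formula n
IsPair p x y = ∀′ (0F ∈′ 1 ↑ʳ p ⇔′ 0F ≐ 1 ↑ʳ x ∨′ 0F ≐ 1 ↑ʳ y)

-- p = (x , y) = {{x} , {x , y}}
IsOrderedPair : (p x y : Fin n) → Formula n
IsOrderedPair p x y =
  ∃′ ∃′ (IsPair 1F (2 ↑ʳ x) (2 ↑ʳ x) ∧′ IsPair 0F (2 ↑ʳ x) (2 ↑ʳ y) ∧′
         IsPair (2 ↑ʳ p) 1F 0F)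

infix 30 ⟨_,_⟩∈′_

⟨_,_⟩∈′_ : (x y r : Fin n) → Formula n
⟨ x , y ⟩∈′ r = ∃′∈[ r ] IsOrderedPair 0F (1 ↑ʳ x) (1 ↑ʳ y)

-- s = x ∪ {x}
IsSuccessor : (s x : Fin n) → Formula n
IsSuccessor s x = ∀′ (0F ∈′ 1 ↑ʳ s ⇔′ 0F ∈′ 1 ↑ʳ x ∨′ 0F ≐ 1 ↑ʳ x)

IsInductive : Fin n → Formula n
IsInductive w =
  (∃′∈[ w ] IsEmpty 0F) ∧′
  (∀′∈[ w ] ∃′∈[ 1 ↑ʳ w ] IsSuccessor 0F 1F)

-- w = ω, the least inductive set
IsOmega : Fin n → Formula n
IsOmega w = IsInductive w ∧′ (∀′ (IsInductive 0F ⇒′ 1 ↑ʳ w ⊆′ 0F))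

IsFunctionOn : (f a : Fin n) → Formula n
IsFunctionOn f a =
  (∀′∈[ f ] ∃′∈[ 1 ↑ʳ a ] ∃′ IsOrderedPair 2F 1F 0F) ∧′
  (∀′∈[ a ] ∃′ ⟨ 1F , 0F ⟩∈′ 2 ↑ʳ f) ∧′
  (∀′ ∀′ ∀′ (⟨ 2F , 1F ⟩∈′ 3 ↑ʳ f ∧′ ⟨ 2F , 0F ⟩∈′ 3 ↑ʳ f ⇒′ 1F ≐ 0F))

-- f : a → b
IsMap : (f a b : Fin n) → Formula n
IsMap f a b =
  IsFunctionOn f a ∧′ (∀′ ∀′ (⟨ 1F , 0F ⟩∈′ 2 ↑ʳ f ⇒′ 0F ∈′ 2 ↑ʳ b))

IsInjection : (f a b : Fin n) → Formula n
IsInjection f a b =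
  IsMap f a b ∧′
  (∀′ ∀′ ∀′ (⟨ 2F , 0F ⟩∈′ 3 ↑ʳ f ∧′ ⟨ 1F , 0F ⟩∈′ 3 ↑ʳ f ⇒′ 2F ≐ 1F))

-- Countable sets may be finite.
IsCountable : Fin n → Formula n
IsCountable a = ∃′ ∃′ (IsOmega 1F ∧′ IsInjection 0F (2 ↑ʳ a) 1F)

data ZF : Theory where
  extensionality : ZF (∀′ ∀′ ((∀′ (0F ∈′ 2F ⇔′ 0F ∈′ 1F)) ⇒′ 1F ≐ 0F))
  foundation : ZF (∀′ ((∃′ 0F ∈′ 1F) ⇒′ (∃′∈[ 0F ] ¬′ (∃′ (0F ∈′ 1F ∧′ 0F ∈′ 2F)))))
  pairing : ZF (∀′ ∀′ ∃′ IsPair 0F 2F 1F)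
  union : ZF (∀′ ∃′ ∀′ (0F ∈′ 1F ⇔′ (∃′∈[ 2F ] 1F ∈′ 0F)))
  powerSet : ZF (∀′ ∃′ ∀′ (0F ∈′ 1F ⇔′ 0F ⊆′ 2F))
  infinity : ZF (∃′ IsInductive 0F)
  -- ∀ params ∀a ∃b ∀x (x ∈ b ⇔ x ∈ a ∧ φ(x , params))
  separation : ∀ {n} (φ : Formula (1 + n)) → ZF (closure n
    (∀′ ∃′ ∀′ (0F ∈′ 1F ⇔′ 0F ∈′ 2F ∧′ rename (0F ◂ (3 ↑ʳ_)) φ)))
  -- ∀ params ∀a (∀x ∈ a ∀y ∀z (φ(x , y , params) ∧ φ(x , z , params) ⇒ y = z)
  --              ⇒ ∃b ∀y (y ∈ b ⇔ ∃x ∈ a φ(x , y , params)))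
  replacement : ∀ {n} (φ : Formula (2 + n)) → ZF (closure n
    (∀′ ((∀′∈[ 0F ] ∀′ ∀′ (rename (2F ◂ 1F ◂ (4 ↑ʳ_)) φ ∧′
                           rename (2F ◂ 0F ◂ (4 ↑ʳ_)) φ ⇒′ 1F ≐ 0F)) ⇒′
         (∃′ ∀′ (0F ∈′ 1F ⇔′ (∃′∈[ 2F ] rename (0F ◂ 1F ◂ (4 ↑ʳ_)) φ))))))

-- Every set a of nonempty sets has a choice function.
AC : Sentence
AC = ∀′ ((∀′∈[ 0F ] ∃′ 0F ∈′ 1F) ⇒′
         (∃′ (IsFunctionOn 0F 1F ∧′ (∀′ ∀′ (⟨ 1F , 0F ⟩∈′ 2F ⇒′ 0F ∈′ 1F)))))

-- For every nonempty a and relation r with ∀x ∈ a ∃y ∈ a x r y, there is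
-- f : ω → a with f(k) r f(k + 1) for all k ∈ ω.
DC : Sentence
DC = ∀′ ∀′ ((∃′ 0F ∈′ 2F) ∧′ (∀′∈[ 1F ] ∃′∈[ 2F ] ⟨ 1F , 0F ⟩∈′ 2F) ⇒′
            (∃′ ∃′ (IsOmega 1F ∧′ IsMap 0F 1F 3F ∧′ Step 0F 2F)))
  where
  Step : (f r : Fin n) → Formula n
  Step f r = ∀′ ∀′ ∀′ ∀′ (IsSuccessor 2F 3F ∧′
                          ⟨ 3F , 1F ⟩∈′ 4 ↑ʳ f ∧′ ⟨ 2F , 0F ⟩∈′ 4 ↑ʳ f ⇒′
                          ⟨ 1F , 0F ⟩∈′ 4 ↑ʳ r)

ZFC : Theory
ZFC = ZF ∪ ｛ AC ｝

ZF+DC : Theory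
ZF+DC = ZF ∪ ｛ DC ｝

-- L is the preorder as a set of pairs: ⟨ p , q ⟩∈′ L says p ≤ q.
IsForcing : (P L : Fin n) → Formula n
IsForcing P L =
  (∀′∈[ L ] ∃′∈[ 1 ↑ʳ P ] ∃′∈[ 2 ↑ʳ P ] IsOrderedPair 2F 1F 0F) ∧′
  (∀′∈[ P ] ⟨ 0F , 0F ⟩∈′ 1 ↑ʳ L) ∧′
  (∀′ ∀′ ∀′ (⟨ 2F , 1F ⟩∈′ 3 ↑ʳ L ∧′ ⟨ 1F , 0F ⟩∈′ 3 ↑ʳ L ⇒′
             ⟨ 2F , 0F ⟩∈′ 3 ↑ʳ L)) ∧′
  (∃′∈[ P ] ∀′∈[ 1 ↑ʳ P ] ⟨ 0F , 1F ⟩∈′ 2 ↑ʳ L)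

Compatible : (P L p q : Fin n) → Formula n
Compatible P L p q =
  ∃′∈[ P ] (⟨ 0F , 1 ↑ʳ p ⟩∈′ 1 ↑ʳ L ∧′ ⟨ 0F , 1 ↑ʳ q ⟩∈′ 1 ↑ʳ L)

IsAntichain : (P L A : Fin n) → Formula n
IsAntichain P L A =
  A ⊆′ P ∧′
  (∀′∈[ A ] ∀′∈[ 1 ↑ʳ A ]
    (¬′ 1F ≐ 0F ⇒′ ¬′ Compatible (2 ↑ʳ P) (2 ↑ʳ L) 1F 0F))

IsMaximalAntichain : (P L A : Fin n) → Formula n
IsMaximalAntichain P L A =
  IsAntichain P L A ∧′
  (∀′ (IsAntichain (1 ↑ʳ P) (1 ↑ʳ L) 0F ∧′ 1 ↑ʳ A ⊆′ 0F ⇒′ 0F ≐ 1 ↑ʳ A))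

IsPredense : (P L D : Fin n) → Formula n
IsPredense P L D =
  D ⊆′ P ∧′
  (∀′∈[ P ] ∃′∈[ 1 ↑ʳ D ] Compatible (2 ↑ʳ P) (2 ↑ʳ L) 1F 0F)

CCC₁ CCC₂ CCC₃ : (P L : Fin n) → Formula n
CCC₁ P L = ∀′ (IsMaximalAntichain (1 ↑ʳ P) (1 ↑ʳ L) 0F ⇒′ IsCountable 0F)
CCC₂ P L = ∀′ (IsAntichain (1 ↑ʳ P) (1 ↑ʳ L) 0F ⇒′ IsCountable 0F)
CCC₃ P L =
  ∀′ (IsPredense (1 ↑ʳ P) (1 ↑ʳ L) 0F ⇒′
      (∃′ (0F ⊆′ 1F ∧′ IsCountable 0F ∧′ IsPredense (2 ↑ʳ P) (2 ↑ʳ L) 0F)))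

EveryForcing SomeForcing : (∀ {n} → (P L : Fin n) → Formula n) → Sentence
EveryForcing φ = ∀′ ∀′ (IsForcing 1F 0F ⇒′ φ 1F 0F)
SomeForcing  φ = ∃′ ∃′ (IsForcing 1F 0F ∧′ φ 1F 0F)

{-# OPTIONS --safe #-}
module Submission where

-- From a consistent ZFC one gets a Henkin model, over which all semantic
-- reasoning is done up to double negation. Let I = 𝒫 ω. Force with the countable
-- partial functions from I × I to 2 and keep the names that are hereditarily
-- symmetric for the subsets of I × I, acting on conditions by symmetric
-- difference, with countable sets of rows as supports. The symmetric extension
-- satisfies ZF, and also DC, since descending sequences of conditions have lower
-- bounds and countable unions of supports are supports.
--
-- In the extension let A i be the set of all shifts of the i-th generic row, and
-- 𝒜 the family of the sets A i. A partial choice function for 𝒜 with support s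
-- cannot choose from A i for i ∉ s, because a shift of row i outside the domain
-- of a condition would move its choice. Hence the partial choice functions for 𝒜
-- are countable and never total.
--
-- Order a top element and the pairs ‹ a , x › with x ∈ a ∈ 𝒜, two pairs with the
-- same a being equivalent and all others incompatible. Antichains other than
-- that of the top are partial choice functions, so CCC₂ holds; a countable
-- predense set of pairs would yield a total choice function, so CCC₃ fails.
-- Adding uncountably many pairwise incompatible elements destroys CCC₂, but
-- CCC₁ survives: a maximal antichain without the top would be a total choice
-- function on the pairs.
--
-- In ZF, an antichain A is contained in every predense subset of the predense
-- set A ∪ {p : p is incompatible with every element of A}.

open import Data.Empty using (⊥; ⊥-elim)
open import Data.Fin using (Fin; zero; suc; lift; _↑ˡ_) renaming (_↑ʳ_ to infixr 40 _↑ʳ_)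
open import Data.Fin.Patterns using (0F; 1F; 2F; 3F; 4F; 5F; 6F; 8F; 9F)
open import Data.List using (List; []; _∷_; map; length; lookup) renaming (_++_ to _++ˡ_)
open import Data.List.Membership.Propositional using () renaming (_∈_ to _∈ˡ_)
open import Data.List.Membership.Propositional.Properties using (∈-map⁺; ∈-map⁻; ∈-++⁺ˡ; ∈-++⁺ʳ; ∈-lookup)
open import Data.List.Properties using (map-cong; map-∘)
open import Data.List.Relation.Unary.All as All using (All; []; _∷_)
open import Data.List.Relation.Unary.All.Properties using (++⁺) renaming (map⁺ to All-map⁺)
open import Data.List.Relation.Unary.Any using (here; there)
open import Data.Nat as ℕ using (ℕ; zero; suc; _+_; z≤n; s≤s; _⊔_; _≤′_; ≤′-refl; ≤′-step) renaming (_≤_ to infix 4 _≤ⁿ_)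
open import Data.Nat.Properties as ℕ using (_≟_; ≤-reflexive; m≤m⊔n; m≤n⊔m; m≤n+m; m≤n⇒m≤1+n; ≤∧≢⇒<; 1+n≰n; +-suc; +-identityʳ; ≤⇒≤′; +-comm)
open import Data.Product using (Σ; _×_; _,_; proj₁; proj₂)
open import Data.Sum using (_⊎_; inj₁; inj₂)
open import Data.Vec using (Vec; []; _∷_; _++_; tabulate)
open import Data.Vec.Functional using () renaming (_∷_ to _◂_; [] to ø)
open import Function using (_∘_; id)
open import Relation.Binary.PropositionalEquality using (_≡_; refl; sym; trans; cong; cong₂; subst; subst₂)
open import Relation.Nullary using (¬_; yes; no)
open import Relation.Unary using (_∪_; ｛_｝)
open import Defs

-- Classical reasoning about stable propositions

-- Consistency is a negation, so reasoning up to double negation costs nothing and no excluded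
-- middle is assumed. The universe of the Henkin model is ℕ: it is enumerated from outside, hence a
-- generic filter exists as an external sequence, the extension is again a structure, and soundness
-- yields consistency. Separation and replacement apply to formulas only; this is why predicates on
-- a model are carried along with formulas defining them. Two sizes have to be balanced. Countable
-- conditions and countable supports give DC, whereas rows and columns are indexed by an uncountable
-- set: every support misses a row, and the domain of every condition misses a point of each row.
-- The shift by such a point changes the condition only where it says nothing, fixes all `A i`, and
-- moves every member of the one in its row. As each `A i` is fixed by all shifts, a ground-model
-- enumeration of a support becomes, in the extension, an enumeration of the sets `A i` on which a
-- partial choice function can be defined; this is what makes the function countable there.

record Stable (A : Set) : Set where
  constructor stable
  field dne : ¬ ¬ A → A

open Stable {{...}} public

instance
  ⊥-stable : Stable ⊥
  ⊥-stable = stable λ h → h id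

  Π-stable : {A : Set} {B : A → Set} {{_ : {x : A} → Stable (B x)}} → Stable ((x : A) → B x)
  Π-stable = stable λ h x → dne λ k → h λ f → k (f x)

  ×-stable : {A B : Set} {{_ : Stable A}} {{_ : Stable B}} → Stable (A × B)
  ×-stable = stable λ h → dne (λ k → h (k ∘ proj₁)) , dne (λ k → h (k ∘ proj₂))

infix 2 ∃ᶜ
-- This is what satisfaction of the abbreviation `∃′` amounts to. It is stable, and its witness may
-- be used while proving a stable goal.
∃ᶜ : {A : Set} → (A → Set) → Set
∃ᶜ P = ¬ (∀ x → ¬ P x)
syntax ∃ᶜ (λ x → P) = ∃ᶜ[ x ] P

infixr 3 _∨ᶜ_
-- Follows the abbreviation `∨′`, hence the asymmetric form.
_∨ᶜ_ : Set → Set → Set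
A ∨ᶜ B = ¬ A → B

infix 2 _⇔_
_⇔_ : Set → Set → Set
A ⇔ B = (A → B) × (B → A)

module _ {A : Set} {P : A → Set} where
  ∃ᶜ-intro : ∀ x → P x → ∃ᶜ P
  ∃ᶜ-intro x p k = k x p

  infixl 1 _>>=_
  _>>=_ : {B : Set} {{_ : Stable B}} → ∃ᶜ P → (Σ A P → B) → B
  e >>= f = dne λ k → e λ x p → k (f (x , p))

module _ {A B C : Set} {{_ : Stable C}} where
  ∨ᶜ-elim : A ∨ᶜ B → (A → C) → (B → C) → C
  ∨ᶜ-elim d f g = dne λ k → k (g (d (k ∘ f)))

byCases : (A : Set) {C : Set} {{_ : Stable C}} → (A → C) → (¬ A → C) → C
byCases A f g = dne λ k → k (g (k ∘ f))

∨ᶜ-inl : {A B : Set} → A → A ∨ᶜ B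
∨ᶜ-inl a k = ⊥-elim (k a)

∨ᶜ-inr : {A B : Set} → B → A ∨ᶜ B
∨ᶜ-inr b _ = b

-- Renaming of formulas and derivations

private
  variable
    k m n : ℕ
    T : Theory

lift-cong : {f g : Fin m → Fin n} → (∀ i → f i ≡ g i) → ∀ i → lift 1 f i ≡ lift 1 g i
lift-cong e zero    = refl
lift-cong e (suc i) = cong suc (e i)

rename-cong : {f g : Fin m → Fin n} → (∀ i → f i ≡ g i) → ∀ φ → rename f φ ≡ rename g φ
rename-cong e (x ∈′ y) = cong₂ _∈′_ (e x) (e y)
rename-cong e (x ≐ y)  = cong₂ _≐_ (e x) (e y)
rename-cong e ⊥′       = refl
rename-cong e (φ ⇒′ ψ) = cong₂ _⇒′_ (rename-cong e φ) (rename-cong e ψ)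
rename-cong e (∀′ φ)   = cong ∀′_ (rename-cong (lift-cong e) φ)

rename-id : {f : Fin n → Fin n} → (∀ i → f i ≡ i) → ∀ φ → rename f φ ≡ φ
rename-id e (x ∈′ y) = cong₂ _∈′_ (e x) (e y)
rename-id e (x ≐ y)  = cong₂ _≐_ (e x) (e y)
rename-id e ⊥′       = refl
rename-id e (φ ⇒′ ψ) = cong₂ _⇒′_ (rename-id e φ) (rename-id e ψ)
rename-id e (∀′ φ)   = cong ∀′_ (rename-id (λ { zero → refl ; (suc i) → cong suc (e i) }) φ)

rename-∘ : {f : Fin m → Fin n} {g : Fin k → Fin m} {h : Fin k → Fin n} →
           (∀ i → f (g i) ≡ h i) → ∀ φ → rename f (rename g φ) ≡ rename h φ
rename-∘ e (x ∈′ y) = cong₂ _∈′_ (e x) (e y)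
rename-∘ e (x ≐ y)  = cong₂ _≐_ (e x) (e y)
rename-∘ e ⊥′       = refl
rename-∘ e (φ ⇒′ ψ) = cong₂ _⇒′_ (rename-∘ e φ) (rename-∘ e ψ)
rename-∘ e (∀′ φ)   = cong ∀′_ (rename-∘ (λ { zero → refl ; (suc i) → cong suc (e i) }) φ)

rename-[] : (f : Fin m → Fin n) (φ : Formula (suc m)) (x : Fin m) →
            rename f (φ [ x ]) ≡ rename (lift 1 f) φ [ f x ]
rename-[] f φ x = trans (rename-∘ {h = f ∘ (x ◂ id)} (λ _ → refl) φ)
  (sym (rename-∘ (λ { zero → refl ; (suc i) → refl }) φ))

rename-weaken : (f : Fin m → Fin n) (φ : Formula m) →
                weaken (rename f φ) ≡ rename (lift 1 f) (weaken φ)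
rename-weaken f φ = trans (rename-∘ {h = suc ∘ f} (λ _ → refl) φ) (sym (rename-∘ (λ _ → refl) φ))

-- Each stage of the Henkin construction has its own scope, so derivations must be carried from one
-- scope to the next.
rename-⊢ : (f : Fin m → Fin n) {Γ : List (Formula m)} {φ : Formula m} →
           T ∣ Γ ⊢ φ → T ∣ map (rename f) Γ ⊢ rename f φ
rename-⊢ f (axiom {σ} a) = subst (_ ∣ _ ⊢_) (sym (rename-∘ (λ ()) σ)) (axiom a)
rename-⊢ f (hyp h)       = hyp (∈-map⁺ (rename f) h)
rename-⊢ f (⇒I d)        = ⇒I (rename-⊢ f d)
rename-⊢ f (⇒E d e)      = ⇒E (rename-⊢ f d) (rename-⊢ f e)
rename-⊢ f (raa d)       = raa (rename-⊢ f d)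
rename-⊢ {T = T} f {Γ} (∀I {φ} d) = ∀I (subst (λ Δ → T ∣ Δ ⊢ rename (lift 1 f) φ)
  (trans (sym (map-∘ Γ)) (trans (map-cong (λ ψ → sym (rename-weaken f ψ)) Γ) (map-∘ Γ)))
  (rename-⊢ (lift 1 f) d))
rename-⊢ f (∀E {φ} d x)  = subst (_ ∣ _ ⊢_) (sym (rename-[] f φ x)) (∀E (rename-⊢ f d) (f x))
rename-⊢ f ≐I            = ≐I
rename-⊢ {T = T} f (≐E φ {x} {y} d e) = subst (T ∣ _ ⊢_) (sym (rename-[] f φ y))
  (≐E (rename (lift 1 f) φ) (rename-⊢ f d) (subst (T ∣ _ ⊢_) (rename-[] f φ x) (rename-⊢ f e)))
rename-⊢ f inhabited     = inhabited

infix 4 _⊆ˡ_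
_⊆ˡ_ : List (Formula n) → List (Formula n) → Set
Γ ⊆ˡ Δ = ∀ {φ} → φ ∈ˡ Γ → φ ∈ˡ Δ

∷-⊆ˡ : {φ : Formula n} {Γ Δ : List (Formula n)} → Γ ⊆ˡ Δ → φ ∷ Γ ⊆ˡ φ ∷ Δ
∷-⊆ˡ s (here e)  = here e
∷-⊆ˡ s (there h) = there (s h)

weaken-⊆ˡ : {Γ Δ : List (Formula n)} → Γ ⊆ˡ Δ → map weaken Γ ⊆ˡ map weaken Δ
weaken-⊆ˡ s h with ∈-map⁻ weaken h
... | ψ , ψ∈ , refl = ∈-map⁺ weaken (s ψ∈)

⊆-⊢ : {Γ Δ : List (Formula n)} {φ : Formula n} → Γ ⊆ˡ Δ → T ∣ Γ ⊢ φ → T ∣ Δ ⊢ φ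
⊆-⊢ s (axiom a)  = axiom a
⊆-⊢ s (hyp h)    = hyp (s h)
⊆-⊢ s (⇒I d)     = ⇒I (⊆-⊢ (∷-⊆ˡ s) d)
⊆-⊢ s (⇒E d e)   = ⇒E (⊆-⊢ s d) (⊆-⊢ s e)
⊆-⊢ s (raa d)    = raa (⊆-⊢ (∷-⊆ˡ s) d)
⊆-⊢ s (∀I d)     = ∀I (⊆-⊢ (weaken-⊆ˡ s) d)
⊆-⊢ s (∀E d x)   = ∀E (⊆-⊢ s d) x
⊆-⊢ s ≐I         = ≐I
⊆-⊢ s (≐E φ d e) = ≐E φ (⊆-⊢ s d) (⊆-⊢ s e)
⊆-⊢ s inhabited  = inhabited

wk-⊢ : {Γ : List (Formula n)} {φ ψ : Formula n} → T ∣ Γ ⊢ φ → T ∣ ψ ∷ Γ ⊢ φ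
wk-⊢ = ⊆-⊢ there

⊥E : {Γ : List (Formula n)} {φ : Formula n} → T ∣ Γ ⊢ ⊥′ → T ∣ Γ ⊢ φ
⊥E d = raa (wk-⊢ d)

-- Tarski semantics

record Structure : Set₁ where
  infix 6 _∈_ _≈_
  field
    U        : Set
    _∈_ _≈_  : U → U → Set
    ∈-stable : ∀ {x y} → Stable (x ∈ y)
    ≈-stable : ∀ {x y} → Stable (x ≈ y)
    ≈-refl   : ∀ {x} → x ≈ x
    ≈-sym    : ∀ {x y} → x ≈ y → y ≈ x
    ≈-trans  : ∀ {x y z} → x ≈ y → y ≈ z → x ≈ z
    ∈-resp   : ∀ {x x′ y y′} → x ≈ x′ → y ≈ y′ → x ∈ y → x′ ∈ y′
    point    : U

module Satisfaction (𝓢 : Structure) where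
  open Structure 𝓢

  Env : ℕ → Set
  Env n = Fin n → U

  sat : Formula n → Env n → Set
  sat (x ∈′ y) ρ = ρ x ∈ ρ y
  sat (x ≐ y)  ρ = ρ x ≈ ρ y
  sat ⊥′       ρ = ⊥
  sat (φ ⇒′ ψ) ρ = sat φ ρ → sat ψ ρ
  sat (∀′ φ)   ρ = ∀ x → sat φ (x ◂ ρ)

  -- Atoms are stable by assumption and ⊥, ⇒, ∀ preserve stability. This is what makes `raa` sound
  -- without excluded middle.
  sat-stable : (φ : Formula n) (ρ : Env n) → Stable (sat φ ρ)
  sat-stable (x ∈′ y) ρ = ∈-stable
  sat-stable (x ≐ y)  ρ = ≈-stable
  sat-stable ⊥′       ρ = ⊥-stable
  sat-stable (φ ⇒′ ψ) ρ = Π-stable {{sat-stable ψ ρ}}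
  sat-stable (∀′ φ)   ρ = Π-stable {{λ {x} → sat-stable φ (x ◂ ρ)}}

  infix 4 _≋_
  _≋_ : Env n → Env n → Set
  ρ ≋ σ = ∀ i → ρ i ≈ σ i

  ◂-≋ : {ρ σ : Env n} {x y : U} → x ≈ y → ρ ≋ σ → x ◂ ρ ≋ y ◂ σ
  ◂-≋ e es zero    = e
  ◂-≋ e es (suc i) = es i

  ≋-sym : {ρ σ : Env n} → ρ ≋ σ → σ ≋ ρ
  ≋-sym e i = ≈-sym (e i)

  sat-resp : (φ : Formula n) {ρ σ : Env n} → ρ ≋ σ → sat φ ρ → sat φ σ
  sat-resp (x ∈′ y) e h = ∈-resp (e x) (e y) h
  sat-resp (x ≐ y)  e h = ≈-trans (≈-sym (e x)) (≈-trans h (e y))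
  sat-resp ⊥′       e h = h
  sat-resp (φ ⇒′ ψ) e h a = sat-resp ψ e (h (sat-resp φ (≋-sym e) a))
  sat-resp (∀′ φ)   e h x = sat-resp φ (◂-≋ ≈-refl e) (h x)

  sat-rename : (φ : Formula m) (f : Fin m → Fin n) {ρ : Env n} {σ : Env m} →
               (∀ i → ρ (f i) ≡ σ i) → sat (rename f φ) ρ ⇔ sat φ σ
  sat-rename (x ∈′ y) f e = subst₂ _∈_ (e x) (e y) , subst₂ _∈_ (sym (e x)) (sym (e y))
  sat-rename (x ≐ y)  f e = subst₂ _≈_ (e x) (e y) , subst₂ _≈_ (sym (e x)) (sym (e y))
  sat-rename ⊥′       f e = id , id
  sat-rename (φ ⇒′ ψ) f e =
    (λ h a → proj₁ (sat-rename ψ f e) (h (proj₂ (sat-rename φ f e) a))) ,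
    (λ h a → proj₂ (sat-rename ψ f e) (h (proj₁ (sat-rename φ f e) a)))
  sat-rename (∀′ φ) f {ρ} {σ} e =
    (λ h x → proj₁ (sat-rename φ (lift 1 f) (e′ x)) (h x)) ,
    (λ h x → proj₂ (sat-rename φ (lift 1 f) (e′ x)) (h x))
    where
    e′ : ∀ x i → (x ◂ ρ) (lift 1 f i) ≡ (x ◂ σ) i
    e′ x zero    = refl
    e′ x (suc i) = e i

  sat-closure : ∀ n (φ : Formula n) → (∀ ρ → sat φ ρ) → ∀ ρ → sat (closure n φ) ρ
  sat-closure zero    φ h = h
  sat-closure (suc n) φ h = sat-closure n (∀′ φ) λ ρ x → h (x ◂ ρ)

  sat-closure⁻ : ∀ n (φ : Formula n) {ρ₀ : Env 0} → sat (closure n φ) ρ₀ → ∀ ρ → sat φ ρ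
  sat-closure⁻ zero    φ h ρ = sat-resp φ (λ ()) h
  sat-closure⁻ (suc n) φ h ρ = sat-resp φ (λ { zero → ≈-refl ; (suc i) → ≈-refl })
    (sat-closure⁻ n (∀′ φ) h (ρ ∘ suc) (ρ 0F))

  module _ (sat-T : ∀ {σ} → T σ → ∀ ρ → sat σ ρ) where
    soundness : {Γ : List (Formula n)} {φ : Formula n} → T ∣ Γ ⊢ φ →
                ∀ ρ → (∀ {ψ} → ψ ∈ˡ Γ → sat ψ ρ) → sat φ ρ
    soundness (axiom {σ} a)  ρ γ = proj₂ (sat-rename σ (λ ()) {σ = λ ()} (λ ())) (sat-T a _)
    soundness (hyp h)        ρ γ = γ h
    soundness (⇒I d)         ρ γ a = soundness d ρ λ { (here refl) → a ; (there h) → γ h }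
    soundness (⇒E d e)       ρ γ = soundness d ρ γ (soundness e ρ γ)
    soundness (raa {φ} d)    ρ γ = dne {{sat-stable φ ρ}} λ k →
      soundness d ρ λ { (here refl) → k ; (there h) → γ h }
    soundness {Γ = Γ} (∀I d) ρ γ x = soundness d (x ◂ ρ) γ′
      where
      γ′ : ∀ {ψ} → ψ ∈ˡ map weaken Γ → sat ψ (x ◂ ρ)
      γ′ h with ∈-map⁻ weaken h
      ... | ψ , ψ∈ , refl = proj₂ (sat-rename ψ suc (λ _ → refl)) (γ ψ∈)
    soundness (∀E {φ} d x)   ρ γ = proj₂ (sat-rename φ _ λ { zero → refl ; (suc i) → refl })
      (soundness d ρ γ (ρ x))
    soundness ≐I             ρ γ = ≈-refl
    soundness (≐E φ d e)     ρ γ = proj₂ (sat-rename φ _ λ { zero → refl ; (suc i) → refl })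
      (sat-resp φ (◂-≋ (soundness d ρ γ) λ _ → ≈-refl)
        (proj₁ (sat-rename φ _ λ { zero → refl ; (suc i) → refl }) (soundness e ρ γ)))
    soundness inhabited      ρ γ k = k point ≈-refl

    consistent : Consistent T
    consistent d = soundness d (λ ()) (λ ())

-- An enumeration of formulas

unpair-step : ℕ × ℕ → ℕ × ℕ
unpair-step (zero  , b) = suc b , 0
unpair-step (suc a , b) = a , suc b

-- Walks through all pairs along the antidiagonals: the inverse of Cantor's pairing function,
-- obtained by iteration.
unpair : ℕ → ℕ × ℕ
unpair zero    = 0 , 0
unpair (suc n) = unpair-step (unpair n)

-- The bound on `n` later ensures that a goal is treated at a stage whose scope contains all its
-- constants.
Paired : ℕ → ℕ → Set
Paired a b = Σ ℕ λ n → unpair n ≡ (a , b) × a + b ≤ⁿ n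

paired-diagonal : ∀ b a → Paired (a + b) 0 → Paired a b
paired-diagonal zero    a h = subst (λ c → Paired c 0) (+-identityʳ a) h
paired-diagonal (suc b) a h with paired-diagonal b (suc a) (subst (λ c → Paired c 0) (+-suc a b) h)
... | n , e , l = suc n , cong unpair-step e , ℕ.≤-trans (≤-reflexive (+-suc a b)) (m≤n⇒m≤1+n l)

paired-axis : ∀ a → Paired a 0
paired-axis zero    = 0 , refl , z≤n
paired-axis (suc a) with paired-diagonal a 0 (paired-axis a)
... | n , e , l = suc n , cong unpair-step e , s≤s (ℕ.≤-trans (≤-reflexive (+-identityʳ a)) l)

paired : ∀ a b → Paired a b
paired a b = paired-diagonal b a (paired-axis (a + b))

-- The elements of the model are the variables of all scopes, named by the
-- scope in which they appear: cst n i is the name of the variable i of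
-- Fin (suc n), and idx n is its inverse.
idx : ∀ n → ℕ → Fin (suc n)
idx zero    c = zero
idx (suc n) c with c ≟ suc n
... | yes _ = zero
... | no  _ = suc (idx n c)

cst : ∀ n → Fin (suc n) → ℕ
cst n       zero    = n
cst (suc n) (suc i) = cst n i

cst≤ : ∀ n i → cst n i ≤ⁿ n
cst≤ n       zero    = ℕ.≤-refl
cst≤ (suc n) (suc i) = m≤n⇒m≤1+n (cst≤ n i)

idx-self : ∀ n → idx (suc n) (suc n) ≡ zero
idx-self n with suc n ≟ suc n
... | yes _ = refl
... | no ¬e = ⊥-elim (¬e refl)

idx-suc : ∀ n {c} → c ≤ⁿ n → idx (suc n) c ≡ suc (idx n c)
idx-suc n {c} c≤n with c ≟ suc n
... | yes refl = ⊥-elim (1+n≰n c≤n)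
... | no  _    = refl

idx-cst : ∀ n i → idx n (cst n i) ≡ i
idx-cst zero    zero    = refl
idx-cst (suc n) zero    = idx-self n
idx-cst (suc n) (suc i) = trans (idx-suc n (cst≤ n i)) (cong suc (idx-cst n i))

cst-idx : ∀ n {c} → c ≤ⁿ n → cst n (idx n c) ≡ c
cst-idx zero    z≤n = refl
cst-idx (suc n) {c} c≤ with c ≟ suc n
... | yes e = sym e
... | no ¬e with ≤∧≢⇒< c≤ ¬e
...   | s≤s c≤n = cst-idx n c≤n

-- The first argument is fuel. Tags 0 to 3 stand for the constructors other than `⊥′`; every other
-- tag, like exhausted fuel, gives `⊥′`.
decode : ℕ → ∀ n → ℕ → Formula (suc n)
decode-node : ℕ → ∀ n → ℕ → ℕ × ℕ → Formula (suc n)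

decode zero    n c = ⊥′
decode (suc f) n c = decode-node f n (proj₁ (unpair c)) (unpair (proj₂ (unpair c)))

decode-node f n 0 (a , b) = idx n a ∈′ idx n b
decode-node f n 1 (a , b) = idx n a ≐ idx n b
decode-node f n 2 (a , b) = decode f n a ⇒′ decode f n b
decode-node f n 3 (a , b) = ∀′ decode f (suc n) a
decode-node f n _ _       = ⊥′

-- Asking for all sufficiently large fuel lets two subformulas be decoded with the same fuel.
Decoded : Formula (suc n) → Set
Decoded {n} φ = Σ ℕ λ c → Σ ℕ λ d → ∀ f → d ≤ⁿ f → decode f n c ≡ φ

decoded-node : ∀ t a b {φ : Formula (suc n)} d → (∀ f → d ≤ⁿ f → decode-node f n t (a , b) ≡ φ) → Decoded φ
decoded-node t a b d h with paired a b
... | r , er , _ with paired t r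
... | c , ec , _ = c , suc d , λ { (suc f) (s≤s d≤f) →
  trans (cong (λ p → decode-node f _ (proj₁ p) (unpair (proj₂ p))) ec)
        (trans (cong (decode-node f _ t) er) (h f d≤f)) }

decoded : (φ : Formula (suc n)) → Decoded φ
decoded {n} (x ∈′ y) = decoded-node 0 (cst n x) (cst n y) 0 λ f _ → cong₂ _∈′_ (idx-cst n x) (idx-cst n y)
decoded {n} (x ≐ y)  = decoded-node 1 (cst n x) (cst n y) 0 λ f _ → cong₂ _≐_ (idx-cst n x) (idx-cst n y)
decoded ⊥′ = decoded-node 4 0 0 0 λ _ _ → refl
decoded (φ ⇒′ ψ) with decoded φ | decoded ψ
... | a , d , h | b , e , i = decoded-node 2 a b (d ⊔ e) λ f l →
  cong₂ _⇒′_ (h f (ℕ.≤-trans (m≤m⊔n d e) l)) (i f (ℕ.≤-trans (m≤n⊔m d e) l))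
decoded (∀′ φ) with decoded φ
... | a , d , h = decoded-node 3 a 0 d λ f l → cong ∀′_ (h f l)

inst : ∀ n → Formula m → (Fin m → ℕ) → Formula (suc n)
inst n φ ρ = rename (idx n ∘ ρ) φ

Bounded : ℕ → (Fin m → ℕ) → Set
Bounded n ρ = ∀ i → ρ i ≤ⁿ n

bound : (ρ : Fin m → ℕ) → Σ ℕ λ n → Bounded n ρ
bound {zero}  ρ = 0 , λ ()
bound {suc m} ρ with bound (ρ ∘ suc)
... | n , h = ρ zero ⊔ n , λ { zero → m≤m⊔n _ n ; (suc i) → ℕ.≤-trans (h i) (m≤n⊔m (ρ zero) n) }

inst-suc : (φ : Formula m) {ρ : Fin m → ℕ} → Bounded n ρ → weaken (inst n φ ρ) ≡ inst (suc n) φ ρ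
inst-suc φ b = rename-∘ (λ i → sym (idx-suc _ (b i))) φ

abstract
  goal-at : ∀ N → ℕ → ℕ × ℕ → Formula (suc N)
  goal-at N m (f , c) = inst N (decode f m c) (cst m)

  -- `N` encodes a scope, a fuel and a code. The second component of `unpair N` is padding, by which
  -- `N` can be made at least as large as every constant in the goal.
  goal : ∀ N → Formula (suc N)
  goal N = let m , z = unpair (proj₁ (unpair N)) in goal-at N m (unpair z)

  goal-hits : (φ : Formula m) (ρ : Fin m → ℕ) →
              Σ ℕ λ N → Bounded N ρ × goal N ≡ inst N φ ρ
  goal-hits φ ρ with bound ρ
  ... | n , b with decoded (inst n φ ρ)
  ... | c , d , h with paired d c
  ... | z , ez , _ with paired n z
  ... | x , ex , _ with paired x n
  ... | N , eN , l = N , (λ i → ℕ.≤-trans (b i) (ℕ.≤-trans (m≤n+m n x) l)) , eq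
    where
    eq : goal N ≡ inst N φ ρ
    eq = trans (cong (λ p → let m , z = unpair (proj₁ p) in goal-at N m (unpair z)) eN)
        (trans (cong (λ p → goal-at N (proj₁ p) (unpair (proj₂ p))) ex)
        (trans (cong (goal-at N n) ez)
        (trans (cong (λ ψ → inst N ψ (cst n)) (h d ℕ.≤-refl))
               (rename-∘ (λ i → cong (idx N) (cst-idx n (b i))) φ))))

-- Henkin's theorem: the stages Δ n extend T in scope suc n; the stage after n
-- decides goal n, and if that is a universal formula, makes the fresh variable
-- a witness for it.

module Henkin (T : Theory) (con : Consistent T) where

  -- For a goal that is not universal the weakening turns the witness axiom into a provable one, so
  -- all stages have the same form.
  body : Formula n → Formula (suc n)
  body (∀′ φ) = φ
  body φ      = weaken φ

  -- The Henkin axiom in universal form: the newest variable is a counterexample to `∀′ φ` if there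
  -- is any.
  witness : Formula (suc n) → Formula (suc n)
  witness φ = φ ⇒′ weaken (∀′ φ)

  Proves : (Formula n → Set) → Formula n → Set
  Proves Δ φ = Σ (List _) λ Γ → All Δ Γ × (T ∣ Γ ⊢ φ)

  -- Consistency of the extended stage is a condition inside the membership predicate, so no
  -- undecidable case distinction enters the definition.
  Δ Δ′ : ∀ n → Formula (suc n) → Set
  Δ zero    ψ = ⊥
  Δ (suc n) ψ = Δ′ (suc n) ψ ⊎
    (ψ ≡ weaken (goal n) × ¬ Proves (λ θ → Δ′ (suc n) θ ⊎ θ ≡ weaken (goal n)) ⊥′)
  Δ′ zero    ψ = ⊥
  Δ′ (suc n) ψ = (Σ _ λ χ → Δ n χ × ψ ≡ weaken χ) ⊎ ψ ≡ witness (body (goal n))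

  Prov : ∀ n → Formula (suc n) → Set
  Prov n = Proves (Δ n)

  Proves-⇒E : {P : Formula n → Set} {φ ψ : Formula n} → Proves P (φ ⇒′ ψ) → Proves P φ → Proves P ψ
  Proves-⇒E (Γ , a , d) (Γ′ , a′ , d′) =
    Γ ++ˡ Γ′ , ++⁺ a a′ , ⇒E (⊆-⊢ ∈-++⁺ˡ d) (⊆-⊢ (∈-++⁺ʳ Γ) d′)

  Proves-hyp : {P : Formula n → Set} {φ : Formula n} → P φ → Proves P φ
  Proves-hyp p = _ ∷ [] , p ∷ [] , hyp (here refl)

  Proves-map : {P : Formula n → Set} {φ ψ : Formula n} →
    (∀ {Γ} → T ∣ Γ ⊢ φ → T ∣ Γ ⊢ ψ) → Proves P φ → Proves P ψ
  Proves-map f (Γ , a , d) = Γ , a , f d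

  separate : {P : Formula n → Set} {θ : Formula n} (Γ : List (Formula n)) →
    All (λ ψ → P ψ ⊎ ψ ≡ θ) Γ → Σ (List _) λ Γ′ → All P Γ′ × Γ ⊆ˡ θ ∷ Γ′
  separate [] [] = [] , [] , λ ()
  separate (ψ ∷ Γ) (h ∷ hs) with separate Γ hs
  separate (ψ ∷ Γ) (inj₁ p ∷ hs) | Γ′ , a , s = ψ ∷ Γ′ , p ∷ a ,
    λ { (here e) → there (here e)
      ; (there i) → ∷-⊆ˡ there (s i) }
  separate (ψ ∷ Γ) (inj₂ refl ∷ hs) | Γ′ , a , s = Γ′ , a , λ { (here e) → here e ; (there i) → s i }

  discharge : {P : Formula n → Set} {θ : Formula n} →
    Proves (λ ψ → P ψ ⊎ ψ ≡ θ) ⊥′ → Proves P (¬′ θ)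
  discharge (Γ , a , d) with separate Γ a
  ... | Γ′ , a′ , s = Γ′ , a′ , ⇒I (⊆-⊢ s d)

  unweaken : {P : Formula n → Set} (Γ : List (Formula (suc n))) →
    All (λ ψ → Σ _ λ χ → P χ × ψ ≡ weaken χ) Γ → Σ (List _) λ Γ′ → All P Γ′ × Γ ≡ map weaken Γ′
  unweaken [] [] = [] , [] , refl
  unweaken (_ ∷ Γ) ((χ , p , refl) ∷ hs) with unweaken Γ hs
  ... | Γ′ , a , refl = χ ∷ Γ′ , p ∷ a , refl

  -- Generalise over the fresh variable and contradict `inhabited`; in the empty scope there is no
  -- variable that could be substituted instead.
  strengthen : {Γ : List (Formula n)} → T ∣ map weaken Γ ⊢ ⊥′ → T ∣ Γ ⊢ ⊥′
  strengthen d = ⇒E inhabited (∀I (⇒I (wk-⊢ d)))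

  -- The negated axiom yields `φ` for a fresh variable, hence `∀′ φ`, and it also yields the
  -- negation of `∀′ φ`.
  refute-witness : {Γ : List (Formula n)} (φ : Formula (suc n)) →
    T ∣ map weaken Γ ⊢ ¬′ (witness φ) → T ∣ Γ ⊢ ⊥′
  refute-witness {Γ = Γ} φ d = ⇒E (⇒I refutes) (∀I holds)
    where
    refutes : T ∣ (∀′ φ) ∷ Γ ⊢ ⊥′
    refutes = strengthen (⇒E (wk-⊢ d) (⇒I (hyp (there (here refl)))))
    holds : T ∣ map weaken Γ ⊢ φ
    holds = raa (⇒E (wk-⊢ d) (⇒I (⊥E (⇒E (hyp (there (here refl))) (hyp (here refl))))))

  -- If the goal may be added consistently, this is the claim itself. If not, nothing was added, and
  -- a contradiction would come from the previous stage and the witness axiom. The two cases are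
  -- joined under a double negation.
  Δ-consistent : ∀ n → ¬ Prov n ⊥′
  -- The first stage has one variable and no hypotheses; dropping the variable leaves a refutation
  -- of `T`.
  Δ-consistent zero    ([] , _ , d) = con (strengthen d)
  Δ-consistent zero    (_ ∷ _ , () ∷ _ , d)
  Δ-consistent (suc n) (Γ , a , d) = ¬¬em λ c → no-goal c
    where
    P : Formula (suc (suc n)) → Set
    P θ = Δ′ (suc n) θ ⊎ θ ≡ weaken (goal n)
    Δ′-consistent : ¬ Proves (Δ′ (suc n)) ⊥′
    Δ′-consistent p with discharge p
    ... | Γ₁ , a₁ , d₁ with unweaken Γ₁ a₁
    ... | Γ₂ , a₂ , refl = Δ-consistent n (Γ₂ , a₂ , refute-witness (body (goal n)) d₁)
    no-goal : ¬ Proves P ⊥′ → ⊥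
    no-goal c = c (Γ , All.map (λ { (inj₁ h) → inj₁ h ; (inj₂ (e , _)) → inj₂ e }) a , d)
    ¬¬em : ¬ ¬ ¬ Proves P ⊥′
    ¬¬em k = Δ′-consistent (Γ , All.map (λ { (inj₁ h) → h ; (inj₂ (_ , c)) → ⊥-elim (k c) }) a , d)

  Prov-suc : {ψ : Formula (suc n)} → Prov n ψ → Prov (suc n) (weaken ψ)
  Prov-suc (Γ , a , d) = map weaken Γ ,
    All-map⁺ (All.map (λ h → inj₁ (inj₁ (_ , h , refl))) a) , rename-⊢ suc d

  -- Truth is provability at all late stages rather than at one, so that two truths can be combined
  -- at the larger of their bounds.
  record True (φ : Formula m) (ρ : Fin m → ℕ) : Set where
    constructor eventually
    field stages : ∃ᶜ[ n ] (∀ N → n ≤ⁿ N → Prov N (inst N φ ρ))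

  open True

  instance
    True-stable : {φ : Formula m} {ρ : Fin m → ℕ} → Stable (True φ ρ)
    True-stable = stable λ h → eventually λ k → h λ t → stages t k

  True-intro : (φ : Formula m) {ρ : Fin m → ℕ} → Bounded n ρ → Prov n (inst n φ ρ) → True φ ρ
  True-intro {n = n} φ {ρ} b p = eventually (∃ᶜ-intro n (λ _ l → go (≤⇒≤′ l)))
    where
    bounded : ∀ {N} → n ≤′ N → Bounded N ρ
    bounded ≤′-refl     i = b i
    bounded (≤′-step l) i = m≤n⇒m≤1+n (bounded l i)
    go : ∀ {N} → n ≤′ N → Prov N (inst N φ ρ)
    go ≤′-refl     = p
    go (≤′-step l) = subst (Prov _) (inst-suc φ (bounded l)) (Prov-suc (go l))

  True-map : {φ : Formula m} {ψ : Formula k} {ρ : Fin m → ℕ} {σ : Fin k → ℕ} →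
    (∀ N → Prov N (inst N φ ρ) → Prov N (inst N ψ σ)) → True φ ρ → True ψ σ
  True-map f t = stages t >>= λ (n , h) → eventually (∃ᶜ-intro n λ N l → f N (h N l))

  True-map₂ : {φ : Formula m} {ψ : Formula k} {χ : Formula n}
    {ρ : Fin m → ℕ} {σ : Fin k → ℕ} {τ : Fin n → ℕ} →
    (∀ N → Prov N (inst N φ ρ) → Prov N (inst N ψ σ) → Prov N (inst N χ τ)) →
    True φ ρ → True ψ σ → True χ τ
  True-map₂ f t u = stages t >>= λ (a , h) → stages u >>= λ (b , i) →
    eventually (∃ᶜ-intro (a ⊔ b) λ N l → f N (h N (ℕ.≤-trans (m≤m⊔n a b) l)) (i N (ℕ.≤-trans (m≤n⊔m a b) l)))

  True-⊥ : {ρ : Fin m → ℕ} → ¬ True ⊥′ ρ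
  True-⊥ t = stages t λ n h → Δ-consistent n (h n ℕ.≤-refl)

  True-⇒E : {φ ψ : Formula m} {ρ : Fin m → ℕ} → True (φ ⇒′ ψ) ρ → True φ ρ → True ψ ρ
  True-⇒E = True-map₂ λ N → Proves-⇒E

  -- The stage that treats `φ` rejects it only if it proves `¬′ φ`, which would then remain provable
  -- at all later stages.
  True-¬ : (φ : Formula m) {ρ : Fin m → ℕ} → ¬ True (¬′ φ) ρ → True φ ρ
  True-¬ φ {ρ} h with goal-hits φ ρ
  ... | N , b , e = True-intro φ b′ (subst (Prov (suc N)) eq (Proves-hyp (inj₂ (refl , con′))))
    where
    b′ : Bounded (suc N) ρ
    b′ i = m≤n⇒m≤1+n (b i)
    eq : weaken (goal N) ≡ inst (suc N) φ ρ
    eq = trans (cong weaken e) (inst-suc φ b)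
    con′ : ¬ Proves (λ θ → Δ′ (suc N) θ ⊎ θ ≡ weaken (goal N)) ⊥′
    con′ p with discharge p
    ... | Γ , a , d = h (True-intro (¬′ φ) b′
      (subst (λ θ → Prov (suc N) (¬′ θ)) eq (Γ , All.map inj₁ a , d)))

  True-∀E : {φ : Formula (suc m)} {ρ : Fin m → ℕ} → True (∀′ φ) ρ → ∀ c → True φ (c ◂ ρ)
  True-∀E {φ = φ} {ρ} t c = True-map {φ = ∀′ φ} {ψ = φ} (λ N → λ (Γ , a , d) → Γ , a ,
    subst (T ∣ Γ ⊢_) (rename-∘ (λ { zero → refl ; (suc i) → refl }) φ) (∀E d (idx N c))) t

  -- The constant introduced by the stage that treats `∀′ φ`. It is an actual number, not one that
  -- exists up to double negation; this is what turns the axioms of the theory into operations on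
  -- the model.
  ε′ : (φ : Formula (suc m)) (ρ : Fin m → ℕ) → Σ ℕ λ c → True φ (c ◂ ρ) → True (∀′ φ) ρ
  ε′ φ ρ with goal-hits (∀′ φ) ρ
  ... | N , b , e = suc N , λ t → True-map {φ = weaken (∀′ φ)} {ψ = ∀′ φ}
    (λ M → subst (Prov M) (rename-∘ (λ _ → refl) (∀′ φ)))
    (True-⇒E (True-intro (witness φ) b′ (subst (Prov (suc N)) eq (Proves-hyp (inj₁ (inj₂ refl))))) t)
    where
    b′ : Bounded (suc N) (suc N ◂ ρ)
    b′ zero    = ℕ.≤-refl
    b′ (suc i) = m≤n⇒m≤1+n (b i)
    eq : witness (body (goal N)) ≡ inst (suc N) (witness φ) (suc N ◂ ρ)
    eq = trans (cong (witness ∘ body) e) (cong₂ _⇒′_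
      (rename-cong (λ { zero → sym (idx-self N) ; (suc i) → sym (idx-suc N (b i)) }) φ)
      (trans (inst-suc (∀′ φ) b) (sym (rename-∘ (λ _ → refl) (∀′ φ)))))

  ≐-subst : (φ : Formula (suc (suc k))) {Γ : List (Formula (suc n))} {x y : Fin (suc n)} (f : Fin (suc k) → Fin (suc n)) →
    T ∣ Γ ⊢ x ≐ y → T ∣ Γ ⊢ rename (x ◂ f) φ → T ∣ Γ ⊢ rename (y ◂ f) φ
  ≐-subst φ f e d = subst (T ∣ _ ⊢_) (rename-∘ (λ { zero → refl ; (suc i) → refl }) φ)
    (≐E (rename (lift 1 f) φ) e (subst (T ∣ _ ⊢_) (sym (rename-∘ (λ { zero → refl ; (suc i) → refl }) φ)) d))

  True-≐ : (φ : Formula (suc (suc k))) {x y : ℕ} {ρ : Fin (suc k) → ℕ} →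
    True (0F ≐ 1F) (x ◂ y ◂ ø) → True φ (x ◂ ρ) → True φ (y ◂ ρ)
  True-≐ φ {x} {y} {ρ} = True-map₂ {φ = 0F ≐ 1F} {ψ = φ} {χ = φ} λ N p q →
    Proves-⇒E {φ = inst N φ (x ◂ ρ)} (Proves-map (λ {Γ} d → ⇒I
      (subst (T ∣ _ ⊢_) (rename-cong {f = idx N y ◂ (idx N ∘ ρ)} (λ { zero → refl ; (suc i) → refl }) φ)
        (≐-subst φ (idx N ∘ ρ) (wk-⊢ d)
          (subst (T ∣ inst N φ (x ◂ ρ) ∷ Γ ⊢_) (rename-cong {f = idx N ∘ (x ◂ ρ)} (λ { zero → refl ; (suc i) → refl }) φ) (hyp (here refl)))))) p) q

  𝓗 : Structure
  𝓗 = record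
    { U        = ℕ
    ; _∈_      = λ x y → True (0F ∈′ 1F) (x ◂ y ◂ ø)
    ; _≈_      = _≈_
    ; ∈-stable = True-stable
    ; ≈-stable = True-stable
    ; ≈-refl   = ≈-refl
    ; ≈-sym    = ≈-sym
    ; ≈-trans  = λ {x} e f → True-map {φ = 1F ≐ 0F} (λ N → id)
                   (True-≐ (1F ≐ 0F) {ρ = x ◂ ø} f (True-map {φ = 0F ≐ 1F} (λ N → id) e))
    ; ∈-resp   = λ {x} {x′} {y} {y′} e f h → True-map {φ = 1F ∈′ 0F} (λ N → id)
                   (True-≐ (1F ∈′ 0F) {ρ = x′ ◂ ø} f (True-map {φ = 0F ∈′ 1F} (λ N → id)
                     (True-≐ (0F ∈′ 1F) {ρ = y ◂ ø} e (True-map {φ = 0F ∈′ 1F} (λ N → id) h))))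
    ; point    = 0
    }
    where
    _≈_ : ℕ → ℕ → Set
    x ≈ y = True (0F ≐ 1F) (x ◂ y ◂ ø)
    ≈-refl : ∀ {x} → x ≈ x
    ≈-refl = eventually (∃ᶜ-intro 0 λ _ _ → [] , [] , ≐I)
    ≈-sym : ∀ {x y} → x ≈ y → y ≈ x
    ≈-sym {x} e = True-map {φ = 0F ≐ 1F} (λ N → id) (True-≐ (0F ≐ 1F) {ρ = x ◂ ø} e (True-map {φ = 0F ≐ 1F} (λ N → id) ≈-refl))

  open Satisfaction 𝓗

  -- For ∀, truth of the instance at the witness constant suffices. For ⇒, completeness reduces the
  -- claim to refuting `¬′ (φ ⇒′ ψ)`, from which both `φ` and the failure of `ψ` follow.
  truth  : (φ : Formula m) {ρ : Fin m → ℕ} → sat φ ρ → True φ ρ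
  truth⁻ : (φ : Formula m) {ρ : Fin m → ℕ} → True φ ρ → sat φ ρ
  truth (x ∈′ y) h = True-map {φ = 0F ∈′ 1F} {ψ = x ∈′ y} (λ N → id) h
  truth (x ≐ y)  h = True-map {φ = 0F ≐ 1F} {ψ = x ≐ y} (λ N → id) h
  truth ⊥′       ()
  truth (φ ⇒′ ψ) h = True-¬ (φ ⇒′ ψ) λ t → True-⊥ (True-⇒E t (True-¬ (φ ⇒′ ψ) λ t′ → ¬ψ t (truth ψ (h (truth⁻ φ (φ-true t))))))
    where
    φ-true : True (¬′ (φ ⇒′ ψ)) _ → True φ _
    φ-true = True-map {φ = ¬′ (φ ⇒′ ψ)} {ψ = φ} λ N → Proves-map λ d →
      raa (⇒E (wk-⊢ d) (⇒I (⊥E (⇒E (hyp (there (here refl))) (hyp (here refl))))))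
    ¬ψ : True (¬′ (φ ⇒′ ψ)) _ → ¬ True ψ _
    ¬ψ t u = True-⊥ (True-⇒E t (True-map {φ = ψ} {ψ = φ ⇒′ ψ} (λ N → Proves-map λ d → ⇒I (wk-⊢ d)) u))
  truth (∀′ φ) {ρ} h = let c , w = ε′ φ ρ in w (truth φ (h c))
  truth⁻ (x ∈′ y) t = True-map {φ = x ∈′ y} {ψ = 0F ∈′ 1F} (λ N → id) t
  truth⁻ (x ≐ y)  t = True-map {φ = x ≐ y} {ψ = 0F ≐ 1F} (λ N → id) t
  truth⁻ ⊥′       t = True-⊥ {ρ = ø} (True-map {φ = ⊥′} {ψ = ⊥′} (λ N → id) t)
  truth⁻ (φ ⇒′ ψ) t h = truth⁻ ψ (True-⇒E t (truth φ h))
  truth⁻ (∀′ φ)   t x = truth⁻ φ (True-∀E t x)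

  𝓗-sat : ∀ {σ} → T σ → ∀ ρ → sat σ ρ
  𝓗-sat {σ} a ρ = truth⁻ σ (eventually (∃ᶜ-intro 0 λ _ _ → [] , [] ,
    subst (T ∣ [] ⊢_) (rename-cong {f = λ ()} (λ ()) σ) (axiom a)))

  -- A counterexample to `∀′ ¬′ φ` is a witness of `∃′ φ`.
  ε : (φ : Formula (suc m)) (ρ : Fin m → ℕ) → ℕ
  ε φ ρ = proj₁ (ε′ (¬′ φ) ρ)

  ε-spec : (φ : Formula (suc m)) (ρ : Fin m → ℕ) → sat (∃′ φ) ρ → sat φ (ε φ ρ ◂ ρ)
  ε-spec φ ρ h = dne {{sat-stable φ _}} λ k →
    h (truth⁻ (∀′ ¬′ φ) (proj₂ (ε′ (¬′ φ) ρ) (truth (¬′ φ) k)))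

∧-elim : {A B : Set} {{_ : Stable A}} {{_ : Stable B}} → ¬ (A → ¬ B) → A × B
∧-elim h = dne (λ k → h λ a _ → k a) , dne (λ k → h λ _ b → k b)

∧-intro : {A B : Set} → A × B → ¬ (A → ¬ B)
∧-intro (a , b) k = k a b

-- Models of ZF with operations in place of the existence axioms

record ZFModel : Set₁ where
  field 𝓢 : Structure
  open Structure 𝓢 public
  open Satisfaction 𝓢 public
  field
    extensional : ∀ {x y} → (∀ z → z ∈ x ⇔ z ∈ y) → x ≈ y
    regular     : ∀ x → ∃ᶜ[ y ] y ∈ x → ∃ᶜ[ y ] y ∈ x × (∀ z → z ∈ y → ¬ z ∈ x)
    ⁅_,_⁆       : U → U → U
    ∈-pair      : ∀ {x y z} → z ∈ ⁅ x , y ⁆ ⇔ (z ≈ x ∨ᶜ z ≈ y)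
    ⋃           : U → U
    ∈-⋃         : ∀ {x z} → z ∈ ⋃ x ⇔ (∃ᶜ[ y ] y ∈ x × z ∈ y)
    𝒫           : U → U
    ∈-𝒫         : ∀ {x z} → z ∈ 𝒫 x ⇔ (∀ w → w ∈ z → w ∈ x)
    inf         : U
    inf-zero    : ∃ᶜ[ e ] e ∈ inf × (∀ z → ¬ z ∈ e)
    inf-suc     : ∀ x → x ∈ inf → ∃ᶜ[ s ] s ∈ inf × (∀ z → z ∈ s ⇔ (z ∈ x ∨ᶜ z ≈ x))
    separate    : Formula (suc n) → Env n → U → U
    ∈-separate  : (φ : Formula (suc n)) (ρ : Env n) {a z : U} →
                  z ∈ separate φ ρ a ⇔ (z ∈ a × sat φ (z ◂ ρ))
    replace     : Formula (suc (suc n)) → Env n → U → U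
    ∈-replace   : (φ : Formula (suc (suc n))) (ρ : Env n) {a : U} →
                  (∀ x → x ∈ a → ∀ y z → sat φ (x ◂ y ◂ ρ) → sat φ (x ◂ z ◂ ρ) → y ≈ z) →
                  ∀ {y} → y ∈ replace φ ρ a ⇔ (∃ᶜ[ x ] x ∈ a × sat φ (x ◂ y ◂ ρ))

skip₁ : Fin (suc n) → Fin (suc (suc n))
skip₁ zero    = zero
skip₁ (suc i) = suc (suc i)

-- Meanings of formulas

module Connectives (𝓢 : Structure) where
  open Structure 𝓢
  open Satisfaction 𝓢

  private
    variable
      A B : Set
      φ ψ : Formula n
      ρ : Env n
      P : U → Set

  -- Assembled along the syntax of a formula, it translates encoded connectives into ordinary
  -- products, sums of cases and quantifiers over the model.
  record Means (φ : Formula n) (ρ : Env n) (A : Set) : Set where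
    constructor means
    field
      to   : sat φ ρ → A
      from : A → sat φ ρ

  open Means public

  m⇒ : Means φ ρ A → Means ψ ρ B → Means (φ ⇒′ ψ) ρ (A → B)
  m⇒ p q = means (λ h a → to q (h (from p a))) (λ h a → from q (h (to p a)))

  m¬ : Means φ ρ A → Means (¬′ φ) ρ (¬ A)
  m¬ p = m⇒ p (means id id)

  m∨ : Means φ ρ A → Means ψ ρ B → Means (φ ∨′ ψ) ρ (A ∨ᶜ B)
  m∨ p q = m⇒ (m¬ p) q

  m∧ : Means φ ρ A → Means ψ ρ B → Means (φ ∧′ ψ) ρ (A × B)
  m∧ {φ = φ} {ρ} {ψ = ψ} p q = means
    (λ h → let a , b = ∧-elim {{sat-stable φ ρ}} {{sat-stable ψ ρ}} h in to p a , to q b)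
    (λ (a , b) → ∧-intro (from p a , from q b))

  m⇔ : Means φ ρ A → Means ψ ρ B → Means (φ ⇔′ ψ) ρ (A ⇔ B)
  m⇔ p q = m∧ (m⇒ p q) (m⇒ q p)

  m∀ : (∀ x → Means φ (x ◂ ρ) (P x)) → Means (∀′ φ) ρ (∀ x → P x)
  m∀ p = means (λ h x → to (p x) (h x)) (λ h x → from (p x) (h x))

  m∃ : (∀ x → Means φ (x ◂ ρ) (P x)) → Means (∃′ φ) ρ (∃ᶜ P)
  m∃ p = means (λ h k → h λ x q → k x (to (p x) q)) (λ h k → h λ x q → k x (from (p x) q))

  m≐ : {i j : Fin n} → Means (i ≐ j) ρ (ρ i ≈ ρ j)
  m≐ = means id id

  m∈ : {i j : Fin n} → Means (i ∈′ j) ρ (ρ i ∈ ρ j)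
  m∈ = means id id

  m∀∈ : {i : Fin n} → (∀ x → Means φ (x ◂ ρ) (P x)) → Means (∀′∈[ i ] φ) ρ (∀ x → x ∈ ρ i → P x)
  m∀∈ p = m∀ λ x → m⇒ m∈ (p x)

  m∃∈ : {i : Fin n} → (∀ x → Means φ (x ◂ ρ) (P x)) → Means (∃′∈[ i ] φ) ρ (∃ᶜ[ x ] x ∈ ρ i × P x)
  m∃∈ p = m∃ λ x → m∧ m∈ (p x)

  Means-cong : A ⇔ B → Means φ ρ A → Means φ ρ B
  Means-cong (f , f⁻) p = means (λ h → f (to p h)) (λ h → from p (f⁻ h))

  curry-⇔ : {A B C : Set} → (A × B → C) ⇔ (A → B → C)
  curry-⇔ = (λ f a b → f (a , b)) , (λ f (a , b) → f a b)

  mRename : (φ : Formula m) (f : Fin m → Fin k) {ρ : Env k} {σ : Env m} → (∀ i → ρ (f i) ≡ σ i) →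
            Means (rename f φ) ρ (sat φ σ)
  mRename φ f e = means (proj₁ (sat-rename φ f e)) (proj₂ (sat-rename φ f e))

  holds : (φ : Formula n) (ρ : Env n) → Means φ ρ A → A → sat φ ρ
  holds φ ρ = from

  given : (φ : Formula n) (ρ : Env n) → Means φ ρ A → sat φ ρ → A
  given φ ρ = to

  separationBody : Formula (suc n) → Formula n
  separationBody φ = ∀′ ∃′ ∀′ (0F ∈′ 1F ⇔′ 0F ∈′ 2F ∧′ rename (0F ◂ (3 ↑ʳ_)) φ)

  mSeparation : (φ : Formula (suc n)) {ρ : Env n} → Means (separationBody φ) ρ
    (∀ a → ∃ᶜ[ b ] (∀ x → x ∈ b ⇔ (x ∈ a × sat φ (x ◂ ρ))))
  mSeparation φ = m∀ λ a → m∃ λ b → m∀ λ x → m⇔ m∈ (m∧ m∈ (mRename φ _ λ { zero → refl ; (suc i) → refl }))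

  replacementBody : Formula (suc (suc n)) → Formula n
  replacementBody φ = ∀′ ((∀′∈[ 0F ] ∀′ ∀′ (rename (2F ◂ 1F ◂ (4 ↑ʳ_)) φ ∧′
                                           rename (2F ◂ 0F ◂ (4 ↑ʳ_)) φ ⇒′ 1F ≐ 0F)) ⇒′
                          (∃′ ∀′ (0F ∈′ 1F ⇔′ (∃′∈[ 2F ] rename (0F ◂ 1F ◂ (4 ↑ʳ_)) φ))))

  mReplacement : (φ : Formula (suc (suc n))) {ρ : Env n} → Means (replacementBody φ) ρ
    (∀ a → (∀ x → x ∈ a → ∀ y z → sat φ (x ◂ y ◂ ρ) → sat φ (x ◂ z ◂ ρ) → y ≈ z) →
      ∃ᶜ[ b ] (∀ y → y ∈ b ⇔ (∃ᶜ[ x ] x ∈ a × sat φ (x ◂ y ◂ ρ))))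
  mReplacement φ = m∀ λ a → m⇒
    (m∀∈ λ x → m∀ λ y → m∀ λ z → Means-cong curry-⇔ (m⇒
      (m∧ (mRename φ _ λ { zero → refl ; 1F → refl ; (suc (suc i)) → refl })
          (mRename φ _ λ { zero → refl ; 1F → refl ; (suc (suc i)) → refl })) m≐))
    (m∃ λ b → m∀ λ y → m⇔ m∈ (m∃∈ λ x → mRename φ _ λ { zero → refl ; 1F → refl ; (suc (suc i)) → refl }))

module Internal (𝓜 : ZFModel) where
  open ZFModel 𝓜 public

  -- Definable predicates and terms

  module Definability where
    instance
      ∈-stable′ : ∀ {x y} → Stable (x ∈ y)
      ∈-stable′ = ∈-stable
      ≈-stable′ : ∀ {x y} → Stable (x ≈ y)
      ≈-stable′ = ≈-stable

    append : Env n → Env m → Env (n + m)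
    append {zero}  ρ σ = σ
    append {suc n} ρ σ = ρ 0F ◂ append (ρ ∘ suc) σ

    append-≋ : {ρ ρ′ : Env n} {σ : Env m} → ρ ≋ ρ′ → append ρ σ ≋ append ρ′ σ
    append-≋ {zero}  e i = ≈-refl
    append-≋ {suc n} e = ◂-≋ (e 0F) (append-≋ {n} (e ∘ suc))

    append-↑ˡ : (ρ : Env n) {σ : Env m} (i : Fin n) → append ρ σ (i ↑ˡ m) ≡ ρ i
    append-↑ˡ ρ zero    = refl
    append-↑ˡ ρ (suc i) = append-↑ˡ (ρ ∘ suc) i

    append-↑ʳ : (ρ : Env n) {σ : Env m} (i : Fin m) → append ρ σ (n ↑ʳ i) ≡ σ i
    append-↑ʳ {zero}  ρ i = refl
    append-↑ʳ {suc n} ρ i = append-↑ʳ (ρ ∘ suc) i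

    rename-left : (Fin n → Fin k) → Fin (n + m) → Fin (k + m)
    rename-left {zero}  {k} f i       = k ↑ʳ i
    rename-left {suc n} {m = m} f zero = f zero ↑ˡ m
    rename-left {suc n} f (suc i)     = rename-left (f ∘ suc) i

    append-rename : (f : Fin n → Fin k) {ρ : Env k} {σ : Env m} →
                    ∀ i → append ρ σ (rename-left f i) ≡ append (ρ ∘ f) σ i
    append-rename {zero}  f {ρ} i       = append-↑ʳ ρ i
    append-rename {suc n} f {ρ} zero    = append-↑ˡ ρ (f zero)
    append-rename {suc n} f {ρ} (suc i) = append-rename (f ∘ suc) i

    append-lift : (f : Fin m → Fin k) {ρ : Env n} {σ : Env m} {τ : Env k} → (∀ i → τ (f i) ≡ σ i) →
                  ∀ i → append ρ τ (lift n f i) ≡ append ρ σ i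
    append-lift {n = zero}  f e i       = e i
    append-lift {n = suc n} f e zero    = refl
    append-lift {n = suc n} f e (suc i) = append-lift {n = n} f e i

    -- A formula with parameters from the model that is equivalent to `P`; without it separation and
    -- replacement could not be applied to `P`.
    record Def {n} (P : Env n → Set) : Set where
      constructor def
      field
        {arity} : ℕ
        code    : Formula (n + arity)
        par     : Env arity
        sound   : ∀ ρ → P ρ ⇔ sat code (append ρ par)

    open Def

    module _ {P : Env n → Set} (d : Def P) where
      Def-stable : ∀ {ρ} → Stable (P ρ)
      Def-stable {ρ} = stable λ h → proj₂ (sound d ρ)
        (dne {{sat-stable (code d) _}} λ k → h λ p → k (proj₁ (sound d ρ) p))

      Def-resp : ∀ {ρ σ} → ρ ≋ σ → P ρ → P σ
      Def-resp {ρ} {σ} e p = proj₂ (sound d σ) (sat-resp (code d) (append-≋ e) (proj₁ (sound d ρ) p))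

    abstract
      d-cong : {P Q : Env n → Set} → (∀ ρ → Q ρ ⇔ P ρ) → Def P → Def Q
      d-cong h (def c p s) = def c p λ ρ →
        (λ q → proj₁ (s ρ) (proj₁ (h ρ) q)) , (λ q → proj₂ (h ρ) (proj₂ (s ρ) q))

      d-rename : {P : Env n → Set} (f : Fin n → Fin k) → Def P → Def (λ ρ → P (ρ ∘ f))
      d-rename f (def c p s) = def (rename (rename-left f) c) p λ ρ →
        (λ q → proj₂ (sat-rename c _ (append-rename f)) (proj₁ (s _) q)) ,
        (λ q → proj₂ (s _) (proj₁ (sat-rename c _ (append-rename f)) q))

      d-⊥ : Def {n} (λ _ → ⊥)
      d-⊥ = def {arity = 0} ⊥′ ø λ ρ → id , id

      d-∈ : (i j : Fin n) → Def (λ ρ → ρ i ∈ ρ j)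
      d-∈ i j = def {arity = 0} ((i ↑ˡ 0) ∈′ (j ↑ˡ 0)) ø λ ρ →
        subst₂ _∈_ (sym (append-↑ˡ ρ i)) (sym (append-↑ˡ ρ j)) , subst₂ _∈_ (append-↑ˡ ρ i) (append-↑ˡ ρ j)

      d-≈ : (i j : Fin n) → Def (λ ρ → ρ i ≈ ρ j)
      d-≈ i j = def {arity = 0} ((i ↑ˡ 0) ≐ (j ↑ˡ 0)) ø λ ρ →
        subst₂ _≈_ (sym (append-↑ˡ ρ i)) (sym (append-↑ˡ ρ j)) , subst₂ _≈_ (append-↑ˡ ρ i) (append-↑ˡ ρ j)

      d-con : (i : Fin n) (c : U) → Def (λ ρ → ρ i ≈ c)
      d-con {n} i c = def {arity = 1} ((i ↑ˡ 1) ≐ (n ↑ʳ 0F)) (c ◂ ø) λ ρ →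
        subst₂ _≈_ (sym (append-↑ˡ ρ i)) (sym (append-↑ʳ ρ 0F)) , subst₂ _≈_ (append-↑ˡ ρ i) (append-↑ʳ ρ 0F)

      d-⇒ : {P Q : Env n → Set} → Def P → Def Q → Def (λ ρ → P ρ → Q ρ)
      d-⇒ {n} (def {a} c p s) (def {b} c′ p′ s′) =
        def (rename (lift n (_↑ˡ b)) c ⇒′ rename (lift n (a ↑ʳ_)) c′) (append p p′) λ ρ →
          (λ f h → proj₂ (r₂ ρ) (proj₁ (s′ ρ) (f (proj₂ (s ρ) (proj₁ (r₁ ρ) h))))) ,
          (λ f h → proj₂ (s′ ρ) (proj₁ (r₂ ρ) (f (proj₂ (r₁ ρ) (proj₁ (s ρ) h)))))
        where
        r₁ : ∀ ρ → sat (rename (lift n (_↑ˡ b)) c) (append ρ (append p p′)) ⇔ sat c (append ρ p)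
        r₁ ρ = sat-rename c _ (append-lift {n = n} (_↑ˡ b) (append-↑ˡ p))
        r₂ : ∀ ρ → sat (rename (lift n (a ↑ʳ_)) c′) (append ρ (append p p′)) ⇔ sat c′ (append ρ p′)
        r₂ ρ = sat-rename c′ _ (append-lift {n = n} (a ↑ʳ_) (append-↑ʳ p))

      d-∀ : {P : Env (suc n) → Set} → Def P → Def (λ ρ → ∀ x → P (x ◂ ρ))
      d-∀ (def c p s) = def (∀′ c) p λ ρ →
        (λ h x → proj₁ (s (x ◂ ρ)) (h x)) , (λ h x → proj₂ (s (x ◂ ρ)) (h x))

    record Pr (n : ℕ) : Set₁ where
      constructor pr
      field
        pred   : Env n → Set
        is-def : Def pred

    -- The language has no function symbols, so an operation enters formulas through its graph.
    record Tm (n : ℕ) : Set where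
      constructor tm
      field
        val   : Env n → U
        graph : Def {suc n} (λ ρ → ρ 0F ≈ val (ρ ∘ suc))

    open Pr public
    open Tm public

    Pr-stable : (P : Pr n) {ρ : Env n} → Stable (pred P ρ)
    Pr-stable P = Def-stable (is-def P)

    Pr-resp : (P : Pr n) {ρ σ : Env n} → ρ ≋ σ → pred P ρ → pred P σ
    Pr-resp P = Def-resp (is-def P)

    Tm-cong : (t : Tm n) {ρ σ : Env n} → ρ ≋ σ → val t ρ ≈ val t σ
    Tm-cong t e = Def-resp (graph t) (◂-≋ ≈-refl e) ≈-refl

    v : Fin n → Tm n
    v i = tm (λ ρ → ρ i) (d-≈ zero (suc i))

    con : U → Tm n
    con c = tm (λ _ → c) (d-con zero c)

    infix  30 _∈ᵖ_ _≈ᵖ_ _∉ᵖ_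
    infix  25 ¬ᵖ_
    infixr 20 _∧ᵖ_
    infixr 15 _∨ᵖ_
    infixr 10 _⇒ᵖ_
    infix   8 _⇔ᵖ_
    infixr  5 ∀ᵖ_ ∃ᵖ_

    abstract
      -- Substitution of a term is expressed as: everything equal to its value satisfies `P`.
      d-term : {P : Env (suc n) → Set} → Def P → (t : Tm n) → Def (λ ρ → P (val t ρ ◂ ρ))
      d-term {P = P} d t = d-cong
        (λ ρ → (λ p x e → Def-resp d (◂-≋ (≈-sym e) λ _ → ≈-refl) p) , λ h → h (val t ρ) ≈-refl)
        (d-∀ (d-⇒ (graph t) d))

    wkT : Tm n → Tm (suc n)
    wkT t = tm (λ ρ → val t (ρ ∘ suc)) (d-rename skip₁ (graph t))

    renP : (Fin n → Fin k) → Pr n → Pr k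
    renP f P = pr (λ ρ → pred P (ρ ∘ f)) (d-rename f (is-def P))

    _∈ᵖ_ _≈ᵖ_ _∉ᵖ_ : Tm n → Tm n → Pr n
    t ∈ᵖ s = pr (λ ρ → val t ρ ∈ val s ρ) (d-term (d-term (d-∈ 0F 1F) (wkT t)) s)
    t ≈ᵖ s = pr (λ ρ → val t ρ ≈ val s ρ) (d-term (d-term (d-≈ 0F 1F) (wkT t)) s)

    ⊥ᵖ : Pr n
    ⊥ᵖ = pr (λ _ → ⊥) d-⊥

    _⇒ᵖ_ _∧ᵖ_ _∨ᵖ_ _⇔ᵖ_ : Pr n → Pr n → Pr n
    P ⇒ᵖ Q = pr (λ ρ → pred P ρ → pred Q ρ) (d-⇒ (is-def P) (is-def Q))

    ¬ᵖ_ : Pr n → Pr n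
    ¬ᵖ P = P ⇒ᵖ ⊥ᵖ

    t ∉ᵖ s = ¬ᵖ (t ∈ᵖ s)
    P ∨ᵖ Q = ¬ᵖ P ⇒ᵖ Q
    P ∧ᵖ Q = pr (λ ρ → pred P ρ × pred Q ρ)
      (d-cong (λ ρ → ∧-intro , ∧-elim {{Pr-stable P}} {{Pr-stable Q}}) (is-def (¬ᵖ (P ⇒ᵖ ¬ᵖ Q))))
    P ⇔ᵖ Q = (P ⇒ᵖ Q) ∧ᵖ (Q ⇒ᵖ P)

    ∀ᵖ_ ∃ᵖ_ : Pr (suc n) → Pr n
    ∀ᵖ P = pr (λ ρ → ∀ x → pred P (x ◂ ρ)) (d-∀ (is-def P))
    ∃ᵖ P = ¬ᵖ (∀ᵖ ¬ᵖ P)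

    ∃ᵖ∈ : Tm n → Pr (suc n) → Pr n
    ∃ᵖ∈ t P = ∃ᵖ (v 0F ∈ᵖ wkT t ∧ᵖ P)

    abstract
      -- By extensionality the graph of `f` is definable as soon as membership in its values is.
      setTm : (f : Env n → U) (P : Pr (suc n)) → (∀ ρ z → z ∈ f ρ ⇔ pred P (z ◂ ρ)) →
              Def {suc n} (λ ρ → ρ 0F ≈ f (ρ ∘ suc))
      setTm f P h = d-cong (λ ρ →
          (λ e z → (λ i → to {ρ = ρ} (proj₁ (h _ z) (∈-resp ≈-refl e i))) ,
                   (λ p → ∈-resp ≈-refl (≈-sym e) (proj₂ (h _ z) (from {ρ = ρ} p)))) ,
          (λ q → extensional λ z → (λ i → proj₂ (h _ z) (from {ρ = ρ} (proj₁ (q z) i))) ,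
                                   (λ i → proj₂ (q z) (to {ρ = ρ} (proj₁ (h _ z) i)))))
        (is-def (∀ᵖ (v 0F ∈ᵖ v 1F ⇔ᵖ renP skip₁ P)))
        where
        to : ∀ {z} {ρ : Env _} → pred P (z ◂ (ρ ∘ suc)) → pred P ((z ◂ ρ) ∘ skip₁)
        to {z} {ρ} = Pr-resp P {z ◂ (ρ ∘ suc)} {(z ◂ ρ) ∘ skip₁} λ { zero → ≈-refl ; (suc i) → ≈-refl }
        from : ∀ {z} {ρ : Env _} → pred P ((z ◂ ρ) ∘ skip₁) → pred P (z ◂ (ρ ∘ suc))
        from {z} {ρ} = Pr-resp P {(z ◂ ρ) ∘ skip₁} {z ◂ (ρ ∘ suc)} λ { zero → ≈-refl ; (suc i) → ≈-refl }

    setT : (f : Env n → U) (P : Pr (suc n)) → (∀ ρ z → z ∈ f ρ ⇔ pred P (z ◂ ρ)) → Tm n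
    setT f P h = tm f (setTm f P h)

    abstract
      sepᵉ : Pr (suc n) → Env n → U → U
      sepᵉ P ρ a = separate (code (is-def P)) (append ρ (par (is-def P))) a

      ∈-sepᵉ : (P : Pr (suc n)) (ρ : Env n) {a z : U} → z ∈ sepᵉ P ρ a ⇔ (z ∈ a × pred P (z ◂ ρ))
      ∈-sepᵉ P ρ = let d = is-def P ; s = ∈-separate (code d) (append ρ (par d)) in
        (λ h → let i , p = proj₁ s h in i , proj₂ (sound d (_ ◂ ρ)) p) ,
        (λ (i , p) → proj₂ s (i , proj₁ (sound d (_ ◂ ρ)) p))

      repᵉ : Pr (suc (suc n)) → Env n → U → U
      repᵉ P ρ a = replace (code (is-def P)) (append ρ (par (is-def P))) a

      ∈-repᵉ : (P : Pr (suc (suc n))) (ρ : Env n) {a : U} →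
        (∀ x → x ∈ a → ∀ y z → pred P (x ◂ y ◂ ρ) → pred P (x ◂ z ◂ ρ) → y ≈ z) →
        ∀ {y} → y ∈ repᵉ P ρ a ⇔ (∃ᶜ[ x ] x ∈ a × pred P (x ◂ y ◂ ρ))
      ∈-repᵉ P ρ f = let d = is-def P ; s = ∈-replace (code d) (append ρ (par d))
                              (λ x i y z p q → f x i y z (proj₂ (sound d (x ◂ y ◂ ρ)) p) (proj₂ (sound d (x ◂ z ◂ ρ)) q)) in
        (λ h → proj₁ s h >>= λ (x , i , p) → ∃ᶜ-intro x (i , proj₂ (sound d (x ◂ _ ◂ ρ)) p)) ,
        (λ h → h >>= λ (x , i , p) → proj₂ s (∃ᶜ-intro x (i , proj₁ (sound d (x ◂ _ ◂ ρ)) p)))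

  open Definability public

  -- Elementary set theory: pairs, products, images, application

  module SetTheory where
    private
      variable
        a b c w x x′ y y′ z z′ : U

    infix 6 _⊆_
    _⊆_ : U → U → Set
    x ⊆ y = ∀ z → z ∈ x → z ∈ y

    ∈-respˡ : x ≈ y → x ∈ z → y ∈ z
    ∈-respˡ e = ∈-resp e ≈-refl

    ∈-respʳ : y ≈ z → x ∈ y → x ∈ z
    ∈-respʳ e = ∈-resp ≈-refl e

    ≈-⊆ : x ≈ y → x ⊆ y
    ≈-⊆ e z = ∈-respʳ e

    ⊆-antisym : x ⊆ y → y ⊆ x → x ≈ y
    ⊆-antisym p q = extensional λ z → p z , q z

    -- Closed definable predicates and terms are applied to vectors of terms.

    vals : Vec (Tm n) k → Env n → Env k
    vals []       ρ = ø
    vals (t ∷ ts) ρ = val t ρ ◂ vals ts ρ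

    renT : (Fin n → Fin k) → Tm n → Tm k
    renT f t = tm (λ ρ → val t (ρ ∘ f)) (d-cong (λ ρ → id , id) (d-rename (lift 1 f) (graph t)))

    ≡⇒≋ : {ρ σ : Env n} → (∀ i → ρ i ≡ σ i) → ρ ≋ σ
    ≡⇒≋ {ρ = ρ} e i = subst (ρ i ≈_) (e i) ≈-refl

    abstract
      d-apply : (ts : Vec (Tm n) k) {P : Env k → Set} → Def P → Def (λ ρ → P (vals ts ρ))
      d-apply {n} ts d = d-cong
        (λ ρ → Def-resp d (≡⇒≋ (λ i → sym (append-↑ˡ (vals ts ρ) i))) , Def-resp d (≡⇒≋ (append-↑ˡ (vals ts ρ))))
        (go ts (d-rename (_↑ˡ n) d))
        where
        go : ∀ {k} (ts : Vec (Tm n) k) {Q : Env (k + n) → Set} → Def Q →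
             Def (λ ρ → Q (append (vals ts ρ) ρ))
        go []       d = d
        go {suc k} (t ∷ ts) d = d-cong
          (λ ρ → Def-resp d (◂-≋ (Tm-cong t (≋-sym (eq ρ))) (λ _ → ≈-refl)) ,
                 Def-resp d (◂-≋ (Tm-cong t (eq ρ)) (λ _ → ≈-refl)))
          (go ts (d-term d (renT (k ↑ʳ_) t)))
          where
          eq : ∀ ρ → append (vals ts ρ) ρ ∘ (k ↑ʳ_) ≋ ρ
          eq ρ = ≡⇒≋ (append-↑ʳ (vals ts ρ))

    infix 40 _⟦_⟧ _⟦_⟧ᵗ
    _⟦_⟧ : Pr k → Vec (Tm n) k → Pr n
    P ⟦ ts ⟧ = pr (λ ρ → pred P (vals ts ρ)) (d-apply ts (is-def P))

    weaken-terms : Vec (Tm n) k → Vec (Tm (suc n)) k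
    weaken-terms []       = []
    weaken-terms (t ∷ ts) = wkT t ∷ weaken-terms ts

    vals-weaken : (ts : Vec (Tm n) k) (ρ : Env (suc n)) → vals (weaken-terms ts) ρ ≋ vals ts (ρ ∘ suc)
    vals-weaken (t ∷ ts) ρ = ◂-≋ ≈-refl (vals-weaken ts ρ)

    _⟦_⟧ᵗ : Tm k → Vec (Tm n) k → Tm n
    t ⟦ ts ⟧ᵗ = tm (λ ρ → val t (vals ts ρ)) (d-cong
      (λ ρ → (λ e → ≈-trans e (Tm-cong t (≋-sym (vals-weaken ts ρ)))) ,
             (λ e → ≈-trans e (Tm-cong t (vals-weaken ts ρ))))
      (d-apply (v 0F ∷ weaken-terms ts) (graph t)))

    v0 : Tm (suc n)
    v0 = v 0F
    v1 : Tm (suc (suc n))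
    v1 = v 1F
    v2 : Tm (suc (suc (suc n)))
    v2 = v 2F
    v3 : Tm (suc (suc (suc (suc n))))
    v3 = v 3F
    v4 : Tm (suc (suc (suc (suc (suc n)))))
    v4 = v 4F
    v5 : Tm (suc (suc (suc (suc (suc (suc n))))))
    v5 = v 5F

    pairT : Tm n → Tm n → Tm n
    pairT t s = setT (λ ρ → ⁅ val t ρ , val s ρ ⁆) (v0 ≈ᵖ wkT t ∨ᵖ v0 ≈ᵖ wkT s) λ ρ z → ∈-pair

    ⋃T 𝒫T : Tm n → Tm n
    ⋃T t = setT (λ ρ → ⋃ (val t ρ)) (∃ᵖ∈ (wkT t) (v1 ∈ᵖ v0)) λ ρ z → ∈-⋃
    𝒫T t = setT (λ ρ → 𝒫 (val t ρ)) (∀ᵖ (v0 ∈ᵖ v1 ⇒ᵖ v0 ∈ᵖ wkT (wkT t))) λ ρ z → ∈-𝒫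

    sepT : Tm n → Pr (suc n) → Tm n
    sepT t P = setT (λ ρ → sepᵉ P ρ (val t ρ)) (v0 ∈ᵖ wkT t ∧ᵖ P) λ ρ z → ∈-sepᵉ P ρ

    abstract
      imgᵉ : Tm (suc n) → Env n → U → U
      imgᵉ t ρ a = repᵉ (v1 ≈ᵖ renT skip₁ t) ρ a

      ∈-imgᵉ : (t : Tm (suc n)) (ρ : Env n) → z ∈ imgᵉ t ρ a ⇔ (∃ᶜ[ x ] x ∈ a × z ≈ val t (x ◂ ρ))
      ∈-imgᵉ {z = z} t ρ = let s = ∈-repᵉ (v1 ≈ᵖ renT skip₁ t) ρ λ x i y z p q → ≈-trans p (≈-trans (Tm-cong t (eq x)) (≈-trans (Tm-cong t (≋-sym (eq x))) (≈-sym q))) in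
        (λ h → proj₁ s h >>= λ (x , i , p) → ∃ᶜ-intro x (i , ≈-trans p (Tm-cong t (eq x)))) ,
        (λ h → h >>= λ (x , i , p) → proj₂ s (∃ᶜ-intro x (i , ≈-trans p (Tm-cong t (≋-sym (eq x))))))
        where
        eq : ∀ x {z} → (x ◂ z ◂ ρ) ∘ skip₁ ≋ x ◂ ρ
        eq x zero    = ≈-refl
        eq x (suc i) = ≈-refl

    imgT : Tm n → Tm (suc n) → Tm n
    imgT {n} a t = setT (λ ρ → imgᵉ t ρ (val a ρ)) (∃ᵖ∈ (wkT a) (v1 ≈ᵖ renT skip₁ t)) λ ρ z →
        (λ h → proj₁ (∈-imgᵉ t ρ) h >>= λ (x , i , p) → ∃ᶜ-intro x (i , ≈-trans p (Tm-cong t (≋-sym (eq ρ z x))))) ,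
        (λ h → h >>= λ (x , i , p) → proj₂ (∈-imgᵉ t ρ) (∃ᶜ-intro x (i , ≈-trans p (Tm-cong t (eq ρ z x)))))
        where
        eq : ∀ (ρ : Env n) z x → (x ◂ z ◂ ρ) ∘ skip₁ ≋ x ◂ ρ
        eq ρ z x zero    = ≈-refl
        eq ρ z x (suc i) = ≈-refl

    -- Basic operations

    abstract
      ∅ : U
      ∅ = sepᵉ ⊥ᵖ ø point

      ∉∅ : ¬ z ∈ ∅
      ∉∅ h = proj₂ (proj₁ (∈-sepᵉ ⊥ᵖ ø) h)

    empty-≈ : (∀ z → ¬ z ∈ x) → x ≈ ∅
    empty-≈ h = extensional λ z → (λ i → ⊥-elim (h z i)) , (λ i → ⊥-elim (∉∅ i))

    pair-l : x ∈ ⁅ x , y ⁆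
    pair-l = proj₂ ∈-pair (∨ᶜ-inl ≈-refl)

    pair-r : y ∈ ⁅ x , y ⁆
    pair-r = proj₂ ∈-pair (∨ᶜ-inr ≈-refl)

    pair-elim : {C : Set} {{_ : Stable C}} → z ∈ ⁅ x , y ⁆ → (z ≈ x → C) → (z ≈ y → C) → C
    pair-elim h = ∨ᶜ-elim (proj₁ ∈-pair h)

    ∈-sing : z ∈ ⁅ x , x ⁆ → z ≈ x
    ∈-sing h = pair-elim h id id

    ⋃-intro : y ∈ x → z ∈ y → z ∈ ⋃ x
    ⋃-intro i j = proj₂ ∈-⋃ (∃ᶜ-intro _ (i , j))

    infixl 9 _∪ₛ_
    _∪ₛ_ : U → U → U
    a ∪ₛ b = ⋃ ⁅ a , b ⁆
    ∪T : Tm n → Tm n → Tm n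
    ∪T t s = ⋃T (pairT t s)

    ∪-l : z ∈ a → z ∈ a ∪ₛ b
    ∪-l = ⋃-intro pair-l

    ∪-r : z ∈ b → z ∈ a ∪ₛ b
    ∪-r = ⋃-intro pair-r

    ∪-elim : {C : Set} {{_ : Stable C}} → z ∈ a ∪ₛ b → (z ∈ a → C) → (z ∈ b → C) → C
    ∪-elim h f g = proj₁ ∈-⋃ h >>= λ (y , i , j) →
      pair-elim i (λ e → f (∈-respʳ e j)) (λ e → g (∈-respʳ e j))

    abstract
      opF : Tm 2
      opF = pairT (pairT v0 v0) (pairT v0 v1)

    ‹_,_› : U → U → U
    ‹ x , y › = val opF (x ◂ y ◂ ø)

    opT : Tm n → Tm n → Tm n
    opT t s = opF ⟦ t ∷ s ∷ [] ⟧ᵗ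

    abstract
      op-≈ : ‹ x , y › ≈ ⁅ ⁅ x , x ⁆ , ⁅ x , y ⁆ ⁆
      op-≈ = ≈-refl

    op-cong : x ≈ x′ → y ≈ y′ → ‹ x , y › ≈ ‹ x′ , y′ ›
    op-cong {x} {x′} {y} {y′} e f = Tm-cong opF {x ◂ y ◂ ø} {x′ ◂ y′ ◂ ø} (◂-≋ e (◂-≋ f λ ()))

    op-l : ⁅ x , x ⁆ ∈ ‹ x , y ›
    op-l = ∈-respʳ (≈-sym op-≈) pair-l

    op-r : ⁅ x , y ⁆ ∈ ‹ x , y ›
    op-r = ∈-respʳ (≈-sym op-≈) pair-r

    op-elim : {C : Set} {{_ : Stable C}} → z ∈ ‹ x , y › → (z ≈ ⁅ x , x ⁆ → C) → (z ≈ ⁅ x , y ⁆ → C) → C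
    op-elim h = pair-elim (∈-respʳ op-≈ h)

    op-inj : ‹ x , y › ≈ ‹ x′ , y′ › → x ≈ x′ × y ≈ y′
    op-inj {x} {y} {x′} {y′} e = x≈x′ , y≈y′
      where
      half : ∀ {x y x′ y′} → ‹ x , y › ≈ ‹ x′ , y′ › → y ≈ x′ ∨ᶜ y ≈ y′
      half e = op-elim (∈-respʳ e op-r)
        (λ h → ∨ᶜ-inl (∈-sing (∈-respʳ h pair-r)))
        (λ h → proj₁ ∈-pair (∈-respʳ h pair-r))
      x≈x′ : x ≈ x′
      x≈x′ = op-elim (∈-respʳ e op-l)
        (λ h → ∈-sing (∈-respʳ h pair-l))
        (λ h → ≈-sym (∈-sing (∈-respʳ (≈-sym h) pair-l)))
      y≈y′ : y ≈ y′
      y≈y′ = ∨ᶜ-elim (half e) (λ p → ∨ᶜ-elim (half (≈-sym e))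
        (λ q → ≈-trans p (≈-trans (≈-sym x≈x′) (≈-sym q))) ≈-sym) id

    -- For p = ‹ x , y › the set ⋃ ⋃ p is x ∪ y, so either component can be separated from it.
    FstP SndP : Pr 2
    FstP = ∃ᵖ ∃ᵖ (v3 ≈ᵖ opT v1 v0 ∧ᵖ v2 ∈ᵖ v1)
    SndP = ∃ᵖ ∃ᵖ (v3 ≈ᵖ opT v1 v0 ∧ᵖ v2 ∈ᵖ v0)

    fst-val snd-val : Tm 1
    fst-val = sepT (⋃T (⋃T v0)) FstP
    snd-val = sepT (⋃T (⋃T v0)) SndP

    fst-val-≈ : val fst-val (‹ x , y › ◂ ø) ≈ x
    fst-val-≈ {x} {y} = ⊆-antisym
      (λ z h → proj₂ (proj₁ (∈-sepᵉ FstP (‹ x , y › ◂ ø)) h) >>=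
        λ (a , h) → h >>= λ (b , e , i) → ∈-respʳ (≈-sym (proj₁ (op-inj e))) i)
      (λ z i → proj₂ (∈-sepᵉ FstP (‹ x , y › ◂ ø))
        (⋃-intro (⋃-intro op-l pair-l) i , ∃ᶜ-intro x (∃ᶜ-intro y (≈-refl , i))))

    snd-val-≈ : val snd-val (‹ x , y › ◂ ø) ≈ y
    snd-val-≈ {x} {y} = ⊆-antisym
      (λ z h → proj₂ (proj₁ (∈-sepᵉ SndP (‹ x , y › ◂ ø)) h) >>=
        λ (a , h) → h >>= λ (b , e , i) → ∈-respʳ (≈-sym (proj₂ (op-inj e))) i)
      (λ z i → proj₂ (∈-sepᵉ SndP (‹ x , y › ◂ ø))
        (⋃-intro (⋃-intro op-r pair-r) i , ∃ᶜ-intro x (∃ᶜ-intro y (≈-refl , i))))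

    abstract
      fstF sndF : Tm 1
      fstF = fst-val
      sndF = snd-val

    fstT sndT : Tm n → Tm n
    fstT t = fstF ⟦ t ∷ [] ⟧ᵗ
    sndT t = sndF ⟦ t ∷ [] ⟧ᵗ

    fst snd : U → U
    fst p = val fstF (p ◂ ø)
    snd p = val sndF (p ◂ ø)

    fst-cong : x ≈ y → fst x ≈ fst y
    fst-cong e = Tm-cong fstF (◂-≋ e λ ())

    snd-cong : x ≈ y → snd x ≈ snd y
    snd-cong e = Tm-cong sndF (◂-≋ e λ ())

    abstract
      fst-op : fst ‹ x , y › ≈ x
      fst-op = fst-val-≈

      snd-op : snd ‹ x , y › ≈ y
      snd-op = snd-val-≈

    prod-rowT : Tm 3
    prod-rowT = imgT v2 (opT v1 v0)

    prod-val : Tm 2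
    prod-val = ⋃T (imgT v0 prod-rowT)

    ∈-prod-val : z ∈ val prod-val (a ◂ b ◂ ø) ⇔ (∃ᶜ[ x ] ∃ᶜ[ y ] x ∈ a × y ∈ b × z ≈ ‹ x , y ›)
    ∈-prod-val {z} {a} {b} =
      (λ h → proj₁ ∈-⋃ h >>= λ (s , i , j) → proj₁ (∈-imgᵉ prod-rowT (a ◂ b ◂ ø)) i >>= λ (x , x∈ , e) →
        proj₁ (∈-imgᵉ (opT v1 v0) (x ◂ a ◂ b ◂ ø)) (∈-respʳ e j) >>= λ (y , y∈ , e′) → ∃ᶜ-intro x (∃ᶜ-intro y (x∈ , y∈ , e′))) ,
      (λ h → h >>= λ (x , h) → h >>= λ (y , x∈ , y∈ , e) →
        ⋃-intro (proj₂ (∈-imgᵉ prod-rowT (a ◂ b ◂ ø)) (∃ᶜ-intro x (x∈ , ≈-refl)))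
                (proj₂ (∈-imgᵉ (opT v1 v0) (x ◂ a ◂ b ◂ ø)) (∃ᶜ-intro y (y∈ , e))))

    abstract
      prodF : Tm 2
      prodF = prod-val

    prodT : Tm n → Tm n → Tm n
    prodT a b = prodF ⟦ a ∷ b ∷ [] ⟧ᵗ

    infixl 10 _×ₛ_
    _×ₛ_ : U → U → U
    a ×ₛ b = val prodF (a ◂ b ◂ ø)

    abstract
      ∈-prod : z ∈ a ×ₛ b ⇔ (∃ᶜ[ x ] ∃ᶜ[ y ] x ∈ a × y ∈ b × z ≈ ‹ x , y ›)
      ∈-prod = ∈-prod-val

    op-∈-prod : x ∈ a → y ∈ b → ‹ x , y › ∈ a ×ₛ b
    op-∈-prod i j = proj₂ ∈-prod (∃ᶜ-intro _ (∃ᶜ-intro _ (i , j , ≈-refl)))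

    op-∈-prod⁻ : ‹ x , y › ∈ a ×ₛ b → x ∈ a × y ∈ b
    op-∈-prod⁻ h = proj₁ ∈-prod h >>= λ (x , h) → h >>= λ (y , i , j , e) →
      ∈-respˡ (≈-sym (proj₁ (op-inj e))) i , ∈-respˡ (≈-sym (proj₂ (op-inj e))) j

    sep : U → Pr 1 → U
    sep a P = sepᵉ P ø a

    img : U → Tm 1 → U
    img a t = imgᵉ t ø a

    img-intro : (t : Tm (suc n)) {ρ : Env n} → x ∈ a → val t (x ◂ ρ) ∈ imgᵉ t ρ a
    img-intro t i = proj₂ (∈-imgᵉ t _) (∃ᶜ-intro _ (i , ≈-refl))

    -- The value of a functional set of pairs at an argument
    apply-val : Tm 2
    apply-val = ⋃T (imgT (sepT v0 (fstT v0 ≈ᵖ v2)) (sndT v0))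

    abstract
      applyF : Tm 2
      applyF = apply-val

    infixl 11 _$ₛ_
    _$ₛ_ : U → U → U
    g $ₛ x = val applyF (g ◂ x ◂ ø)

    Functional Relational : U → Set
    Functional f = ∀ x y z → ‹ x , y › ∈ f → ‹ x , z › ∈ f → y ≈ z
    Relational f = ∀ w → w ∈ f → ∃ᶜ[ x ] ∃ᶜ[ y ] w ≈ ‹ x , y ›

    FunctionalP : Pr 1
    FunctionalP = ∀ᵖ ∀ᵖ ∀ᵖ (opT v2 v1 ∈ᵖ v3 ⇒ᵖ opT v2 v0 ∈ᵖ v3 ⇒ᵖ v1 ≈ᵖ v0)

    apply-val-≈ : Relational b → Functional b → ‹ x , y › ∈ b → val apply-val (b ◂ x ◂ ø) ≈ y
    apply-val-≈ {b} {x} {y} rel f h = ⊆-antisym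
      (λ z i → proj₁ ∈-⋃ i >>= λ (s , i , j) → proj₁ (∈-imgᵉ (sndT v0) (b ◂ x ◂ ø)) i >>= λ (w , w∈ , e) →
        let w∈b , e′ = proj₁ (∈-sepᵉ (fstT v0 ≈ᵖ v2) (b ◂ x ◂ ø)) w∈ in rel w w∈b >>= λ (x₁ , h₁) → h₁ >>= λ (y₁ , e₁) →
        let x₁≈ = ≈-trans (≈-sym fst-op) (≈-trans (fst-cong (≈-sym e₁)) e′) in
        ∈-respʳ (≈-trans e (≈-trans (snd-cong e₁) (≈-trans snd-op
          (f x y₁ y (∈-respˡ (≈-trans e₁ (op-cong x₁≈ ≈-refl)) w∈b) h)))) j)
      (λ z i → ⋃-intro (img-intro (sndT v0) (proj₂ (∈-sepᵉ (fstT v0 ≈ᵖ v2) (b ◂ x ◂ ø)) (h , fst-op))) (∈-respʳ (≈-sym snd-op) i))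

    abstract
      $-≈ : Relational b → Functional b → ‹ x , y › ∈ b → b $ₛ x ≈ y
      $-≈ = apply-val-≈

  open SetTheory public

  module Recursion where

    private
      variable
        a b c w x x′ y y′ z z′ : U

    -- The natural numbers

    abstract
      sucF : Tm 1
      sucF = ∪T v0 (pairT v0 v0)

    succ : U → U
    succ x = val sucF (x ◂ ø)

    sucT : Tm n → Tm n
    sucT t = sucF ⟦ t ∷ [] ⟧ᵗ

    abstract
      succ-≈ : succ x ≈ x ∪ₛ ⁅ x , x ⁆
      succ-≈ = ≈-refl

    succ-self : x ∈ succ x
    succ-self = ∈-respʳ (≈-sym succ-≈) (∪-r pair-l)

    succ-old : z ∈ x → z ∈ succ x
    succ-old i = ∈-respʳ (≈-sym succ-≈) (∪-l i)

    succ-elim : {C : Set} {{_ : Stable C}} → z ∈ succ x → (z ∈ x → C) → (z ≈ x → C) → C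
    succ-elim h f g = ∪-elim (∈-respʳ succ-≈ h) f (λ i → g (∈-sing i))

    ∈-succ : z ∈ succ x ⇔ (z ∈ x ∨ᶜ z ≈ x)
    ∈-succ = (λ h → succ-elim h ∨ᶜ-inl ∨ᶜ-inr) ,
             (λ h → ∨ᶜ-elim h succ-old (λ e → ∈-respˡ (≈-sym e) succ-self))

    succ-cong : x ≈ y → succ x ≈ succ y
    succ-cong {x} {y} e = Tm-cong sucF {x ◂ ø} {y ◂ ø} (◂-≋ e λ ())

    Inductive : U → Set
    Inductive w = ∅ ∈ w × (∀ x → x ∈ w → succ x ∈ w)
    InductiveP : Pr 1
    InductiveP = con ∅ ∈ᵖ v0 ∧ᵖ (∀ᵖ (v0 ∈ᵖ v1 ⇒ᵖ sucT v0 ∈ᵖ v1))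

    inf-inductive : Inductive inf
    inf-inductive =
      (inf-zero >>= λ (e , i , h) → ∈-respˡ (empty-≈ h) i) ,
      (λ x i → inf-suc x i >>= λ (s , j , h) → ∈-respˡ (extensional λ z →
        (λ p → proj₂ ∈-succ (proj₁ (h z) p)) , (λ p → proj₂ (h z) (proj₁ ∈-succ p))) j)

    ω-val : U
    ω-val = sep inf (∀ᵖ (InductiveP ⟦ v0 ∷ [] ⟧ ⇒ᵖ v1 ∈ᵖ v0))

    ∈-ω-val : z ∈ ω-val ⇔ (z ∈ inf × (∀ w → Inductive w → z ∈ w))
    ∈-ω-val = ∈-sepᵉ (∀ᵖ (InductiveP ⟦ v0 ∷ [] ⟧ ⇒ᵖ v1 ∈ᵖ v0)) ø

    abstract
      ω : U
      ω = ω-val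

      ω-least : Inductive w → ω ⊆ w
      ω-least h z i = proj₂ (proj₁ ∈-ω-val i) _ h

      ω-inductive : Inductive ω
      ω-inductive = proj₂ ∈-ω-val (proj₁ inf-inductive , λ w h → proj₁ h) ,
        λ x i → let j , h = proj₁ ∈-ω-val i in
          proj₂ ∈-ω-val (proj₂ inf-inductive x j , λ w k → proj₂ k x (h w k))

    ω-zero : ∅ ∈ ω
    ω-zero = proj₁ ω-inductive

    ω-suc : x ∈ ω → succ x ∈ ω
    ω-suc = proj₂ ω-inductive _

    ω-induction : (P : Pr 1) → pred P (∅ ◂ ø) →
      (∀ x → x ∈ ω → pred P (x ◂ ø) → pred P (succ x ◂ ø)) → ∀ x → x ∈ ω → pred P (x ◂ ø)
    ω-induction P h₀ hₛ x i = proj₂ (proj₁ (∈-sepᵉ P ø) (ω-least (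
      proj₂ (∈-sepᵉ P ø) (ω-zero , h₀) ,
      λ y j → let k , p = proj₁ (∈-sepᵉ P ø) j in proj₂ (∈-sepᵉ P ø) (ω-suc k , hₛ y k p)) x i))

    Transitive : U → Set
    Transitive t = ∀ x → x ∈ t → x ⊆ t

    ω-transitive : Transitive ω
    ω-transitive = ω-induction (∀ᵖ (v0 ∈ᵖ v1 ⇒ᵖ v0 ∈ᵖ con ω)) (λ z h → ⊥-elim (∉∅ h))
      λ x i h z j → succ-elim j (h z) (λ e → ∈-respˡ (≈-sym e) i)

    -- Three levels of descendants, so that the components of the ordered pairs
    -- in a set are among them.
    descF : Tm 1
    descF = ∪T (∪T v0 (⋃T v0)) (⋃T (⋃T v0))
    desc : U → U
    desc x = val descF (x ◂ ø)

    desc-∈ : y ∈ x → y ∈ desc x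
    desc-∈ i = ∪-l (∪-l i)

    desc-fst : ‹ y , z › ∈ x → y ∈ desc x
    desc-fst i = ∪-r (⋃-intro (⋃-intro i op-l) pair-l)

    -- Foundation for the set of counterexamples in `t`. The transitive set is kept explicit because
    -- transitive closures are themselves obtained from this induction, by recursion on ω.
    ∈-induction-in : {t : U} → Transitive t → (P : Pr 1) →
      (∀ x → x ∈ t → (∀ y → y ∈ x → pred P (y ◂ ø)) → pred P (x ◂ ø)) → ∀ x → x ∈ t → pred P (x ◂ ø)
    ∈-induction-in {t} tr P step x i = dne {{Pr-stable P}} λ k →
      regular bad (∃ᶜ-intro x (proj₂ ∈-bad (i , k))) λ y (j , h) →
        let y∈ , ¬p = proj₁ ∈-bad j in ¬p (step y y∈ λ z z∈ →
          dne {{Pr-stable P}} λ ¬q → h z z∈ (proj₂ ∈-bad (tr y y∈ z z∈ , ¬q)))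
      where
      bad : U
      bad = sep t (¬ᵖ P)
      ∈-bad : ∀ {z} → z ∈ bad ⇔ (z ∈ t × ¬ pred P (z ◂ ø))
      ∈-bad = ∈-sepᵉ (¬ᵖ P) ø

    desc-transitive : Transitive a → x ∈ a → desc x ⊆ a
    desc-transitive tr i z h = ∪-elim h
      (λ h → ∪-elim h (tr _ i z) (λ h → proj₁ ∈-⋃ h >>= λ (y , j , k) → tr y (tr _ i y j) z k))
      (λ h → proj₁ ∈-⋃ h >>= λ (y , j , k) → proj₁ ∈-⋃ j >>= λ (u , l , m) → tr y (tr u (tr _ i u l) y m) z k)

    -- Ordinary induction for the statement that `P` holds at a set, at its elements and at their
    -- elements; the induction hypothesis for the elements of `x` then covers all three levels of
    -- `desc x`.
    desc-induction-in : {t : U} → Transitive t → (P : Pr 1) →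
      (∀ x → x ∈ t → (∀ y → y ∈ desc x → pred P (y ◂ ø)) → pred P (x ◂ ø)) → ∀ x → x ∈ t → pred P (x ◂ ø)
    desc-induction-in tr P step x i = proj₁ (∈-induction-in tr
      (P ∧ᵖ (∀ᵖ (v0 ∈ᵖ v1 ⇒ᵖ P ⟦ v0 ∷ [] ⟧)) ∧ᵖ (∀ᵖ ∀ᵖ (v1 ∈ᵖ v2 ⇒ᵖ v0 ∈ᵖ v1 ⇒ᵖ P ⟦ v0 ∷ [] ⟧)))
      (λ x i h →
        step x i (λ y j → ∪-elim {{Pr-stable P}} j (λ j → ∪-elim {{Pr-stable P}} j
            (λ j → proj₁ (h y j))
            (λ j → _>>=_ {{Pr-stable P}} (proj₁ ∈-⋃ j) λ (u , k , l) → proj₁ (proj₂ (h u k)) y l))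
            (λ j → _>>=_ {{Pr-stable P}} (proj₁ ∈-⋃ j) λ (u , k , l) → _>>=_ {{Pr-stable P}} (proj₁ ∈-⋃ k) λ (u′ , k′ , l′) →
              proj₂ (proj₂ (h u′ k′)) u y l′ l)) ,
        (λ y j → proj₁ (h y j)) , λ y z j k → proj₁ (proj₂ (h y j)) z k) x i)

    restrictF : Tm 2
    restrictF = sepT v0 (∃ᵖ ∃ᵖ (v1 ∈ᵖ v4 ∧ᵖ v2 ≈ᵖ opT v1 v0))
    restrict : U → U → U
    restrict f a = val restrictF (f ◂ a ◂ ø)

    ∈-restrict : ∀ {f} → w ∈ restrict f a ⇔ (w ∈ f × (∃ᶜ[ y ] ∃ᶜ[ z ] y ∈ a × w ≈ ‹ y , z ›))
    ∈-restrict {a = a} {f} = ∈-sepᵉ (∃ᵖ ∃ᵖ (v1 ∈ᵖ v4 ∧ᵖ v2 ≈ᵖ opT v1 v0)) (f ◂ a ◂ ø)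

    restrict-⊆ : ∀ {f g} → (∀ y z → y ∈ a → ‹ y , z › ∈ f → ‹ y , z › ∈ g) → restrict f a ⊆ restrict g a
    restrict-⊆ h w i = let j , k = proj₁ ∈-restrict i in k >>= λ (y , k) → k >>= λ (z , l , e) →
      proj₂ ∈-restrict (∈-respˡ (≈-sym e) (h y z l (∈-respˡ e j)) , ∃ᶜ-intro y (∃ᶜ-intro z (l , e)))

    -- Recursion over descendants: rec x π = H (x , rec ↾ desc x , π)

    module Rec (H : Tm 3) where

      ApproxAt : U → U → U → U → Set
      ApproxAt x f t π = (∀ y → y ∈ desc x → y ∈ t) × (∃ᶜ[ z ] ‹ x , z › ∈ f) ×
        (∀ z → ‹ x , z › ∈ f → z ≈ val H (x ◂ restrict f (desc x) ◂ π ◂ ø))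

      ApproxAtP : Pr 4
      ApproxAtP = (∀ᵖ (v0 ∈ᵖ descF ⟦ v1 ∷ [] ⟧ᵗ ⇒ᵖ v0 ∈ᵖ v3)) ∧ᵖ
        (∃ᵖ (opT v1 v0 ∈ᵖ v2)) ∧ᵖ
        (∀ᵖ (opT v1 v0 ∈ᵖ v2 ⇒ᵖ v0 ≈ᵖ H ⟦ v1 ∷ restrictF ⟦ v2 ∷ descF ⟦ v1 ∷ [] ⟧ᵗ ∷ [] ⟧ᵗ ∷ v4 ∷ [] ⟧ᵗ))

      Approx : U → U → U → Set
      Approx f t π = ∀ x → x ∈ t → ApproxAt x f t π

      abstract
        RecP : Pr 3
        RecP = ∃ᵖ ∃ᵖ ((∀ᵖ (v0 ∈ᵖ v2 ⇒ᵖ ApproxAtP ⟦ v0 ∷ v1 ∷ v2 ∷ v5 ∷ [] ⟧)) ∧ᵖ v2 ∈ᵖ v1 ∧ᵖ opT v2 v3 ∈ᵖ v0)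

      Rec : U → U → U → Set
      Rec x z π = pred RecP (x ◂ z ◂ π ◂ ø)

      instance
        Rec-stable : ∀ {π} → Stable (Rec x z π)
        Rec-stable = Pr-stable RecP

      abstract
        Rec-intro : ∀ {f t π} → Approx f t π → x ∈ t → ‹ x , z › ∈ f → Rec x z π
        Rec-intro A i j = ∃ᶜ-intro _ (∃ᶜ-intro _ (A , i , j))

        Rec-elim : ∀ {π} → Rec x z π → ∃ᶜ[ t ] ∃ᶜ[ f ] Approx f t π × x ∈ t × ‹ x , z › ∈ f
        Rec-elim r = r

      H-cong : ∀ {g g′ π} → g ≈ g′ → val H (x ◂ g ◂ π ◂ ø) ≈ val H (x ◂ g′ ◂ π ◂ ø)
      H-cong e = Tm-cong H (◂-≋ ≈-refl (◂-≋ e λ _ → ≈-refl))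

      approx-transitive : ∀ {f t π} → Approx f t π → Transitive t
      approx-transitive A x i y j = proj₁ (A x i) y (desc-∈ j)

      -- By induction the two approximations have the same restriction to `desc x`, and `H` depends
      -- on nothing else.
      approx-unique : ∀ {f t f′ t′ π} → Approx f t π → Approx f′ t′ π →
        ∀ x → x ∈ t → x ∈ t′ → ∀ z z′ → ‹ x , z › ∈ f → ‹ x , z′ › ∈ f′ → z ≈ z′
      approx-unique {f} {t} {f′} {t′} A A′ = desc-induction-in (approx-transitive A)
        (v0 ∈ᵖ con t′ ⇒ᵖ (∀ᵖ ∀ᵖ (opT v2 v1 ∈ᵖ con f ⇒ᵖ opT v2 v0 ∈ᵖ con f′ ⇒ᵖ v1 ≈ᵖ v0)))
        λ x i h i′ z z′ j j′ → ≈-trans (proj₂ (proj₂ (A x i)) z j) (≈-trans (H-cong (⊆-antisym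
          (restrict-⊆ λ y u k l → proj₁ (proj₂ (A′ y (proj₁ (A′ x i′) y k))) >>= λ (u′ , l′) →
            ∈-respˡ (op-cong ≈-refl (≈-sym (h y k (proj₁ (A′ x i′) y k) u u′ l l′))) l′)
          (restrict-⊆ λ y u′ k l′ → proj₁ (proj₂ (A y (proj₁ (A x i) y k))) >>= λ (u , l) →
            ∈-respˡ (op-cong ≈-refl (h y k (proj₁ (A′ x i′) y k) u u′ l l′)) l)))
          (≈-sym (proj₂ (proj₂ (A′ x i′)) z′ j′)))

      Rec-resp : ∀ {π} → x ≈ x′ → z ≈ z′ → Rec x z π → Rec x′ z′ π
      Rec-resp {x} {x′} {z} {z′} {π} e e′ = Pr-resp RecP {x ◂ z ◂ π ◂ ø} {x′ ◂ z′ ◂ π ◂ ø} (◂-≋ e (◂-≋ e′ λ _ → ≈-refl))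

      Rec-unique : ∀ {π} → Rec x z π → Rec x z′ π → z ≈ z′
      Rec-unique r r′ = Rec-elim r >>= λ (t , r) → r >>= λ (f , A , i , j) →
        Rec-elim r′ >>= λ (t′ , r′) → r′ >>= λ (f′ , A′ , i′ , j′) → approx-unique A A′ _ i i′ _ _ j j′

      module _ {t π : U} (tr : Transitive t) where
        domain graph-set : U
        domain = sep t (∃ᵖ (RecP ⟦ v1 ∷ v0 ∷ con π ∷ [] ⟧))
        graph-set = repᵉ (∃ᵖ (RecP ⟦ v1 ∷ v0 ∷ con π ∷ [] ⟧ ∧ᵖ v2 ≈ᵖ opT v1 v0)) ø domain

        ∈-domain : x ∈ domain ⇔ (x ∈ t × (∃ᶜ[ z ] Rec x z π))
        ∈-domain = ∈-sepᵉ (∃ᵖ (RecP ⟦ v1 ∷ v0 ∷ con π ∷ [] ⟧)) ø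

        ∈-graph : ‹ x , z › ∈ graph-set ⇔ (x ∈ domain × Rec x z π)
        ∈-graph =
          (λ h → proj₁ spec h >>= λ (y , i , e) → e >>= λ (u , r , e) → let e₁ , e₂ = op-inj e in
            ∈-respˡ (≈-sym e₁) i , Rec-resp (≈-sym e₁) (≈-sym e₂) r) ,
          (λ (i , r) → proj₂ spec (∃ᶜ-intro _ (i , ∃ᶜ-intro _ (r , ≈-refl))))
          where
          spec : w ∈ graph-set ⇔ (∃ᶜ[ y ] y ∈ domain × (∃ᶜ[ u ] Rec y u π × w ≈ ‹ y , u ›))
          spec = ∈-repᵉ (∃ᵖ (RecP ⟦ v1 ∷ v0 ∷ con π ∷ [] ⟧ ∧ᵖ v2 ≈ᵖ opT v1 v0)) ø
            λ x _ y z p q → p >>= λ (u , r , e) → q >>= λ (u′ , r′ , e′) →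
              ≈-trans e (≈-trans (op-cong ≈-refl (Rec-unique r r′)) (≈-sym e′))

        in-domain : x ∈ t → Rec x z π → x ∈ domain
        in-domain i r = proj₂ ∈-domain (i , ∃ᶜ-intro _ r)

        Rec-desc : x ∈ t → Rec x z π → ∃ᶜ[ f ] (∀ y → y ∈ desc x → ∃ᶜ[ u ] ‹ y , u › ∈ f) ×
          (∀ y u → y ∈ desc x → ‹ y , u › ∈ f → Rec y u π) × z ≈ val H (x ◂ restrict f (desc x) ◂ π ◂ ø)
        Rec-desc i r = Rec-elim r >>= λ (t′ , r) → r >>= λ (f , A , i′ , j) → ∃ᶜ-intro f
          ((λ y k → proj₁ (proj₂ (A y (proj₁ (A _ i′) y k)))) ,
           (λ y u k l → Rec-intro A (proj₁ (A _ i′) y k) l) ,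
           proj₂ (proj₂ (A _ i′)) _ j)

        module Extend (x : U) (x∈t : x ∈ t) (x∉ : ¬ x ∈ domain)
                       (ih : ∀ y → y ∈ desc x → ∃ᶜ[ u ] Rec y u π) where
          z₀ f t′ : U
          z₀ = val H (x ◂ restrict graph-set (desc x) ◂ π ◂ ø)
          f  = graph-set ∪ₛ ⁅ ‹ x , z₀ › , ‹ x , z₀ › ⁆
          t′ = domain ∪ₛ ⁅ x , x ⁆

          sub : ∀ y → y ∈ desc x → y ∈ domain
          sub y i = ih y i >>= λ (u , r) → in-domain (desc-transitive tr x∈t y i) r

          f→graph : ∀ y u → y ∈ domain → ‹ y , u › ∈ f → ‹ y , u › ∈ graph-set
          f→graph y u i h = ∪-elim h id λ k → ⊥-elim (x∉ (∈-respˡ (proj₁ (op-inj (∈-sing k))) i))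

          rec-f : ∀ y u → y ∈ domain → ‹ y , u › ∈ f → Rec y u π
          rec-f y u i h = proj₂ (proj₁ ∈-graph (f→graph y u i h))

          total-f : ∀ y → y ∈ domain → ∃ᶜ[ u ] ‹ y , u › ∈ f
          total-f y i = proj₂ (proj₁ ∈-domain i) >>= λ (u , r) → ∃ᶜ-intro u (∪-l (proj₂ ∈-graph (i , r)))

          closed : ∀ y z → y ∈ domain → Rec y z π → ∀ y′ → y′ ∈ desc y → y′ ∈ domain
          closed y z i r y′ j = let y∈t = proj₁ (proj₁ ∈-domain i) in
            Rec-desc y∈t r >>= λ (g , tot , rec , _) → tot y′ j >>= λ (u , k) →
            in-domain (desc-transitive tr y∈t y′ j) (rec y′ u j k)

          equation : ∀ y z → y ∈ domain → Rec y z π → z ≈ val H (y ◂ restrict f (desc y) ◂ π ◂ ø)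
          equation y z i r = Rec-desc (proj₁ (proj₁ ∈-domain i)) r >>= λ (g , tot , rec , e) →
            ≈-trans e (H-cong (⊆-antisym
              (restrict-⊆ λ y′ u j l → ∪-l (proj₂ ∈-graph (closed y z i r y′ j , rec y′ u j l)))
              (restrict-⊆ λ y′ u j l → tot y′ j >>= λ (u′ , l′) →
                ∈-respˡ (op-cong ≈-refl (Rec-unique (rec y′ u′ j l′) (rec-f y′ u (closed y z i r y′ j) l))) l′)))

          at-old : ∀ y → y ∈ domain → ApproxAt y f t′ π
          at-old y i = proj₂ (proj₁ ∈-domain i) >>= λ (z , r) →
            (λ y′ j → ∪-l (closed y z i r y′ j)) , total-f y i ,
            λ z′ k → equation y z′ i (rec-f y z′ i k)

          at-new : ApproxAt x f t′ π
          at-new = (λ y′ j → ∪-l (sub y′ j)) , ∃ᶜ-intro z₀ (∪-r pair-l) ,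
            λ z′ k → ∪-elim k
              (λ k → ⊥-elim (x∉ (proj₁ (proj₁ ∈-graph k))))
              (λ k → ≈-trans (proj₂ (op-inj (∈-sing k))) (H-cong (⊆-antisym
                (restrict-⊆ λ y′ u j l → ∪-l l)
                (restrict-⊆ λ y′ u j l → f→graph y′ u (sub y′ j) l))))

          -- Descendants of old points already lie in the domain, so the added pair leaves their
          -- equations intact; the value at `x` was chosen to satisfy its own.
          approx : Approx f t′ π
          approx y y∈ = ∪-elim {{Pr-stable ApproxAtP {y ◂ f ◂ t′ ◂ π ◂ ø}}} y∈ (at-old y)
            (λ i → Pr-resp ApproxAtP {x ◂ f ◂ t′ ◂ π ◂ ø} {y ◂ f ◂ t′ ◂ π ◂ ø} (◂-≋ (≈-sym (∈-sing i)) λ _ → ≈-refl) at-new)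

          result : ∃ᶜ[ z ] Rec x z π
          result = ∃ᶜ-intro z₀ (Rec-intro approx (∪-r pair-l) (∪-r pair-l))

        Rec-total-in : ∀ x → x ∈ t → ∃ᶜ[ z ] Rec x z π
        Rec-total-in = desc-induction-in tr (∃ᵖ (RecP ⟦ v1 ∷ v0 ∷ con π ∷ [] ⟧)) λ x x∈t ih →
          byCases (x ∈ domain) (λ i → proj₂ (proj₁ ∈-domain i)) λ x∉ → Extend.result x x∈t x∉ ih

    module RecFun (H : Tm 3) where
      open Rec H public

      abstract
        -- The union of the set of values, which has at most one element; so the term is available
        -- before totality is known.
        recT : Tm 2
        recT = setT (λ ρ → ⋃ (repᵉ RecP (ρ 1F ◂ ø) ⁅ ρ 0F , ρ 0F ⁆))
          (∃ᵖ (RecP ⟦ v2 ∷ v0 ∷ v3 ∷ [] ⟧ ∧ᵖ v1 ∈ᵖ v0)) λ ρ z →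
            let s = ∈-repᵉ RecP (ρ 1F ◂ ø) (λ _ _ _ _ → Rec-unique) in
            (λ h → proj₁ ∈-⋃ h >>= λ (u , i , j) → proj₁ s i >>= λ (x , k , r) →
              ∃ᶜ-intro u (Rec-resp (∈-sing k) ≈-refl r , j)) ,
            (λ h → h >>= λ (u , r , j) → ⋃-intro (proj₂ s (∃ᶜ-intro (ρ 0F) (pair-l , r))) j)

        ∈-rec : ∀ {π} → w ∈ val recT (x ◂ π ◂ ø) ⇔ (∃ᶜ[ z ] Rec x z π × w ∈ z)
        ∈-rec {w} {x} {π} =
          (λ h → proj₁ ∈-⋃ h >>= λ (u , i , j) → proj₁ s i >>= λ (x , k , r) →
            ∃ᶜ-intro u (Rec-resp (∈-sing k) ≈-refl r , j)) ,
          (λ h → h >>= λ (u , r , j) → ⋃-intro (proj₂ s (∃ᶜ-intro x (pair-l , r))) j)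
          where
          s : ∀ {y} → y ∈ repᵉ RecP (π ◂ ø) ⁅ x , x ⁆ ⇔ (∃ᶜ[ u ] u ∈ ⁅ x , x ⁆ × Rec u y π)
          s = ∈-repᵉ RecP (π ◂ ø) (λ _ _ _ _ → Rec-unique)

      rec : U → U → U
      rec x π = val recT (x ◂ π ◂ ø)

      rec-≈ : ∀ {π} → Rec x z π → rec x π ≈ z
      rec-≈ r = ⊆-antisym
        (λ w h → proj₁ ∈-rec h >>= λ (u , r′ , j) → ∈-respʳ (Rec-unique r′ r) j)
        (λ w i → proj₂ ∈-rec (∃ᶜ-intro _ (r , i)))

      rec-cong : ∀ {π} → x ≈ x′ → rec x π ≈ rec x′ π
      rec-cong {x} {x′} {π} e = Tm-cong recT {x ◂ π ◂ ø} {x′ ◂ π ◂ ø} (◂-≋ e λ _ → ≈-refl)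

      traceF : Tm 2
      traceF = imgT (descF ⟦ v0 ∷ [] ⟧ᵗ) (opT v0 (recT ⟦ v0 ∷ v2 ∷ [] ⟧ᵗ))

      trace : U → U → U
      trace x π = val traceF (x ◂ π ◂ ø)

      ∈-trace : ∀ {π} → w ∈ trace x π ⇔ (∃ᶜ[ y ] y ∈ desc x × w ≈ ‹ y , rec y π ›)
      ∈-trace {x = x} {π} = ∈-imgᵉ (opT v0 (recT ⟦ v0 ∷ v2 ∷ [] ⟧ᵗ)) (x ◂ π ◂ ø)

      trace-$ : ∀ {π} → y ∈ desc x → trace x π $ₛ y ≈ rec y π
      trace-$ {y} {x} {π} i = $-≈
        (λ w h → proj₁ ∈-trace h >>= λ (y , _ , e) → ∃ᶜ-intro y (∃ᶜ-intro (rec y π) e))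
        (λ a b c h h′ → ≈-trans (value h) (≈-sym (value h′)))
        (proj₂ ∈-trace (∃ᶜ-intro y (i , ≈-refl)))
        where
        value : ‹ a , b › ∈ trace x π → b ≈ rec a π
        value h = proj₁ ∈-trace h >>= λ (y , _ , e) → let e₁ , e₂ = op-inj e in ≈-trans e₂ (rec-cong (≈-sym e₁))

      rec-equation-in : ∀ {t π} → Transitive t → x ∈ t → rec x π ≈ val H (x ◂ trace x π ◂ π ◂ ø)
      rec-equation-in {x} {t} {π} tr i = Rec-total-in {π = π} tr x i >>= λ (z , r) →
        Rec-desc {π = π} tr i r >>= λ (f , tot , rec′ , e) → ≈-trans (rec-≈ r) (≈-trans e (H-cong (⊆-antisym
          (λ w h → let j , k = proj₁ ∈-restrict h in k >>= λ (y , k) → k >>= λ (u , l , e) →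
            proj₂ ∈-trace (∃ᶜ-intro y (l , ≈-trans e (op-cong ≈-refl (≈-sym (rec-≈ (rec′ y u l (∈-respˡ e j))))))))
          (λ w h → proj₁ ∈-trace h >>= λ (y , l , e) → tot y l >>= λ (u , j) →
            let e′ = ≈-trans e (op-cong ≈-refl (rec-≈ (rec′ y u l j))) in
            proj₂ ∈-restrict (∈-respˡ (≈-sym e′) j , ∃ᶜ-intro y (∃ᶜ-intro u (l , e′)))))))

    -- Transitive closure

    tc-step : Tm 3
    tc-step = ∪T (pairT v2 v2) (⋃T (imgT v0 (⋃T (applyF ⟦ v2 ∷ v0 ∷ [] ⟧ᵗ))))

    module TC = RecFun tc-step

    tc-stage-base : ∀ n → n ∈ ω → x ∈ TC.rec n x
    tc-stage-base n i = ∈-respʳ (≈-sym (TC.rec-equation-in ω-transitive i)) (∪-l pair-l)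

    tc-stage-step : ∀ m n → n ∈ ω → m ∈ n → ⋃ (TC.rec m x) ⊆ TC.rec n x
    tc-stage-step {x} m n i j z k = ∈-respʳ (≈-sym (TC.rec-equation-in ω-transitive i))
      (∪-r (⋃-intro (img-intro (⋃T (applyF ⟦ v2 ∷ v0 ∷ [] ⟧ᵗ)) j) (∈-respʳ e k)))
      where
      e : ⋃ (TC.rec m x) ≈ ⋃ (TC.trace n x $ₛ m)
      e = Tm-cong (⋃T v0) {TC.rec m x ◂ ø} {(TC.trace n x $ₛ m) ◂ ø} (◂-≋ (≈-sym (TC.trace-$ (desc-∈ j))) λ ())

    tc-stageT : U → Tm 1
    tc-stageT x = TC.recT ⟦ v0 ∷ con x ∷ [] ⟧ᵗ

    -- This closure contains `x` itself, since every stage includes the singleton of `x`.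
    tc : U → U
    tc x = ⋃ (img ω (tc-stageT x))

    tc-intro : ∀ n → n ∈ ω → TC.rec n x ⊆ tc x
    tc-intro {x} n i z j = ⋃-intro (img-intro (tc-stageT x) i) j

    tc-elim : z ∈ tc x → ∃ᶜ[ n ] n ∈ ω × z ∈ TC.rec n x
    tc-elim {z} {x} h = proj₁ ∈-⋃ h >>= λ (s , i , j) → proj₁ (∈-imgᵉ (tc-stageT x) ø) i >>= λ (n , n∈ , e) →
      ∃ᶜ-intro n (n∈ , ∈-respʳ e j)

    tc-transitive : Transitive (tc x)
    tc-transitive {x} y i z j = tc-elim i >>= λ (n , n∈ , k) →
      tc-intro (succ n) (ω-suc n∈) z (tc-stage-step n (succ n) (ω-suc n∈) succ-self z (⋃-intro k j))

    in-transitive : ∀ x → ∃ᶜ[ t ] Transitive t × x ∈ t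
    in-transitive x = ∃ᶜ-intro (tc x) (tc-transitive , tc-intro ∅ ω-zero x (tc-stage-base ∅ ω-zero))

    ∈-induction : (P : Pr 1) → (∀ x → (∀ y → y ∈ x → pred P (y ◂ ø)) → pred P (x ◂ ø)) → ∀ x → pred P (x ◂ ø)
    ∈-induction P step x = _>>=_ {{Pr-stable P}} (in-transitive x) λ (t , tr , i) →
      ∈-induction-in tr P (λ x _ → step x) x i

    desc-induction : (P : Pr 1) → (∀ x → (∀ y → y ∈ desc x → pred P (y ◂ ø)) → pred P (x ◂ ø)) → ∀ x → pred P (x ◂ ø)
    desc-induction P step x = _>>=_ {{Pr-stable P}} (in-transitive x) λ (t , tr , i) →
      desc-induction-in tr P (λ x _ → step x) x i

    module Recursive (H : Tm 3) where
      open RecFun H public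

      rec-equation : ∀ {π} → rec x π ≈ val H (x ◂ trace x π ◂ π ◂ ø)
      rec-equation {x} = in-transitive x >>= λ (t , tr , i) → rec-equation-in tr i

    -- Ranks: rank x is the stage of the cumulative hierarchy of which x is first a subset.

    powT : Tm 4
    powT = 𝒫T (applyF ⟦ v2 ∷ v0 ∷ [] ⟧ᵗ)

    rank-step : Tm 3
    rank-step = ⋃T (imgT v0 powT)

    module Rank = Recursive rank-step

    ∈-rank-rec : z ∈ Rank.rec x ∅ ⇔ (∃ᶜ[ y ] y ∈ x × z ⊆ Rank.rec y ∅)
    ∈-rank-rec {z} {x} =
      (λ h → proj₁ ∈-⋃ (∈-respʳ Rank.rec-equation h) >>= λ (s , i , j) →
        proj₁ (∈-imgᵉ powT (x ◂ Rank.trace x ∅ ◂ ∅ ◂ ø)) i >>= λ (y , y∈ , e) →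
        ∃ᶜ-intro y (y∈ , λ u k → ∈-respʳ (Rank.trace-$ (desc-∈ y∈)) (proj₁ ∈-𝒫 (∈-respʳ e j) u k))) ,
      (λ h → h >>= λ (y , y∈ , s) → ∈-respʳ (≈-sym Rank.rec-equation)
        (⋃-intro (img-intro powT y∈)
          (proj₂ ∈-𝒫 λ u k → ∈-respʳ (≈-sym (Rank.trace-$ (desc-∈ y∈))) (s u k))))

    abstract
      rankF : Tm 1
      rankF = Rank.recT ⟦ v0 ∷ con ∅ ∷ [] ⟧ᵗ

    rank : U → U
    rank x = val rankF (x ◂ ø)

    abstract
      ∈-rank : z ∈ rank x ⇔ (∃ᶜ[ y ] y ∈ x × z ⊆ rank y)
      ∈-rank = ∈-rank-rec

    ⊆P : Tm n → Tm n → Pr n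
    ⊆P t s = ∀ᵖ (v0 ∈ᵖ wkT t ⇒ᵖ v0 ∈ᵖ wkT s)

    rankT : Tm n → Tm n
    rankT t = rankF ⟦ t ∷ [] ⟧ᵗ

    rank-mono : ∀ y x → x ⊆ rank y → rank x ⊆ rank y
    rank-mono = ∈-induction (∀ᵖ (⊆P v0 (rankT v1) ⇒ᵖ ⊆P (rankT v0) (rankT v1)))
      λ y ih x s z h → proj₁ ∈-rank h >>= λ (u , u∈ , z⊆) → proj₁ ∈-rank (s u u∈) >>= λ (w , w∈ , u⊆) →
        proj₂ ∈-rank (∃ᶜ-intro w (w∈ , λ t k → ih w w∈ u u⊆ t (z⊆ t k)))

    -- Stages are compared without ordinals. If z ⊆ rank w with w ∈ y, then `x` is not included in
    -- rank w, and by induction an element of `x` outside it has a rank that includes rank w.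
    rank-linear : ∀ y x → ¬ x ∈ rank y → rank y ⊆ rank x
    rank-linear = ∈-induction (∀ᵖ (v0 ∉ᵖ rankT v1 ⇒ᵖ ⊆P (rankT v1) (rankT v0)))
      λ y ih x x∉ z h → proj₁ ∈-rank h >>= λ (w , w∈ , z⊆) → dne λ k →
        x∉ (proj₂ ∈-rank (∃ᶜ-intro w (w∈ , λ u u∈ → dne λ u∉ →
          k (proj₂ ∈-rank (∃ᶜ-intro u (u∈ , λ t t∈ → ih w w∈ u u∉ t (z⊆ t t∈)))))))

    ⊆-rank : ∀ x → x ⊆ rank x
    ⊆-rank = ∈-induction (⊆P v0 (rankT v0)) λ x ih y y∈ → proj₂ ∈-rank (∃ᶜ-intro y (y∈ , ih y y∈))

    rank-induction : (P : Pr 1) → (∀ x → (∀ y → y ∈ rank x → pred P (y ◂ ø)) → pred P (x ◂ ø)) → ∀ x → pred P (x ◂ ø)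
    rank-induction P step x = ∈-induction (∀ᵖ (⊆P v0 (rankT v1) ⇒ᵖ P ⟦ v0 ∷ [] ⟧))
      (λ y ih z z⊆ → step z λ u u∈ → _>>=_ {{Pr-stable P}} (proj₁ ∈-rank u∈) λ (w , w∈ , u⊆) →
        _>>=_ {{Pr-stable P}} (proj₁ ∈-rank (z⊆ w w∈)) λ (y′ , y′∈ , w⊆) →
          ih y′ y′∈ u λ t t∈ → rank-mono y′ w w⊆ t (u⊆ t t∈)) x x (⊆-rank x)

    -- Collection

    module Collection (P : Pr 2) where
      -- Scott's trick: the witnesses of least rank share one stage, which is determined by `x`, so
      -- replacement applies to the stages where it would not apply to the witnesses.
      MinimalP : Pr 2
      MinimalP = P ∧ᵖ (∀ᵖ (P ⟦ v1 ∷ v0 ∷ [] ⟧ ⇒ᵖ ⊆P (rankT v2) (rankT v0)))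

      minimal : ∀ x → (∃ᶜ[ y ] pred P (x ◂ y ◂ ø)) → ∃ᶜ[ y ] pred MinimalP (x ◂ y ◂ ø)
      minimal x e k = e λ y p → rank-induction (¬ᵖ P ⟦ con x ∷ v0 ∷ [] ⟧)
        (λ y ih p → k y (p , λ y′ p′ → rank-linear y y′ λ i → ih y′ i p′)) y p

      level : Pr 2
      level = ∃ᵖ (MinimalP ⟦ v1 ∷ v0 ∷ [] ⟧ ∧ᵖ v2 ≈ᵖ rankT v0)

      collect : U → U
      collect a = ⋃ (img (repᵉ level ø a) (𝒫T v0))

      collect-spec : ∀ {a x} → x ∈ a → (∃ᶜ[ y ] pred P (x ◂ y ◂ ø)) →
        ∃ᶜ[ y ] y ∈ collect a × pred P (x ◂ y ◂ ø)
      collect-spec {a} {x} x∈ e = minimal x e >>= λ (y , p , q) → ∃ᶜ-intro y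
        (⋃-intro (img-intro (𝒫T v0) (proj₂ (∈-repᵉ level ø functional)
          (∃ᶜ-intro x (x∈ , ∃ᶜ-intro y ((p , q) , ≈-refl))))) (proj₂ ∈-𝒫 (⊆-rank y)) , p)
        where
        functional : ∀ x → x ∈ a → ∀ y z → pred level (x ◂ y ◂ ø) → pred level (x ◂ z ◂ ø) → y ≈ z
        functional x _ y z h h′ = h >>= λ (u , (p , q) , e) → h′ >>= λ (u′ , (p′ , q′) , e′) →
          ≈-trans e (≈-trans (⊆-antisym (q u′ p′) (q′ u p)) (≈-sym e′))

  open Recursion public

  -- Meanings of the set-theoretic formulas, and the axioms of ZF

  module Meaning where
    open Connectives 𝓢 public

    private
      variable
        a b c w x x′ y y′ z z′ : U
        A B : Set
        φ ψ : Formula n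
        ρ : Env n
        P : U → Set

    m⊆ : (x y : Fin n) → Means (x ⊆′ y) ρ (ρ x ⊆ ρ y)
    m⊆ x y = m∀∈ λ _ → m∈

    mEmpty : (x : Fin n) → Means (IsEmpty x) ρ (∀ z → ¬ z ∈ ρ x)
    mEmpty x = m∀ λ z → m¬ m∈

    mPair : (p x y : Fin n) → Means (IsPair p x y) ρ (ρ p ≈ ⁅ ρ x , ρ y ⁆)
    mPair p x y = Means-cong
      ((λ h → extensional λ z → (λ i → proj₂ ∈-pair (proj₁ (h z) i)) , (λ i → proj₂ (h z) (proj₁ ∈-pair i))) ,
       (λ e z → (λ i → proj₁ ∈-pair (∈-respʳ e i)) , (λ h → ∈-respʳ (≈-sym e) (proj₂ ∈-pair h))))
      (m∀ λ z → m⇔ m∈ (m∨ m≐ m≐))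

    mSuccessor : (s x : Fin n) → Means (IsSuccessor s x) ρ (ρ s ≈ succ (ρ x))
    mSuccessor s x = Means-cong
      ((λ h → extensional λ z → (λ i → proj₂ ∈-succ (proj₁ (h z) i)) , (λ i → proj₂ (h z) (proj₁ ∈-succ i))) ,
       (λ e z → (λ i → proj₁ ∈-succ (∈-respʳ e i)) , (λ h → ∈-respʳ (≈-sym e) (proj₂ ∈-succ h))))
      (m∀ λ z → m⇔ m∈ (m∨ m∈ m≐))

    mOrderedPair : (p x y : Fin n) → Means (IsOrderedPair p x y) ρ (ρ p ≈ ‹ ρ x , ρ y ›)
    mOrderedPair {ρ = ρ} p x y = Means-cong
      ((λ h → h >>= λ (s , h) → h >>= λ (d , e , e′ , e″) →
         ≈-trans e″ (≈-trans (Tm-cong (pairT v0 v1) {s ◂ d ◂ ø} {⁅ ρ x , ρ x ⁆ ◂ ⁅ ρ x , ρ y ⁆ ◂ ø} (◂-≋ e (◂-≋ e′ λ ()))) (≈-sym op-≈))) ,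
       (λ e → ∃ᶜ-intro _ (∃ᶜ-intro _ (≈-refl , ≈-refl , ≈-trans e op-≈))))
      (m∃ λ s → m∃ λ d → m∧ (mPair 1F (2 ↑ʳ x) (2 ↑ʳ x)) (m∧ (mPair 0F (2 ↑ʳ x) (2 ↑ʳ y)) (mPair (2 ↑ʳ p) 1F 0F)))

    m⟨⟩∈ : (x y r : Fin n) → Means (⟨ x , y ⟩∈′ r) ρ (‹ ρ x , ρ y › ∈ ρ r)
    m⟨⟩∈ x y r = Means-cong
      ((λ h → h >>= λ (p , i , e) → ∈-respˡ e i) , (λ i → ∃ᶜ-intro _ (i , ≈-refl)))
      (m∃∈ λ p → mOrderedPair 0F (1 ↑ʳ x) (1 ↑ʳ y))

    mInductive : (w : Fin n) → Means (IsInductive w) ρ (Inductive (ρ w))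
    mInductive w = Means-cong
      ((λ (h , h′) → (h >>= λ (e , i , k) → ∈-respˡ (empty-≈ k) i) ,
                     (λ x i → h′ x i >>= λ (s , j , e) → ∈-respˡ e j)) ,
       (λ (h , h′) → ∃ᶜ-intro ∅ (h , λ z → ∉∅) , λ x i → ∃ᶜ-intro (succ x) (h′ x i , ≈-refl)))
      (m∧ (m∃∈ λ e → mEmpty 0F) (m∀∈ λ x → m∃∈ λ s → mSuccessor 0F 1F))

    mOmega : (w : Fin n) → Means (IsOmega w) ρ (ρ w ≈ ω)
    mOmega {ρ = ρ} w = Means-cong
      ((λ (h , h′) → ⊆-antisym (h′ ω ω-inductive) (ω-least h)) ,
       (λ e → Pr-resp InductiveP {ω ◂ ø} {ρ w ◂ ø} (◂-≋ (≈-sym e) λ ()) ω-inductive ,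
              λ v h z i → ω-least h z (∈-respʳ e i)))
      (m∧ (mInductive w) (m∀ λ v → m⇒ (mInductive 0F) (m⊆ (1 ↑ʳ w) 0F)))

    FunctionOn : U → U → Set
    Map Injection : U → U → U → Set
    FunctionOn f a = (∀ w → w ∈ f → ∃ᶜ[ x ] x ∈ a × (∃ᶜ[ y ] w ≈ ‹ x , y ›)) ×
                     (∀ x → x ∈ a → ∃ᶜ[ y ] ‹ x , y › ∈ f) × Functional f
    Map f a b = FunctionOn f a × (∀ x y → ‹ x , y › ∈ f → y ∈ b)
    Injection f a b = Map f a b × (∀ x y z → ‹ x , z › ∈ f → ‹ y , z › ∈ f → x ≈ y)

    Countable : U → Set
    Countable a = ∃ᶜ[ f ] Injection f a ω

    mFunctionOn : (f a : Fin n) → Means (IsFunctionOn f a) ρ (FunctionOn (ρ f) (ρ a))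
    mFunctionOn f a = m∧
      (m∀∈ λ w → m∃∈ λ x → m∃ λ y → mOrderedPair 2F 1F 0F)
      (m∧ (m∀∈ λ x → m∃ λ y → m⟨⟩∈ 1F 0F (2 ↑ʳ f))
        (m∀ λ x → m∀ λ y → m∀ λ z → Means-cong curry-⇔ (m⇒ (m∧ (m⟨⟩∈ 2F 1F (3 ↑ʳ f)) (m⟨⟩∈ 2F 0F (3 ↑ʳ f))) m≐)))

    mMap : (f a b : Fin n) → Means (IsMap f a b) ρ (Map (ρ f) (ρ a) (ρ b))
    mMap f a b = m∧ (mFunctionOn f a) (m∀ λ x → m∀ λ y → m⇒ (m⟨⟩∈ 1F 0F (2 ↑ʳ f)) m∈)

    mInjection : (f a b : Fin n) → Means (IsInjection f a b) ρ (Injection (ρ f) (ρ a) (ρ b))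
    mInjection f a b = m∧ (mMap f a b) (m∀ λ x → m∀ λ y → m∀ λ z →
      Means-cong curry-⇔ (m⇒ (m∧ (m⟨⟩∈ 2F 0F (3 ↑ʳ f)) (m⟨⟩∈ 1F 0F (3 ↑ʳ f))) m≐))

    mCountable : (a : Fin n) → Means (IsCountable a) ρ (Countable (ρ a))
    mCountable {ρ = ρ} a = Means-cong
      ((λ h → h >>= λ (w , h) → h >>= λ (f , e , (on , range) , inj) →
         ∃ᶜ-intro f ((on , λ x y i → ∈-respʳ e (range x y i)) , inj)) ,
       (λ h → h >>= λ (f , i) → ∃ᶜ-intro ω (∃ᶜ-intro f (≈-refl , i))))
      (m∃ λ w → m∃ λ f → m∧ (mOmega 1F) (mInjection 0F (2 ↑ʳ a) 1F))

    -- A ZFModel satisfies the axioms of ZF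

    sat-ZF : ∀ {σ} → ZF σ → ∀ ρ → sat σ ρ
    sat-ZF {σ} extensionality ρ = holds σ ρ (m∀ λ x → m∀ λ y → m⇒ (m∀ λ z → m⇔ m∈ m∈) m≐) λ x y → extensional
    sat-ZF {σ} foundation ρ = holds σ ρ (m∀ λ x → m⇒ (m∃ λ y → m∈) (m∃∈ λ y → m¬ (m∃ λ z → m∧ m∈ m∈)))
      λ x h → regular x h >>= λ (y , i , k) → ∃ᶜ-intro y (i , λ e → e λ z (j , l) → k z j l)
    sat-ZF {σ} pairing ρ = holds σ ρ (m∀ λ x → m∀ λ y → m∃ λ p → mPair 0F 2F 1F) λ x y → ∃ᶜ-intro _ ≈-refl
    sat-ZF {σ} union ρ = holds σ ρ (m∀ λ x → m∃ λ u → m∀ λ z → m⇔ m∈ (m∃∈ λ y → m∈)) λ x → ∃ᶜ-intro (⋃ x) λ z → ∈-⋃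
    sat-ZF {σ} powerSet ρ = holds σ ρ (m∀ λ x → m∃ λ p → m∀ λ z → m⇔ m∈ (m⊆ 0F 2F)) λ x → ∃ᶜ-intro (𝒫 x) λ z → ∈-𝒫
    sat-ZF {σ} infinity ρ = holds σ ρ (m∃ λ w → mInductive 0F) (∃ᶜ-intro ω ω-inductive)
    sat-ZF (separation {n} φ) = sat-closure n (separationBody φ) λ ρ →
      holds (separationBody φ) ρ (mSeparation φ) λ a → ∃ᶜ-intro (separate φ ρ a) λ z → ∈-separate φ ρ
    sat-ZF (replacement {n} φ) = sat-closure n (replacementBody φ) λ ρ →
      holds (replacementBody φ) ρ (mReplacement φ) λ a functional → ∃ᶜ-intro (replace φ ρ a) λ y → ∈-replace φ ρ functional

  open Meaning public

  -- Iteration, addition and a walk through ω × ω inside a model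

  module Naturals where

    private
      variable
        a b c w x x′ y y′ z z′ : U

    ∉-cycle : x ∈ y → ¬ y ∈ x
    ∉-cycle {x} {y} i j = ∈-induction (∀ᵖ (v0 ∈ᵖ v1 ⇒ᵖ ¬ᵖ v1 ∈ᵖ v0)) (λ x ih y j i → ih y j x i j) x y j i

    succ-inj : succ x ≈ succ y → x ≈ y
    succ-inj e = succ-elim (∈-respʳ e succ-self)
      (λ i → succ-elim (∈-respʳ (≈-sym e) succ-self) (λ j → ⊥-elim (∉-cycle i j)) ≈-sym) id

    succ-≉∅ : ¬ succ x ≈ ∅
    succ-≉∅ e = ∉∅ (∈-respʳ e succ-self)

    sing-≈ : ⋃ ⁅ x , x ⁆ ≈ x
    sing-≈ = ⊆-antisym (λ z h → proj₁ ∈-⋃ h >>= λ (y , i , j) → ∈-respʳ (∈-sing i) j) (λ z → ⋃-intro pair-l)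

    ⋃-cong : x ≈ y → ⋃ x ≈ ⋃ y
    ⋃-cong {x} {y} e = Tm-cong (⋃T v0) {x ◂ ø} {y ◂ ø} (◂-≋ e λ ())

    $-cong : x ≈ x′ → y ≈ y′ → x $ₛ y ≈ x′ $ₛ y′
    $-cong {x} {x′} {y} {y′} e e′ = Tm-cong applyF {x ◂ y ◂ ø} {x′ ◂ y′ ◂ ø} (◂-≋ e (◂-≋ e′ λ ()))

    -- Iteration: iter ‹ z , r › n = r (… r (z)), n times

    iter-nextT : Tm 4
    iter-nextT = applyF ⟦ sndT v3 ∷ applyF ⟦ v2 ∷ v0 ∷ [] ⟧ᵗ ∷ [] ⟧ᵗ

    -- Definition by cases: at zero one set is the singleton of the start and the other is empty, at
    -- a successor the singleton of the next value comes from the second; `⋃` extracts the value.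
    iter-base iter-next iter-step : Tm 3
    iter-base = sepT (pairT (fstT v2) (fstT v2)) (v1 ≈ᵖ con ∅)
    iter-next = imgT (sepT v0 (v1 ≈ᵖ sucT v0)) iter-nextT
    iter-step = ⋃T (∪T iter-base iter-next)

    abstract
      iterH : Tm 3
      iterH = iter-step

      iterH-≈ : (ρ : Env 3) → val iterH ρ ≈ val iter-step ρ
      iterH-≈ ρ = ≈-refl

    module Iter = Recursive iterH

    iter : U → U → U
    iter π n = Iter.rec n π

    module _ (π : U) where
      private
        env : U → Env 3
        env n = n ◂ Iter.trace n π ◂ π ◂ ø

      ∈-iter-base : ∀ n → w ∈ val iter-base (env n) ⇔ (w ∈ ⁅ fst π , fst π ⁆ × n ≈ ∅)
      ∈-iter-base n = ∈-sepᵉ (v1 ≈ᵖ con ∅) (env n)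

      iter-next-elim : ∀ n → w ∈ val iter-next (env n) →
        ∃ᶜ[ m ] (m ∈ n × n ≈ succ m) × w ≈ snd π $ₛ (Iter.trace n π $ₛ m)
      iter-next-elim {w} n h = proj₁ (∈-imgᵉ iter-nextT (env n)) h >>= λ (m , i , e) → found m i e
        where
        found : ∀ m → m ∈ sepᵉ (v1 ≈ᵖ sucT v0) (env n) n → w ≈ val iter-nextT (m ◂ env n) →
          ∃ᶜ[ m ] (m ∈ n × n ≈ succ m) × w ≈ snd π $ₛ (Iter.trace n π $ₛ m)
        found m i e = ∃ᶜ-intro m (proj₁ (∈-sepᵉ (v1 ≈ᵖ sucT v0) (env n)) i , e)

      iter-next-intro : ∀ m → snd π $ₛ (Iter.trace (succ m) π $ₛ m) ∈ val iter-next (env (succ m))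
      iter-next-intro m = img-intro iter-nextT {env (succ m)} (proj₂ (∈-sepᵉ (v1 ≈ᵖ sucT v0) (env (succ m))) (succ-self , ≈-refl))

      iter-zero : iter π ∅ ≈ fst π
      iter-zero = ≈-trans Iter.rec-equation (≈-trans (≈-trans (iterH-≈ _) (⋃-cong (⊆-antisym
        (λ z h → ∪-elim h (λ i → proj₁ (proj₁ (∈-iter-base ∅) i))
          (λ i → iter-next-elim ∅ i >>= λ (m , (j , _) , _) → ⊥-elim (∉∅ j)))
        (λ z i → ∪-l (proj₂ (∈-iter-base ∅) (i , ≈-refl)))))) sing-≈)

      iter-suc : iter π (succ x) ≈ snd π $ₛ iter π x
      iter-suc {x} = ≈-trans Iter.rec-equation (≈-trans (≈-trans (iterH-≈ _) (⋃-cong (⊆-antisym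
        (λ z h → ∪-elim h (λ i → ⊥-elim (succ-≉∅ (proj₂ (proj₁ (∈-iter-base (succ x)) i))))
          (λ i → iter-next-elim (succ x) i >>= λ (m , (j , e) , e′) →
            ∈-respˡ (≈-sym (≈-trans e′ ($-cong ≈-refl (≈-trans (Iter.trace-$ (desc-∈ j)) (Iter.rec-cong (succ-inj (≈-sym e))))))) pair-l))
        (λ z i → ∪-r (∈-respˡ (≈-trans ($-cong ≈-refl (Iter.trace-$ (desc-∈ succ-self))) (≈-sym (∈-sing i))) (iter-next-intro x))))))
        sing-≈)

    -- Addition: a + b = a ∪ { a + x | x ∈ b }

    add-valT : Tm 4
    add-valT = applyF ⟦ v2 ∷ v0 ∷ [] ⟧ᵗ

    add-step : Tm 3
    add-step = ∪T v2 (imgT v0 add-valT)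

    abstract
      addH : Tm 3
      addH = add-step

      addH-≈ : (ρ : Env 3) → val addH ρ ≈ val add-step ρ
      addH-≈ ρ = ≈-refl

    module Add = Recursive addH

    infixl 12 _+ₛ_
    _+ₛ_ : U → U → U
    a +ₛ b = Add.rec b a

    ∈-add : z ∈ a +ₛ b ⇔ (z ∈ a ∨ᶜ (∃ᶜ[ x ] x ∈ b × z ≈ a +ₛ x))
    ∈-add {z} {a} {b} =
      (λ h → ∪-elim (∈-respʳ (≈-trans Add.rec-equation (addH-≈ _)) h) ∨ᶜ-inl λ i → ∨ᶜ-inr
        (proj₁ (∈-imgᵉ add-valT (b ◂ Add.trace b a ◂ a ◂ ø)) i >>= λ (x , j , e) →
          ∃ᶜ-intro x (j , ≈-trans e (Add.trace-$ (desc-∈ j))))) ,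
      (λ h → ∈-respʳ (≈-sym (≈-trans Add.rec-equation (addH-≈ _))) (∨ᶜ-elim h ∪-l λ h → h >>= λ (x , j , e) →
        ∪-r (proj₂ (∈-imgᵉ add-valT (b ◂ Add.trace b a ◂ a ◂ ø))
          (∃ᶜ-intro x (j , ≈-trans e (≈-sym (Add.trace-$ (desc-∈ j))))))))

    add-zero : a +ₛ ∅ ≈ a
    add-zero = ⊆-antisym (λ z h → ∨ᶜ-elim (proj₁ ∈-add h) id λ h → h >>= λ (x , i , _) → ⊥-elim (∉∅ i))
      (λ z i → proj₂ ∈-add (∨ᶜ-inl i))

    add-suc : a +ₛ succ b ≈ succ (a +ₛ b)
    add-suc {a} {b} = ⊆-antisym
      (λ z h → ∨ᶜ-elim (proj₁ ∈-add h) (λ i → succ-old (proj₂ ∈-add (∨ᶜ-inl i))) λ h → h >>= λ (x , i , e) →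
        succ-elim i (λ i → succ-old (proj₂ ∈-add (∨ᶜ-inr (∃ᶜ-intro x (i , e)))))
          (λ e′ → ∈-respˡ (≈-sym (≈-trans e (Add.rec-cong e′))) succ-self))
      (λ z h → succ-elim h
        (λ h → proj₂ ∈-add (∨ᶜ-elim (proj₁ ∈-add h) ∨ᶜ-inl λ h → h >>= λ (x , i , e) → ∨ᶜ-inr (∃ᶜ-intro x (succ-old i , e))))
        (λ e → proj₂ ∈-add (∨ᶜ-inr (∃ᶜ-intro b (succ-self , e)))))

    addT : Tm n → Tm n → Tm n
    addT t s = Add.recT ⟦ s ∷ t ∷ [] ⟧ᵗ

    suc-add : ∀ b → b ∈ ω → ∀ a → succ a +ₛ b ≈ succ (a +ₛ b)
    suc-add = ω-induction (∀ᵖ (addT (sucT v0) v1 ≈ᵖ sucT (addT v0 v1)))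
      (λ a → ≈-trans add-zero (≈-sym (succ-cong add-zero)))
      λ b i ih a → ≈-trans add-suc (≈-trans (succ-cong (ih a)) (≈-sym (succ-cong add-suc)))

    zero-add : ∀ b → b ∈ ω → ∅ +ₛ b ≈ b
    zero-add = ω-induction (addT (con ∅) v0 ≈ᵖ v0) add-zero λ b i e → ≈-trans add-suc (succ-cong e)

    add-ω : ∀ b → b ∈ ω → ∀ a → a ∈ ω → a +ₛ b ∈ ω
    add-ω = ω-induction (∀ᵖ (v0 ∈ᵖ con ω ⇒ᵖ addT v0 v1 ∈ᵖ con ω)) (λ a i → ∈-respˡ (≈-sym add-zero) i)
      λ b _ ih a i → ∈-respˡ (≈-sym add-suc) (ω-suc (ih a i))

    -- An enumeration of ω × ω along the diagonals

    WalkP : Pr 1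
    WalkP = ∃ᵖ ∃ᵖ (v2 ≈ᵖ opT (opT (con ∅) v0) (opT (sucT v0) (con ∅)) ∨ᵖ
                   v2 ≈ᵖ opT (opT (sucT v1) v0) (opT v1 (sucT v0)))

    ω² walk-step : U
    ω² = ω ×ₛ ω
    walk-step = sep (ω² ×ₛ ω²) WalkP

    ∈-walk-step : w ∈ walk-step ⇔ (w ∈ ω² ×ₛ ω² × (∃ᶜ[ a ] ∃ᶜ[ b ]
      (w ≈ ‹ ‹ ∅ , b › , ‹ succ b , ∅ › › ∨ᶜ w ≈ ‹ ‹ succ a , b › , ‹ a , succ b › ›)))
    ∈-walk-step = ∈-sepᵉ WalkP ø

    walk-step-0 : b ∈ ω → ‹ ‹ ∅ , b › , ‹ succ b , ∅ › › ∈ walk-step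
    walk-step-0 i = proj₂ ∈-walk-step (op-∈-prod (op-∈-prod ω-zero i) (op-∈-prod (ω-suc i) ω-zero) ,
      ∃ᶜ-intro ∅ (∃ᶜ-intro _ (∨ᶜ-inl ≈-refl)))

    walk-step-s : a ∈ ω → b ∈ ω → ‹ ‹ succ a , b › , ‹ a , succ b › › ∈ walk-step
    walk-step-s i j = proj₂ ∈-walk-step (op-∈-prod (op-∈-prod (ω-suc i) j) (op-∈-prod i (ω-suc j)) ,
      ∃ᶜ-intro _ (∃ᶜ-intro _ (∨ᶜ-inr ≈-refl)))

    walk-step-relational : Relational walk-step
    walk-step-relational w i = proj₁ ∈-prod (proj₁ (proj₁ ∈-walk-step i)) >>= λ (x , h) → h >>= λ (y , _ , _ , e) →
      ∃ᶜ-intro x (∃ᶜ-intro y e)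

    walk-step-functional : Functional walk-step
    walk-step-functional x y z i j =
      proj₂ (proj₁ ∈-walk-step i) >>= λ (a , h) → h >>= λ (b , h) →
      proj₂ (proj₁ ∈-walk-step j) >>= λ (a′ , h′) → h′ >>= λ (b′ , h′) →
      ∨ᶜ-elim h
        (λ e → let e₁ , e₂ = op-inj e in ∨ᶜ-elim h′
          (λ e′ → let e₁′ , e₂′ = op-inj e′ ; _ , eb = op-inj (≈-trans (≈-sym e₁) e₁′) in
            ≈-trans e₂ (≈-trans (op-cong (succ-cong eb) ≈-refl) (≈-sym e₂′)))
          (λ e′ → let e₁′ , _ = op-inj e′ in ⊥-elim (succ-≉∅ (≈-sym (proj₁ (op-inj (≈-trans (≈-sym e₁) e₁′)))))))
        (λ e → let e₁ , e₂ = op-inj e in ∨ᶜ-elim h′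
          (λ e′ → let e₁′ , _ = op-inj e′ in ⊥-elim (succ-≉∅ (proj₁ (op-inj (≈-trans (≈-sym e₁) e₁′)))))
          (λ e′ → let e₁′ , e₂′ = op-inj e′ ; ea , eb = op-inj (≈-trans (≈-sym e₁) e₁′) in
            ≈-trans e₂ (≈-trans (op-cong (succ-inj ea) (succ-cong eb)) (≈-sym e₂′))))

    walk : U → U
    walk = iter ‹ ‹ ∅ , ∅ › , walk-step ›
    walkT : Tm n → Tm n
    walkT t = Iter.recT ⟦ t ∷ con ‹ ‹ ∅ , ∅ › , walk-step › ∷ [] ⟧ᵗ

    Visited : U → U → Set
    Visited a b = ∃ᶜ[ n ] n ∈ ω × walk n ≈ ‹ a , b ›
    VisitedP : Pr 2
    VisitedP = ∃ᵖ (v0 ∈ᵖ con ω ∧ᵖ walkT v0 ≈ᵖ opT v1 v2)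

    visited-resp : a ≈ x → b ≈ y → Visited a b → Visited x y
    visited-resp e e′ h = h >>= λ (n , i , e″) → ∃ᶜ-intro n (i , ≈-trans e″ (op-cong e e′))

    visited-step : ‹ ‹ a , b › , ‹ x , y › › ∈ walk-step → Visited a b → Visited x y
    visited-step s h = h >>= λ (n , i , e) → ∃ᶜ-intro (succ n) (ω-suc i ,
      ≈-trans (iter-suc _) (≈-trans ($-cong snd-op e) ($-≈ walk-step-relational walk-step-functional s)))

    -- Induction on `a`, since the walk goes from (succ a, b) to (a, succ b).
    visited-down : ∀ a → a ∈ ω → ∀ b → b ∈ ω → Visited a b → Visited ∅ (a +ₛ b)
    visited-down = ω-induction (∀ᵖ (v0 ∈ᵖ con ω ⇒ᵖ VisitedP ⟦ v1 ∷ v0 ∷ [] ⟧ ⇒ᵖ VisitedP ⟦ con ∅ ∷ addT v1 v0 ∷ [] ⟧))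
      (λ b i h → visited-resp ≈-refl (≈-sym (zero-add b i)) h)
      λ a i ih b j h → visited-resp ≈-refl (≈-trans add-suc (≈-sym (suc-add b j a)))
        (ih (succ b) (ω-suc j) (visited-step (walk-step-s i j) h))

    -- The end (∅, a) of one diagonal is followed by the start (succ a, ∅) of the next.
    visited-axis : ∀ a → a ∈ ω → Visited a ∅
    visited-axis = ω-induction (VisitedP ⟦ v0 ∷ con ∅ ∷ [] ⟧)
      (∃ᶜ-intro ∅ (ω-zero , ≈-trans (iter-zero _) fst-op))
      λ a i h → visited-step (walk-step-0 i) (visited-resp ≈-refl add-zero (visited-down a i ∅ ω-zero h))

    visited-along : ∀ b → b ∈ ω → ∀ a → a ∈ ω → Visited (a +ₛ b) ∅ → Visited a b
    visited-along = ω-induction (∀ᵖ (v0 ∈ᵖ con ω ⇒ᵖ VisitedP ⟦ addT v0 v1 ∷ con ∅ ∷ [] ⟧ ⇒ᵖ VisitedP ⟦ v0 ∷ v1 ∷ [] ⟧))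
      (λ a i h → visited-resp add-zero ≈-refl h)
      λ b j ih a i h → visited-step (walk-step-s i j) (ih (succ a) (ω-suc i)
        (visited-resp (≈-trans add-suc (≈-sym (suc-add b j a))) ≈-refl h))

    visited : a ∈ ω → b ∈ ω → Visited a b
    visited i j = visited-along _ j _ i (visited-axis _ (add-ω _ j _ i))

  open Naturals public

  -- Countability from labels

  module Enumerating where

    private
      variable
        x y z w : U

    ∅-least : ∀ n → n ∈ ω → n ≈ ∅ ∨ᶜ ∅ ∈ n
    ∅-least = ω-induction (v0 ≈ᵖ con ∅ ∨ᵖ con ∅ ∈ᵖ v0) (∨ᶜ-inl ≈-refl) λ n i h → ∨ᶜ-inr (∨ᶜ-elim h
      (λ e → ∈-respˡ e succ-self) succ-old)

    succ-mono : ∀ n → n ∈ ω → ∀ m → m ∈ n → succ m ∈ succ n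
    succ-mono = ω-induction (∀ᵖ (v0 ∈ᵖ v1 ⇒ᵖ sucT v0 ∈ᵖ sucT v1)) (λ m h → ⊥-elim (∉∅ h))
      λ n i ih m h → succ-elim h (λ h → succ-old (ih m h)) (λ e → ∈-respˡ (≈-sym (succ-cong e)) succ-self)

    Comparable : U → U → Set
    Comparable m n = m ∈ n ∨ᶜ (m ≈ n ∨ᶜ n ∈ m)

    ω-linear : ∀ n → n ∈ ω → ∀ m → m ∈ ω → Comparable m n
    ω-linear = ω-induction (∀ᵖ (v0 ∈ᵖ con ω ⇒ᵖ (v0 ∈ᵖ v1 ∨ᵖ (v0 ≈ᵖ v1 ∨ᵖ v1 ∈ᵖ v0))))
      (λ m i → ∨ᶜ-inr (∅-least m i))
      λ n i ih m j → ∨ᶜ-elim (ih m j) (λ h → ∨ᶜ-inl (succ-old h)) λ h → ∨ᶜ-elim h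
        (λ e → ∨ᶜ-inl (∈-respˡ (≈-sym e) succ-self))
        (λ h → ∨ᶜ-inr (succ-elim (succ-mono m j n h) ∨ᶜ-inr (λ e → ∨ᶜ-inl (≈-sym e))))

    module _ (c : U) (R : Pr 2) (labelled : ∀ z → z ∈ c → ∃ᶜ[ n ] n ∈ ω × pred R (n ◂ z ◂ ø))
             (faithful : ∀ n z z′ → z ∈ c → z′ ∈ c → pred R (n ◂ z ◂ ø) → pred R (n ◂ z′ ◂ ø) → z ≈ z′) where
      private
        LeastP : Pr 2
        LeastP = R ∧ᵖ (∀ᵖ (v0 ∈ᵖ v1 ⇒ᵖ ¬ᵖ R ⟦ v0 ∷ v2 ∷ [] ⟧))

        Least : U → U → Set
        Least n z = pred R (n ◂ z ◂ ø) × (∀ m → m ∈ n → ¬ pred R (m ◂ z ◂ ø))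

        LabelP : Pr 1
        LabelP = ∃ᵖ ∃ᵖ (v2 ≈ᵖ opT v1 v0 ∧ᵖ LeastP ⟦ v0 ∷ v1 ∷ [] ⟧)

        h : U
        h = sep (c ×ₛ ω) LabelP

        least-resp : ∀ {n n′ z z′} → n ≈ n′ → z ≈ z′ → Least n z → Least n′ z′
        least-resp {n} {n′} {z} {z′} e e′ = Pr-resp LeastP {n ◂ z ◂ ø} {n′ ◂ z′ ◂ ø} (◂-≋ e (◂-≋ e′ λ ()))

        ∈-h : ∀ {z n} → ‹ z , n › ∈ h ⇔ (z ∈ c × n ∈ ω × Least n z)
        ∈-h {z} {n} =
          (λ i → let j , k = proj₁ (∈-sepᵉ LabelP ø) i ; z∈ , n∈ = op-∈-prod⁻ j in z∈ , n∈ ,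
            _>>=_ {{Pr-stable LeastP {n ◂ z ◂ ø}}} k λ (z′ , k) → _>>=_ {{Pr-stable LeastP {n ◂ z ◂ ø}}} k λ (n′ , e , l) →
              let e₁ , e₂ = op-inj e in least-resp (≈-sym e₂) (≈-sym e₁) l) ,
          (λ (z∈ , n∈ , l) → proj₂ (∈-sepᵉ LabelP ø) (op-∈-prod z∈ n∈ , ∃ᶜ-intro z (∃ᶜ-intro n (≈-refl , l))))

        LabelsP : U → Pr 1
        LabelsP z = R ⟦ v0 ∷ con z ∷ [] ⟧

        least-exists : ∀ z → z ∈ c → ∃ᶜ[ n ] n ∈ ω × Least n z
        least-exists z i = labelled z i >>= λ (n , n∈ , r) → regular (sep ω (LabelsP z))
          (∃ᶜ-intro n (proj₂ (∈-sepᵉ (LabelsP z) ø) (n∈ , r))) >>= λ (m , j , min) →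
          let m∈ , r′ = proj₁ (∈-sepᵉ (LabelsP z) ø) j in ∃ᶜ-intro m (m∈ , r′ , λ m′ k r″ →
            min m′ k (proj₂ (∈-sepᵉ (LabelsP z) ø) (ω-transitive m m∈ m′ k , r″)))

        least-unique : ∀ {z n n′} → n ∈ ω → n′ ∈ ω → Least n z → Least n′ z → n ≈ n′
        least-unique i j (r , l) (r′ , l′) = ∨ᶜ-elim (ω-linear _ j _ i) (λ k → ⊥-elim (l′ _ k r)) λ k →
          ∨ᶜ-elim k id (λ k → ⊥-elim (l _ k r′))

        injection : Injection h c ω
        injection =
          (((λ w i → proj₁ ∈-prod (proj₁ (proj₁ (∈-sepᵉ LabelP ø) i)) >>= λ (z , k) → k >>= λ (n , z∈ , _ , e) →
               ∃ᶜ-intro z (z∈ , ∃ᶜ-intro n e)) ,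
            (λ z i → least-exists z i >>= λ (n , n∈ , l) → ∃ᶜ-intro n (proj₂ ∈-h (i , n∈ , l))) ,
            (λ z n n′ i j → let _ , n∈ , l = proj₁ ∈-h i ; _ , n′∈ , l′ = proj₁ ∈-h j in least-unique n∈ n′∈ l l′)) ,
           (λ z n i → proj₁ (proj₂ (proj₁ ∈-h i)))) ,
          (λ z z′ n i j → let z∈ , _ , r , _ = proj₁ ∈-h i ; z′∈ , _ , r′ , _ = proj₁ ∈-h j in faithful n z z′ z∈ z′∈ r r′)

        countable-intro : ∀ f → Injection f c ω → Countable c
        countable-intro f i = ∃ᶜ-intro f i

      -- Sending each element to its least label gives an injection without any use of choice, so
      -- the argument is available in the symmetric extension.
      countable-labelled : Countable c
      countable-labelled = countable-intro h injection

    -- A pair in a functional set is determined by its first component, so it can inherit the labels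
    -- of that component.
    countable-graph : ∀ c f → Functional c → Functional f →
      (∀ z → z ∈ c → ∃ᶜ[ n ] ∃ᶜ[ a ] ∃ᶜ[ x ] n ∈ ω × z ≈ ‹ a , x › × ‹ n , a › ∈ f) → Countable c
    countable-graph c f fun fun-f h = countable-labelled c FirstP
      (λ z i → h z i >>= λ (n , k) → k >>= λ (a , k) → k >>= λ (x , n∈ , e , j) → ∃ᶜ-intro n (n∈ , ∃ᶜ-intro a (∃ᶜ-intro x (e , j))))
      λ n z z′ i j l l′ → l >>= λ (a , k) → k >>= λ (x , e , h) → l′ >>= λ (a′ , k) → k >>= λ (x′ , e′ , h′) →
        let a≈ = fun-f n a a′ h h′ in
        ≈-trans e (≈-trans (op-cong a≈ (fun a x x′ (∈-respˡ e i) (∈-respˡ (op-cong (≈-sym a≈) ≈-refl) (∈-respˡ e′ j)))) (≈-sym e′))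
      where
      FirstP : Pr 2
      FirstP = ∃ᵖ ∃ᵖ (v3 ≈ᵖ opT v1 v0 ∧ᵖ opT v2 v1 ∈ᵖ con f)

  open Enumerating public

  -- Notions of forcing and the chain conditions in a model

  module Chains where

    IsPreorder′ : U → U → Set
    IsPreorder′ P L = (∀ w → w ∈ L → ∃ᶜ[ x ] x ∈ P × (∃ᶜ[ y ] y ∈ P × w ≈ ‹ x , y ›)) ×
      (∀ x → x ∈ P → ‹ x , x › ∈ L) ×
      (∀ x y z → ‹ x , y › ∈ L × ‹ y , z › ∈ L → ‹ x , z › ∈ L) ×
      (∃ᶜ[ m ] m ∈ P × (∀ x → x ∈ P → ‹ x , m › ∈ L))

    Compat : U → U → U → U → Set
    Compat P L x y = ∃ᶜ[ r ] r ∈ P × ‹ r , x › ∈ L × ‹ r , y › ∈ L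

    Antichain MaximalAntichain Predense : U → U → U → Set
    Antichain P L A = A ⊆ P × (∀ x → x ∈ A → ∀ y → y ∈ A → ¬ x ≈ y → ¬ Compat P L x y)
    MaximalAntichain P L A = Antichain P L A × (∀ B → Antichain P L B × A ⊆ B → B ≈ A)
    Predense P L D = D ⊆ P × (∀ x → x ∈ P → ∃ᶜ[ y ] y ∈ D × Compat P L x y)

    ccc₁ ccc₂ ccc₃ : U → U → Set
    ccc₁ P L = ∀ A → MaximalAntichain P L A → Countable A
    ccc₂ P L = ∀ A → Antichain P L A → Countable A
    ccc₃ P L = ∀ D → Predense P L D → ∃ᶜ[ E ] E ⊆ D × Countable E × Predense P L E

    module _ {n} {ρ : Env n} where
      mForcing : (P L : Fin n) → Means (IsForcing P L) ρ (IsPreorder′ (ρ P) (ρ L))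
      mForcing P L = m∧ (m∀∈ λ w → m∃∈ λ x → m∃∈ λ y → mOrderedPair 2F 1F 0F)
        (m∧ (m∀∈ λ x → m⟨⟩∈ 0F 0F (1 ↑ʳ L))
        (m∧ (m∀ λ x → m∀ λ y → m∀ λ z → m⇒ (m∧ (m⟨⟩∈ 2F 1F (3 ↑ʳ L)) (m⟨⟩∈ 1F 0F (3 ↑ʳ L))) (m⟨⟩∈ 2F 0F (3 ↑ʳ L)))
            (m∃∈ λ m → m∀∈ λ x → m⟨⟩∈ 0F 1F (2 ↑ʳ L))))

      mCompatible : (P L p q : Fin n) → Means (Compatible P L p q) ρ (Compat (ρ P) (ρ L) (ρ p) (ρ q))
      mCompatible P L p q = m∃∈ λ r → m∧ (m⟨⟩∈ 0F (1 ↑ʳ p) (1 ↑ʳ L)) (m⟨⟩∈ 0F (1 ↑ʳ q) (1 ↑ʳ L))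

    mAntichain : {ρ : Env n} (P L A : Fin n) → Means (IsAntichain P L A) ρ (Antichain (ρ P) (ρ L) (ρ A))
    mAntichain P L A = m∧ (m⊆ A P) (m∀∈ λ x → m∀∈ λ y → m⇒ (m¬ m≐) (m¬ (mCompatible (2 ↑ʳ P) (2 ↑ʳ L) 1F 0F)))

    mMaximalAntichain : {ρ : Env n} (P L A : Fin n) → Means (IsMaximalAntichain P L A) ρ (MaximalAntichain (ρ P) (ρ L) (ρ A))
    mMaximalAntichain P L A = m∧ (mAntichain P L A)
      (m∀ λ B → m⇒ (m∧ (mAntichain (1 ↑ʳ P) (1 ↑ʳ L) 0F) (m⊆ (1 ↑ʳ A) 0F)) m≐)

    mPredense : {ρ : Env n} (P L D : Fin n) → Means (IsPredense P L D) ρ (Predense (ρ P) (ρ L) (ρ D))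
    mPredense P L D = m∧ (m⊆ D P) (m∀∈ λ x → m∃∈ λ y → mCompatible (2 ↑ʳ P) (2 ↑ʳ L) 1F 0F)

    mCCC₁ : {ρ : Env n} (P L : Fin n) → Means (CCC₁ P L) ρ (ccc₁ (ρ P) (ρ L))
    mCCC₁ P L = m∀ λ A → m⇒ (mMaximalAntichain (1 ↑ʳ P) (1 ↑ʳ L) 0F) (mCountable 0F)

    mCCC₂ : {ρ : Env n} (P L : Fin n) → Means (CCC₂ P L) ρ (ccc₂ (ρ P) (ρ L))
    mCCC₂ P L = m∀ λ A → m⇒ (mAntichain (1 ↑ʳ P) (1 ↑ʳ L) 0F) (mCountable 0F)

    mCCC₃ : {ρ : Env n} (P L : Fin n) → Means (CCC₃ P L) ρ (ccc₃ (ρ P) (ρ L))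
    mCCC₃ P L = m∀ λ D → m⇒ (mPredense (1 ↑ʳ P) (1 ↑ʳ L) 0F)
      (m∃ λ E → m∧ (m⊆ 0F 1F) (m∧ (mCountable 0F) (mPredense (2 ↑ʳ P) (2 ↑ʳ L) 0F)))

  open Chains public

-- Enumerated models of ZFC

record ZFCModel : Set₁ where
  field
    zf        : ZFModel
  open Internal zf
  field
    -- An enumeration from outside the model, along which all its dense sets can be met one after
    -- the other.
    enum      : ℕ → U
    enum-onto : ∀ x → Σ ℕ λ n → enum n ≡ x
    -- An external selection of elements, used to continue the generic sequence; the axiom of choice
    -- inside the model is `choice`.
    pick      : U → U
    pick-∈    : ∀ x → ∃ᶜ[ y ] y ∈ x → pick x ∈ x
    choice    : ∀ a → (∀ x → x ∈ a → ∃ᶜ[ y ] y ∈ x) →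
                ∃ᶜ[ f ] FunctionOn f a × (∀ x y → ‹ x , y › ∈ f → y ∈ x)

-- The Henkin model of ZFC

module HenkinZFC (consistent-ZFC : Consistent ZFC) where
  open Henkin ZFC consistent-ZFC
  open Structure 𝓗
  open Satisfaction 𝓗
  open Connectives 𝓗

  private
    ax : ∀ {σ} → ZF σ → ∀ ρ → sat σ ρ
    ax a = 𝓗-sat (inj₁ a)

    witnessed : (φ : Formula (suc m)) (ρ : Env m) {P : U → Set} → (∀ x → Means φ (x ◂ ρ) (P x)) →
                sat (∃′ φ) ρ → P (ε φ ρ)
    witnessed φ ρ p h = to (p (ε φ ρ)) (ε-spec φ ρ h)

    unionφ powerφ : Formula 2
    unionφ = ∀′ (0F ∈′ 1F ⇔′ (∃′∈[ 2F ] 1F ∈′ 0F))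
    powerφ = ∀′ (0F ∈′ 1F ⇔′ 0F ⊆′ 2F)

    infiniteM : {ρ : Env 0} → ∀ w → Means (IsInductive 0F) (w ◂ ρ) ((∃ᶜ[ e ] e ∈ w × (∀ z → ¬ z ∈ e)) ×
      (∀ x → x ∈ w → ∃ᶜ[ s ] s ∈ w × (∀ z → z ∈ s ⇔ (z ∈ x ∨ᶜ z ≈ x))))
    infiniteM w = m∧ (m∃∈ λ e → m∀ λ z → m¬ m∈) (m∀∈ λ x → m∃∈ λ s → m∀ λ z → m⇔ m∈ (m∨ m∈ m≐))

    sepφ : Formula (suc m) → Formula (suc (suc m))
    sepφ φ = ∀′ (0F ∈′ 1F ⇔′ 0F ∈′ 2F ∧′ rename (0F ◂ (3 ↑ʳ_)) φ)

    repφ : Formula (suc (suc m)) → Formula (suc (suc m))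
    repφ φ = ∀′ (0F ∈′ 1F ⇔′ (∃′∈[ 2F ] rename (0F ◂ 1F ◂ (4 ↑ʳ_)) φ))

    functionalφ : Formula (suc (suc m)) → Formula (suc m)
    functionalφ φ = ∀′∈[ 0F ] ∀′ ∀′ (rename (2F ◂ 1F ◂ (4 ↑ʳ_)) φ ∧′ rename (2F ◂ 0F ◂ (4 ↑ʳ_)) φ ⇒′ 1F ≐ 0F)

    functionalM : (φ : Formula (suc (suc m))) {ρ : Env m} → ∀ a → Means (functionalφ φ) (a ◂ ρ)
      (∀ x → x ∈ a → ∀ y z → sat φ (x ◂ y ◂ ρ) → sat φ (x ◂ z ◂ ρ) → y ≈ z)
    functionalM φ a = m∀∈ λ x → m∀ λ y → m∀ λ z → Means-cong curry-⇔ (m⇒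
      (m∧ (mRename φ _ λ { zero → refl ; 1F → refl ; (suc (suc i)) → refl })
          (mRename φ _ λ { zero → refl ; 1F → refl ; (suc (suc i)) → refl })) m≐)

    model : ZFModel
    model = record
      { 𝓢 = 𝓗
      ; extensional = λ {x} {y} h → ax extensionality ø x y λ z → ∧-intro (h z)
      ; regular = λ x h → given (∃′∈[ 0F ] ¬′ (∃′ (0F ∈′ 1F ∧′ 0F ∈′ 2F))) (x ◂ ø) (m∃∈ λ y → Means-cong
          ((λ k z i j → k λ e → e z (i , j)) , (λ k e → e λ z (i , j) → k z i j)) (m¬ (m∃ λ z → m∧ m∈ m∈)))
          (ax foundation ø x h)
      ; ⁅_,_⁆ = λ x y → ε (IsPair 0F 2F 1F) (y ◂ x ◂ ø)
      ; ∈-pair = λ {x} {y} {z} → witnessed (IsPair 0F 2F 1F) (y ◂ x ◂ ø) (λ p → m∀ λ z → m⇔ m∈ (m∨ m≐ m≐)) (ax pairing ø x y) z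
      ; ⋃ = λ x → ε unionφ (x ◂ ø)
      ; ∈-⋃ = λ {x} {z} → witnessed unionφ (x ◂ ø) (λ u → m∀ λ z → m⇔ m∈ (m∃∈ λ y → m∈)) (ax union ø x) z
      ; 𝒫 = λ x → ε powerφ (x ◂ ø)
      ; ∈-𝒫 = λ {x} {z} → witnessed powerφ (x ◂ ø) (λ u → m∀ λ z → m⇔ m∈ (m∀∈ λ y → m∈)) (ax powerSet ø x) z
      ; inf = ε (IsInductive 0F) ø
      ; inf-zero = proj₁ (witnessed (IsInductive 0F) ø infiniteM (ax infinity ø))
      ; inf-suc = proj₂ (witnessed (IsInductive 0F) ø infiniteM (ax infinity ø))
      ; separate = λ φ ρ a → ε (sepφ φ) (a ◂ ρ)
      ; ∈-separate = λ φ ρ {a} {z} → witnessed (sepφ φ) (a ◂ ρ)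
          (λ b → m∀ λ z → m⇔ m∈ (m∧ m∈ (mRename φ _ {σ = z ◂ ρ} λ { zero → refl ; (suc i) → refl })))
          (sat-closure⁻ _ (separationBody φ) (ax (separation φ) ø) ρ a) z
      ; replace = λ φ ρ a → ε (repφ φ) (a ◂ ρ)
      ; ∈-replace = λ φ ρ {a} f {y} → witnessed (repφ φ) (a ◂ ρ)
          (λ b → m∀ λ y → m⇔ m∈ (m∃∈ λ x → mRename φ _ {σ = x ◂ y ◂ ρ} λ { zero → refl ; 1F → refl ; (suc (suc i)) → refl }))
          (sat-closure⁻ _ (replacementBody φ) (ax (replacement φ) ø) ρ a (holds (functionalφ φ) (a ◂ ρ) (functionalM φ a) f)) y
      }

  zfc : ZFCModel
  zfc = record
    { zf        = model
    ; enum      = id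
    ; enum-onto = λ n → n , refl
    ; pick      = λ x → ε (0F ∈′ 1F) (x ◂ ø)
    ; pick-∈    = λ x h → ε-spec (0F ∈′ 1F) (x ◂ ø) h
    ; choice    = M.given AC ø (M.m∀ λ a → M.m⇒ (M.m∀∈ λ x → M.m∃ λ y → M.m∈)
        (M.m∃ λ f → M.m∧ (M.mFunctionOn 0F 1F) (M.m∀ λ x → M.m∀ λ y → M.m⇒ (M.m⟨⟩∈ 1F 0F 2F) M.m∈)))
        (𝓗-sat (inj₂ refl) ø)
    }
    where module M = Internal model

-- Exclusive disjunction of stable propositions

Xor : Set → Set → Set
Xor A B = ¬ (A ⇔ B)

module _ {A B : Set} {{_ : Stable A}} {{_ : Stable B}} where

  xor-false : Xor A B → ¬ B → A
  xor-false h ¬b = dne λ ¬a → h ((λ a → ⊥-elim (¬a a)) , (λ b → ⊥-elim (¬b b)))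

  xor-intro : A → ¬ B → Xor A B
  xor-intro a ¬b e = ¬b (proj₁ e a)

  xor-intro′ : ¬ A → B → Xor A B
  xor-intro′ ¬a b e = ¬a (proj₂ e b)

  xor-cancel : Xor (Xor A B) B ⇔ A
  xor-cancel = (λ h → byCases B (λ b → dne λ ¬a → xor-true-¬ h b (xor-intro′ ¬a b))
                                (λ ¬b → xor-false (xor-false-x h ¬b) ¬b)) ,
               (λ a e → byCases B (λ b → proj₂ e b ((λ _ → b) , (λ _ → a))) (λ ¬b → ¬b (proj₁ e (xor-intro a ¬b))))
    where
    xor-true-¬ : Xor (Xor A B) B → B → ¬ Xor A B
    xor-true-¬ h b x = h ((λ _ → b) , (λ _ → x))
    xor-false-x : Xor (Xor A B) B → ¬ B → Xor A B
    xor-false-x h ¬b e = h ((λ x → ⊥-elim (x e)) , (λ b → ⊥-elim (¬b b)))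

xor-cong : {A A′ B B′ : Set} → A ⇔ A′ → B ⇔ B′ → Xor A B → Xor A′ B′
xor-cong (f , f⁻) (g , g⁻) h (p , q) = h ((λ a → g⁻ (p (f a))) , (λ b → f⁻ (q (g b))))

xor-swap : {A B C : Set} {{_ : Stable A}} {{_ : Stable B}} {{_ : Stable C}} → Xor (Xor A B) C → Xor (Xor A C) B
xor-swap {A} {B} {C} h (p , q) = byCases B
  (λ b → byCases C
    (λ c → h ((λ _ → c) , λ _ e → q b ((λ _ → c) , (λ _ → proj₂ e b))))
    (λ ¬c → h ((λ x → ⊥-elim (q b ((λ a → ⊥-elim (x ((λ _ → b) , (λ _ → a)))) , (λ c → ⊥-elim (¬c c))))) , (λ c → ⊥-elim (¬c c)))))
  (λ ¬b → byCases C
    (λ c → h ((λ _ → c) , λ _ e → ¬b (p λ f → ¬b (proj₁ e (proj₂ f c)))))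
    (λ ¬c → h ((λ x → ⊥-elim (x ((λ a → ⊥-elim (¬b (p λ f → ¬c (proj₁ f a)))) , (λ b → ⊥-elim (¬b b))))) , (λ c → ⊥-elim (¬c c)))))

module _ {A B : Set} {{_ : Stable A}} where
  xor-t : B → Xor A B ⇔ (¬ A)
  xor-t b = (λ h a → h ((λ _ → b) , (λ _ → a))) , (λ ¬a e → ¬a (proj₂ e b))

  xor-f : ¬ B → Xor A B ⇔ A
  xor-f ¬b = (λ h → dne λ ¬a → h ((λ a → ⊥-elim (¬a a)) , (λ b → ⊥-elim (¬b b)))) , (λ a e → ¬b (proj₁ e a))

xor-assoc : {A B C : Set} {{_ : Stable A}} {{_ : Stable B}} {{_ : Stable C}} → Xor (Xor A B) C ⇔ Xor A (Xor B C)
xor-assoc {A} {B} {C} = byCases C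
  (λ c → byCases B
    (λ b → let ¬bc = λ h → proj₁ (xor-t {B} {C} c) h b in
      (λ h → proj₂ (xor-f ¬bc) (dne λ ¬a → proj₁ (xor-t c) h (proj₂ (xor-t b) ¬a))) ,
      (λ h → proj₂ (xor-t c) λ x → proj₁ (xor-t b) x (proj₁ (xor-f ¬bc) h)))
    (λ ¬b → let bc = proj₂ (xor-t {B} {C} c) ¬b in
      (λ h → proj₂ (xor-t bc) λ a → proj₁ (xor-t c) h (proj₂ (xor-f ¬b) a)) ,
      (λ h → proj₂ (xor-t c) λ x → proj₁ (xor-t bc) h (proj₁ (xor-f ¬b) x))))
  (λ ¬c → (λ h → xor-cong (id , id) ((λ b → proj₂ (xor-f ¬c) b) , (λ x → proj₁ (xor-f ¬c) x)) (proj₁ (xor-f ¬c) h)) ,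
          (λ h → proj₂ (xor-f ¬c) (xor-cong (id , id) ((λ x → proj₁ (xor-f ¬c) x) , (λ b → proj₂ (xor-f ¬c) b)) h)))

module SymmetricExtension (𝓩 : ZFCModel) where
  open ZFCModel 𝓩 public
  open Internal zf public

  -- Countable sets in the ground model

  module Countability where
    private
      variable
        a b c w x x′ y y′ z z′ : U

    -- Countability by an enumeration that may list further sets as well, so it passes to subsets
    -- with the same enumeration.
    Ctbl : U → Set
    Ctbl s = ∃ᶜ[ e ] Functional e × (∀ x → x ∈ s → ∃ᶜ[ n ] n ∈ ω × ‹ n , x › ∈ e)

    CtblP : Pr 1
    CtblP = ∃ᵖ (FunctionalP ⟦ v0 ∷ [] ⟧ ∧ᵖ (∀ᵖ (v0 ∈ᵖ v2 ⇒ᵖ (∃ᵖ (v0 ∈ᵖ con ω ∧ᵖ opT v0 v1 ∈ᵖ v2)))))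

    ctbl-intro : ∀ e → Functional e → (∀ y → y ∈ x → ∃ᶜ[ n ] n ∈ ω × ‹ n , y › ∈ e) → Ctbl x
    ctbl-intro e f c = ∃ᶜ-intro e (f , c)

    ctbl-⊆ : x ⊆ y → Ctbl y → Ctbl x
    ctbl-⊆ s h = h >>= λ (e , f , c) → ∃ᶜ-intro e (f , λ z i → c z (s z i))

    functional-pair : ¬ a ≈ b → Functional ⁅ ‹ a , x › , ‹ b , y › ⁆
    functional-pair ne u w w′ h h′ = pair-elim h
      (λ e → pair-elim h′ (λ e′ → ≈-trans (proj₂ (op-inj e)) (≈-sym (proj₂ (op-inj e′))))
        (λ e′ → ⊥-elim (ne (≈-trans (≈-sym (proj₁ (op-inj e))) (proj₁ (op-inj e′))))))
      (λ e → pair-elim h′ (λ e′ → ⊥-elim (ne (≈-trans (≈-sym (proj₁ (op-inj e′))) (proj₁ (op-inj e)))))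
        (λ e′ → ≈-trans (proj₂ (op-inj e)) (≈-sym (proj₂ (op-inj e′)))))

    ctbl-pair : Ctbl ⁅ x , y ⁆
    ctbl-pair {x} {y} = ∃ᶜ-intro ⁅ ‹ ∅ , x › , ‹ succ ∅ , y › ⁆
      (functional-pair (λ e → succ-≉∅ (≈-sym e)) , λ z i → pair-elim i
        (λ e → ∃ᶜ-intro ∅ (ω-zero , ∈-respˡ (op-cong ≈-refl (≈-sym e)) pair-l))
        (λ e → ∃ᶜ-intro (succ ∅) (ω-suc ω-zero , ∈-respˡ (op-cong ≈-refl (≈-sym e)) pair-r)))

    -- Countable unions: choose an enumeration of every member and compose with walk.

    module CountableUnion (ℱ eℱ : U) (functional-eℱ : Functional eℱ)
      (covers-eℱ : ∀ x → x ∈ ℱ → ∃ᶜ[ n ] n ∈ ω × ‹ n , x › ∈ eℱ) (each : ∀ x → x ∈ ℱ → Ctbl x) where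

      EnumerationP : Pr 2
      EnumerationP = FunctionalP ⟦ v0 ∷ [] ⟧ ∧ᵖ (∀ᵖ (v0 ∈ᵖ v2 ⇒ᵖ (∃ᵖ (v0 ∈ᵖ con ω ∧ᵖ opT v0 v1 ∈ᵖ v2))))

      abstract
        enumsT : Tm 1
        enumsT = sepT (𝒫T (prodT (con ω) v0)) EnumerationP

      enums : U → U
      enums x = val enumsT (x ◂ ø)

      abstract
        ∈-enums : z ∈ enums x ⇔ (z ∈ 𝒫 (ω ×ₛ x) × Functional z × (∀ y → y ∈ x → ∃ᶜ[ n ] n ∈ ω × ‹ n , y › ∈ z))
        ∈-enums {x = x} = ∈-sepᵉ EnumerationP (x ◂ ø)

      PartP : U → Pr 1
      PartP x = v0 ∈ᵖ con (ω ×ₛ x)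

      -- Cutting an enumeration of `x` down to ω × x makes the candidates a set, from which choice
      -- can select.
      enums-nonempty : ∀ x → x ∈ ℱ → ∃ᶜ[ e ] e ∈ enums x
      enums-nonempty x i = each x i >>= λ (e , f , c) → ∃ᶜ-intro (sep e (PartP x)) (proj₂ ∈-enums
        (proj₂ ∈-𝒫 (λ w h → proj₂ (proj₁ (∈-sepᵉ (PartP x) ø) h)) ,
         (λ a b b′ h h′ → f a b b′ (proj₁ (proj₁ (∈-sepᵉ (PartP x) ø) h)) (proj₁ (proj₁ (∈-sepᵉ (PartP x) ø) h′))) ,
         (λ y j → c y j >>= λ (n , n∈ , k) → ∃ᶜ-intro n (n∈ , proj₂ (∈-sepᵉ (PartP x) ø) (k , op-∈-prod n∈ j)))))

      family : U
      family = img ℱ enumsT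

      UnionP : U → Pr 1
      UnionP f = ∃ᵖ ∃ᵖ ∃ᵖ ∃ᵖ (walkT (fstT v4) ≈ᵖ opT v3 v2 ∧ᵖ opT v3 v1 ∈ᵖ con eℱ ∧ᵖ v1 ∈ᵖ con ℱ ∧ᵖ
        opT (enumsT ⟦ v1 ∷ [] ⟧ᵗ) v0 ∈ᵖ con f ∧ᵖ opT v2 (sndT v4) ∈ᵖ v0)

      -- With the n-th pair of the walk being (a, b): `x` is the a-th set, `g` its chosen
      -- enumeration and `s` the b-th entry of `g`.
      Listed : U → U → U → Set
      Listed f n s = ∃ᶜ[ a ] ∃ᶜ[ b ] ∃ᶜ[ x ] ∃ᶜ[ g ] walk n ≈ ‹ a , b › × ‹ a , x › ∈ eℱ × x ∈ ℱ ×
        ‹ enums x , g › ∈ f × ‹ b , s › ∈ g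

      module _ (f : U) (functional-f : Functional f) (total-f : ∀ x → x ∈ family → ∃ᶜ[ y ] ‹ x , y › ∈ f)
               (choice-f : ∀ x y → ‹ x , y › ∈ f → y ∈ x) where

        list : U
        list = sep (ω ×ₛ ⋃ ℱ) (UnionP f)

        walk-cong : x ≈ y → walk x ≈ walk y
        walk-cong = Iter.rec-cong

        ∈-list : ∀ {n s} → ‹ n , s › ∈ list ⇔ (‹ n , s › ∈ ω ×ₛ ⋃ ℱ × Listed f n s)
        ∈-list {n} {s} =
          (λ h → let i , k = proj₁ (∈-sepᵉ (UnionP f) ø) h in i , (k >>= λ (a , k) → k >>= λ (b , k) → k >>= λ (x , k) →
            k >>= λ (g , e , h₁ , h₂ , h₃ , h₄) → ∃ᶜ-intro a (∃ᶜ-intro b (∃ᶜ-intro x (∃ᶜ-intro g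
              (≈-trans (walk-cong (≈-sym fst-op)) e , h₁ , h₂ , h₃ , ∈-respˡ (op-cong ≈-refl snd-op) h₄)))))) ,
          (λ (i , k) → proj₂ (∈-sepᵉ (UnionP f) ø) (i , (k >>= λ (a , k) → k >>= λ (b , k) → k >>= λ (x , k) →
            k >>= λ (g , e , h₁ , h₂ , h₃ , h₄) → ∃ᶜ-intro a (∃ᶜ-intro b (∃ᶜ-intro x (∃ᶜ-intro g
              (≈-trans (walk-cong fst-op) e , h₁ , h₂ , h₃ , ∈-respˡ (op-cong ≈-refl (≈-sym snd-op)) h₄)))))))

        list-functional : Functional list
        list-functional n s s′ h h′ =
          proj₂ (proj₁ ∈-list h) >>= λ (a , k) → k >>= λ (b , k) → k >>= λ (x , k) → k >>= λ (g , e , h₁ , h₂ , h₃ , h₄) →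
          proj₂ (proj₁ ∈-list h′) >>= λ (a′ , k) → k >>= λ (b′ , k) → k >>= λ (x′ , k) → k >>= λ (g′ , e′ , h₁′ , h₂′ , h₃′ , h₄′) →
          let ea , eb = op-inj (≈-trans (≈-sym e) e′)
              ex = functional-eℱ a x x′ h₁ (∈-respˡ (op-cong (≈-sym ea) ≈-refl) h₁′)
              eE = Tm-cong enumsT {x ◂ ø} {x′ ◂ ø} (◂-≋ ex λ ())
              eg = functional-f (enums x) g g′ h₃ (∈-respˡ (op-cong (≈-sym eE) ≈-refl) h₃′)
              fg = proj₁ (proj₂ (proj₁ ∈-enums (choice-f _ _ h₃)))
          in fg b s s′ h₄ (∈-respˡ (op-cong (≈-sym eb) ≈-refl) (∈-respʳ (≈-sym eg) h₄′))

        list-covers : ∀ s → s ∈ ⋃ ℱ → ∃ᶜ[ n ] n ∈ ω × ‹ n , s › ∈ list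
        list-covers s h = proj₁ ∈-⋃ h >>= λ (x , i , j) → covers-eℱ x i >>= λ (a , a∈ , h₁) →
          total-f (enums x) (img-intro enumsT i) >>= λ (g , h₃) →
          proj₂ (proj₂ (proj₁ ∈-enums (choice-f _ _ h₃))) s j >>= λ (b , b∈ , h₄) →
          visited a∈ b∈ >>= λ (n , n∈ , e) → ∃ᶜ-intro n (n∈ , proj₂ ∈-list (op-∈-prod n∈ h ,
            ∃ᶜ-intro a (∃ᶜ-intro b (∃ᶜ-intro x (∃ᶜ-intro g (e , h₁ , i , h₃ , h₄))))))

        ctbl-union : Ctbl (⋃ ℱ)
        ctbl-union = ctbl-intro list list-functional list-covers

      family-nonempty : ∀ E → E ∈ family → ∃ᶜ[ g ] g ∈ E
      family-nonempty E h = proj₁ (∈-imgᵉ enumsT ø) h >>= λ (x , i , e) →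
        enums-nonempty x i >>= λ (g , j) → ∃ᶜ-intro g (∈-respʳ (≈-sym e) j)

      ctbl-⋃′ : Ctbl (⋃ ℱ)
      ctbl-⋃′ = choice family family-nonempty >>= λ (f , (_ , tot , fun) , ch) → ctbl-union f fun tot ch

    ctbl-⋃ : Ctbl x → (∀ y → y ∈ x → Ctbl y) → Ctbl (⋃ x)
    ctbl-⋃ {x} h each = h >>= λ (e , f , c) → CountableUnion.ctbl-⋃′ x e f c each

    ctbl-∪ : Ctbl x → Ctbl y → Ctbl (x ∪ₛ y)
    ctbl-∪ {x} {y} cx cy = ctbl-⋃ ctbl-pair λ z i → pair-elim i (λ e → ctbl-⊆ (≈-⊆ e) cx) (λ e → ctbl-⊆ (≈-⊆ e) cy)

    ctbl-img-ω : (t : Tm 1) → Ctbl (img ω t)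
    ctbl-img-ω t = ctbl-intro (img ω (opT v0 t))
      (λ a b b′ h h′ → value h h′)
      (λ x i → proj₁ (∈-imgᵉ t ø) i >>= λ (n , n∈ , e) → ∃ᶜ-intro n (n∈ , ∈-respˡ (op-cong ≈-refl (≈-sym e)) (img-intro (opT v0 t) n∈)))
      where
      value : ‹ a , b › ∈ img ω (opT v0 t) → ‹ a , c › ∈ img ω (opT v0 t) → b ≈ c
      value h h′ = proj₁ (∈-imgᵉ (opT v0 t) ø) h >>= λ (n , _ , e) → proj₁ (∈-imgᵉ (opT v0 t) ø) h′ >>= λ (n′ , _ , e′) →
        let e₁ , e₂ = op-inj e ; e₁′ , e₂′ = op-inj e′ in
        ≈-trans e₂ (≈-trans (Tm-cong t {n ◂ ø} {n′ ◂ ø} (◂-≋ (≈-trans (≈-sym e₁) e₁′) λ ())) (≈-sym e₂′))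

    DiagonalP : U → Pr 1
    DiagonalP e = ∀ᵖ (opT v1 v0 ∈ᵖ con e ⇒ᵖ v1 ∉ᵖ v0)

    -- Cantor's diagonal set: the numbers that do not belong to the set listed at them.
    uncountable-𝒫ω : Ctbl x → ∃ᶜ[ d ] d ∈ 𝒫 ω × ¬ d ∈ x
    uncountable-𝒫ω {x} h = h >>= λ (e , f , c) → ∃ᶜ-intro (d e)
      (proj₂ ∈-𝒫 (λ z i → proj₁ (proj₁ (∈-d e) i)) , λ i → c (d e) i λ n (n∈ , j) →
        let n∉ : ¬ n ∈ d e
            n∉ k = proj₂ (proj₁ (∈-d e) k) (d e) j k
        in n∉ (proj₂ (∈-d e) (n∈ , λ y l k → n∉ (∈-respʳ (f n y (d e) l j) k))))
      where
      d : U → U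
      d e = sep ω (DiagonalP e)
      ∈-d : ∀ e → z ∈ d e ⇔ (z ∈ ω × (∀ y → ‹ z , y › ∈ e → ¬ z ∈ y))
      ∈-d e = ∈-sepᵉ (DiagonalP e) ø

  open Countability public

  -- The forcing conditions and the group acting on them

  module Poset where

    private
      variable
        a b c d p q r s t w x x′ y y′ z z′ : U

    -- `I` indexes both the rows and the columns of `K`. Its uncountability is used for each: to
    -- find a row outside a support, and a point of a given row outside the domain of a condition.
    I K 𝒢 : U
    I = 𝒫 ω
    K = I ×ₛ I
    𝒢 = 𝒫 K

    DiffP : Pr 3
    DiffP = ¬ᵖ (v0 ∈ᵖ v1 ⇔ᵖ v0 ∈ᵖ v2)

    abstract
      diffF : Tm 2
      diffF = sepT (∪T v0 v1) DiffP

    infixl 9 _△_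
    _△_ : U → U → U
    a △ b = val diffF (a ◂ b ◂ ø)

    diffT : Tm n → Tm n → Tm n
    diffT t s = diffF ⟦ t ∷ s ∷ [] ⟧ᵗ

    abstract
      ∈-△ : w ∈ a △ b ⇔ Xor (w ∈ a) (w ∈ b)
      ∈-△ {w} {a} {b} = (λ h → proj₂ (proj₁ (∈-sepᵉ DiffP (a ◂ b ◂ ø)) h)) ,
        (λ h → proj₂ (∈-sepᵉ DiffP (a ◂ b ◂ ø)) (byCases (w ∈ b) ∪-r (λ ¬b → ∪-l (xor-false h ¬b)) , h))

    △-cong : a ≈ x → b ≈ y → a △ b ≈ x △ y
    △-cong {a} {x} {b} {y} e e′ = Tm-cong diffF {a ◂ b ◂ ø} {x ◂ y ◂ ø} (◂-≋ e (◂-≋ e′ λ ()))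

    △-∈𝒢 : a ∈ 𝒢 → b ∈ 𝒢 → a △ b ∈ 𝒢
    △-∈𝒢 {b = b} i j = proj₂ ∈-𝒫 λ w h → byCases (w ∈ b) (proj₁ ∈-𝒫 j w)
      (λ ¬b → proj₁ ∈-𝒫 i w (xor-false (proj₁ ∈-△ h) ¬b))

    △-cancel : a △ b △ b ≈ a
    △-cancel = extensional λ w →
      (λ h → proj₁ xor-cancel (xor-cong ∈-△ (id , id) (proj₁ ∈-△ h))) ,
      (λ h → proj₂ ∈-△ (xor-cong ((proj₂ ∈-△) , (proj₁ ∈-△)) (id , id) (proj₂ xor-cancel h)))

    △-swap : a △ b △ c ≈ a △ c △ b
    △-swap = ⊆-antisym half half
      where
      half : ∀ {a b c} → a △ b △ c ⊆ a △ c △ b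
      half w h = proj₂ ∈-△ (xor-cong (proj₂ ∈-△ , proj₁ ∈-△) (id , id)
        (xor-swap (xor-cong ∈-△ (id , id) (proj₁ ∈-△ h))))

    △-assoc : a △ b △ c ≈ a △ (b △ c)
    △-assoc = extensional λ w →
      (λ h → proj₂ ∈-△ (xor-cong (id , id) (proj₂ ∈-△ , proj₁ ∈-△) (proj₁ xor-assoc (xor-cong ∈-△ (id , id) (proj₁ ∈-△ h))))) ,
      (λ h → proj₂ ∈-△ (xor-cong (proj₂ ∈-△ , proj₁ ∈-△) (id , id) (proj₂ xor-assoc (xor-cong (id , id) ∈-△ (proj₁ ∈-△ h)))))

    CondP : Pr 1
    CondP = CtblP ⟦ fstT v0 ∷ [] ⟧

    abstract
      -- A countable partial function is represented by its domain and a subset of `K` of which only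
      -- the trace on the domain counts. Thus a shift acts on the second component by symmetric
      -- difference and keeps the domain, and equivalent conditions need not be equal.
      ℙ : U
      ℙ = sep (𝒢 ×ₛ 𝒢) CondP

      cond-elim : p ∈ ℙ → p ∈ 𝒢 ×ₛ 𝒢 × Ctbl (fst p)
      cond-elim = proj₁ (∈-sepᵉ CondP ø)

      cond-intro : p ∈ 𝒢 ×ₛ 𝒢 → Ctbl (fst p) → p ∈ ℙ
      cond-intro i c = proj₂ (∈-sepᵉ CondP ø) (i , c)

    cond-mk : c ∈ 𝒢 → Ctbl c → a ∈ 𝒢 → ‹ c , a › ∈ ℙ
    cond-mk i h j = cond-intro (op-∈-prod i j) (ctbl-⊆ (≈-⊆ fst-op) h)

    cond-parts : p ∈ ℙ → p ≈ ‹ fst p , snd p › × fst p ∈ 𝒢 × snd p ∈ 𝒢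
    cond-parts i = proj₁ ∈-prod (proj₁ (cond-elim i)) >>= λ (x , h) → h >>= λ (y , x∈ , y∈ , e) →
      let e₁ = ≈-trans (fst-cong e) fst-op ; e₂ = ≈-trans (snd-cong e) snd-op in
      ≈-trans e (op-cong (≈-sym e₁) (≈-sym e₂)) , ∈-respˡ (≈-sym e₁) x∈ , ∈-respˡ (≈-sym e₂) y∈

    Agree : U → U → Set
    Agree q p = ∀ k → k ∈ fst p → k ∈ fst q × (k ∈ snd q ⇔ k ∈ snd p)

    abstract
      LeP : Pr 2
      LeP = v0 ∈ᵖ con ℙ ∧ᵖ v1 ∈ᵖ con ℙ ∧ᵖ (∀ᵖ (v0 ∈ᵖ fstT v2 ⇒ᵖ v0 ∈ᵖ fstT v1 ∧ᵖ (v0 ∈ᵖ sndT v1 ⇔ᵖ v0 ∈ᵖ sndT v2)))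

    infix 6 _≤_
    _≤_ : U → U → Set
    q ≤ p = pred LeP (q ◂ p ◂ ø)

    instance
      ≤-stable : Stable (q ≤ p)
      ≤-stable = Pr-stable LeP

    abstract
      ≤-intro : q ∈ ℙ → p ∈ ℙ → Agree q p → q ≤ p
      ≤-intro i j h = i , j , h

      ≤-elim : q ≤ p → q ∈ ℙ × p ∈ ℙ × Agree q p
      ≤-elim h = h

    ≤-l : q ≤ p → q ∈ ℙ
    ≤-l h = proj₁ (≤-elim h)

    ≤-r : q ≤ p → p ∈ ℙ
    ≤-r h = proj₁ (proj₂ (≤-elim h))

    ≤-resp : q ≈ x → p ≈ y → q ≤ p → x ≤ y
    ≤-resp {q} {x} {p} {y} e e′ = Pr-resp LeP {q ◂ p ◂ ø} {x ◂ y ◂ ø} (◂-≋ e (◂-≋ e′ λ ()))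

    ≤-refl : p ∈ ℙ → p ≤ p
    ≤-refl i = ≤-intro i i λ k h → h , id , id

    ≤-trans : p ≤ q → q ≤ r → p ≤ r
    ≤-trans h h′ = ≤-intro (≤-l h) (≤-r h′) λ k i →
      let j , f , f⁻ = proj₂ (proj₂ (≤-elim h′)) k i ; j′ , g , g⁻ = proj₂ (proj₂ (≤-elim h)) k j in
      j′ , (λ l → f (g l)) , (λ l → g⁻ (f⁻ l))

    -- The action of 𝒢 on conditions

    abstract
      shiftF : Tm 2
      shiftF = opT (fstT v1) (diffT (sndT v1) v0)

    infixr 12 _·_
    _·_ : U → U → U
    t · p = val shiftF (t ◂ p ◂ ø)

    shiftT : Tm n → Tm n → Tm n
    shiftT t p = shiftF ⟦ t ∷ p ∷ [] ⟧ᵗ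

    ·-cong : t ≈ s → p ≈ q → t · p ≈ s · q
    ·-cong {t} {s} {p} {q} e e′ = Tm-cong shiftF {t ◂ p ◂ ø} {s ◂ q ◂ ø} (◂-≋ e (◂-≋ e′ λ ()))

    abstract
      ·-≈ : t · p ≈ ‹ fst p , snd p △ t ›
      ·-≈ = ≈-refl

    fst-· : fst (t · p) ≈ fst p
    fst-· = ≈-trans (fst-cong ·-≈) fst-op

    snd-· : snd (t · p) ≈ snd p △ t
    snd-· = ≈-trans (snd-cong ·-≈) snd-op

    ·-∈ℙ : t ∈ 𝒢 → p ∈ ℙ → t · p ∈ ℙ
    ·-∈ℙ i j = let _ , f , s = cond-parts j in
      ∈-respˡ (≈-sym ·-≈) (cond-mk f (proj₂ (cond-elim j)) (△-∈𝒢 s i))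

    ·-mono : t ∈ 𝒢 → q ≤ p → t · q ≤ t · p
    ·-mono {t} {q} {p} i h = ≤-intro (·-∈ℙ i (≤-l h)) (·-∈ℙ i (≤-r h)) λ k j →
      let j′ , e = proj₂ (proj₂ (≤-elim h)) k (∈-respʳ fst-· j) in
      ∈-respʳ (≈-sym fst-·) j′ , go e , go (proj₂ e , proj₁ e)
      where
      go : ∀ {k q p} → k ∈ snd q ⇔ k ∈ snd p → k ∈ snd (t · q) → k ∈ snd (t · p)
      go e h = ∈-respʳ (≈-sym snd-·) (proj₂ ∈-△ (xor-cong e (id , id) (proj₁ ∈-△ (∈-respʳ snd-· h))))

    ·-cancel : p ∈ ℙ → t · t · p ≈ p
    ·-cancel j = ≈-trans ·-≈ (≈-trans (op-cong fst-· (≈-trans (△-cong snd-· ≈-refl) △-cancel)) (≈-sym (proj₁ (cond-parts j))))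

    ·-swap : s · t · p ≈ t · s · p
    ·-swap = ≈-trans half (≈-sym (≈-trans half (op-cong ≈-refl △-swap)))
      where
      half : ∀ {s t p} → s · t · p ≈ ‹ fst p , snd p △ t △ s ›
      half = ≈-trans ·-≈ (op-cong fst-· (△-cong snd-· ≈-refl))

    ·-△ : t · s · p ≈ (s △ t) · p
    ·-△ = ≈-trans ·-≈ (≈-trans (op-cong fst-· (≈-trans (△-cong snd-· ≈-refl) △-assoc)) (≈-sym ·-≈))

    -- The second component does change, but only outside the domain; hence equivalence in the
    -- preorder and not equality.
    ·-outside : t ∈ 𝒢 → p ∈ ℙ → (∀ k → k ∈ fst p → ¬ k ∈ t) → t · p ≤ p × p ≤ t · p
    ·-outside {t} {p} i j out =
      ≤-intro (·-∈ℙ i j) j (λ k h → ∈-respʳ (≈-sym fst-·) h , same k h) ,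
      ≤-intro j (·-∈ℙ i j) (λ k h → let h′ = ∈-respʳ fst-· h in h′ , proj₂ (same k h′) , proj₁ (same k h′))
      where
      same : ∀ k → k ∈ fst p → k ∈ snd (t · p) ⇔ k ∈ snd p
      same k h = (λ l → xor-false (proj₁ ∈-△ (∈-respʳ snd-· l)) (out k h)) ,
                 (λ l → ∈-respʳ (≈-sym snd-·) (proj₂ ∈-△ (xor-intro l (out k h))))

    -- Lower bounds of descending sequences

    module Descending (seq : Tm 1) (start : val seq (∅ ◂ ø) ∈ ℙ)
      (desc′ : ∀ n → n ∈ ω → val seq (succ n ◂ ø) ≤ val seq (n ◂ ø)) where

      at : U → U
      at n = val seq (n ◂ ø)

      at-cong : x ≈ y → at x ≈ at y
      at-cong {x} {y} e = Tm-cong seq {x ◂ ø} {y ◂ ø} (◂-≋ e λ ())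

      at-∈ℙ : ∀ n → n ∈ ω → at n ∈ ℙ
      at-∈ℙ n i = ≤-r (desc′ n i)

      atT : Tm n → Tm n
      atT t = seq ⟦ t ∷ [] ⟧ᵗ

      below-l : ∀ b → b ∈ ω → ∀ a → a ∈ ω → at (a +ₛ b) ≤ at a
      below-l = ω-induction (∀ᵖ (v0 ∈ᵖ con ω ⇒ᵖ LeP ⟦ atT (addT v0 v1) ∷ atT v0 ∷ [] ⟧))
        (λ a i → ≤-resp (at-cong (≈-sym add-zero)) ≈-refl (≤-refl (at-∈ℙ a i)))
        λ b j ih a i → ≤-trans (≤-resp (at-cong (≈-sym add-suc)) ≈-refl (desc′ (a +ₛ b) (add-ω b j a i))) (ih a i)

      below-r : ∀ a → a ∈ ω → ∀ b → b ∈ ω → at (a +ₛ b) ≤ at b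
      below-r = ω-induction (∀ᵖ (v0 ∈ᵖ con ω ⇒ᵖ LeP ⟦ atT (addT v1 v0) ∷ atT v0 ∷ [] ⟧))
        (λ b j → ≤-resp (at-cong (≈-sym (zero-add b j))) ≈-refl (≤-refl (at-∈ℙ b j)))
        λ a i ih b j → ≤-trans (≤-resp (at-cong (≈-sym (suc-add b j a))) ≈-refl (desc′ (a +ₛ b) (add-ω b j a i))) (ih b j)

      -- A point is consulted only at stages whose domain contains it, as the second component is
      -- arbitrary elsewhere.
      LimitP : Pr 1
      LimitP = ∃ᵖ (v0 ∈ᵖ con ω ∧ᵖ v1 ∈ᵖ fstT (atT v0) ∧ᵖ v1 ∈ᵖ sndT (atT v0))

      abstract
        lim-dom lim-val : U
        lim-dom = ⋃ (img ω (fstT seq))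
        lim-val = sep K LimitP

        ∈-lim-dom : ∀ {k} → k ∈ lim-dom ⇔ (∃ᶜ[ n ] n ∈ ω × k ∈ fst (at n))
        ∈-lim-dom = (λ h → proj₁ ∈-⋃ h >>= λ (s , i , j) → proj₁ (∈-imgᵉ (fstT seq) ø) i >>= λ (n , n∈ , e) →
                       ∃ᶜ-intro n (n∈ , ∈-respʳ e j)) ,
                    (λ h → h >>= λ (n , n∈ , j) → ⋃-intro (img-intro (fstT seq) n∈) j)

        ∈-lim-val : ∀ {k} → k ∈ lim-val ⇔ (k ∈ K × (∃ᶜ[ n ] n ∈ ω × k ∈ fst (at n) × k ∈ snd (at n)))
        ∈-lim-val = ∈-sepᵉ LimitP ø

        ctbl-lim-dom : Ctbl lim-dom
        ctbl-lim-dom = ctbl-⋃ (ctbl-img-ω (fstT seq)) λ y h → proj₁ (∈-imgᵉ (fstT seq) ø) h >>= λ (n , n∈ , e) →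
          ctbl-⊆ (≈-⊆ e) (proj₂ (cond-elim (at-∈ℙ n n∈)))

      limit : U
      limit = ‹ lim-dom , lim-val ›

      limit-∈ℙ : limit ∈ ℙ
      limit-∈ℙ = cond-mk
        (proj₂ ∈-𝒫 λ k h → proj₁ ∈-lim-dom h >>= λ (n , n∈ , j) → proj₁ ∈-𝒫 (proj₁ (proj₂ (cond-parts (at-∈ℙ n n∈)))) k j)
        ctbl-lim-dom (proj₂ ∈-𝒫 λ k h → proj₁ (proj₁ ∈-lim-val h))

      -- Stages `n` and `m` are compared through stage n + m, which lies below both.
      coherent : ∀ n m k → n ∈ ω → m ∈ ω → k ∈ fst (at n) → k ∈ fst (at m) → k ∈ snd (at n) → k ∈ snd (at m)
      coherent n m k n∈ m∈ i j h =
        proj₁ (proj₂ (proj₂ (proj₂ (≤-elim (below-r n n∈ m m∈))) k j))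
          (proj₂ (proj₂ (proj₂ (proj₂ (≤-elim (below-l m m∈ n n∈))) k i)) h)

      limit-≤ : ∀ n → n ∈ ω → limit ≤ at n
      limit-≤ n n∈ = ≤-intro limit-∈ℙ (at-∈ℙ n n∈) λ k i →
        ∈-respʳ (≈-sym fst-op) (proj₂ ∈-lim-dom (∃ᶜ-intro n (n∈ , i))) ,
        (λ h → proj₂ (proj₁ ∈-lim-val (∈-respʳ snd-op h)) >>= λ (m , m∈ , j , l) → coherent m n k m∈ n∈ j i l) ,
        (λ h → ∈-respʳ (≈-sym snd-op) (proj₂ ∈-lim-val
          (proj₁ ∈-𝒫 (proj₁ (proj₂ (cond-parts (at-∈ℙ n n∈)))) k i , ∃ᶜ-intro n (n∈ , i , h))))

  open Poset public

  -- Names and the action of 𝒢 on them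

  module Action where

    private
      variable
        a b c d p q r s t u w x x′ y y′ z z′ : U

    -- Any set can be read as a name: only its members that are pairs with a condition count.
    Edge : U → U → U → Set
    Edge u q x = ‹ u , q › ∈ x × q ∈ ℙ
    EdgeP : Tm n → Tm n → Tm n → Pr n
    EdgeP u q x = opT u q ∈ᵖ x ∧ᵖ q ∈ᵖ con ℙ

    child-induction : (P : Pr 1) → (∀ x → (∀ u q → Edge u q x → pred P (u ◂ ø)) → pred P (x ◂ ø)) → ∀ x → pred P (x ◂ ø)
    child-induction P step = desc-induction P λ x ih → step x λ u q (i , _) → ih u (desc-fst i)

    EdgesP : Pr 4
    EdgesP = ∃ᵖ ∃ᵖ (v2 ≈ᵖ opT v1 v0 ∧ᵖ v0 ∈ᵖ con ℙ)

    act-valT : Tm 4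
    act-valT = opT (applyF ⟦ v2 ∷ fstT v0 ∷ [] ⟧ᵗ) (shiftT v3 (sndT v0))

    act-step : Tm 3
    act-step = imgT (sepT v0 EdgesP) act-valT

    abstract
      actH : Tm 3
      actH = act-step

      actH-≈ : (ρ : Env 3) → val actH ρ ≈ val act-step ρ
      actH-≈ ρ = ≈-refl

    module Act = Recursive actH

    private
      env : U → U → Env 3
      env t x = x ◂ Act.trace x t ◂ t ◂ ø

      act-val-≈ : Edge u q x → val act-valT (‹ u , q › ◂ env t x) ≈ ‹ Act.rec u t , t · q ›
      act-val-≈ (i , _) = op-cong (≈-trans ($-cong ≈-refl fst-op) (Act.trace-$ (desc-fst i))) (·-cong ≈-refl snd-op)

      act-val-cong : {ρ : Env 3} → w ≈ z → val act-valT (w ◂ ρ) ≈ val act-valT (z ◂ ρ)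
      act-val-cong {w} {z} {ρ} e = Tm-cong act-valT {w ◂ ρ} {z ◂ ρ} (◂-≋ e λ _ → ≈-refl)

      ∈-act-rec : w ∈ Act.rec x t ⇔ (∃ᶜ[ u ] ∃ᶜ[ q ] Edge u q x × w ≈ ‹ Act.rec u t , t · q ›)
      ∈-act-rec {w} {x} {t} = to′ , from′
        where
        to′ : w ∈ Act.rec x t → ∃ᶜ[ u ] ∃ᶜ[ q ] Edge u q x × w ≈ ‹ Act.rec u t , t · q ›
        to′ h = proj₁ (∈-imgᵉ act-valT (env t x)) (∈-respʳ (≈-trans Act.rec-equation (actH-≈ (env t x))) h) >>= λ (e , i , e≈) →
          let j , k = proj₁ (∈-sepᵉ EdgesP (env t x)) i in k >>= λ (u , k) → k >>= λ (q , e′ , q∈) →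
          ∃ᶜ-intro u (∃ᶜ-intro q ((∈-respˡ e′ j , q∈) , ≈-trans e≈ (≈-trans (act-val-cong {ρ = env t x} e′) (act-val-≈ (∈-respˡ e′ j , q∈)))))
        from′ : (∃ᶜ[ u ] ∃ᶜ[ q ] Edge u q x × w ≈ ‹ Act.rec u t , t · q ›) → w ∈ Act.rec x t
        from′ h = h >>= λ (u , h) → h >>= λ (q , (i , q∈) , e) →
          ∈-respʳ (≈-sym (≈-trans Act.rec-equation (actH-≈ (env t x)))) (∈-respˡ (≈-sym (≈-trans e (≈-sym (act-val-≈ (i , q∈)))))
            (img-intro act-valT {env t x} (proj₂ (∈-sepᵉ EdgesP (env t x)) (i , ∃ᶜ-intro u (∃ᶜ-intro q (≈-refl , q∈))))))

    abstract
      actF : Tm 2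
      actF = Act.recT ⟦ v1 ∷ v0 ∷ [] ⟧ᵗ

    act : U → U → U
    act t x = val actF (t ◂ x ◂ ø)

    actT : Tm n → Tm n → Tm n
    actT t x = actF ⟦ t ∷ x ∷ [] ⟧ᵗ

    abstract
      ∈-act : w ∈ act t x ⇔ (∃ᶜ[ u ] ∃ᶜ[ q ] Edge u q x × w ≈ ‹ act t u , t · q ›)
      ∈-act = ∈-act-rec

    act-cong : t ≈ s → x ≈ y → act t x ≈ act s y
    act-cong {t} {s} {x} {y} e e′ = Tm-cong actF {t ◂ x ◂ ø} {s ◂ y ◂ ø} (◂-≋ e (◂-≋ e′ λ ()))

    act-edge : t ∈ 𝒢 → Edge u q x → Edge (act t u) (t · q) (act t x)
    act-edge i (j , q∈) = proj₂ ∈-act (∃ᶜ-intro _ (∃ᶜ-intro _ ((j , q∈) , ≈-refl))) , ·-∈ℙ i q∈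

    act-edge⁻ : ‹ w , r › ∈ act t x → ∃ᶜ[ u ] ∃ᶜ[ q ] Edge u q x × w ≈ act t u × r ≈ t · q
    act-edge⁻ h = proj₁ ∈-act h >>= λ (u , h) → h >>= λ (q , i , e) → ∃ᶜ-intro u (∃ᶜ-intro q (i , op-inj e))

    act-swap : s ∈ 𝒢 → t ∈ 𝒢 → ∀ x → act s (act t x) ≈ act t (act s x)
    act-swap {s} {t} s∈ t∈ = child-induction (actT (con s) (actT (con t) v0) ≈ᵖ actT (con t) (actT (con s) v0)) λ x ih →
      ⊆-antisym (λ w h → half s∈ t∈ (λ u q i → ih u q i) h) (λ w h → half t∈ s∈ (λ u q i → ≈-sym (ih u q i)) h)
      where
      half : ∀ {s t x w} → s ∈ 𝒢 → t ∈ 𝒢 → (∀ u q → Edge u q x → act s (act t u) ≈ act t (act s u)) →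
             w ∈ act s (act t x) → w ∈ act t (act s x)
      half {s} {t} s∈ t∈ ih h = proj₁ ∈-act h >>= λ (w′ , h) → h >>= λ (r , (i , _) , e) →
        act-edge⁻ i >>= λ (u , h) → h >>= λ (q , i , e₁ , e₂) →
        ∈-respˡ (≈-sym (≈-trans e (op-cong (≈-trans (act-cong ≈-refl e₁) (ih u q i)) (≈-trans (·-cong ≈-refl e₂) ·-swap))))
          (proj₁ (act-edge t∈ (act-edge s∈ i)))

    act-△ : s ∈ 𝒢 → t ∈ 𝒢 → ∀ x → act t (act s x) ≈ act (s △ t) x
    act-△ {s} {t} s∈ t∈ = child-induction (actT (con t) (actT (con s) v0) ≈ᵖ actT (con (s △ t)) v0) λ x ih → ⊆-antisym
      (λ w h → proj₁ ∈-act h >>= λ (w′ , h) → h >>= λ (r , (i , _) , e) → act-edge⁻ i >>= λ (u , h) → h >>= λ (q , i , e₁ , e₂) →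
        ∈-respˡ (≈-sym (≈-trans e (op-cong (≈-trans (act-cong ≈-refl e₁) (ih u q i)) (≈-trans (·-cong ≈-refl e₂) ·-△))))
          (proj₁ (act-edge (△-∈𝒢 s∈ t∈) i)))
      (λ w h → proj₁ ∈-act h >>= λ (u , h) → h >>= λ (q , i , e) →
        ∈-respˡ (≈-sym (≈-trans e (op-cong (≈-sym (ih u q i)) (≈-sym ·-△)))) (proj₁ (act-edge t∈ (act-edge s∈ i))))

    -- Hereditarily symmetric names

    -- The shifts with no point in the rows of `s` form the subgroup that a name with support `s`
    -- has to be invariant under.
    Fixes : U → U → Set
    Fixes t s = ∀ i j → i ∈ s → ¬ ‹ i , j › ∈ t
    FixesP : Tm n → Tm n → Pr n
    FixesP t s = ∀ᵖ ∀ᵖ (v1 ∈ᵖ wkT (wkT s) ⇒ᵖ opT v1 v0 ∉ᵖ wkT (wkT t))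

    Supports : U → U → Set
    Supports s x = ∀ t → t ∈ 𝒢 → Fixes t s → act t x ≈ x
    SupportsP : Tm n → Tm n → Pr n
    SupportsP s x = ∀ᵖ (v0 ∈ᵖ con 𝒢 ⇒ᵖ FixesP v0 (wkT s) ⇒ᵖ actT v0 (wkT x) ≈ᵖ wkT x)

    -- The action erases members that are not edges, so a name with other members could not be
    -- recovered from its shifts.
    Clean : U → Set
    Clean x = ∀ w → w ∈ x → ∃ᶜ[ u ] ∃ᶜ[ q ] w ≈ ‹ u , q › × q ∈ ℙ
    CleanP : Tm n → Pr n
    CleanP x = ∀ᵖ (v0 ∈ᵖ wkT x ⇒ᵖ (∃ᵖ ∃ᵖ (v2 ≈ᵖ opT v1 v0 ∧ᵖ v0 ∈ᵖ con ℙ)))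

    Symmetric : U → Set
    Symmetric x = ∃ᶜ[ s ] Ctbl s × Supports s x
    SymmetricP : Tm n → Pr n
    SymmetricP x = ∃ᵖ (CtblP ⟦ v0 ∷ [] ⟧ ∧ᵖ SupportsP v0 (wkT x))

    HereditaryIn : U → U → Set
    HereditaryIn h y = Clean y × Symmetric y × (∀ u q → ‹ u , q › ∈ y → u ∈ h)

    HereditaryInP : Pr 2
    HereditaryInP = CleanP v1 ∧ᵖ SymmetricP v1 ∧ᵖ (∀ᵖ ∀ᵖ (opT v1 v0 ∈ᵖ v3 ⇒ᵖ v1 ∈ᵖ v2))

    abstract
      -- A set of names closed under children witnesses the hereditary property, so that a single
      -- formula defines it without recursion.
      HSP : Pr 1
      HSP = ∃ᵖ (v1 ∈ᵖ v0 ∧ᵖ (∀ᵖ (v0 ∈ᵖ v1 ⇒ᵖ HereditaryInP ⟦ v1 ∷ v0 ∷ [] ⟧)))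

    HS : U → Set
    HS x = pred HSP (x ◂ ø)

    instance
      HS-stable : Stable (HS x)
      HS-stable = Pr-stable HSP

    HS-resp : x ≈ y → HS x → HS y
    HS-resp {x} {y} e = Pr-resp HSP {x ◂ ø} {y ◂ ø} (◂-≋ e λ ())

    abstract
      HS-unfold : HS x → ∃ᶜ[ h ] x ∈ h × (∀ y → y ∈ h → HereditaryIn h y)
      HS-unfold h = h

      HS-fold : ∀ h → x ∈ h → (∀ y → y ∈ h → HereditaryIn h y) → HS x
      HS-fold h i k = ∃ᶜ-intro h (i , k)

    HS-clean : HS x → Clean x
    HS-clean h = HS-unfold h >>= λ (w , i , k) → proj₁ (k _ i)

    HS-symmetric : HS x → Symmetric x
    HS-symmetric h = HS-unfold h >>= λ (w , i , k) → proj₁ (proj₂ (k _ i))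

    HS-child : HS x → ‹ u , q › ∈ x → HS u
    HS-child h j = HS-unfold h >>= λ (w , i , k) → HS-fold w (proj₂ (proj₂ (k _ i)) _ _ j) k

    module _ (x : U) (clean : Clean x) (symm : Symmetric x) (children : ∀ u q → ‹ u , q › ∈ x → HS u)
             (t : U) (tr : Transitive t) (x∈t : x ∈ t) where
      private
        W : U
        W = sep t HSP ∪ₛ ⁅ x , x ⁆

        in-W : y ∈ t → HS y → y ∈ W
        in-W i h = ∪-l (proj₂ (∈-sepᵉ HSP ø) (i , h))

        hereditary-old : ∀ y → y ∈ t → HS y → HereditaryIn W y
        hereditary-old y i h = HS-clean h , HS-symmetric h ,
          λ u q j → in-W (desc-transitive tr i u (desc-fst j)) (HS-child h j)

        hereditary-new : HereditaryIn W x
        hereditary-new = clean , symm , λ u q j → in-W (desc-transitive tr x∈t u (desc-fst j)) (children u q j)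

        hereditary : ∀ y → y ∈ W → HereditaryIn W y
        hereditary y i = ∪-elim {{Pr-stable HereditaryInP {W ◂ y ◂ ø}}} i
          (λ i → let j , h = proj₁ (∈-sepᵉ HSP ø) i in hereditary-old y j h)
          (λ i → Pr-resp HereditaryInP {W ◂ x ◂ ø} {W ◂ y ◂ ø} (◂-≋ ≈-refl (◂-≋ (≈-sym (∈-sing i)) λ ())) hereditary-new)

      HS-intro-in : HS x
      HS-intro-in = HS-fold W (∪-r pair-l) hereditary

    -- The hereditarily symmetric elements of a transitive set around `x`, together with `x`, form a
    -- closed set of names.
    HS-intro : Clean x → Symmetric x → (∀ u q → ‹ u , q › ∈ x → HS u) → HS x
    HS-intro {x} c s k = in-transitive x >>= λ (t , tr , i) → HS-intro-in x c s k t tr i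

    act-clean : t ∈ 𝒢 → Clean (act t x)
    act-clean i w h = proj₁ ∈-act h >>= λ (u , h) → h >>= λ (q , (_ , q∈) , e) → ∃ᶜ-intro _ (∃ᶜ-intro _ (e , ·-∈ℙ i q∈))

    -- Shifts commute, so every support of `x` is also a support of the shifted name.
    HS-act : t ∈ 𝒢 → ∀ x → HS x → HS (act t x)
    HS-act {t} t∈ = child-induction (HSP ⟦ v0 ∷ [] ⟧ ⇒ᵖ HSP ⟦ actT (con t) v0 ∷ [] ⟧) λ x ih h → HS-intro (act-clean t∈)
      (HS-symmetric h >>= λ (s , c , supp) → ∃ᶜ-intro s (c , λ t′ i f → ≈-trans (act-swap i t∈ x) (act-cong ≈-refl (supp t′ i f))))
      λ w r i → act-edge⁻ i >>= λ (u , k) → k >>= λ (q , j , e , _) → HS-resp (≈-sym e) (ih u q j (HS-child h (proj₁ j)))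

    act-cancel : t ∈ 𝒢 → ∀ x → HS x → act t (act t x) ≈ x
    act-cancel {t} t∈ = child-induction (HSP ⟦ v0 ∷ [] ⟧ ⇒ᵖ actT (con t) (actT (con t) v0) ≈ᵖ v0) λ x ih h → ⊆-antisym
      (λ w i → proj₁ ∈-act i >>= λ (w′ , k) → k >>= λ (r , (i , _) , e) → act-edge⁻ i >>= λ (u , k) → k >>= λ (q , j , e₁ , e₂) →
        ∈-respˡ (≈-sym (≈-trans e (same x ih h u q j e₁ e₂))) (proj₁ j))
      (λ w i → HS-clean h w i >>= λ (u , k) → k >>= λ (q , e , q∈) → let j = ∈-respˡ e i , q∈ in
        ∈-respˡ (≈-trans (same x ih h u q j ≈-refl ≈-refl) (≈-sym e)) (proj₁ (act-edge t∈ (act-edge t∈ j))))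
      where
      same : ∀ x → (∀ u q → Edge u q x → HS u → act t (act t u) ≈ u) → HS x → ∀ u q {w r} → Edge u q x →
             w ≈ act t u → r ≈ t · q → ‹ act t w , t · r › ≈ ‹ u , q ›
      same x ih h u q j e₁ e₂ = op-cong (≈-trans (act-cong ≈-refl e₁) (ih u q j (HS-child h (proj₁ j))))
        (≈-trans (·-cong ≈-refl e₂) (·-cancel (proj₂ j)))

  open Action public

  -- The forcing relation: equality of names is forced by the conditions that
  -- belong to some symmetric bisimulation.

  module Forcing where

    private
      variable
        p q r s t u w x x′ y y′ z z′ : U

    ⟪_∣_∣_⟫ : U → U → U → U
    ⟪ s ∣ u ∣ w ⟫ = ‹ s , ‹ u , w › ›
    tripleT : Tm n → Tm n → Tm n → Tm n
    tripleT s u w = opT s (opT u w)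

    triple-inj : ⟪ s ∣ u ∣ w ⟫ ≈ ⟪ p ∣ x ∣ y ⟫ → s ≈ p × u ≈ x × w ≈ y
    triple-inj e = let e₁ , e₂ = op-inj e in e₁ , op-inj e₂

    -- One inclusion below `p`: a child of `x` that a condition puts into `x` is, densely, paired by
    -- `b` with a child of `y`.
    Matches : U → U → U → U → Set
    Matches b p x y = ∀ u q → Edge u q x → ∀ r → r ≤ p → r ≤ q →
      ∃ᶜ[ s ] ∃ᶜ[ w ] ∃ᶜ[ q′ ] s ≤ r × Edge w q′ y × s ≤ q′ × ⟪ s ∣ u ∣ w ⟫ ∈ b

    MatchesP : Pr 4
    MatchesP = ∀ᵖ ∀ᵖ (EdgeP v1 v0 v4 ⇒ᵖ (∀ᵖ (LeP ⟦ v0 ∷ v4 ∷ [] ⟧ ⇒ᵖ LeP ⟦ v0 ∷ v1 ∷ [] ⟧ ⇒ᵖ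
      (∃ᵖ ∃ᵖ ∃ᵖ (LeP ⟦ v2 ∷ v3 ∷ [] ⟧ ∧ᵖ EdgeP v1 v0 (v 9F) ∧ᵖ LeP ⟦ v2 ∷ v0 ∷ [] ⟧ ∧ᵖ
        tripleT v2 v5 v1 ∈ᵖ v 6F)))))

    abstract
      -- A greatest-fixed-point definition: one existential formula replaces a simultaneous
      -- recursion on two names.
      EqP : Pr 3
      EqP = v0 ∈ᵖ con ℙ ∧ᵖ (∃ᵖ ((∀ᵖ ∀ᵖ ∀ᵖ (tripleT v2 v1 v0 ∈ᵖ v3 ⇒ᵖ tripleT v2 v0 v1 ∈ᵖ v3 ∧ᵖ
        MatchesP ⟦ v3 ∷ v2 ∷ v1 ∷ v0 ∷ [] ⟧)) ∧ᵖ tripleT v1 v2 v3 ∈ᵖ v0))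

    Eq : U → U → U → Set
    Eq p x y = pred EqP (p ◂ x ◂ y ◂ ø)

    instance
      Eq-stable : Stable (Eq p x y)
      Eq-stable = Pr-stable EqP

    Bisimulation : U → Set
    Bisimulation b = ∀ s u w → ⟪ s ∣ u ∣ w ⟫ ∈ b → ⟪ s ∣ w ∣ u ⟫ ∈ b × Matches b s u w

    abstract
      Eq-unfold : Eq p x y → p ∈ ℙ × (∃ᶜ[ b ] Bisimulation b × ⟪ p ∣ x ∣ y ⟫ ∈ b)
      Eq-unfold h = h

      Eq-intro : p ∈ ℙ → ∀ b → Bisimulation b → ⟪ p ∣ x ∣ y ⟫ ∈ b → Eq p x y
      Eq-intro i b B j = i , ∃ᶜ-intro b (B , j)

    Eq-resp : p ≈ q → x ≈ x′ → y ≈ y′ → Eq p x y → Eq q x′ y′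
    Eq-resp {p} {q} {x} {x′} {y} {y′} e e′ e″ = Pr-resp EqP {p ◂ x ◂ y ◂ ø} {q ◂ x′ ◂ y′ ◂ ø} (◂-≋ e (◂-≋ e′ (◂-≋ e″ λ ())))

    Eq-∈ℙ : Eq p x y → p ∈ ℙ
    Eq-∈ℙ h = proj₁ (Eq-unfold h)

    Eq-sym : Eq p x y → Eq p y x
    Eq-sym h = let i , k = Eq-unfold h in k >>= λ (b , B , j) → Eq-intro i b B (proj₁ (B _ _ _ j))

    Found : U → U → U → Set
    Found r u y = ∃ᶜ[ s ] ∃ᶜ[ w ] ∃ᶜ[ q ] s ≤ r × Edge w q y × s ≤ q × Eq s u w

    Half : U → U → U → Set
    Half p x y = ∀ u q → Edge u q x → ∀ r → r ≤ p → r ≤ q → Found r u y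

    found : s ≤ r → Edge w q y → s ≤ q → Eq s u w → Found r u y
    found i j k l = ∃ᶜ-intro _ (∃ᶜ-intro _ (∃ᶜ-intro _ (i , j , k , l)))

    found-≤ : s ≤ r → Found s u y → Found r u y
    found-≤ i h = h >>= λ (s , h) → h >>= λ (w , h) → h >>= λ (q , j , k , l , m) → found (≤-trans j i) k l m

    Eq-half : Eq p x y → Half p x y
    Eq-half h u q e r i j = proj₂ (Eq-unfold h) >>= λ (b , B , k) → proj₂ (B _ _ _ k) u q e r i j >>= λ (s , h) →
      h >>= λ (w , h) → h >>= λ (q′ , l , e′ , m , k′) → found l e′ m (Eq-intro (≤-l l) b B k′)

    module _ (p x y t : U) (p∈ : p ∈ ℙ) (tr : Transitive t) (x∈ : x ∈ t) (y∈ : y ∈ t)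
             (forth : Half p x y) (back : Half p y x) where
      private
        EqTripleP : Pr 1
        EqTripleP = EqP ⟦ fstT v0 ∷ fstT (sndT v0) ∷ sndT (sndT v0) ∷ [] ⟧

        b₀ b : U
        b₀ = sep (ℙ ×ₛ (t ×ₛ t)) EqTripleP
        b  = b₀ ∪ₛ ⁅ ⟪ p ∣ x ∣ y ⟫ , ⟪ p ∣ y ∣ x ⟫ ⁆

        ∈-b₀ : ⟪ s ∣ u ∣ w ⟫ ∈ b₀ → u ∈ t × w ∈ t × Eq s u w
        ∈-b₀ h = let i , k = proj₁ (∈-sepᵉ EqTripleP ø) h ; _ , j = op-∈-prod⁻ i ; u∈ , w∈ = op-∈-prod⁻ j in
          u∈ , w∈ , Eq-resp fst-op (≈-trans (fst-cong snd-op) fst-op) (≈-trans (snd-cong snd-op) snd-op) k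

        b₀-∈ : u ∈ t → w ∈ t → Eq s u w → ⟪ s ∣ u ∣ w ⟫ ∈ b₀
        b₀-∈ u∈ w∈ k = proj₂ (∈-sepᵉ EqTripleP ø) (op-∈-prod (Eq-∈ℙ k) (op-∈-prod u∈ w∈) ,
          Eq-resp (≈-sym fst-op) (≈-sym (≈-trans (fst-cong snd-op) fst-op)) (≈-sym (≈-trans (snd-cong snd-op) snd-op)) k)

        child-∈t : z ∈ t → Edge u q z → u ∈ t
        child-∈t i (j , _) = desc-transitive tr i _ (desc-fst j)

        matches : ∀ {p x y} → x ∈ t → y ∈ t → Half p x y → Matches b p x y
        matches x∈ y∈ h u q e r i j = h u q e r i j >>= λ (s , k) → k >>= λ (w , k) → k >>= λ (q′ , l , e′ , m , eq) →
          ∃ᶜ-intro s (∃ᶜ-intro w (∃ᶜ-intro q′ (l , e′ , m , ∪-l (b₀-∈ (child-∈t x∈ e) (child-∈t y∈ e′) eq))))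

        Step : U → U → U → Set
        Step s u w = ⟪ s ∣ w ∣ u ⟫ ∈ b × Matches b s u w

        StepP : Pr 3
        StepP = tripleT v0 v2 v1 ∈ᵖ con b ∧ᵖ MatchesP ⟦ con b ∷ v0 ∷ v1 ∷ v2 ∷ [] ⟧

        step-resp : ∀ {s u w s′ u′ w′} → ⟪ s ∣ u ∣ w ⟫ ≈ ⟪ s′ ∣ u′ ∣ w′ ⟫ → Step s′ u′ w′ → Step s u w
        step-resp {s} {u} {w} {s′} {u′} {w′} e = let e₁ , e₂ , e₃ = triple-inj e in
          Pr-resp StepP {s′ ◂ u′ ◂ w′ ◂ ø} {s ◂ u ◂ w ◂ ø} (◂-≋ (≈-sym e₁) (◂-≋ (≈-sym e₂) (◂-≋ (≈-sym e₃) λ ())))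

        bisimulation : ∀ s u w → ⟪ s ∣ u ∣ w ⟫ ∈ b → Step s u w
        bisimulation s u w h = ∪-elim {{Pr-stable StepP {s ◂ u ◂ w ◂ ø}}} h
          (λ h → let u∈ , w∈ , eq = ∈-b₀ h in ∪-l (b₀-∈ w∈ u∈ (Eq-sym eq)) , matches u∈ w∈ (Eq-half eq))
          (λ h → pair-elim {{Pr-stable StepP {s ◂ u ◂ w ◂ ø}}} h
            (λ e → step-resp e (∪-r pair-r , matches x∈ y∈ forth))
            (λ e → step-resp e (∪-r pair-l , matches y∈ x∈ back)))

      Eq-fold-in : Eq p x y
      Eq-fold-in = Eq-intro p∈ b bisimulation (∪-r pair-l)

    -- The forced equalities between names from a transitive set form a bisimulation, and it remains
    -- one when the triples for `x`, `y` and for `y`, `x` are added.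
    Eq-fold : p ∈ ℙ → Half p x y → Half p y x → Eq p x y
    Eq-fold {p} {x} {y} i f g = in-transitive ⁅ x , y ⁆ >>= λ (t , tr , j) →
      Eq-fold-in p x y t i tr (tr _ j x pair-l) (tr _ j y pair-r) f g

    Eq-refl : p ∈ ℙ → Eq p x x
    Eq-refl {p} {x} = child-induction (∀ᵖ (v0 ∈ᵖ con ℙ ⇒ᵖ EqP ⟦ v0 ∷ v1 ∷ v1 ∷ [] ⟧))
      (λ x ih p i → let h : Half p x x
                        h u q e r j k = found (≤-refl (≤-l j)) e k (ih u q e r (≤-l j)) in Eq-fold i h h) x p

    Eq-mono : q ≤ p → Eq p x y → Eq q x y
    Eq-mono i h = Eq-fold (≤-l i) (λ u q e r j k → Eq-half h u q e r (≤-trans j i) k)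
      (λ u q e r j k → Eq-half (Eq-sym h) u q e r (≤-trans j i) k)

    Eq-local : p ∈ ℙ → (∀ q → q ≤ p → ∃ᶜ[ r ] r ≤ q × Eq r x y) → Eq p x y
    Eq-local {p} i h = Eq-fold i (half h) (half λ q j → h q j >>= λ (r , k , e) → ∃ᶜ-intro r (k , Eq-sym e))
      where
      half : ∀ {x y} → (∀ q → q ≤ p → ∃ᶜ[ r ] r ≤ q × Eq r x y) → Half p x y
      half h u q e r j k = h r j >>= λ (r′ , l , eq) → found-≤ l (Eq-half eq u q e r′ (≤-refl (≤-l l)) (≤-trans l k))

    Eq-trans : Eq p x y → Eq p y z → Eq p x z
    Eq-trans {p} {x} {y} {z} = child-induction
      (∀ᵖ ∀ᵖ ∀ᵖ (EqP ⟦ v2 ∷ v3 ∷ v1 ∷ [] ⟧ ⇒ᵖ EqP ⟦ v2 ∷ v1 ∷ v0 ∷ [] ⟧ ⇒ᵖ EqP ⟦ v2 ∷ v3 ∷ v0 ∷ [] ⟧))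
      (λ x ih p y z h h′ → Eq-fold (Eq-∈ℙ h)
        (λ u q e r i j → Eq-half h u q e r i j >>= λ (s , k) → k >>= λ (w , k) → k >>= λ (q₁ , l , e₁ , m , eq) →
          Eq-half h′ w q₁ e₁ s (≤-trans l i) m >>= λ (s′ , k) → k >>= λ (w′ , k) → k >>= λ (q₂ , l′ , e₂ , m′ , eq′) →
          found (≤-trans l′ l) e₂ m′ (ih u q e s′ w w′ (Eq-mono l′ eq) eq′))
        (λ u q e r i j → Eq-half (Eq-sym h′) u q e r i j >>= λ (s , k) → k >>= λ (w , k) → k >>= λ (q₁ , l , e₁ , m , eq) →
          Eq-half (Eq-sym h) w q₁ e₁ s (≤-trans l i) m >>= λ (s′ , k) → k >>= λ (w′ , k) → k >>= λ (q₂ , l′ , e₂ , m′ , eq′) →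
          found (≤-trans l′ l) e₂ m′ (Eq-sym (ih w′ q₂ e₂ s′ w u (Eq-sym eq′) (Eq-sym (Eq-mono l′ eq))))))
      x p y z

    FoundP : Pr 3
    FoundP = ∃ᵖ ∃ᵖ ∃ᵖ (LeP ⟦ v2 ∷ v3 ∷ [] ⟧ ∧ᵖ EdgeP v1 v0 v5 ∧ᵖ LeP ⟦ v2 ∷ v0 ∷ [] ⟧ ∧ᵖ EqP ⟦ v2 ∷ v4 ∷ v1 ∷ [] ⟧)

    abstract
      MemP : Pr 3
      MemP = v0 ∈ᵖ con ℙ ∧ᵖ (∀ᵖ (LeP ⟦ v0 ∷ v1 ∷ [] ⟧ ⇒ᵖ FoundP ⟦ v0 ∷ v2 ∷ v3 ∷ [] ⟧))

    Mem : U → U → U → Set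
    Mem p x y = pred MemP (p ◂ x ◂ y ◂ ø)

    instance
      Mem-stable : Stable (Mem p x y)
      Mem-stable = Pr-stable MemP

    abstract
      Mem-elim : Mem p x y → p ∈ ℙ × (∀ q → q ≤ p → Found q x y)
      Mem-elim h = h

      Mem-intro : p ∈ ℙ → (∀ q → q ≤ p → Found q x y) → Mem p x y
      Mem-intro i h = i , h

    Mem-resp : p ≈ q → x ≈ x′ → y ≈ y′ → Mem p x y → Mem q x′ y′
    Mem-resp {p} {q} {x} {x′} {y} {y′} e e′ e″ = Pr-resp MemP {p ◂ x ◂ y ◂ ø} {q ◂ x′ ◂ y′ ◂ ø} (◂-≋ e (◂-≋ e′ (◂-≋ e″ λ ())))

    Mem-∈ℙ : Mem p x y → p ∈ ℙ
    Mem-∈ℙ h = proj₁ (Mem-elim h)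

    Mem-edge : Edge u q x → p ≤ q → Mem p u x
    Mem-edge e i = Mem-intro (≤-l i) λ r j → found (≤-refl (≤-l j)) e (≤-trans j i) (Eq-refl (≤-l j))

    Mem-mono : q ≤ p → Mem p x y → Mem q x y
    Mem-mono i h = Mem-intro (≤-l i) λ r j → proj₂ (Mem-elim h) r (≤-trans j i)

    Mem-local : p ∈ ℙ → (∀ q → q ≤ p → ∃ᶜ[ r ] r ≤ q × Mem r x y) → Mem p x y
    Mem-local i h = Mem-intro i λ q j → h q j >>= λ (r , k , m) → found-≤ k (proj₂ (Mem-elim m) r (≤-refl (≤-l k)))

    Mem-respˡ : Eq p x x′ → Mem p x y → Mem p x′ y
    Mem-respˡ e h = Mem-intro (Mem-∈ℙ h) λ q i → proj₂ (Mem-elim h) q i >>= λ (s , k) → k >>= λ (w , k) →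
      k >>= λ (q′ , l , e′ , m , eq) → found l e′ m (Eq-trans (Eq-sym (Eq-mono (≤-trans l i) e)) eq)

    Mem-respʳ : Eq p y y′ → Mem p x y → Mem p x y′
    Mem-respʳ e h = Mem-intro (Mem-∈ℙ h) λ q i → proj₂ (Mem-elim h) q i >>= λ (s , k) → k >>= λ (w , k) →
      k >>= λ (q′ , l , e′ , m , eq) → Eq-half e w q′ e′ s (≤-trans l i) m >>= λ (s′ , k) → k >>= λ (w′ , k) →
      k >>= λ (q″ , l′ , e″ , m′ , eq′) → found (≤-trans l′ l) e″ m′ (Eq-trans (Eq-mono l′ eq) eq′)

    module _ {t : U} (t∈ : t ∈ 𝒢) where

      shift-≤ : p ∈ ℙ → r ≤ t · p → t · r ≤ p
      shift-≤ i h = ≤-resp ≈-refl (·-cancel i) (·-mono t∈ h)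

      act-Found : p ∈ ℙ → (∀ s w → Eq s u w → Eq (t · s) (act t u) (act t w)) → Found (t · p) u y → Found p (act t u) (act t y)
      act-Found i ih h = h >>= λ (s , k) → k >>= λ (w , k) → k >>= λ (q , l , e , m , eq) →
        found (shift-≤ i l) (act-edge t∈ e) (·-mono t∈ m) (ih s w eq)

      act-Eq : ∀ x p y → Eq p x y → Eq (t · p) (act t x) (act t y)
      act-Eq = child-induction (∀ᵖ ∀ᵖ (EqP ⟦ v1 ∷ v2 ∷ v0 ∷ [] ⟧ ⇒ᵖ EqP ⟦ shiftT (con t) v1 ∷ actT (con t) v2 ∷ actT (con t) v0 ∷ [] ⟧))
        λ x ih p y h → Eq-fold (·-∈ℙ t∈ (Eq-∈ℙ h))
          (λ u′ q′ (e , q′∈) r i j → act-edge⁻ e >>= λ (u , k) → k >>= λ (q , e , e₁ , e₂) →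
            found-resp e₁ (act-Found (≤-l i) (λ s w eq → ih u q e s w eq)
              (Eq-half h u q e (t · r) (shift-≤ (Eq-∈ℙ h) i) (shift-≤ (proj₂ e) (≤-resp ≈-refl e₂ j)))))
          (λ u′ q′ (e , q′∈) r i j → act-edge⁻ e >>= λ (u , k) → k >>= λ (q , e , e₁ , e₂) →
            Eq-half (Eq-sym h) u q e (t · r) (shift-≤ (Eq-∈ℙ h) i) (shift-≤ (proj₂ e) (≤-resp ≈-refl e₂ j)) >>= λ (s , k) →
            k >>= λ (w , k) → k >>= λ (q₁ , l , e′ , m , eq) →
            found (shift-≤ (≤-l i) l) (act-edge t∈ e′) (·-mono t∈ m)
              (Eq-resp ≈-refl (≈-sym e₁) ≈-refl (Eq-sym (ih w q₁ e′ s u (Eq-sym eq)))))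
        where
        found-resp : ∀ {r u u′ y} → u′ ≈ u → Found r u y → Found r u′ y
        found-resp {r} {u} {u′} {y} e = Pr-resp FoundP {r ◂ u ◂ y ◂ ø} {r ◂ u′ ◂ y ◂ ø} (◂-≋ ≈-refl (◂-≋ (≈-sym e) λ _ → ≈-refl))

      act-Mem : Mem p x y → Mem (t · p) (act t x) (act t y)
      act-Mem {p} {x} {y} h = Mem-intro (·-∈ℙ t∈ (Mem-∈ℙ h)) λ q i → act-Found (≤-l i) (λ s w → act-Eq x s w)
        (proj₂ (Mem-elim h) (t · q) (shift-≤ (Mem-∈ℙ h) i))

    -- Forcing of arbitrary formulas

    -- For the primitive connectives ⊥, ⇒ and ∀ no clause mentions density; density enters through
    -- the atoms alone and `forces-local` propagates it.
    forces : U → Formula n → Env n → Set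
    forces p (x ∈′ y) ρ = Mem p (ρ x) (ρ y)
    forces p (x ≐ y)  ρ = Eq p (ρ x) (ρ y)
    forces p ⊥′       ρ = ⊥
    forces p (φ ⇒′ ψ) ρ = ∀ q → q ≤ p → forces q φ ρ → forces q ψ ρ
    forces p (∀′ φ)   ρ = ∀ x → HS x → forces p φ (x ◂ ρ)

    swap₁ : Fin (suc (suc n)) → Fin (suc (suc n))
    swap₁ zero          = 1F
    swap₁ (suc zero)    = 0F
    swap₁ (suc (suc i)) = suc (suc i)

    abstract
      -- Definability of forcing, one formula at a time: the recursion on `φ` takes place outside
      -- the model.
      forces-def : (φ : Formula n) → Def {suc n} (λ ρ → forces (ρ 0F) φ (ρ ∘ suc))
      forces-def (x ∈′ y) = is-def (MemP ⟦ v 0F ∷ v (suc x) ∷ v (suc y) ∷ [] ⟧)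
      forces-def (x ≐ y)  = is-def (EqP ⟦ v 0F ∷ v (suc x) ∷ v (suc y) ∷ [] ⟧)
      forces-def ⊥′       = d-⊥
      forces-def (φ ⇒′ ψ) = d-∀ (d-⇒ (is-def (LeP ⟦ v 0F ∷ v 1F ∷ [] ⟧))
        (d-⇒ (d-rename skip₁ (forces-def φ)) (d-rename skip₁ (forces-def ψ))))
      forces-def {n} (∀′ φ) = d-∀ (d-⇒ (is-def (HSP ⟦ v 0F ∷ [] ⟧)) (d-cong
        (λ ρ → Def-resp (forces-def φ) {ρ 1F ◂ ρ 0F ◂ λ i → ρ (suc (suc i))} {ρ ∘ swap₁} (λ { zero → ≈-refl ; (suc zero) → ≈-refl ; (suc (suc i)) → ≈-refl }) ,
               Def-resp (forces-def φ) {ρ ∘ swap₁} {ρ 1F ◂ ρ 0F ◂ λ i → ρ (suc (suc i))} (λ { zero → ≈-refl ; (suc zero) → ≈-refl ; (suc (suc i)) → ≈-refl }))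
        (d-rename swap₁ (forces-def φ))))

    ForcesP : Formula n → Pr (suc n)
    ForcesP φ = pr (λ ρ → forces (ρ 0F) φ (ρ ∘ suc)) (forces-def φ)

    forces-stable : (φ : Formula n) {ρ : Env n} → Stable (forces p φ ρ)
    forces-stable {p = p} φ {ρ} = Pr-stable (ForcesP φ) {p ◂ ρ}

    forces-resp : (φ : Formula n) {ρ σ : Env n} → p ≈ q → ρ ≋ σ → forces p φ ρ → forces q φ σ
    forces-resp {p = p} {q} φ {ρ} {σ} e es = Pr-resp (ForcesP φ) {p ◂ ρ} {q ◂ σ} (◂-≋ e es)

    forces-mono : (φ : Formula n) {ρ : Env n} → q ≤ p → forces p φ ρ → forces q φ ρ
    forces-mono (x ∈′ y) i h = Mem-mono i h
    forces-mono (x ≐ y)  i h = Eq-mono i h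
    forces-mono ⊥′       i h = h
    forces-mono (φ ⇒′ ψ) i h r j k = h r (≤-trans j i) k
    forces-mono (∀′ φ)   i h x hs = forces-mono φ i (h x hs)

    forces-local : (φ : Formula n) {ρ : Env n} → p ∈ ℙ → (∀ q → q ≤ p → ∃ᶜ[ r ] r ≤ q × forces r φ ρ) → forces p φ ρ
    forces-local (x ∈′ y) i h = Mem-local i h
    forces-local (x ≐ y)  i h = Eq-local i h
    forces-local ⊥′       i h = h _ (≤-refl i) λ r (j , k) → k
    forces-local (φ ⇒′ ψ) i h q j k = forces-local ψ (≤-l j) λ q′ l → h q′ (≤-trans l j) >>= λ (r , m , f) →
      ∃ᶜ-intro r (m , f r (≤-refl (≤-l m)) (forces-mono φ (≤-trans m l) k))
    forces-local (∀′ φ) i h x hs = forces-local φ i λ q j → h q j >>= λ (r , k , f) → ∃ᶜ-intro r (k , f x hs)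

    HSEnv : Env n → Set
    HSEnv ρ = ∀ i → HS (ρ i)

    ◂-HS : {ρ : Env n} → HS x → HSEnv ρ → HSEnv (x ◂ ρ)
    ◂-HS h hs zero    = h
    ◂-HS h hs (suc i) = hs i

    -- The symmetry lemma. A shift is its own inverse on conditions up to equality and on symmetric
    -- names, so in the clauses for ⇒ and ∀ the stronger condition and the name are pulled back by
    -- the same shift.
    forces-act : (φ : Formula n) {ρ : Env n} → t ∈ 𝒢 → HSEnv ρ → p ∈ ℙ → forces p φ ρ → forces (t · p) φ (act t ∘ ρ)
    forces-act (x ∈′ y) t∈ hs i h = act-Mem t∈ h
    forces-act (x ≐ y)  t∈ hs i h = act-Eq t∈ _ _ _ h
    forces-act ⊥′       t∈ hs i h = h
    forces-act {t = t} (φ ⇒′ ψ) t∈ hs i h q j k = forces-resp ψ (·-cancel (≤-l j)) (λ i → ≈-refl)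
      (forces-act ψ t∈ hs (·-∈ℙ t∈ (≤-l j)) (h (t · q) (shift-≤ t∈ i j)
        (forces-resp φ ≈-refl (λ i → act-cancel t∈ _ (hs i)) (forces-act φ t∈ (λ i → HS-act t∈ _ (hs i)) (≤-l j) k))))
    forces-act {t = t} {p} (∀′ φ) {ρ} t∈ hs i h x hx = forces-resp φ ≈-refl
      (λ { zero → act-cancel t∈ x hx ; (suc i) → ≈-refl })
      (forces-act φ {act t x ◂ ρ} t∈ (◂-HS (HS-act t∈ x hx) hs) i (h (act t x) (HS-act t∈ x hx)))

  open Forcing public

  -- A generic filter, and the symmetric extension it determines

  module Extension where

    private
      variable
        p q r s t u w x x′ y y′ z z′ : U

    private
      vals-append : (us : Vec (Tm n) k) (ρ : Env m) (σ : Env n) →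
                    vals (us ++ tabulate (con ∘ ρ)) σ ≋ append (vals us σ) ρ
      vals-append (u ∷ us) ρ σ = ◂-≋ ≈-refl (vals-append us ρ σ)
      vals-append []       ρ σ = consts ρ
        where
        consts : ∀ {m} (ρ : Env m) → vals (tabulate (con ∘ ρ)) σ ≋ ρ
        consts ρ zero    = ≈-refl
        consts ρ (suc i) = consts (ρ ∘ suc) i

    forcesP : (φ : Formula (k + m)) → Tm n → Vec (Tm n) k → Env m → Pr n
    forcesP {k} {m} φ t us ρ = pr (λ σ → forces (val t σ) φ (append (vals us σ) ρ))
      (d-cong (λ σ → forces-resp φ ≈-refl (≋-sym (vals-append us ρ σ)) , forces-resp φ ≈-refl (vals-append us ρ σ))
        (is-def (ForcesP φ ⟦ t ∷ (us ++ tabulate (con ∘ ρ)) ⟧)))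

    ∅∈𝒢 : ∅ ∈ 𝒢
    ∅∈𝒢 = proj₂ ∈-𝒫 λ z h → ⊥-elim (∉∅ h)

    ctbl-∅ : Ctbl ∅
    ctbl-∅ = ctbl-⊆ (λ z h → ⊥-elim (∉∅ h)) (ctbl-pair {∅} {∅})

    -- An extension of `p` that lies in `d` whenever `d` has an element below `p`. These form one
    -- nonempty set, so the next step is taken without deciding whether `d` can be entered.
    ExtP : U → U → Pr 1
    ExtP p d = LeP ⟦ v0 ∷ con p ∷ [] ⟧ ∧ᵖ ((∃ᵖ (v0 ∈ᵖ con d ∧ᵖ LeP ⟦ v0 ∷ con p ∷ [] ⟧)) ⇒ᵖ v0 ∈ᵖ con d)

    extensions : U → U → U
    extensions p d = sep ℙ (ExtP p d)

    ∈-extensions : ∀ {d} → q ∈ extensions p d ⇔ (q ∈ ℙ × q ≤ p × ((∃ᶜ[ r ] r ∈ d × r ≤ p) → q ∈ d))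
    ∈-extensions {p = p} {d} = ∈-sepᵉ (ExtP p d) ø

    extensions-nonempty : ∀ p d → p ∈ ℙ → ∃ᶜ[ q ] q ∈ extensions p d
    extensions-nonempty p d i = byCases (∃ᶜ[ r ] r ∈ d × r ≤ p)
      (λ h → h >>= λ (r , j , k) → ∃ᶜ-intro r (proj₂ ∈-extensions (≤-l k , k , λ _ → j)))
      (λ h → ∃ᶜ-intro p (proj₂ ∈-extensions (i , ≤-refl i , λ k → ⊥-elim (h k))))

    -- Step `n` enters the n-th set of the model if it has an element below the current condition.
    g : ℕ → U
    g zero    = ‹ ∅ , ∅ ›
    g (suc n) = pick (extensions (g n) (enum n))

    g-∈ℙ : ∀ n → g n ∈ ℙ
    g-ext : ∀ n → g (suc n) ∈ extensions (g n) (enum n)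
    g-∈ℙ zero    = cond-mk ∅∈𝒢 ctbl-∅ ∅∈𝒢
    g-∈ℙ (suc n) = proj₁ (proj₁ ∈-extensions (g-ext n))
    g-ext n = pick-∈ _ (extensions-nonempty (g n) (enum n) (g-∈ℙ n))

    g-suc : ∀ n → g (suc n) ≤ g n
    g-suc n = proj₁ (proj₂ (proj₁ ∈-extensions (g-ext n)))

    g-+ : ∀ m n → g (m + n) ≤ g n
    g-+ zero    n = ≤-refl (g-∈ℙ n)
    g-+ (suc m) n = ≤-trans (g-suc (m + n)) (g-+ m n)

    G : U → Set
    G p = ∃ᶜ[ n ] g n ≤ p

    G-∈ℙ : G p → p ∈ ℙ
    G-∈ℙ h = h >>= λ (n , i) → ≤-r i

    G-up : p ≤ q → G p → G q
    G-up i h = h >>= λ (n , j) → ∃ᶜ-intro n (≤-trans j i)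

    G-g : ∀ n → G (g n)
    G-g n = ∃ᶜ-intro n (≤-refl (g-∈ℙ n))

    G-directed : G p → G q → ∃ᶜ[ r ] G r × r ≤ p × r ≤ q
    G-directed h h′ = h >>= λ (n , i) → h′ >>= λ (m , j) → ∃ᶜ-intro (g (n + m))
      (G-g (n + m) , ≤-trans (subst (λ k → g k ≤ g n) (+-comm m n) (g-+ m n)) i , ≤-trans (g-+ n m) j)

    module _ (P : Pr 1) (p : U) where
      private
        DenseP : Pr 1
        DenseP = (P ∧ᵖ LeP ⟦ v0 ∷ con p ∷ [] ⟧) ∨ᵖ (¬ᵖ (∃ᵖ (LeP ⟦ v0 ∷ v1 ∷ [] ⟧ ∧ᵖ LeP ⟦ v0 ∷ con p ∷ [] ⟧)))

        dense : U
        dense = sep ℙ DenseP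

        ∈-dense : q ∈ dense ⇔ (q ∈ ℙ × ((pred P (q ◂ ø) × q ≤ p) ∨ᶜ (¬ (∃ᶜ[ s ] s ≤ q × s ≤ p))))
        ∈-dense = ∈-sepᵉ DenseP ø

      module _ (Gp : G p) (h : ∀ q → q ≤ p → ∃ᶜ[ r ] r ≤ q × pred P (r ◂ ø)) where
        private
          reachable : ∀ q → q ∈ ℙ → ∃ᶜ[ r ] r ∈ dense × r ≤ q
          reachable q i = byCases (∃ᶜ[ s ] s ≤ q × s ≤ p)
            (λ c → c >>= λ (s , j , k) → h s k >>= λ (r , l , Pr) →
              ∃ᶜ-intro r (proj₂ ∈-dense (≤-l l , ∨ᶜ-inl (Pr , ≤-trans l k)) , ≤-trans l j))
            (λ nc → ∃ᶜ-intro q (proj₂ ∈-dense (i , ∨ᶜ-inr nc) , ≤-refl i))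

          in-dense : ∀ n → enum n ≡ dense → g (suc n) ∈ dense
          in-dense n e = subst (g (suc n) ∈_) e (proj₂ (proj₂ (proj₁ ∈-extensions (g-ext n)))
            (subst (λ d → ∃ᶜ[ r ] r ∈ d × r ≤ g n) (sym e) (reachable (g n) (g-∈ℙ n))))

        generic : ∃ᶜ[ r ] G r × r ≤ p × pred P (r ◂ ø)
        generic k = let n , e = enum-onto dense in ∨ᶜ-elim (proj₂ (proj₁ ∈-dense (in-dense n e)))
          (λ (Pr , l) → k (g (suc n)) (G-g (suc n) , l , Pr))
          (λ nc → G-directed (G-g (suc n)) Gp λ r (_ , i , j) → nc (∃ᶜ-intro r (i , j)))

    N : Set
    N = Σ U HS

    names : (Fin n → N) → Env n
    names ρ i = proj₁ (ρ i)

    names-HS : (ρ : Fin n → N) → HSEnv (names ρ)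
    names-HS ρ i = proj₂ (ρ i)

    infix 6 _∈ᴺ_ _≈ᴺ_
    record _∈ᴺ_ (x y : N) : Set where
      constructor ∈-forced
      field ∈-forcing : ∃ᶜ[ p ] G p × Mem p (proj₁ x) (proj₁ y)

    record _≈ᴺ_ (x y : N) : Set where
      constructor ≈-forced
      field ≈-forcing : ∃ᶜ[ p ] G p × Eq p (proj₁ x) (proj₁ y)

    open _∈ᴺ_ public
    open _≈ᴺ_ public

    instance
      ∈ᴺ-stable : {x y : N} → Stable (x ∈ᴺ y)
      ∈ᴺ-stable = stable λ h → ∈-forced λ k → h λ m → ∈-forcing m k
      ≈ᴺ-stable : {x y : N} → Stable (x ≈ᴺ y)
      ≈ᴺ-stable = stable λ h → ≈-forced λ k → h λ m → ≈-forcing m k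

    𝓝 : Structure
    𝓝 = record
      { U        = N
      ; _∈_      = _∈ᴺ_
      ; _≈_      = _≈ᴺ_
      ; ∈-stable = ∈ᴺ-stable
      ; ≈-stable = ≈ᴺ-stable
      ; ≈-refl   = ≈-forced (∃ᶜ-intro (g 0) (G-g 0 , Eq-refl (g-∈ℙ 0)))
      ; ≈-sym    = λ (≈-forced h) → ≈-forced (h >>= λ (p , i , e) → ∃ᶜ-intro p (i , Eq-sym e))
      ; ≈-trans  = λ (≈-forced h) (≈-forced h′) → ≈-forced (h >>= λ (p , i , e) → h′ >>= λ (q , j , e′) →
          G-directed i j >>= λ (r , k , l , m) → ∃ᶜ-intro r (k , Eq-trans (Eq-mono l e) (Eq-mono m e′)))
      ; ∈-resp   = λ (≈-forced h) (≈-forced h′) (∈-forced k) → ∈-forced (h >>= λ (p , i , e) → h′ >>= λ (q , j , e′) →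
          G-directed i j >>= λ (r , Gr , l , m) → k >>= λ (p′ , i′ , mem) → G-directed Gr i′ >>= λ (r′ , Gr′ , l′ , m′) →
          ∃ᶜ-intro r′ (Gr′ , Mem-respˡ (Eq-mono (≤-trans l′ l) e) (Mem-respʳ (Eq-mono (≤-trans l′ m) e′) (Mem-mono m′ mem))))
      ; point    = ∅ , HS-intro (λ w h → ⊥-elim (∉∅ h))
          (∃ᶜ-intro ∅ (ctbl-∅ , λ t _ _ → empty-≈ λ z h → proj₁ ∈-act h λ u h → h λ q ((i , _) , _) → ∉∅ i))
          (λ u q h → ⊥-elim (∉∅ h))
      }

    private module S = Satisfaction 𝓝

    Forced : Formula n → (Fin n → N) → Set
    Forced φ ρ = ∃ᶜ[ p ] G p × forces p φ (names ρ)

    names-◂ : ∀ (x : N) (ρ : Fin n → N) i → names (x ◂ ρ) i ≡ (proj₁ x ◂ names ρ) i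
    names-◂ x ρ zero    = refl
    names-◂ x ρ (suc i) = refl

    forces-◂ : (φ : Formula (suc n)) (x : N) {ρ : Fin n → N} → forces p φ (proj₁ x ◂ names ρ) → forces p φ (names (x ◂ ρ))
    forces-◂ φ x {ρ} = forces-resp φ ≈-refl (≋-sym (≡⇒≋ (names-◂ x ρ)))

    forces-◂⁻ : (φ : Formula (suc n)) (x : N) {ρ : Fin n → N} → forces p φ (names (x ◂ ρ)) → forces p φ (proj₁ x ◂ names ρ)
    forces-◂⁻ φ x {ρ} = forces-resp φ ≈-refl (≡⇒≋ (names-◂ x ρ))

    -- The contrapositive of `forces-local`.
    refute : (φ : Formula n) {ρ : Env n} → p ∈ ℙ → ¬ forces p φ ρ → ∃ᶜ[ q ] q ≤ p × (∀ r → r ≤ q → ¬ forces r φ ρ)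
    refute φ i h k = h (forces-local φ i λ q j l → k q (j , λ r m f → l r (m , f)))

    module _ (φ ψ : Formula n) (ρ : Env n) where
      DecideP : Pr 1
      DecideP = forcesP (φ ⇒′ ψ) v0 [] ρ ∨ᵖ (forcesP φ v0 [] ρ ∧ᵖ (∀ᵖ (LeP ⟦ v0 ∷ v1 ∷ [] ⟧ ⇒ᵖ ¬ᵖ forcesP ψ v0 [] ρ)))

      -- If `q` does not force the implication, some extension forces `φ` but not `ψ`, and `refute`
      -- excludes `ψ` further down; such decisions are therefore dense.
      decide-⇒ : G p → ∃ᶜ[ r ] G r × r ≤ p × (forces r (φ ⇒′ ψ) ρ ∨ᶜ (forces r φ ρ × (∀ s → s ≤ r → ¬ forces s ψ ρ)))
      decide-⇒ {p} Gp = generic DecideP p Gp dense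
        where
        dense : ∀ q → q ≤ p → ∃ᶜ[ r ] r ≤ q × pred DecideP (r ◂ ø)
        dense q i = byCases (forces q (φ ⇒′ ψ) ρ) (λ f → ∃ᶜ-intro q (≤-refl (≤-l i) , ∨ᶜ-inl f))
          λ nf k → nf λ q′ j f → dne {{forces-stable ψ}} λ nψ → refute ψ (≤-l j) nψ λ r (l , h) →
            k r (≤-trans l j , ∨ᶜ-inr (forces-mono φ l f , h))

    module _ (φ : Formula (suc n)) (ρ : Env n) where
      CounterP : Pr 1
      CounterP = forcesP (∀′ φ) v0 [] ρ ∨ᵖ (∃ᵖ (HSP ⟦ v0 ∷ [] ⟧ ∧ᵖ (∀ᵖ (LeP ⟦ v0 ∷ v2 ∷ [] ⟧ ⇒ᵖ ¬ᵖ forcesP φ v0 (v1 ∷ []) ρ))))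

      decide-∀ : G p → ∃ᶜ[ r ] G r × r ≤ p × (forces r (∀′ φ) ρ ∨ᶜ (∃ᶜ[ x ] HS x × (∀ s → s ≤ r → ¬ forces s φ (x ◂ ρ))))
      decide-∀ {p} Gp = generic CounterP p Gp dense
        where
        dense : ∀ q → q ≤ p → ∃ᶜ[ r ] r ≤ q × pred CounterP (r ◂ ø)
        dense q i = byCases (forces q (∀′ φ) ρ) (λ f → ∃ᶜ-intro q (≤-refl (≤-l i) , ∨ᶜ-inl f))
          λ nf k → nf λ x hs → dne {{forces-stable φ}} λ nφ → refute φ (≤-l i) nφ λ r (l , h) →
            k r (l , ∨ᶜ-inr (∃ᶜ-intro x (hs , h)))

    -- In the cases ⇒ and ∀ the filter contains a deciding condition; the negative decision names a
    -- counterexample, which the induction hypotheses show to contradict satisfaction.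
    truth-lemma  : (φ : Formula n) (ρ : Fin n → N) → S.sat φ ρ → Forced φ ρ
    truth-lemma⁻ : (φ : Formula n) (ρ : Fin n → N) → Forced φ ρ → S.sat φ ρ
    truth-lemma (x ∈′ y) ρ h = ∈-forcing h
    truth-lemma (x ≐ y)  ρ h = ≈-forcing h
    truth-lemma ⊥′       ρ ()
    truth-lemma (φ ⇒′ ψ) ρ h = decide-⇒ φ ψ (names ρ) (G-g 0) >>= λ (r , Gr , _ , d) → ∨ᶜ-elim d
      (λ f → ∃ᶜ-intro r (Gr , f))
      (λ (f , nψ) → ⊥-elim (truth-lemma ψ ρ (h (truth-lemma⁻ φ ρ (∃ᶜ-intro r (Gr , f)))) λ q (Gq , f′) →
        G-directed Gr Gq λ s (_ , i , j) → nψ s i (forces-mono ψ j f′)))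
    truth-lemma (∀′ φ) ρ h = decide-∀ φ (names ρ) (G-g 0) >>= λ (r , Gr , _ , d) → ∨ᶜ-elim d
      (λ f → ∃ᶜ-intro r (Gr , f))
      (λ e → e >>= λ (x , hs , nφ) → ⊥-elim (truth-lemma φ ((x , hs) ◂ ρ) (h (x , hs)) λ q (Gq , f′) →
        G-directed Gr Gq λ s (_ , i , j) → nφ s i (forces-mono φ j (forces-◂⁻ φ (x , hs) f′))))
    truth-lemma⁻ (x ∈′ y) ρ h = ∈-forced h
    truth-lemma⁻ (x ≐ y)  ρ h = ≈-forced h
    truth-lemma⁻ ⊥′       ρ h = h λ p (_ , f) → f
    truth-lemma⁻ (φ ⇒′ ψ) ρ h a = truth-lemma⁻ ψ ρ (h >>= λ (p , Gp , f) → truth-lemma φ ρ a >>= λ (q , Gq , f′) →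
      G-directed Gp Gq >>= λ (r , Gr , i , j) → ∃ᶜ-intro r (Gr , f r i (forces-mono φ j f′)))
    truth-lemma⁻ (∀′ φ) ρ h x = truth-lemma⁻ φ (x ◂ ρ) (h >>= λ (p , Gp , f) →
      ∃ᶜ-intro p (Gp , forces-◂ φ x (f (proj₁ x) (proj₂ x))))

    private
      EdgeFoundP : U → U → Pr 1
      EdgeFoundP x y = ∃ᵖ ∃ᵖ (EdgeP v1 v0 (con y) ∧ᵖ LeP ⟦ v2 ∷ v0 ∷ [] ⟧ ∧ᵖ EqP ⟦ v2 ∷ con x ∷ v1 ∷ [] ⟧)

    -- Forced membership only gives an edge densely; genericity supplies one whose condition is in
    -- the filter.
    ∈ᴺ-elim : (x y : N) → x ∈ᴺ y → ∃ᶜ[ u ] ∃ᶜ[ q ] Edge (proj₁ u) q (proj₁ y) × G q × x ≈ᴺ u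
    ∈ᴺ-elim (x , hx) (y , hy) h = ∈-forcing h >>= λ (p , Gp , m) → generic (EdgeFoundP x y) p Gp
      (λ q i → proj₂ (Mem-elim m) q i >>= λ (s , k) → k >>= λ (w , k) → k >>= λ (q′ , l , e , j , eq) →
        ∃ᶜ-intro s (l , ∃ᶜ-intro w (∃ᶜ-intro q′ (e , j , eq)))) >>= λ (r , Gr , _ , k) →
      k >>= λ (w , k) → k >>= λ (q , e , j , eq) →
        ∃ᶜ-intro (w , HS-child hy (proj₁ e)) (∃ᶜ-intro q (e , G-up j Gr , ≈-forced (∃ᶜ-intro r (Gr , eq))))

    ∈ᴺ-intro : (u y : N) → Edge (proj₁ u) q (proj₁ y) → G q → u ∈ᴺ y
    ∈ᴺ-intro {q} u y e Gq = ∈-forced (∃ᶜ-intro q (Gq , Mem-edge e (≤-refl (G-∈ℙ Gq))))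

  open Extension public

  -- The symmetric extension is a model of ZF

  module ExtensionModel where
    open Structure 𝓝 public using () renaming (≈-refl to ≈ᴺ-refl; ≈-sym to ≈ᴺ-sym; ≈-trans to ≈ᴺ-trans; ∈-resp to ∈ᴺ-resp)
    module S = Satisfaction 𝓝

    private
      variable
        p q r s t u w x x′ y y′ z z′ B : U

    -- Comprehension for names

    orbT : Tm 1
    orbT = actT (fstT v0) (sndT v0)

    abstract
      -- Closing the candidates under all shifts keeps the bound from contributing to the support:
      -- only the parameters of a comprehension need one.
      orb : U → U
      orb B = img (𝒢 ×ₛ sep B HSP) orbT

      orb-intro : t ∈ 𝒢 → u ∈ B → HS u → act t u ∈ orb B
      orb-intro i j h = ∈-respˡ (act-cong fst-op snd-op) (img-intro orbT (op-∈-prod i (proj₂ (∈-sepᵉ HSP ø) (j , h))))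

      orb-elim : w ∈ orb B → ∃ᶜ[ t ] ∃ᶜ[ u ] t ∈ 𝒢 × u ∈ B × HS u × w ≈ act t u
      orb-elim h = proj₁ (∈-imgᵉ orbT ø) h >>= λ (z , i , e) → proj₁ ∈-prod i >>= λ (t , k) → k >>= λ (u , t∈ , u∈ , e′) →
        let u∈B , hs = proj₁ (∈-sepᵉ HSP ø) u∈ in
        ∃ᶜ-intro t (∃ᶜ-intro u (t∈ , u∈B , hs ,
          ≈-trans e (act-cong (≈-trans (fst-cong e′) fst-op) (≈-trans (snd-cong e′) snd-op))))

    act-∅ : HS x → act ∅ x ≈ x
    act-∅ h = HS-symmetric h >>= λ (s , _ , supp) → supp ∅ ∅∈𝒢 λ i j _ k → ∉∅ k

    orb-self : u ∈ B → HS u → u ∈ orb B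
    orb-self i h = ∈-respˡ (act-∅ h) (orb-intro ∅∈𝒢 i h)

    orb-HS : w ∈ orb B → HS w
    orb-HS h = orb-elim h >>= λ (t , k) → k >>= λ (u , t∈ , _ , hs , e) → HS-resp (≈-sym e) (HS-act t∈ u hs)

    orb-act : t ∈ 𝒢 → w ∈ orb B → act t w ∈ orb B
    orb-act i h = orb-elim h >>= λ (s , k) → k >>= λ (u , s∈ , u∈ , hs , e) →
      ∈-respˡ (≈-sym (≈-trans (act-cong ≈-refl e) (act-△ s∈ i u))) (orb-intro (△-∈𝒢 s∈ i) u∈ hs)

    supports-⊆ : s ⊆ t → Supports s x → Supports t x
    supports-⊆ sub h t′ i f = h t′ i λ a b j → f a b (sub a j)

    supports-env : (ρ : Env n) → HSEnv ρ → ∃ᶜ[ s ] Ctbl s × (∀ i → Supports s (ρ i))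
    supports-env {zero}  ρ hs = ∃ᶜ-intro ∅ (ctbl-∅ , λ ())
    supports-env {suc n} ρ hs = supports-env (ρ ∘ suc) (hs ∘ suc) >>= λ (s , c , h) → HS-symmetric (hs zero) >>= λ (s′ , c′ , h′) →
      ∃ᶜ-intro (s ∪ₛ s′) (ctbl-∪ c c′ , λ { zero → supports-⊆ (λ z → ∪-r) h′ ; (suc i) → supports-⊆ (λ z → ∪-l) (h i) })

    module Comprehension (φ : Formula (suc n)) (ρ : Env n) (hs : HSEnv ρ) (B : U) where
      CompP : Pr 1
      CompP = forcesP φ (sndT v0) (fstT v0 ∷ []) ρ

      abstract
        comp : U
        comp = sep (orb B ×ₛ ℙ) CompP

        ∈-comp : ‹ u , q › ∈ comp ⇔ (u ∈ orb B × q ∈ ℙ × forces q φ (u ◂ ρ))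
        ∈-comp {u} {q} =
          (λ h → let i , f = proj₁ (∈-sepᵉ CompP ø) h ; j , k = op-∈-prod⁻ i in
            j , k , forces-resp φ snd-op (◂-≋ fst-op λ _ → ≈-refl) f) ,
          (λ (j , k , f) → proj₂ (∈-sepᵉ CompP ø) (op-∈-prod j k , forces-resp φ (≈-sym snd-op) (◂-≋ (≈-sym fst-op) λ _ → ≈-refl) f))

        comp-pairs : w ∈ comp → ∃ᶜ[ u ] ∃ᶜ[ q ] w ≈ ‹ u , q › × q ∈ ℙ
        comp-pairs h = proj₁ ∈-prod (proj₁ (proj₁ (∈-sepᵉ CompP ø) h)) >>= λ (u , k) → k >>= λ (q , _ , q∈ , e) →
          ∃ᶜ-intro u (∃ᶜ-intro q (e , q∈))

        comp-⊆ : comp ⊆ orb B ×ₛ ℙ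
        comp-⊆ w h = proj₁ (proj₁ (∈-sepᵉ CompP ø) h)

      shifted : t ∈ 𝒢 → (∀ i → act t (ρ i) ≈ ρ i) → ‹ u , q › ∈ comp → ‹ act t u , t · q › ∈ comp
      shifted {t} {u} t∈ fix h = let i , q∈ , f = proj₁ ∈-comp h in
        proj₂ ∈-comp (orb-act t∈ i , ·-∈ℙ t∈ q∈ , forces-resp φ ≈-refl (λ { zero → ≈-refl ; (suc i) → fix i })
          (forces-act φ t∈ (◂-HS (orb-HS i) hs) q∈ f))

      -- By the symmetry lemma a shift that fixes the parameters permutes the edges.
      comp-supports : (∀ i → Supports s (ρ i)) → Supports s comp
      comp-supports supp t t∈ f = ⊆-antisym
        (λ w h → proj₁ ∈-act h >>= λ (u , h) → h >>= λ (q , (i , _) , e) →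
          ∈-respˡ (≈-sym e) (shifted t∈ (λ i → supp i t t∈ f) i))
        (λ w h → comp-pairs h >>= λ (u , k) → k >>= λ (q , e , q∈) → let i = ∈-respˡ e h in
          ∈-respˡ (≈-trans (op-cong (act-cancel t∈ u (orb-HS (proj₁ (proj₁ ∈-comp i)))) (·-cancel q∈)) (≈-sym e))
            (proj₁ (act-edge t∈ (shifted t∈ (λ i → supp i t t∈ f) i , ·-∈ℙ t∈ q∈))))

      comp-HS : HS comp
      comp-HS = HS-intro (λ w h → comp-pairs h)
        (supports-env ρ hs >>= λ (s , c , supp) → ∃ᶜ-intro s (c , comp-supports supp))
        (λ u q h → orb-HS (proj₁ (proj₁ ∈-comp h)))

    abstract
      -- Pairing, union, power set, separation and replacement are all instances, with different
      -- bounds `B` on the candidate names.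
      compᴺ : Formula (suc n) → (Fin n → N) → U → N
      compᴺ φ ρ B = comp , comp-HS
        where open Comprehension φ (names ρ) (names-HS ρ) B

      compᴺ-sat : (φ : Formula (suc n)) (ρ : Fin n → N) (B : U) (z : N) → z ∈ᴺ compᴺ φ ρ B → S.sat φ (z ◂ ρ)
      compᴺ-sat φ ρ B z h = _>>=_ {{S.sat-stable φ _}} (∈ᴺ-elim z (compᴺ φ ρ B) h) λ (u , k) →
        _>>=_ {{S.sat-stable φ _}} k λ (q , (i , _) , Gq , e) →
        S.sat-resp φ (S.◂-≋ (≈ᴺ-sym {z} {u} e) λ i → ≈ᴺ-refl {ρ i})
          (truth-lemma⁻ φ (u ◂ ρ) (∃ᶜ-intro q (Gq , forces-◂ φ u (proj₂ (proj₂ (proj₁ ∈-comp i))))))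
        where open Comprehension φ (names ρ) (names-HS ρ) B

      compᴺ-intro : (φ : Formula (suc n)) (ρ : Fin n → N) (B : U) (z v : N) → proj₁ v ∈ B → z ≈ᴺ v →
                    S.sat φ (z ◂ ρ) → z ∈ᴺ compᴺ φ ρ B
      compᴺ-intro φ ρ B z v i e h = truth-lemma φ (v ◂ ρ) (S.sat-resp φ (S.◂-≋ e λ i → ≈ᴺ-refl {ρ i}) h) >>= λ (q , Gq , f) →
        ∈ᴺ-resp {v} {z} {compᴺ φ ρ B} {compᴺ φ ρ B} (≈ᴺ-sym {z} {v} e) (≈ᴺ-refl {compᴺ φ ρ B})
          (∈ᴺ-intro v (compᴺ φ ρ B) (proj₂ ∈-comp (orb-self i (proj₂ v) , G-∈ℙ Gq , forces-◂⁻ φ v f) , G-∈ℙ Gq) Gq)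
        where open Comprehension φ (names ρ) (names-HS ρ) B

      compᴺ-⊆ : (φ : Formula (suc n)) (ρ : Fin n → N) (B : U) → proj₁ (compᴺ φ ρ B) ⊆ orb B ×ₛ ℙ
      compᴺ-⊆ φ ρ B = comp-⊆
        where open Comprehension φ (names ρ) (names-HS ρ) B

    -- Canonical names for the sets of the ground model

    check-valT : Tm 4
    check-valT = applyF ⟦ v2 ∷ v0 ∷ [] ⟧ᵗ

    check-step : Tm 3
    check-step = prodT (imgT v0 check-valT) (con ℙ)

    abstract
      checkH : Tm 3
      checkH = check-step

      checkH-≈ : (ρ : Env 3) → val checkH ρ ≈ val check-step ρ
      checkH-≈ ρ = ≈-refl

    module Check = Recursive checkH

    private
      ∈-check-rec : w ∈ Check.rec x ∅ ⇔ (∃ᶜ[ y ] ∃ᶜ[ q ] y ∈ x × q ∈ ℙ × w ≈ ‹ Check.rec y ∅ , q ›)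
      ∈-check-rec {w} {x} = to′ , from′
        where
        env : Env 3
        env = x ◂ Check.trace x ∅ ◂ ∅ ◂ ø
        to′ : w ∈ Check.rec x ∅ → ∃ᶜ[ y ] ∃ᶜ[ q ] y ∈ x × q ∈ ℙ × w ≈ ‹ Check.rec y ∅ , q ›
        to′ h = proj₁ ∈-prod (∈-respʳ (≈-trans Check.rec-equation (checkH-≈ env)) h) >>= λ (u , k) → k >>= λ (q , i , j , e) →
          proj₁ (∈-imgᵉ check-valT env) i >>= λ (y , y∈ , e′) →
          ∃ᶜ-intro y (∃ᶜ-intro q (y∈ , j , ≈-trans e (op-cong (≈-trans e′ (Check.trace-$ (desc-∈ y∈))) ≈-refl)))
        from′ : (∃ᶜ[ y ] ∃ᶜ[ q ] y ∈ x × q ∈ ℙ × w ≈ ‹ Check.rec y ∅ , q ›) → w ∈ Check.rec x ∅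
        from′ h = h >>= λ (y , h) → h >>= λ (q , i , j , e) → ∈-respʳ (≈-sym (≈-trans Check.rec-equation (checkH-≈ env)))
          (∈-respˡ (≈-sym (≈-trans e (op-cong (≈-sym (Check.trace-$ (desc-∈ i))) ≈-refl))) (op-∈-prod (img-intro check-valT {env} i) j))

    abstract
      checkF : Tm 1
      checkF = Check.recT ⟦ v0 ∷ con ∅ ∷ [] ⟧ᵗ

    -- Every condition is attached to every child. Attaching the top alone would not give an
    -- invariant name, as a shift changes its second component, whereas a shift maps `ℙ` onto
    -- itself.
    check : U → U
    check x = val checkF (x ◂ ø)

    checkT : Tm n → Tm n
    checkT t = checkF ⟦ t ∷ [] ⟧ᵗ

    abstract
      ∈-check : w ∈ check x ⇔ (∃ᶜ[ y ] ∃ᶜ[ q ] y ∈ x × q ∈ ℙ × w ≈ ‹ check y , q ›)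
      ∈-check = ∈-check-rec

    check-cong : x ≈ y → check x ≈ check y
    check-cong {x} {y} e = Tm-cong checkF {x ◂ ø} {y ◂ ø} (◂-≋ e λ ())

    check-edge : ∀ {y x q} → y ∈ x → q ∈ ℙ → Edge (check y) q (check x)
    check-edge i j = proj₂ ∈-check (∃ᶜ-intro _ (∃ᶜ-intro _ (i , j , ≈-refl))) , j

    act-check : t ∈ 𝒢 → ∀ x → act t (check x) ≈ check x
    act-check {t} t∈ = ∈-induction (actT (con t) (checkT v0) ≈ᵖ checkT v0) λ x ih → ⊆-antisym
      (λ w h → proj₁ ∈-act h >>= λ (u , h) → h >>= λ (q , (i , q∈) , e) → proj₁ ∈-check i >>= λ (y , h) → h >>= λ (q′ , y∈ , _ , e′) →
        ∈-respˡ (≈-sym (≈-trans e (op-cong (≈-trans (act-cong ≈-refl (proj₁ (op-inj e′))) (ih y y∈)) ≈-refl)))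
          (proj₁ (check-edge y∈ (·-∈ℙ t∈ q∈))))
      (λ w h → proj₁ ∈-check h >>= λ (y , h) → h >>= λ (q , y∈ , q∈ , e) →
        ∈-respˡ (≈-trans (op-cong (ih y y∈) (·-cancel q∈)) (≈-sym e)) (proj₁ (act-edge t∈ (check-edge y∈ (·-∈ℙ t∈ q∈)))))

    HS-check : ∀ x → HS (check x)
    HS-check = ∈-induction (HSP ⟦ checkT v0 ∷ [] ⟧) λ x ih → HS-intro
      (λ w h → proj₁ ∈-check h >>= λ (y , h) → h >>= λ (q , _ , q∈ , e) → ∃ᶜ-intro (check y) (∃ᶜ-intro q (e , q∈)))
      (∃ᶜ-intro ∅ (ctbl-∅ , λ t t∈ _ → act-check t∈ x))
      (λ u q h → proj₁ ∈-check h >>= λ (y , h) → h >>= λ (_ , y∈ , _ , e) → HS-resp (≈-sym (proj₁ (op-inj e))) (ih y y∈))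

    checkᴺ : U → N
    checkᴺ x = check x , HS-check x

    ≈⇒≈ᴺ : {x y : N} → proj₁ x ≈ proj₁ y → x ≈ᴺ y
    ≈⇒≈ᴺ e = ≈-forced (∃ᶜ-intro (g 0) (G-g 0 , Eq-resp ≈-refl ≈-refl e (Eq-refl (g-∈ℙ 0))))

    ∈ᴺ-check : (z : N) (x : U) → z ∈ᴺ checkᴺ x ⇔ (∃ᶜ[ y ] y ∈ x × z ≈ᴺ checkᴺ y)
    ∈ᴺ-check z x = to′ , from′
      where
      to′ : z ∈ᴺ checkᴺ x → ∃ᶜ[ y ] y ∈ x × z ≈ᴺ checkᴺ y
      to′ h = ∈ᴺ-elim z (checkᴺ x) h >>= λ (u , k) → k >>= λ (q , (i , _) , _ , e) →
        proj₁ ∈-check i >>= λ (y , k) → k >>= λ (_ , y∈ , _ , e′) →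
        ∃ᶜ-intro y (y∈ , ≈ᴺ-trans {z} {u} {checkᴺ y} e (≈⇒≈ᴺ {u} {checkᴺ y} (proj₁ (op-inj e′))))
      from′ : (∃ᶜ[ y ] y ∈ x × z ≈ᴺ checkᴺ y) → z ∈ᴺ checkᴺ x
      from′ h = h >>= λ (y , y∈ , e) → ∈ᴺ-resp {checkᴺ y} {z} {checkᴺ x} {checkᴺ x} (≈ᴺ-sym {z} {checkᴺ y} e) (≈ᴺ-refl {checkᴺ x})
        (∈ᴺ-intro (checkᴺ y) (checkᴺ x) (check-edge y∈ (g-∈ℙ 0)) (G-g 0))

    -- The axioms of ZF in the extension

    abstract
      trcl : U → U
      trcl = tc

      trcl-transitive : Transitive (trcl x)
      trcl-transitive = tc-transitive

      self-∈tc : x ∈ trcl x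
      self-∈tc {x} = tc-intro ∅ ω-zero x (tc-stage-base ∅ ω-zero)

    child-∈tc : ∀ {u q x y} → y ∈ trcl x → Edge u q y → u ∈ trcl x
    child-∈tc i (j , _) = desc-transitive trcl-transitive i _ (desc-fst j)

    -- Elements may be replaced by equal ones with names in a fixed set of the ground model, which
    -- serves as the bound in comprehension.
    ∈ᴺ-tc : (z x : N) {y : U} → z ∈ᴺ x → proj₁ x ∈ trcl y → ∃ᶜ[ u ] proj₁ u ∈ trcl y × z ≈ᴺ u × u ∈ᴺ x
    ∈ᴺ-tc z x h i = ∈ᴺ-elim z x h >>= λ (u , k) → k >>= λ (q , e , Gq , eq) → ∃ᶜ-intro u (child-∈tc i e , eq , ∈ᴺ-intro u x e Gq)

    inclusionφ : Formula 2
    inclusionφ = ∀′ (0F ∈′ 1F ⇒′ 0F ∈′ 2F)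

    -- Some condition in the filter forces both inclusions, and forced membership of the children is
    -- exactly what `Eq-fold` asks for.
    extensionalᴺ : {x y : N} → (∀ z → z ∈ᴺ x ⇔ z ∈ᴺ y) → x ≈ᴺ y
    extensionalᴺ {x} {y} h =
      truth-lemma inclusionφ (x ◂ y ◂ ø) (λ z → proj₁ (h z)) >>= λ (p , Gp , f) →
      truth-lemma inclusionφ (y ◂ x ◂ ø) (λ z → proj₂ (h z)) >>= λ (q , Gq , f′) →
      G-directed Gp Gq >>= λ (r , Gr , i , j) →
      ≈-forced (∃ᶜ-intro r (Gr , Eq-fold (G-∈ℙ Gr) (half x y i f) (half y x j f′)))
      where
      half : (x y : N) → r ≤ p → forces p inclusionφ (names (x ◂ y ◂ ø)) → Half r (proj₁ x) (proj₁ y)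
      half x y i f u q e s j k = proj₂ (Mem-elim (f u (HS-child (proj₂ x) (proj₁ e)) s (≤-trans j i) (Mem-edge e k))) s (≤-refl (≤-l j))

    descendingφ : Formula 1
    descendingφ = ∀′ (0F ∈′ 1F ⇒′ ¬′ (∀′ (0F ∈′ 1F ⇒′ ¬′ 0F ∈′ 2F)))

    -- The hypothesis is that no element of `x` is minimal. Induction over children: if a condition
    -- put `u` into `x`, a stronger one would put a child of `u` into `x`.
    no-descent : (x : N) → forces p descendingφ (names (x ◂ ø)) → ∀ u → HS u → ∀ q → q ≤ p → ¬ Mem q u (proj₁ x)
    no-descent {p} x f = child-induction
      (HSP ⟦ v0 ∷ [] ⟧ ⇒ᵖ (∀ᵖ (LeP ⟦ v0 ∷ con p ∷ [] ⟧ ⇒ᵖ ¬ᵖ MemP ⟦ v0 ∷ v1 ∷ con (proj₁ x) ∷ [] ⟧)))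
      λ u ih hs q i m → f u hs q i m q (≤-refl (≤-l i)) λ z hz r j mz s k mz′ →
        proj₂ (Mem-elim mz) s k λ s′ h → h λ w h → h λ q′ (l , e , _ , eq) →
          ih w q′ e (HS-child hs (proj₁ e)) s′ (≤-trans (≤-trans l k) (≤-trans j i)) (Mem-respˡ eq (Mem-mono l mz′))

    regularᴺ : (x : N) → ∃ᶜ[ y ] y ∈ᴺ x → ∃ᶜ[ y ] y ∈ᴺ x × (∀ z → z ∈ᴺ y → ¬ z ∈ᴺ x)
    regularᴺ x h k = truth-lemma descendingφ (x ◂ ø) (λ y i m → k y (i , m)) λ p (Gp , f) →
      h λ y e → ∈-forcing e λ q (Gq , m) → G-directed Gp Gq λ r (_ , i , j) → no-descent x f (proj₁ y) (proj₂ y) r i (Mem-mono j m)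

    pairφ : Formula 3
    pairφ = 0F ≐ 1F ∨′ 0F ≐ 2F

    unionφ powerφ : Formula 2
    unionφ = ∃′ (0F ∈′ 2F ∧′ 1F ∈′ 0F)
    powerφ = ∀′ (0F ∈′ 1F ⇒′ 0F ∈′ 2F)

    pairᴺ : N → N → N
    pairᴺ x y = compᴺ pairφ (x ◂ y ◂ ø) ⁅ proj₁ x , proj₁ y ⁆

    unionᴺ powerᴺ : N → N
    unionᴺ x = compᴺ unionφ (x ◂ ø) (trcl (proj₁ x))
    powerᴺ x = compᴺ powerφ (x ◂ ø) (𝒫 (orb (trcl (proj₁ x)) ×ₛ ℙ))

    ∈-pairᴺ : {x y z : N} → z ∈ᴺ pairᴺ x y ⇔ (z ≈ᴺ x ∨ᶜ z ≈ᴺ y)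
    ∈-pairᴺ {x} {y} {z} = compᴺ-sat pairφ (x ◂ y ◂ ø) ⁅ proj₁ x , proj₁ y ⁆ z , λ h → ∨ᶜ-elim h
      (λ e → compᴺ-intro pairφ (x ◂ y ◂ ø) ⁅ proj₁ x , proj₁ y ⁆ z x pair-l e (∨ᶜ-inl e))
      (λ e → compᴺ-intro pairφ (x ◂ y ◂ ø) ⁅ proj₁ x , proj₁ y ⁆ z y pair-r e (∨ᶜ-inr e))

    ∈-unionᴺ : {x z : N} → z ∈ᴺ unionᴺ x ⇔ (∃ᶜ[ y ] y ∈ᴺ x × z ∈ᴺ y)
    ∈-unionᴺ {x} {z} =
      (λ h k → compᴺ-sat unionφ (x ◂ ø) (trcl (proj₁ x)) z h λ y c → c λ i j → k y (i , j)) ,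
      (λ h → h >>= λ (y , i , j) → ∈ᴺ-tc y x i self-∈tc >>= λ (u , u∈ , e , _) →
        ∈ᴺ-tc z u (∈ᴺ-resp {z} {z} {y} {u} (≈ᴺ-refl {z}) e j) u∈ >>= λ (w , w∈ , e′ , _) →
        compᴺ-intro unionφ (x ◂ ø) (trcl (proj₁ x)) z w w∈ e′ λ k → k y λ c → c i j)

    -- A subset of `x` may have names of any rank; this name of the same set has all its edges in a
    -- fixed product, so the power set has a bound.
    traceᴺ : N → N → N
    traceᴺ z x = compᴺ (0F ∈′ 1F) (z ◂ ø) (trcl (proj₁ x))

    ∈-powerᴺ : {x z : N} → z ∈ᴺ powerᴺ x ⇔ (∀ w → w ∈ᴺ z → w ∈ᴺ x)
    ∈-powerᴺ {x} {z} = compᴺ-sat powerφ (x ◂ ø) (𝒫 (orb (trcl (proj₁ x)) ×ₛ ℙ)) z , λ h →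
      compᴺ-intro powerφ (x ◂ ø) (𝒫 (orb (trcl (proj₁ x)) ×ₛ ℙ)) z (traceᴺ z x)
        (proj₂ ∈-𝒫 (compᴺ-⊆ (0F ∈′ 1F) (z ◂ ø) (trcl (proj₁ x))))
        (extensionalᴺ {z} {traceᴺ z x} λ w →
          (λ i → ∈ᴺ-tc w x (h w i) self-∈tc >>= λ (u , u∈ , e , _) → compᴺ-intro (0F ∈′ 1F) (z ◂ ø) (trcl (proj₁ x)) w u u∈ e i) ,
          compᴺ-sat (0F ∈′ 1F) (z ◂ ø) (trcl (proj₁ x)) w)
        h

    separateφ : Formula (suc n) → Formula (suc (suc n))
    separateφ φ = 0F ∈′ 1F ∧′ rename skip₁ φ

    separateᴺ : Formula (suc n) → (Fin n → N) → N → N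
    separateᴺ φ ρ a = compᴺ (separateφ φ) (a ◂ ρ) (trcl (proj₁ a))

    ∈-separateᴺ : (φ : Formula (suc n)) (ρ : Fin n → N) {a z : N} →
      z ∈ᴺ separateᴺ φ ρ a ⇔ (z ∈ᴺ a × S.sat φ (z ◂ ρ))
    ∈-separateᴺ {n} φ ρ {a} {z} =
      (λ h → let i , s = ∧-elim {{∈ᴺ-stable}} {{S.sat-stable (rename skip₁ φ) (z ◂ a ◂ ρ)}}
                           (compᴺ-sat (separateφ φ) (a ◂ ρ) (trcl (proj₁ a)) z h) in i , proj₁ ren s) ,
      (λ (i , s) → ∈ᴺ-tc z a i self-∈tc >>= λ (u , u∈ , e , _) →
        compᴺ-intro (separateφ φ) (a ◂ ρ) (trcl (proj₁ a)) z u u∈ e (∧-intro (i , proj₂ ren s)))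
      where
      ren : S.sat (rename skip₁ φ) (z ◂ a ◂ ρ) ⇔ S.sat φ (z ◂ ρ)
      ren = S.sat-rename φ skip₁ λ { zero → refl ; (suc i) → refl }

    skip₂ : Fin (suc (suc n)) → Fin (suc (suc (suc n)))
    skip₂ zero          = 0F
    skip₂ (suc zero)    = 1F
    skip₂ (suc (suc i)) = suc (suc (suc i))

    replaceφ : Formula (suc (suc n)) → Formula (suc (suc n))
    replaceφ φ = ∃′ (0F ∈′ 2F ∧′ rename skip₂ φ)

    ImageP : Formula (suc (suc n)) → (Fin n → N) → Pr 2
    ImageP φ ρ = HSP ⟦ v1 ∷ [] ⟧ ∧ᵖ forcesP φ (sndT v0) (fstT v0 ∷ v1 ∷ []) (names ρ)

    abstract
      -- Collection in the ground model provides a witness for each name in the closure of `a` and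
      -- each condition that forces `φ` for some value.
      bound-image : Formula (suc (suc n)) → (Fin n → N) → N → U
      bound-image φ ρ a = Collection.collect (ImageP φ ρ) (trcl (proj₁ a) ×ₛ ℙ)

      bound-image-spec : (φ : Formula (suc (suc n))) (ρ : Fin n → N) (a : N) →
        x ∈ trcl (proj₁ a) ×ₛ ℙ → (∃ᶜ[ y ] HS y × forces (snd x) φ (fst x ◂ y ◂ names ρ)) →
        ∃ᶜ[ y ] y ∈ bound-image φ ρ a × HS y × forces (snd x) φ (fst x ◂ y ◂ names ρ)
      bound-image-spec φ ρ a = Collection.collect-spec (ImageP φ ρ)

    replaceᴺ : Formula (suc (suc n)) → (Fin n → N) → N → N
    replaceᴺ φ ρ a = compᴺ (replaceφ φ) (a ◂ ρ) (bound-image φ ρ a)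

    module _ (φ : Formula (suc (suc n))) (ρ : Fin n → N) {a : N}
             (functional : ∀ x → x ∈ᴺ a → ∀ y z → S.sat φ (x ◂ y ◂ ρ) → S.sat φ (x ◂ z ◂ ρ) → y ≈ᴺ z) where
      private
        ren : ∀ x y → S.sat (rename skip₂ φ) (x ◂ y ◂ a ◂ ρ) ⇔ S.sat φ (x ◂ y ◂ ρ)
        ren x y = S.sat-rename φ skip₂ λ { zero → refl ; (suc zero) → refl ; (suc (suc i)) → refl }

        bounded : ∀ x y → x ∈ᴺ a → S.sat φ (x ◂ y ◂ ρ) → ∃ᶜ[ v′ ] proj₁ v′ ∈ bound-image φ ρ a × y ≈ᴺ v′
        bounded x y i h = ∈ᴺ-tc x a i self-∈tc >>= λ (u , u∈ , e , u∈a) →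
          let h′ = S.sat-resp φ (S.◂-≋ e (S.◂-≋ (≈ᴺ-refl {y}) λ i → ≈ᴺ-refl {ρ i})) h in
          truth-lemma φ (u ◂ y ◂ ρ) h′ >>= λ (q , Gq , f) →
          bound-image-spec φ ρ a (op-∈-prod u∈ (G-∈ℙ Gq)) (∃ᶜ-intro (proj₁ y) (proj₂ y ,
            forces-resp φ (≈-sym snd-op) (λ { zero → ≈-sym fst-op ; (suc zero) → ≈-refl ; (suc (suc i)) → ≈-refl }) f)) >>= λ (v′ , v∈ , hs , f′) →
          -- Collection may return a name other than `y`; functionality in the extension identifies
          -- the two values.
          ∃ᶜ-intro (v′ , hs) (v∈ , functional u u∈a y (v′ , hs) h′ (truth-lemma⁻ φ (u ◂ (v′ , hs) ◂ ρ)
            (∃ᶜ-intro q (Gq , forces-resp φ snd-op (λ { zero → fst-op ; (suc zero) → ≈-refl ; (suc (suc i)) → ≈-refl }) f′))))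

      ∈-replaceᴺ : ∀ {y} → y ∈ᴺ replaceᴺ φ ρ a ⇔ (∃ᶜ[ x ] x ∈ᴺ a × S.sat φ (x ◂ y ◂ ρ))
      ∈-replaceᴺ {y} =
        (λ h k → compᴺ-sat (replaceφ φ) (a ◂ ρ) (bound-image φ ρ a) y h λ x c → c λ i s → k x (i , proj₁ (ren x y) s)) ,
        (λ h → h >>= λ (x , i , s) → bounded x y i s >>= λ (v′ , v∈ , e) →
          compᴺ-intro (replaceφ φ) (a ◂ ρ) (bound-image φ ρ a) y v′ v∈ e λ k → k x λ c → c i (proj₂ (ren x y) s))

    inf-zeroᴺ : ∃ᶜ[ e ] e ∈ᴺ checkᴺ ω × (∀ z → ¬ z ∈ᴺ e)
    inf-zeroᴺ = ∃ᶜ-intro (checkᴺ ∅) (proj₂ (∈ᴺ-check (checkᴺ ∅) ω) (∃ᶜ-intro ∅ (ω-zero , ≈ᴺ-refl {checkᴺ ∅})) ,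
      λ z h → proj₁ (∈ᴺ-check z ∅) h λ y (i , _) → ∉∅ i)

    check-succ : ∀ n z → z ∈ᴺ checkᴺ (succ n) ⇔ (z ∈ᴺ checkᴺ n ∨ᶜ z ≈ᴺ checkᴺ n)
    check-succ n z =
      (λ h → proj₁ (∈ᴺ-check z (succ n)) h >>= λ (y , i , e) → succ-elim i
        (λ i → ∨ᶜ-inl (proj₂ (∈ᴺ-check z n) (∃ᶜ-intro y (i , e))))
        (λ e′ → ∨ᶜ-inr (≈ᴺ-trans {z} {checkᴺ y} {checkᴺ n} e (≈⇒≈ᴺ {checkᴺ y} {checkᴺ n} (check-cong e′))))) ,
      (λ h → ∨ᶜ-elim h
        (λ i → proj₁ (∈ᴺ-check z n) i >>= λ (y , i , e) → proj₂ (∈ᴺ-check z (succ n)) (∃ᶜ-intro y (succ-old i , e)))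
        (λ e → proj₂ (∈ᴺ-check z (succ n)) (∃ᶜ-intro n (succ-self , e))))

    inf-sucᴺ : ∀ x → x ∈ᴺ checkᴺ ω → ∃ᶜ[ s ] s ∈ᴺ checkᴺ ω × (∀ z → z ∈ᴺ s ⇔ (z ∈ᴺ x ∨ᶜ z ≈ᴺ x))
    inf-sucᴺ x h = proj₁ (∈ᴺ-check x ω) h >>= λ (n , n∈ , e) → ∃ᶜ-intro (checkᴺ (succ n))
      (proj₂ (∈ᴺ-check (checkᴺ (succ n)) ω) (∃ᶜ-intro (succ n) (ω-suc n∈ , ≈ᴺ-refl {checkᴺ (succ n)})) , λ z →
        (λ i → ∨ᶜ-elim (proj₁ (check-succ n z) i)
          (λ i → ∨ᶜ-inl (∈ᴺ-resp {z} {z} {checkᴺ n} {x} (≈ᴺ-refl {z}) (≈ᴺ-sym {x} {checkᴺ n} e) i))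
          (λ e′ → ∨ᶜ-inr (≈ᴺ-trans {z} {checkᴺ n} {x} e′ (≈ᴺ-sym {x} {checkᴺ n} e)))) ,
        (λ i → proj₂ (check-succ n z) (∨ᶜ-elim i
          (λ i → ∨ᶜ-inl (∈ᴺ-resp {z} {z} {x} {checkᴺ n} (≈ᴺ-refl {z}) e i))
          (λ e′ → ∨ᶜ-inr (≈ᴺ-trans {z} {x} {checkᴺ n} e′ e)))))

    𝓝-ZF : ZFModel
    𝓝-ZF = record
      { 𝓢           = 𝓝
      ; extensional = λ {x} {y} → extensionalᴺ {x} {y}
      ; regular     = regularᴺ
      ; ⁅_,_⁆       = pairᴺ
      ; ∈-pair      = λ {x} {y} {z} → ∈-pairᴺ {x} {y} {z}
      ; ⋃           = unionᴺ
      ; ∈-⋃         = λ {x} {z} → ∈-unionᴺ {x} {z}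
      ; 𝒫           = powerᴺ
      ; ∈-𝒫         = λ {x} {z} → ∈-powerᴺ {x} {z}
      ; inf         = checkᴺ ω
      ; inf-zero    = inf-zeroᴺ
      ; inf-suc     = inf-sucᴺ
      ; separate    = separateᴺ
      ; ∈-separate  = λ φ ρ {a} {z} → ∈-separateᴺ φ ρ {a} {z}
      ; replace     = replaceᴺ
      ; ∈-replace   = λ φ ρ {a} f {y} → ∈-replaceᴺ φ ρ {a} f {y}
      }

  open ExtensionModel public

  -- Names for sets, pairs and sequences, and ω in the extension

  module ExtensionSets where
    module 𝐍 = Internal 𝓝-ZF

    private
      variable
        p q r s t u w x x′ y y′ z z′ F : U

    -- Names F × ℙ, whose value is the set of the values of the names in F

    Invariant : U → U → Set
    Invariant s F = ∀ t → t ∈ 𝒢 → Fixes t s → ∀ u → u ∈ F → act t u ∈ F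

    set-supports : (∀ u → u ∈ F → HS u) → Invariant s F → Supports s (F ×ₛ ℙ)
    set-supports hs inv t t∈ f = ⊆-antisym
      (λ w h → proj₁ ∈-act h >>= λ (u , h) → h >>= λ (q , (i , q∈) , e) →
        ∈-respˡ (≈-sym e) (op-∈-prod (inv t t∈ f u (proj₁ (op-∈-prod⁻ i))) (·-∈ℙ t∈ q∈)))
      (λ w h → proj₁ ∈-prod h >>= λ (u , h) → h >>= λ (q , u∈ , q∈ , e) →
        ∈-respˡ (≈-trans (op-cong (act-cancel t∈ u (hs u u∈)) (·-cancel q∈)) (≈-sym e))
          (proj₁ (act-edge t∈ (op-∈-prod (inv t t∈ f u u∈) (·-∈ℙ t∈ q∈) , ·-∈ℙ t∈ q∈))))

    set-HS : (∀ u → u ∈ F → HS u) → Ctbl s → Invariant s F → HS (F ×ₛ ℙ)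
    set-HS {s = s} hs c inv = HS-intro
      (λ w h → proj₁ ∈-prod h >>= λ (u , h) → h >>= λ (q , _ , q∈ , e) → ∃ᶜ-intro u (∃ᶜ-intro q (e , q∈)))
      (∃ᶜ-intro s (c , set-supports hs inv))
      (λ u q h → hs u (proj₁ (op-∈-prod⁻ h)))

    ∈ᴺ-set : (hs : HS (F ×ₛ ℙ)) (z : N) → z ∈ᴺ (F ×ₛ ℙ , hs) ⇔ (∃ᶜ[ u ] proj₁ u ∈ F × z ≈ᴺ u)
    ∈ᴺ-set {F} hs z =
      (λ h → ∈ᴺ-elim z (F ×ₛ ℙ , hs) h >>= λ (u , k) → k >>= λ (q , (i , _) , _ , e) → ∃ᶜ-intro u (proj₁ (op-∈-prod⁻ i) , e)) ,
      (λ h → h >>= λ (u , i , e) → ∈ᴺ-resp (≈ᴺ-sym e) ≈ᴺ-refl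
        (∈ᴺ-intro u (F ×ₛ ℙ , hs) (op-∈-prod i (g-∈ℙ 0) , g-∈ℙ 0) (G-g 0)))

    pair-HS : ∀ {x y u} → HS x → HS y → u ∈ ⁅ x , y ⁆ → HS u
    pair-HS hx hy i = pair-elim i (λ e → HS-resp (≈-sym e) hx) (λ e → HS-resp (≈-sym e) hy)

    pair-invariant : Supports s x → Supports s y → Invariant s ⁅ x , y ⁆
    pair-invariant sx sy t t∈ f u i = pair-elim i
      (λ e → ∈-respˡ (≈-sym (≈-trans (act-cong ≈-refl e) (sx t t∈ f))) pair-l)
      (λ e → ∈-respˡ (≈-sym (≈-trans (act-cong ≈-refl e) (sy t t∈ f))) pair-r)

    common-support : HS x → HS y → ∃ᶜ[ s ] Ctbl s × Supports s x × Supports s y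
    common-support hx hy = HS-symmetric hx >>= λ (s , c , h) → HS-symmetric hy >>= λ (s′ , c′ , h′) →
      ∃ᶜ-intro (s ∪ₛ s′) (ctbl-∪ c c′ , supports-⊆ (λ z → ∪-l) h , supports-⊆ (λ z → ∪-r) h′)

    pairN : U → U → U
    pairN x y = ⁅ x , y ⁆ ×ₛ ℙ

    pairN-HS : HS x → HS y → HS (pairN x y)
    pairN-HS hx hy = common-support hx hy >>= λ (s , c , sx , sy) →
      set-HS (λ u → pair-HS hx hy) c (pair-invariant sx sy)

    pairN-supports : HS x → HS y → Supports s x → Supports s y → Supports s (pairN x y)
    pairN-supports hx hy sx sy = set-supports (λ u → pair-HS hx hy) (pair-invariant sx sy)

    pairN-≈ : (x y : N) (h : HS (pairN (proj₁ x) (proj₁ y))) → (pairN (proj₁ x) (proj₁ y) , h) ≈ᴺ 𝐍.⁅ x , y ⁆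
    pairN-≈ x y h = extensionalᴺ λ z →
      (λ i → proj₁ (∈ᴺ-set h z) i >>= λ (u , u∈ , e) → pair-elim u∈
        (λ e′ → proj₂ 𝐍.∈-pair (∨ᶜ-inl (≈ᴺ-trans e (≈⇒≈ᴺ e′))))
        (λ e′ → proj₂ 𝐍.∈-pair (∨ᶜ-inr (≈ᴺ-trans e (≈⇒≈ᴺ e′))))) ,
      (λ i → ∨ᶜ-elim (proj₁ 𝐍.∈-pair i)
        (λ e → proj₂ (∈ᴺ-set h z) (∃ᶜ-intro x (pair-l , e)))
        (λ e → proj₂ (∈ᴺ-set h z) (∃ᶜ-intro y (pair-r , e))))

    abstract
      -- Names of ordered pairs as a term of the ground model, so that replacement there can form
      -- the name of a whole sequence.
      opnF : Tm 2
      opnF = prodT (pairT (prodT (pairT v0 v0) (con ℙ)) (prodT (pairT v0 v1) (con ℙ))) (con ℙ)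

    opn : U → U → U
    opn x y = val opnF (x ◂ y ◂ ø)

    opnT : Tm n → Tm n → Tm n
    opnT x y = opnF ⟦ x ∷ y ∷ [] ⟧ᵗ

    abstract
      opn-≈ : opn x y ≈ pairN (pairN x x) (pairN x y)
      opn-≈ = ≈-refl

    opn-HS : HS x → HS y → HS (opn x y)
    opn-HS hx hy = HS-resp (≈-sym opn-≈) (pairN-HS (pairN-HS hx hx) (pairN-HS hx hy))

    opn-supports : HS x → HS y → Supports s x → Supports s y → Supports s (opn x y)
    opn-supports hx hy sx sy t t∈ f = ≈-trans (act-cong ≈-refl opn-≈) (≈-trans
      (pairN-supports (pairN-HS hx hx) (pairN-HS hx hy) (pairN-supports hx hx sx sx) (pairN-supports hx hy sx sy) t t∈ f)
      (≈-sym opn-≈))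

    opn-≈ᴺ : (x y : N) (h : HS (opn (proj₁ x) (proj₁ y))) → (opn (proj₁ x) (proj₁ y) , h) ≈ᴺ 𝐍.‹ x , y ›
    opn-≈ᴺ x y h = ≈ᴺ-trans (≈⇒≈ᴺ {y = _ , pairN-HS h₁ h₂} opn-≈) (≈ᴺ-trans (pairN-≈ (_ , h₁) (_ , h₂) (pairN-HS h₁ h₂))
      (≈ᴺ-trans (𝐍.Tm-cong (𝐍.pairT 𝐍.v0 𝐍.v1) {(_ , h₁) ◂ (_ , h₂) ◂ ø} {𝐍.⁅ x , x ⁆ ◂ 𝐍.⁅ x , y ⁆ ◂ ø}
        (𝐍.◂-≋ (pairN-≈ x x h₁) (𝐍.◂-≋ (pairN-≈ x y h₂) λ ()))) (≈ᴺ-sym 𝐍.op-≈)))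
      where
      h₁ : HS (pairN (proj₁ x) (proj₁ x))
      h₁ = pairN-HS (proj₂ x) (proj₂ x)
      h₂ : HS (pairN (proj₁ x) (proj₁ y))
      h₂ = pairN-HS (proj₂ x) (proj₂ y)

    -- Canonical names and ω

    check-injective : ∀ x p y → Eq p (check x) (check y) → x ≈ y
    check-injective = ∈-induction (∀ᵖ ∀ᵖ (EqP ⟦ v1 ∷ checkT v2 ∷ checkT v0 ∷ [] ⟧ ⇒ᵖ v2 ≈ᵖ v0)) λ x ih p y h →
      let p∈ = Eq-∈ℙ h in ⊆-antisym
      (λ z z∈ → Eq-half h (check z) p (check-edge z∈ p∈) p (≤-refl p∈) (≤-refl p∈) >>= λ (s , k) → k >>= λ (w , k) →
        k >>= λ (q , _ , (e , _) , _ , eq) → proj₁ ∈-check e >>= λ (z′ , k) → k >>= λ (_ , z′∈ , _ , e′) →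
        ∈-respˡ (≈-sym (ih z z∈ s z′ (Eq-resp ≈-refl ≈-refl (proj₁ (op-inj e′)) eq))) z′∈)
      (λ z z∈ → Eq-half (Eq-sym h) (check z) p (check-edge z∈ p∈) p (≤-refl p∈) (≤-refl p∈) >>= λ (s , k) → k >>= λ (w , k) →
        k >>= λ (q , _ , (e , _) , _ , eq) → proj₁ ∈-check e >>= λ (z′ , k) → k >>= λ (_ , z′∈ , _ , e′) →
        ∈-respˡ (ih z′ z′∈ s z (Eq-sym (Eq-resp ≈-refl ≈-refl (proj₁ (op-inj e′)) eq))) z′∈)

    checkᴺ-injective : checkᴺ x ≈ᴺ checkᴺ y → x ≈ y
    checkᴺ-injective {x} {y} h = ≈-forcing h >>= λ (p , _ , e) → check-injective x p y e

    checkᴺ-∅ : checkᴺ ∅ ≈ᴺ 𝐍.∅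
    checkᴺ-∅ = 𝐍.empty-≈ λ z h → proj₁ (∈ᴺ-check z ∅) h λ y (i , _) → ∉∅ i

    checkᴺ-succ : ∀ n → checkᴺ (succ n) ≈ᴺ 𝐍.succ (checkᴺ n)
    checkᴺ-succ n = extensionalᴺ λ z → (λ h → proj₂ 𝐍.∈-succ (proj₁ (check-succ n z) h)) , (λ h → proj₂ (check-succ n z) (proj₁ 𝐍.∈-succ h))

    ω-cases : ∀ n → n ∈ ω → n ≈ ∅ ∨ᶜ (∃ᶜ[ m ] m ∈ ω × n ≈ succ m)
    ω-cases = ω-induction (v0 ≈ᵖ con ∅ ∨ᵖ (∃ᵖ (v0 ∈ᵖ con ω ∧ᵖ v1 ≈ᵖ sucT v0))) (∨ᶜ-inl ≈-refl)
      λ n i _ → ∨ᶜ-inr (∃ᶜ-intro n (i , ≈-refl))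

    check-ω : checkᴺ x ∈ᴺ checkᴺ ω ⇔ x ∈ ω
    check-ω {x} = (λ h → proj₁ (∈ᴺ-check (checkᴺ x) ω) h >>= λ (y , i , e) → ∈-respˡ (≈-sym (checkᴺ-injective e)) i) ,
                  (λ i → proj₂ (∈ᴺ-check (checkᴺ x) ω) (∃ᶜ-intro x (i , ≈ᴺ-refl)))

    MissingP : 𝐍.Pr 1
    MissingP = 𝐍.v0 𝐍.∉ᵖ 𝐍.con 𝐍.ω

    ω⊆checkᴺω : 𝐍.ω 𝐍.⊆ checkᴺ ω
    ω⊆checkᴺω = 𝐍.ω-least 𝐍.inf-inductive

    -- Foundation in the extension gives a minimal element outside ω. It is named by zero or by a
    -- successor, and in the latter case minimality puts the predecessor into ω.
    checkᴺω⊆ω : checkᴺ ω 𝐍.⊆ 𝐍.ω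
    checkᴺω⊆ω z i = dne λ z∉ → 𝐍.regular missing (∃ᶜ-intro z (proj₂ ∈-missing (i , z∉))) λ y (j , min) →
      let y∈ , y∉ = proj₁ ∈-missing j in proj₁ (∈ᴺ-check y ω) y∈ λ n (n∈ , e) → y∉ (∨ᶜ-elim (ω-cases n n∈)
        (λ e′ → 𝐍.∈-respˡ (≈ᴺ-sym (≈ᴺ-trans e (≈ᴺ-trans (≈⇒≈ᴺ (check-cong e′)) checkᴺ-∅))) 𝐍.ω-zero)
        (λ h → h >>= λ (m , m∈ , e′) → 𝐍.∈-respˡ (≈ᴺ-sym (≈ᴺ-trans e (≈ᴺ-trans (≈⇒≈ᴺ (check-cong e′)) (checkᴺ-succ m))))
          (𝐍.ω-suc (dne λ m∉ → min (checkᴺ m)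
            (𝐍.∈-respʳ (≈ᴺ-sym e) (proj₂ (∈ᴺ-check (checkᴺ m) n) (∃ᶜ-intro m (∈-respʳ (≈-sym e′) succ-self , ≈ᴺ-refl))))
            (proj₂ ∈-missing (proj₂ check-ω m∈ , m∉))))))
      where
      missing : N
      missing = 𝐍.sep (checkᴺ ω) MissingP
      ∈-missing : ∀ {z} → z ∈ᴺ missing ⇔ (z ∈ᴺ checkᴺ ω × ¬ z ∈ᴺ 𝐍.ω)
      ∈-missing = 𝐍.∈-sepᵉ MissingP ø

    ω-elim : (z : N) → z ∈ᴺ 𝐍.ω → ∃ᶜ[ n ] n ∈ ω × z ≈ᴺ checkᴺ n
    ω-elim z h = proj₁ (∈ᴺ-check z ω) (ω⊆checkᴺω z h)

    ω-intro : x ∈ ω → checkᴺ x ∈ᴺ 𝐍.ω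
    ω-intro i = checkᴺω⊆ω _ (proj₂ check-ω i)

    -- Sequences of names with a common support

    module Sequence (τ : Tm 1) (s : U) (ctbl-s : Ctbl s)
      (hs : ∀ n → n ∈ ω → HS (val τ (n ◂ ø))) (supp : ∀ n → n ∈ ω → Supports s (val τ (n ◂ ø))) where

      termT : Tm 1
      termT = opnT (checkT v0) τ

      graphU : U
      graphU = img ω termT

      term : ∀ n → n ∈ ω → N
      term n i = val τ (n ◂ ø) , hs n i

      entry : ∀ n → n ∈ ω → N
      entry n i = opn (check n) (val τ (n ◂ ø)) , opn-HS (HS-check n) (hs n i)

      entry-≈ : ∀ n (i : n ∈ ω) → entry n i ≈ᴺ 𝐍.‹ checkᴺ n , term n i ›
      entry-≈ n i = opn-≈ᴺ (checkᴺ n) (term n i) (opn-HS (HS-check n) (hs n i))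

      graph-elim : u ∈ graphU → ∃ᶜ[ n ] n ∈ ω × u ≈ opn (check n) (val τ (n ◂ ø))
      graph-elim = proj₁ (∈-imgᵉ termT ø)

      graph-HS : HS (graphU ×ₛ ℙ)
      graph-HS = set-HS (λ u h → graph-elim h >>= λ (n , i , e) → HS-resp (≈-sym e) (opn-HS (HS-check n) (hs n i))) ctbl-s
        λ t t∈ f u h → graph-elim h >>= λ (n , i , e) → ∈-respˡ (≈-sym (≈-trans (act-cong ≈-refl e)
          (opn-supports (HS-check n) (hs n i) (λ t t∈ _ → act-check t∈ n) (supp n i) t t∈ f))) (img-intro termT i)

      abstract
        seqᴺ : N
        seqᴺ = graphU ×ₛ ℙ , graph-HS

        seq-intro : ∀ n (i : n ∈ ω) → 𝐍.‹ checkᴺ n , term n i › ∈ᴺ seqᴺ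
        seq-intro n i = proj₂ (∈ᴺ-set graph-HS _) (∃ᶜ-intro (entry n i) (img-intro termT i , ≈ᴺ-sym (entry-≈ n i)))

        seq-elim : ∀ z → z ∈ᴺ seqᴺ → ∃ᶜ[ n ] Σ (n ∈ ω) λ i → z ≈ᴺ 𝐍.‹ checkᴺ n , term n i ›
        seq-elim z h = proj₁ (∈ᴺ-set graph-HS z) h >>= λ (u , u∈ , e) → graph-elim u∈ >>= λ (n , i , e′) →
          ∃ᶜ-intro n (i , ≈ᴺ-trans e (≈ᴺ-trans (≈⇒≈ᴺ e′) (entry-≈ n i)))

      term-cong : ∀ n m (i : n ∈ ω) (j : m ∈ ω) → n ≈ m → term n i ≈ᴺ term m j
      term-cong n m i j e = ≈⇒≈ᴺ (Tm-cong τ {n ◂ ø} {m ◂ ø} (◂-≋ e λ ()))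

      seq-at : ∀ n (i : n ∈ ω) y → 𝐍.‹ checkᴺ n , y › ∈ᴺ seqᴺ → y ≈ᴺ term n i
      seq-at n i y h = seq-elim _ h >>= λ (m , j , e) → let e₁ , e₂ = 𝐍.op-inj e in
        ≈ᴺ-trans e₂ (term-cong m n j i (≈-sym (checkᴺ-injective e₁)))

      seq-functional : 𝐍.Functional seqᴺ
      seq-functional x y z h h′ = seq-elim _ h >>= λ (n , i , e) → let e₁ , e₂ = 𝐍.op-inj e in
        ≈ᴺ-trans e₂ (≈ᴺ-sym (seq-at n i z (𝐍.∈-respˡ (𝐍.op-cong e₁ ≈ᴺ-refl) h′)))

      seq-function : 𝐍.FunctionOn seqᴺ 𝐍.ω
      seq-function =
        (λ w h → seq-elim w h >>= λ (n , i , e) → ∃ᶜ-intro (checkᴺ n) (ω-intro i , ∃ᶜ-intro (term n i) e)) ,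
        (λ x h → ω-elim x h >>= λ (n , i , e) → ∃ᶜ-intro (term n i) (𝐍.∈-respˡ (𝐍.op-cong (≈ᴺ-sym e) ≈ᴺ-refl) (seq-intro n i))) ,
        seq-functional

  open ExtensionSets public

  -- Dependent choice in the extension

  module DependentChoice where

    private
      variable
        p q s t u w x x′ y y′ z z′ : U

    forces-Eq : (φ : Formula n) {ρ σ : Env n} → p ∈ ℙ → (∀ i → Eq p (ρ i) (σ i)) → forces p φ ρ → forces p φ σ
    forces-Eq (x ∈′ y) p∈ e h = Mem-respˡ (e x) (Mem-respʳ (e y) h)
    forces-Eq (x ≐ y)  p∈ e h = Eq-trans (Eq-sym (e x)) (Eq-trans h (e y))
    forces-Eq ⊥′       p∈ e h = h
    forces-Eq (φ ⇒′ ψ) p∈ e h q i f = forces-Eq ψ (≤-l i) (λ j → Eq-mono i (e j))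
      (h q i (forces-Eq φ (≤-l i) (λ j → Eq-sym (Eq-mono i (e j))) f))
    forces-Eq (∀′ φ) {ρ} {σ} p∈ e h x hx = forces-Eq φ {x ◂ ρ} {x ◂ σ} p∈ (λ { zero → Eq-refl p∈ ; (suc j) → e j }) (h x hx)

    forces-∃ : (φ : Formula (suc n)) {ρ : Env n} → p ∈ ℙ → forces p (∃′ φ) ρ → ∃ᶜ[ q ] ∃ᶜ[ x ] q ≤ p × HS x × forces q φ (x ◂ ρ)
    forces-∃ {p = p} φ p∈ h k = h p (≤-refl p∈) λ x hx q i f → k q λ c → c x (i , hx , f)

    forces-∧ : (φ ψ : Formula n) {ρ : Env n} → p ∈ ℙ → forces p (φ ∧′ ψ) ρ → ∃ᶜ[ q ] q ≤ p × forces q φ ρ × forces q ψ ρ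
    forces-∧ {p = p} φ ψ p∈ h k = h p (≤-refl p∈) λ q i f s j f′ → k s (≤-trans j i , forces-mono φ j f , f′)

    relatedφ : Formula 3
    relatedφ = ⟨ 0F , 1F ⟩∈′ 2F

    totalφ : Formula 2
    totalφ = ∀′∈[ 0F ] ∃′∈[ 1F ] ⟨ 1F , 0F ⟩∈′ 3F

    module _ (a r : N) where

      Related : U → U → U → Set
      Related q u w = forces q relatedφ (u ◂ w ◂ proj₁ r ◂ ø)
      RelatedP : Tm n → Tm n → Tm n → Pr n
      RelatedP q u w = forcesP relatedφ q (u ∷ w ∷ []) (proj₁ r ◂ ø)

      related-resp : p ≈ q → u ≈ x → w ≈ y → Related p u w → Related q x y
      related-resp {p} {q} {u} {x} {w} {y} e e′ e″ = forces-resp relatedφ {u ◂ w ◂ proj₁ r ◂ ø} {x ◂ y ◂ proj₁ r ◂ ø} e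
        (◂-≋ e′ (◂-≋ e″ λ _ → ≈-refl))

      related-mono : q ≤ p → Related p u w → Related q u w
      related-mono {u = u} {w} = forces-mono relatedφ {u ◂ w ◂ proj₁ r ◂ ø}

      names-totalφ : names (a ◂ r ◂ ø) ≋ proj₁ a ◂ proj₁ r ◂ ø
      names-totalφ zero       = ≈-refl
      names-totalφ (suc zero) = ≈-refl

      -- The witness of totality is replaced by an equal child of the name of `a`, which confines
      -- the construction to a set.
      successor : forces p totalφ (proj₁ a ◂ proj₁ r ◂ ø) → q ≤ p → HS u → Mem q u (proj₁ a) →
        ∃ᶜ[ q′ ] ∃ᶜ[ w ] q′ ≤ q × w ∈ trcl (proj₁ a) × HS w × Mem q′ w (proj₁ a) × Related q′ u w
      successor {u = u} f i hu m = forces-∃ ψ {u ◂ proj₁ a ◂ proj₁ r ◂ ø} (≤-l i) (f u hu _ i m) >>= λ (q₁ , k) → k >>= λ (w , i₁ , hw , f₁) →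
        forces-∧ (0F ∈′ 2F) (⟨ 1F , 0F ⟩∈′ 3F) {w ◂ u ◂ proj₁ a ◂ proj₁ r ◂ ø} (≤-l i₁) f₁ >>= λ (q₂ , i₂ , m₂ , f₂) →
        proj₂ (Mem-elim m₂) q₂ (≤-refl (≤-l i₂)) >>= λ (q₃ , k) → k >>= λ (w′ , k) → k >>= λ (q′ , i₃ , e , i₄ , eq) →
        ∃ᶜ-intro q₃ (∃ᶜ-intro w′ (≤-trans i₃ (≤-trans i₂ i₁) , child-∈tc self-∈tc e , HS-child (proj₂ a) (proj₁ e) ,
          Mem-edge e i₄ , related {q₂} {q₃} {w} {w′} f₂ i₃ eq))
        where
        ψ : Formula 4
        ψ = 0F ∈′ 2F ∧′ ⟨ 1F , 0F ⟩∈′ 3F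
        related : ∀ {q₂ q₃ w w′} → forces q₂ (⟨ 1F , 0F ⟩∈′ 3F) (w ◂ u ◂ proj₁ a ◂ proj₁ r ◂ ø) → q₃ ≤ q₂ → Eq q₃ w w′ → Related q₃ u w′
        related {q₂} {q₃} {w} {w′} f i e = forces-Eq relatedφ {u ◂ w ◂ proj₁ r ◂ ø} {u ◂ w′ ◂ proj₁ r ◂ ø} (≤-l i)
          (λ { zero → Eq-refl (≤-l i) ; (suc zero) → e ; (suc (suc zero)) → Eq-refl (≤-l i) })
          (reindex (forces-mono (⟨ 1F , 0F ⟩∈′ 3F) {w ◂ u ◂ proj₁ a ◂ proj₁ r ◂ ø} i f))
          where
          reindex : forces q₃ (⟨ 1F , 0F ⟩∈′ 3F) (w ◂ u ◂ proj₁ a ◂ proj₁ r ◂ ø) → Related q₃ u w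
          reindex f = f

      -- A state is a condition, an element of a and a support of that element.
      StateP : U → Pr 1
      StateP p = LeP ⟦ fstT v0 ∷ con p ∷ [] ⟧ ∧ᵖ HSP ⟦ fstT (sndT v0) ∷ [] ⟧ ∧ᵖ CtblP ⟦ sndT (sndT v0) ∷ [] ⟧ ∧ᵖ
        SupportsP (sndT (sndT v0)) (fstT (sndT v0)) ∧ᵖ MemP ⟦ fstT v0 ∷ fstT (sndT v0) ∷ con (proj₁ a) ∷ [] ⟧

      -- Supports are recorded in the states so that they are chosen together with the elements;
      -- their countable union then supports the whole sequence.
      State : U → U → Set
      State p z = fst z ≤ p × HS (fst (snd z)) × Ctbl (snd (snd z)) × Supports (snd (snd z)) (fst (snd z)) ×
                  Mem (fst z) (fst (snd z)) (proj₁ a)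

      abstract
        states : U → U
        states p = sep (ℙ ×ₛ (trcl (proj₁ a) ×ₛ 𝒫 I)) (StateP p)

        states-elim : z ∈ states p → State p z
        states-elim {p = p} h = proj₂ (proj₁ (∈-sepᵉ (StateP p) ø) h)

        states-intro : z ∈ ℙ ×ₛ (trcl (proj₁ a) ×ₛ 𝒫 I) → State p z → z ∈ states p
        states-intro {p = p} i h = proj₂ (∈-sepᵉ (StateP p) ø) (i , h)

      InIP : Pr 1
      InIP = v0 ∈ᵖ con I

      -- Shifts only have points in rows from `I`, so a support may be cut down to `I`; this makes
      -- the possible supports a set.
      support-in-I : HS u → ∃ᶜ[ s ] s ∈ 𝒫 I × Ctbl s × Supports s u
      support-in-I h = HS-symmetric h >>= λ (s , c , supp) → ∃ᶜ-intro (sep s InIP)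
        (proj₂ ∈-𝒫 (λ z i → proj₂ (proj₁ (∈-sepᵉ InIP ø) i)) , ctbl-⊆ (λ z i → proj₁ (proj₁ (∈-sepᵉ InIP ø) i)) c ,
         λ t t∈ f → supp t t∈ λ i j i∈ k → f i j (proj₂ (∈-sepᵉ InIP ø) (i∈ , proj₁ (op-∈-prod⁻ (proj₁ ∈-𝒫 t∈ _ k)))) k)

      state-mk : q ≤ p → u ∈ trcl (proj₁ a) → HS u → Mem q u (proj₁ a) →
        ∃ᶜ[ z ] z ∈ states p × fst z ≈ q × fst (snd z) ≈ u
      state-mk {q} {p} {u} i u∈ hu m = support-in-I hu >>= λ (s , s∈ , c , supp) →
        let e₁ = fst-op {q} {‹ u , s ›} ; e₂ = ≈-trans (fst-cong (snd-op {q})) (fst-op {u} {s}) ; e₃ = ≈-trans (snd-cong (snd-op {q})) (snd-op {u} {s}) in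
        ∃ᶜ-intro ‹ q , ‹ u , s › › (states-intro (op-∈-prod (≤-l i) (op-∈-prod u∈ s∈))
          (≤-resp (≈-sym e₁) ≈-refl i , HS-resp (≈-sym e₂) hu , ctbl-⊆ (≈-⊆ e₃) c ,
           (λ t t∈ f → ≈-trans (act-cong ≈-refl e₂) (≈-trans (supp t t∈ λ i j i∈ → f i j (∈-respʳ (≈-sym e₃) i∈)) (≈-sym e₂))) ,
           Mem-resp (≈-sym e₁) (≈-sym e₂) ≈-refl m) , e₁ , e₂)

      NextP : U → Pr 2
      NextP p = LeP ⟦ fstT v0 ∷ fstT v1 ∷ [] ⟧ ∧ᵖ RelatedP (fstT v0) (fstT (sndT v1)) (fstT (sndT v0))

      Next : U → U → Set
      Next z z′ = fst z′ ≤ fst z × Related (fst z′) (fst (snd z)) (fst (snd z′))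

      -- A descending sequence of conditions deciding the elements of a sequence in a.
      record Run (p : U) : Set where
        field
          state   : Tm 1
          state-∈ : ∀ n → n ∈ ω → val state (n ◂ ø) ∈ states p
          next    : ∀ n → n ∈ ω → Next (val state (n ◂ ø)) (val state (succ n ◂ ø))

      module _ (p z₀ : U) (z₀∈ : z₀ ∈ states p) (f : forces p totalφ (proj₁ a ◂ proj₁ r ◂ ø)) where

        abstract
          nextsT : Tm 1
          nextsT = sepT (con (states p)) (NextP p)

        nexts : U → U
        nexts z = val nextsT (z ◂ ø)

        abstract
          ∈-nexts : z′ ∈ nexts z ⇔ (z′ ∈ states p × Next z z′)
          ∈-nexts {z = z} = ∈-sepᵉ (NextP p) (z ◂ ø)

        nexts-nonempty : ∀ z → z ∈ states p → ∃ᶜ[ z′ ] z′ ∈ nexts z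
        nexts-nonempty z i = let l , hu , _ , _ , m = states-elim i in
          successor f l hu m >>= λ (q′ , k) → k >>= λ (w , l′ , w∈ , hw , m′ , rel) →
          state-mk (≤-trans l′ l) w∈ hw m′ >>= λ (z′ , z′∈ , e₁ , e₂) → ∃ᶜ-intro z′ (proj₂ ∈-nexts (z′∈ , ≤-resp (≈-sym e₁) ≈-refl l′ ,
            related-resp (≈-sym e₁) ≈-refl (≈-sym e₂) rel))

        -- Choice in the ground model is applied here, to the sets of admissible next states.
        family : U
        family = img (states p) nextsT

        family-nonempty : ∀ x → x ∈ family → ∃ᶜ[ y ] y ∈ x
        family-nonempty x h = proj₁ (∈-imgᵉ nextsT ø) h >>= λ (z , i , e) → nexts-nonempty z i >>= λ (z′ , j) →
          ∃ᶜ-intro z′ (∈-respʳ (≈-sym e) j)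

        ChosenP : U → Pr 1
        ChosenP c = opT (nextsT ⟦ fstT v0 ∷ [] ⟧ᵗ) (sndT v0) ∈ᵖ con c

        module _ (c : U) (functional-c : Functional c) (total-c : ∀ x → x ∈ family → ∃ᶜ[ y ] ‹ x , y › ∈ c)
                 (choice-c : ∀ x y → ‹ x , y › ∈ c → y ∈ x) where

          abstract
            chosen : U
            chosen = sep (states p ×ₛ states p) (ChosenP c)

            ∈-chosen : ‹ z , z′ › ∈ chosen ⇔ (z ∈ states p × z′ ∈ states p × ‹ nexts z , z′ › ∈ c)
            ∈-chosen =
              (λ h → let i , k = proj₁ (∈-sepᵉ (ChosenP c) ø) h ; j , j′ = op-∈-prod⁻ i in
                j , j′ , ∈-respˡ (op-cong (Tm-cong nextsT (◂-≋ fst-op λ ())) snd-op) k) ,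
              (λ (j , j′ , k) → proj₂ (∈-sepᵉ (ChosenP c) ø) (op-∈-prod j j′ ,
                ∈-respˡ (op-cong (Tm-cong nextsT (◂-≋ (≈-sym fst-op) λ ())) (≈-sym snd-op)) k))

            chosen-relational : Relational chosen
            chosen-relational w h = proj₁ ∈-prod (proj₁ (proj₁ (∈-sepᵉ (ChosenP c) ø) h)) >>= λ (x , k) → k >>= λ (y , _ , _ , e) →
              ∃ᶜ-intro x (∃ᶜ-intro y e)

          chosen-functional : Functional chosen
          chosen-functional x y z h h′ = functional-c _ y z (proj₂ (proj₂ (proj₁ ∈-chosen h))) (proj₂ (proj₂ (proj₁ ∈-chosen h′)))

          chosen-total : ∀ z → z ∈ states p → ∃ᶜ[ z′ ] ‹ z , z′ › ∈ chosen
          chosen-total z i = total-c (nexts z) (img-intro nextsT i) >>= λ (z′ , k) →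
            ∃ᶜ-intro z′ (proj₂ ∈-chosen (i , proj₁ (proj₁ ∈-nexts (choice-c _ _ k)) , k))

          stateT : Tm 1
          stateT = Iter.recT ⟦ v0 ∷ con ‹ z₀ , chosen › ∷ [] ⟧ᵗ

          at : U → U
          at n = iter ‹ z₀ , chosen › n

          at-suc : ∀ n {z′} → ‹ at n , z′ › ∈ chosen → at (succ n) ≈ z′
          at-suc n k = ≈-trans (iter-suc _) (≈-trans ($-cong snd-op ≈-refl) ($-≈ chosen-relational chosen-functional k))

          at-∈ : ∀ n → n ∈ ω → at n ∈ states p
          at-∈ = ω-induction (stateT ∈ᵖ con (states p)) (∈-respˡ (≈-sym (≈-trans (iter-zero _) fst-op)) z₀∈)
            λ n _ i → chosen-total (at n) i >>= λ (z′ , k) → ∈-respˡ (≈-sym (at-suc n k)) (proj₁ (proj₂ (proj₁ ∈-chosen k)))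

          at-next : ∀ n → n ∈ ω → at (succ n) ∈ nexts (at n)
          at-next n i = chosen-total (at n) (at-∈ n i) >>= λ (z′ , k) →
            ∈-respˡ (≈-sym (at-suc n k)) (choice-c _ _ (proj₂ (proj₂ (proj₁ ∈-chosen k))))

          run : Run p
          run = record { state = stateT ; state-∈ = at-∈ ; next = λ n i → proj₂ (proj₁ ∈-nexts (at-next n i)) }

      RunAtP : Pr 4
      RunAtP = HSP ⟦ applyF ⟦ v2 ∷ v0 ∷ [] ⟧ᵗ ∷ [] ⟧ ∧ᵖ SupportsP v1 (applyF ⟦ v2 ∷ v0 ∷ [] ⟧ᵗ) ∧ᵖ
        MemP ⟦ v3 ∷ applyF ⟦ v2 ∷ v0 ∷ [] ⟧ᵗ ∷ con (proj₁ a) ∷ [] ⟧ ∧ᵖ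
        RelatedP v3 (applyF ⟦ v2 ∷ v0 ∷ [] ⟧ᵗ) (applyF ⟦ v2 ∷ sucT v0 ∷ [] ⟧ᵗ)

      RunAt : U → U → U → U → Set
      RunAt n s b q = HS (b $ₛ n) × Supports s (b $ₛ n) × Mem q (b $ₛ n) (proj₁ a) × Related q (b $ₛ n) (b $ₛ succ n)

      GoodP : Pr 1
      GoodP = ∃ᵖ ∃ᵖ (CtblP ⟦ v0 ∷ [] ⟧ ∧ᵖ (∀ᵖ (v0 ∈ᵖ con ω ⇒ᵖ RunAtP ⟦ v0 ∷ v1 ∷ v2 ∷ v3 ∷ [] ⟧)))

      -- One condition that decides an entire sequence of names with a common countable support.
      Good : U → Set
      Good q = ∃ᶜ[ b ] ∃ᶜ[ s ] Ctbl s × (∀ n → n ∈ ω → RunAt n s b q)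

      good-intro : ∀ b s → Ctbl s → (∀ n → n ∈ ω → RunAt n s b q) → Good q
      good-intro b s c h = ∃ᶜ-intro b (∃ᶜ-intro s (c , h))

      below-intro : ∀ q → q ≤ p → Good q → ∃ᶜ[ q ] q ≤ p × Good q
      below-intro q i h = ∃ᶜ-intro q (i , h)

      module _ {p : U} (ru : Run p) where
        open Run ru

        condT elemT suppT : Tm 1
        condT = fstT state
        elemT = fstT (sndT state)
        suppT = sndT (sndT state)

        at-state : U → U
        at-state n = val state (n ◂ ø)

        open Descending condT (≤-l (proj₁ (states-elim (state-∈ ∅ ω-zero)))) (λ n i → proj₁ (next n i))
          using (limit; limit-≤; limit-∈ℙ)

        elems supps : U
        elems = img ω (opT v0 elemT)
        supps = ⋃ (img ω suppT)

        ∈-elems : w ∈ elems ⇔ (∃ᶜ[ n ] n ∈ ω × w ≈ ‹ n , fst (snd (at-state n)) ›)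
        ∈-elems = ∈-imgᵉ (opT v0 elemT) ø

        elem-cong : x ≈ y → fst (snd (at-state x)) ≈ fst (snd (at-state y))
        elem-cong {x} {y} e = Tm-cong elemT {x ◂ ø} {y ◂ ø} (◂-≋ e λ ())

        elems-value : ‹ x , y › ∈ elems → y ≈ fst (snd (at-state x))
        elems-value h = proj₁ ∈-elems h >>= λ (n , _ , e) → let e₁ , e₂ = op-inj e in ≈-trans e₂ (elem-cong (≈-sym e₁))

        elems-$ : ∀ n → n ∈ ω → elems $ₛ n ≈ fst (snd (at-state n))
        elems-$ n i = $-≈
          (λ w h → proj₁ ∈-elems h >>= λ (n , _ , e) → ∃ᶜ-intro n (∃ᶜ-intro _ e))
          (λ x y z h h′ → ≈-trans (elems-value h) (≈-sym (elems-value h′)))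
          (proj₂ ∈-elems (∃ᶜ-intro n (i , ≈-refl)))

        ctbl-supps : Ctbl supps
        ctbl-supps = ctbl-⋃ (ctbl-img-ω suppT) λ y h → proj₁ (∈-imgᵉ suppT ø) h >>= λ (n , i , e) →
          ctbl-⊆ (≈-⊆ e) (proj₁ (proj₂ (proj₂ (states-elim (state-∈ n i)))))

        run-at : ∀ n → n ∈ ω → RunAt n supps elems limit
        run-at n i = let _ , hu , _ , supp , m = states-elim (state-∈ n i) ; _ , rel = next n i ; e = ≈-sym (elems-$ n i) in
          HS-resp e hu ,
          (λ t t∈ f → ≈-trans (act-cong ≈-refl (≈-sym e)) (≈-trans (supp t t∈ λ a b j → f a b (⋃-intro (img-intro suppT i) j)) e)) ,
          Mem-resp ≈-refl e ≈-refl (Mem-mono (limit-≤ n i) m) ,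
          related-resp ≈-refl e (≈-sym (elems-$ (succ n) (ω-suc i))) (related-mono (limit-≤ (succ n) (ω-suc i)) rel)

        good-limit : Good limit
        good-limit = good-intro elems supps ctbl-supps run-at

        run-limit : ∃ᶜ[ q ] q ≤ p × Good q
        run-limit = below-intro limit (≤-trans (limit-≤ ∅ ω-zero) (proj₁ (states-elim (state-∈ ∅ ω-zero)))) good-limit

      -- A run is started below the given condition, and the lower bound of its conditions is good;
      -- so the generic filter contains a good condition.
      good-dense : forces p totalφ (proj₁ a ◂ proj₁ r ◂ ø) → u ∈ trcl (proj₁ a) → HS u → Mem p u (proj₁ a) →
        ∀ q → q ≤ p → ∃ᶜ[ q′ ] q′ ≤ q × Good q′
      good-dense f u∈ hu m q i = state-mk (≤-refl (≤-l i)) u∈ hu (Mem-mono i m) >>= λ (z₀ , z₀∈ , _) →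
        choice (family q z₀ z₀∈ f′) (family-nonempty q z₀ z₀∈ f′) >>= λ (c , (_ , tot , fun) , ch) →
        run-limit (run q z₀ z₀∈ f′ c fun tot ch)
        where
        f′ : forces q totalφ (proj₁ a ◂ proj₁ r ◂ ø)
        f′ = forces-mono totalφ {proj₁ a ◂ proj₁ r ◂ ø} i f

      module _ {q : U} (Gq : G q) (b s : U) (ctbl-s : Ctbl s) (good : ∀ n → n ∈ ω → RunAt n s b q) where
        open Sequence (applyF ⟦ con b ∷ v0 ∷ [] ⟧ᵗ) s ctbl-s (λ n i → proj₁ (good n i)) (λ n i → proj₁ (proj₂ (good n i)))

        seq-map : 𝐍.Map seqᴺ 𝐍.ω a
        seq-map = seq-function , λ x y h → seq-elim _ h >>= λ (n , i , e) →
          𝐍.∈-respˡ (≈ᴺ-sym (proj₂ (𝐍.op-inj e))) (∈-forced (∃ᶜ-intro q (Gq , proj₁ (proj₂ (proj₂ (good n i))))))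

        seq-related : ∀ n (i : n ∈ ω) → 𝐍.‹ term n i , term (succ n) (ω-suc i) › ∈ᴺ r
        seq-related n i = 𝐍.given relatedφ (term n i ◂ term (succ n) (ω-suc i) ◂ r ◂ ø) (𝐍.m⟨⟩∈ 0F 1F 2F) (truth-lemma⁻ relatedφ (term n i ◂ term (succ n) (ω-suc i) ◂ r ◂ ø)
          (∃ᶜ-intro q (Gq , forces-resp relatedφ {(b $ₛ n) ◂ (b $ₛ succ n) ◂ proj₁ r ◂ ø} {names (term n i ◂ term (succ n) (ω-suc i) ◂ r ◂ ø)}
            ≈-refl (λ { zero → ≈-refl ; (suc zero) → ≈-refl ; (suc (suc zero)) → ≈-refl }) (proj₂ (proj₂ (proj₂ (good n i)))))))

        seq-step : ∀ k k′ x y → k′ ≈ᴺ 𝐍.succ k → 𝐍.‹ k , x › ∈ᴺ seqᴺ → 𝐍.‹ k′ , y › ∈ᴺ seqᴺ → 𝐍.‹ x , y › ∈ᴺ r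
        seq-step k k′ x y e h h′ = seq-elim _ h >>= λ (n , i , e₁) → let ek , ex = 𝐍.op-inj e₁ in
          𝐍.∈-respˡ (𝐍.op-cong (≈ᴺ-sym ex) (≈ᴺ-sym (seq-at (succ n) (ω-suc i) y
            (𝐍.∈-respˡ (𝐍.op-cong (≈ᴺ-trans e (≈ᴺ-trans (𝐍.succ-cong ek) (≈ᴺ-sym (checkᴺ-succ n)))) ≈ᴺ-refl) h′)))) (seq-related n i)

        choice-sequence : ∃ᶜ[ f ] 𝐍.Map f 𝐍.ω a × (∀ k k′ x y → k′ ≈ᴺ 𝐍.succ k → 𝐍.‹ k , x › ∈ᴺ f → 𝐍.‹ k′ , y › ∈ᴺ f → 𝐍.‹ x , y › ∈ᴺ r)
        choice-sequence = ∃ᶜ-intro seqᴺ (seq-map , seq-step)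

      dependent-choice : (∃ᶜ[ x ] x ∈ᴺ a) → (∀ x → x ∈ᴺ a → ∃ᶜ[ y ] y ∈ᴺ a × 𝐍.‹ x , y › ∈ᴺ r) →
        ∃ᶜ[ f ] 𝐍.Map f 𝐍.ω a × (∀ k k′ x y → k′ ≈ᴺ 𝐍.succ k → 𝐍.‹ k , x › ∈ᴺ f → 𝐍.‹ k′ , y › ∈ᴺ f → 𝐍.‹ x , y › ∈ᴺ r)
      dependent-choice ne tot = ne >>= λ (x , i) → ∈ᴺ-elim x a i >>= λ (u , k) → k >>= λ (q , e , Gq , _) →
        truth-lemma totalφ (a ◂ r ◂ ø) (𝐍.holds totalφ (a ◂ r ◂ ø) (𝐍.m∀∈ λ x → 𝐍.m∃∈ λ y → 𝐍.m⟨⟩∈ 1F 0F 3F) tot) >>= λ (p , Gp , f) →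
        G-directed Gp Gq >>= λ (p′ , Gp′ , i , j) →
        generic GoodP p′ Gp′ (good-dense (forces-mono totalφ {proj₁ a ◂ proj₁ r ◂ ø} i (forces-resp totalφ {names (a ◂ r ◂ ø)} {proj₁ a ◂ proj₁ r ◂ ø} ≈-refl names-totalφ f))
          (child-∈tc self-∈tc e) (proj₂ u) (Mem-edge e j)) >>= λ (q′ , Gq′ , _ , good) →
        good >>= λ (b , k) → k >>= λ (s , c , h) → choice-sequence Gq′ b s c h

    sat-DC : ∀ ρ → 𝐍.sat DC ρ
    sat-DC ρ = 𝐍.holds DC ρ
      (𝐍.m∀ λ a → 𝐍.m∀ λ r → 𝐍.m⇒ (𝐍.m∧ (𝐍.m∃ λ x → 𝐍.m∈) (𝐍.m∀∈ λ x → 𝐍.m∃∈ λ y → 𝐍.m⟨⟩∈ 1F 0F 2F))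
        (𝐍.m∃ λ w → 𝐍.m∃ λ f → 𝐍.m∧ (𝐍.mOmega 1F) (𝐍.m∧ (𝐍.mMap 0F 1F 3F)
          (𝐍.m∀ λ k → 𝐍.m∀ λ k′ → 𝐍.m∀ λ x → 𝐍.m∀ λ y → 𝐍.m⇒ (𝐍.m∧ (𝐍.mSuccessor 2F 3F) (𝐍.m∧ (𝐍.m⟨⟩∈ 3F 1F 4F) (𝐍.m⟨⟩∈ 2F 0F 4F)))
            (𝐍.m⟨⟩∈ 1F 0F 6F)))))
      λ a r (ne , tot) → dependent-choice a r ne tot >>= λ (f , map , step) →
        ∃ᶜ-intro 𝐍.ω (∃ᶜ-intro f (≈ᴺ-refl , map , λ k k′ x y (e , h , h′) → step k k′ x y e h h′))

  open DependentChoice public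

  -- A family without choice functions: gen i s is the i-th generic subset of I,
  -- shifted by s, and A i consists of all its shifts.

  module Family where

    private
      variable
        a b c p q r s t u w x x′ y y′ z z′ : U

    GenP : Pr 3
    GenP = ∃ᵖ (v0 ∈ᵖ con I ∧ᵖ fstT v1 ≈ᵖ checkT v0 ∧ᵖ opT v2 v0 ∈ᵖ fstT (sndT v1) ∧ᵖ opT v2 v0 ∈ᵖ diffT (sndT (sndT v1)) v3)

    checks : U
    checks = img I (checkT v0)

    abstract
      genF : Tm 2
      genF = sepT (con (checks ×ₛ ℙ)) GenP

    gen : U → U → U
    gen i s = val genF (i ◂ s ◂ ø)

    genT : Tm n → Tm n → Tm n
    genT i s = genF ⟦ i ∷ s ∷ [] ⟧ᵗ

    GenEdge : U → U → U → U → Set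
    GenEdge i s u q = ∃ᶜ[ j ] j ∈ I × u ≈ check j × ‹ i , j › ∈ fst q × ‹ i , j › ∈ snd q △ s

    abstract
      ∈-gen : ∀ {i} → ‹ u , q › ∈ gen i s ⇔ (q ∈ ℙ × GenEdge i s u q)
      ∈-gen {u} {q} {s} {i} =
        (λ h → let k , l = proj₁ (∈-sepᵉ GenP (i ◂ s ◂ ø)) h in proj₂ (op-∈-prod⁻ k) , (l >>= λ (j , j∈ , e , m , m′) →
          ∃ᶜ-intro j (j∈ , ≈-trans (≈-sym fst-op) e , ∈-respʳ (fst-cong snd-op) m , ∈-respʳ (△-cong (snd-cong snd-op) ≈-refl) m′))) ,
        (λ (q∈ , l) → l >>= λ (j , j∈ , e , m , m′) → proj₂ (∈-sepᵉ GenP (i ◂ s ◂ ø))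
          (op-∈-prod (∈-respˡ (≈-sym e) (img-intro (checkT v0) {ø} j∈)) q∈ , ∃ᶜ-intro j (j∈ , ≈-trans fst-op e ,
            ∈-respʳ (fst-cong (≈-sym snd-op)) m , ∈-respʳ (△-cong (snd-cong (≈-sym snd-op)) ≈-refl) m′)))

      gen-pairs : ∀ {i} → w ∈ gen i s → ∃ᶜ[ u ] ∃ᶜ[ q ] w ≈ ‹ u , q › × q ∈ ℙ
      gen-pairs {w} {s} {i} h = proj₁ ∈-prod (proj₁ (proj₁ (∈-sepᵉ GenP (i ◂ s ◂ ø)) h)) >>= λ (u , k) → k >>= λ (q , _ , q∈ , e) →
        ∃ᶜ-intro u (∃ᶜ-intro q (e , q∈))

    gen-⊆ : ∀ {i} → (∀ q j → ‹ i , j › ∈ snd q △ s → ‹ i , j › ∈ snd q △ t) → gen i s ⊆ gen i t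
    gen-⊆ sub w h = gen-pairs h >>= λ (u , k) → k >>= λ (q , e , _) → let q∈ , l = proj₁ ∈-gen (∈-respˡ e h) in
      l >>= λ (j , j∈ , e′ , m , m′) → ∈-respˡ (≈-sym e) (proj₂ ∈-gen (q∈ , ∃ᶜ-intro j (j∈ , e′ , m , sub q j m′)))

    △-middle : a △ b △ (c △ b) ≈ a △ c
    △-middle = ≈-trans (≈-sym △-assoc) (≈-trans (△-cong △-swap ≈-refl) △-cancel)

    -- Passing from `q` to `t · q` changes the values by `t`, and the shift in the name compensates
    -- for it.
    act-gen : ∀ {i} → t ∈ 𝒢 → act t (gen i s) ≈ gen i (s △ t)
    act-gen {t} {s} t∈ = ⊆-antisym
      (λ w h → proj₁ ∈-act h >>= λ (u , k) → k >>= λ (q , (l , q∈) , e) → proj₂ (proj₁ ∈-gen l) >>= λ (j , j∈ , e′ , m , m′) →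
        ∈-respˡ (≈-sym (≈-trans e (op-cong (≈-trans (act-cong ≈-refl e′) (act-check t∈ j)) ≈-refl)))
          (proj₂ ∈-gen (·-∈ℙ t∈ q∈ , ∃ᶜ-intro j (j∈ , ≈-refl , ∈-respʳ (≈-sym fst-·) m ,
            ∈-respʳ (≈-sym (≈-trans (△-cong snd-· ≈-refl) △-middle)) m′))))
      (λ w h → gen-pairs h >>= λ (u , k) → k >>= λ (q , e , _) → let q∈ , l = proj₁ ∈-gen (∈-respˡ e h) in
        l >>= λ (j , j∈ , e′ , m , m′) → ∈-respˡ (≈-trans (op-cong (≈-trans (act-cong ≈-refl e′) (≈-trans (act-check t∈ j) (≈-sym e′))) (·-cancel q∈)) (≈-sym e))
          (proj₁ (act-edge t∈ (proj₂ ∈-gen (·-∈ℙ t∈ q∈ , ∃ᶜ-intro j (j∈ , e′ , ∈-respʳ (≈-sym fst-·) m ,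
            ∈-respʳ (≈-trans (≈-sym △-assoc) (≈-trans △-swap (△-cong (≈-sym snd-·) ≈-refl))) m′)) , ·-∈ℙ t∈ q∈))))

    -- The singleton of `i` is a support: the name looks at row `i` alone.
    gen-HS : ∀ i s → HS (gen i s)
    gen-HS i s = HS-intro (λ w h → gen-pairs h)
      (∃ᶜ-intro ⁅ i , i ⁆ (ctbl-pair , λ t t∈ f → ≈-trans (act-gen t∈) (⊆-antisym
        (gen-⊆ λ q j m → proj₂ ∈-△ (xor-cong (id , id) (same t f j) (proj₁ ∈-△ m)))
        (gen-⊆ λ q j m → proj₂ ∈-△ (xor-cong (id , id) (proj₂ (same t f j) , proj₁ (same t f j)) (proj₁ ∈-△ m))))))
      (λ u q h → proj₂ (proj₁ ∈-gen h) >>= λ (j , _ , e , _) → HS-resp (≈-sym e) (HS-check j))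
      where
      same : ∀ t → Fixes t ⁅ i , i ⁆ → ∀ j → ‹ i , j › ∈ s △ t ⇔ ‹ i , j › ∈ s
      same t f j = (λ h → proj₁ (xor-f (f i j pair-l)) (proj₁ ∈-△ h)) , (λ h → proj₂ ∈-△ (proj₂ (xor-f (f i j pair-l)) h))

    module _ {i j s s′ : U} (j∈ : j ∈ I) (differ : Xor (‹ i , j › ∈ s) (‹ i , j › ∈ s′)) where

      private
        clash : ∀ {q q₂ r} → r ≤ q → r ≤ q₂ → ‹ i , j › ∈ fst q → ‹ i , j › ∈ fst q₂ →
                Xor (‹ i , j › ∈ snd q) (‹ i , j › ∈ s) → Xor (‹ i , j › ∈ snd q₂) (‹ i , j › ∈ s′) → ⊥
        clash {q} {q₂} {r} l l₂ m m₂ x x₂ = byCases (‹ i , j › ∈ snd r)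
            (λ a → differ ((λ b → ⊥-elim (x ((λ _ → b) , (λ _ → proj₁ (agree l m) a)))) ,
                           (λ b → ⊥-elim (x₂ ((λ _ → b) , (λ _ → proj₁ (agree l₂ m₂) a))))))
            (λ ¬a → differ ((λ _ → dne λ ¬b → x₂ ((λ a → ⊥-elim (¬a (proj₂ (agree l₂ m₂) a))) , (λ b → ⊥-elim (¬b b)))) ,
                            (λ _ → dne λ ¬b → x ((λ a → ⊥-elim (¬a (proj₂ (agree l m) a))) , (λ b → ⊥-elim (¬b b))))))
          where
          agree : ∀ {q} → r ≤ q → ‹ i , j › ∈ fst q → ‹ i , j › ∈ snd r ⇔ ‹ i , j › ∈ snd q
          agree l m = proj₂ (proj₂ (proj₂ (≤-elim l)) _ m)

        not-found : ‹ i , j › ∈ fst q → ‹ i , j › ∈ snd q △ s → ¬ Found q (check j) (gen i s′)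
        not-found m m′ f = f λ r k → k λ w k → k λ q₂ (l , (h , _) , l₂ , eq) → proj₂ (proj₁ ∈-gen h) λ j′ (j′∈ , e , m₂ , m₂′) →
          matched l l₂ m m′ m₂ m₂′ (op-cong ≈-refl (≈-sym (check-injective j r j′ (Eq-resp ≈-refl ≈-refl e eq))))
          where
          matched : ∀ {q q₂ r j′} → r ≤ q → r ≤ q₂ → ‹ i , j › ∈ fst q → ‹ i , j › ∈ snd q △ s →
                    ‹ i , j′ › ∈ fst q₂ → ‹ i , j′ › ∈ snd q₂ △ s′ → ‹ i , j′ › ≈ ‹ i , j › → ⊥
          matched l l₂ m m′ m₂ m₂′ e = clash l l₂ m (∈-respˡ e m₂) (proj₁ ∈-△ m′) (proj₁ ∈-△ (∈-respˡ e m₂′))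

      -- Here `q` puts `j` into the first set. Equality would give a compatible condition putting
      -- `j` into the second, but the two would disagree at the point (i, j), where `s` and `s′`
      -- differ.
      gen-separated : Eq q (gen i s) (gen i s′) → ‹ i , j › ∈ fst q → ¬ ‹ i , j › ∈ snd q △ s
      gen-separated {q} e m m′ = not-found m m′
        (Eq-half e (check j) q (proj₂ ∈-gen (q∈ , ∃ᶜ-intro j (j∈ , ≈-refl , m , m′)) , q∈) q (≤-refl q∈) (≤-refl q∈))
        where
        q∈ : q ∈ ℙ
        q∈ = Eq-∈ℙ e

    -- The value at `k` is the one already present in the second component of `q`.
    extended : U → U → U
    extended q k = ‹ fst q ∪ₛ ⁅ k , k ⁆ , snd q ›

    extended-∈ℙ : ∀ {k} → k ∈ K → q ∈ ℙ → extended q k ∈ ℙ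
    extended-∈ℙ k∈ q∈ = let _ , f∈ , s∈ = cond-parts q∈ in
      cond-mk (proj₂ ∈-𝒫 λ z h → ∪-elim h (proj₁ ∈-𝒫 f∈ z) λ h → ∈-respˡ (≈-sym (∈-sing h)) k∈)
        (ctbl-∪ (proj₂ (cond-elim q∈)) ctbl-pair) s∈

    extended-≤ : ∀ {k} → k ∈ K → q ∈ ℙ → extended q k ≤ q
    extended-≤ k∈ q∈ = ≤-intro (extended-∈ℙ k∈ q∈) q∈
      λ z h → ∈-respʳ (≈-sym fst-op) (∪-l h) , ∈-respʳ snd-op , ∈-respʳ (≈-sym snd-op)

    extended-dom : ∀ {k} → k ∈ fst (extended q k)
    extended-dom = ∈-respʳ (≈-sym fst-op) (∪-r pair-l)

    xor-move : {X S S′ : Set} → Xor S S′ → ¬ Xor X S → Xor X S′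
    xor-move d n (f , f⁻) = n λ (g , g⁻) → d ((λ a → f (g⁻ a)) , (λ a → g (f⁻ a)))

    -- Once (i, j) is in the domain, `j` belongs to exactly one of the two sets, and `gen-separated`
    -- is applied from that side.
    gen-distinct : ∀ {i j s s′} → i ∈ I → j ∈ I → Xor (‹ i , j › ∈ s) (‹ i , j › ∈ s′) → ¬ Eq q (gen i s) (gen i s′)
    gen-distinct {q} {i} {j} {s} {s′} i∈ j∈ differ e = byCases (‹ i , j › ∈ snd q′ △ s)
      (gen-separated j∈ differ e′ extended-dom)
      λ n → gen-separated j∈ (λ (f , g′) → differ (g′ , f)) (Eq-sym e′) extended-dom
        (proj₂ ∈-△ (xor-move differ λ x → n (proj₂ ∈-△ x)))
      where
      q′ : U
      q′ = extended q ‹ i , j ›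
      e′ : Eq q′ (gen i s) (gen i s′)
      e′ = Eq-mono (extended-≤ (op-∈-prod i∈ j∈) (Eq-∈ℙ e)) e

    memberT : Tm 2
    memberT = genT v1 v0

    abstract
      membersF : Tm 1
      membersF = imgT (con 𝒢) memberT

    members : U → U
    members i = val membersF (i ◂ ø)

    abstract
      members-intro : ∀ i → s ∈ 𝒢 → gen i s ∈ members i
      members-intro i j = img-intro memberT {i ◂ ø} j

      members-elim : ∀ i → u ∈ members i → ∃ᶜ[ s ] s ∈ 𝒢 × u ≈ gen i s
      members-elim i = proj₁ (∈-imgᵉ memberT (i ◂ ø))

    abstract
      AF : Tm 1
      AF = prodT membersF (con ℙ)

    A : U → U
    A i = val AF (i ◂ ø)

    AT : Tm n → Tm n
    AT t = AF ⟦ t ∷ [] ⟧ᵗ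

    abstract
      A-≈ : ∀ i → A i ≈ members i ×ₛ ℙ
      A-≈ i = ≈-refl

    members-HS : ∀ i u → u ∈ members i → HS u
    members-HS i u h = members-elim i h >>= λ (s , _ , e) → HS-resp (≈-sym e) (gen-HS i s)

    -- Shifts permute the shifts of a row. So the set of them needs no support, although each member
    -- does.
    members-invariant : ∀ i → Invariant ∅ (members i)
    members-invariant i t t∈ _ u h = members-elim i h >>= λ (s , s∈ , e) →
      ∈-respˡ (≈-sym (≈-trans (act-cong ≈-refl e) (act-gen t∈))) (members-intro i (△-∈𝒢 s∈ t∈))

    members-name-HS : ∀ i → HS (members i ×ₛ ℙ)
    members-name-HS i = set-HS (members-HS i) ctbl-∅ (members-invariant i)

    A-HS : ∀ i → HS (A i)
    A-HS i = HS-resp (≈-sym (A-≈ i)) (members-name-HS i)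

    act-A : ∀ i → t ∈ 𝒢 → act t (A i) ≈ A i
    act-A i t∈ = ≈-trans (act-cong ≈-refl (A-≈ i)) (≈-trans
      (set-supports (members-HS i) (members-invariant i) _ t∈ (λ a b h → ⊥-elim (∉∅ h))) (≈-sym (A-≈ i)))

    Aᴺ : U → N
    Aᴺ i = A i , A-HS i

    genᴺ : U → U → N
    genᴺ i s = gen i s , gen-HS i s

    membersᴺ : U → N
    membersᴺ i = members i ×ₛ ℙ , members-name-HS i

    membersᴺ-≈ : ∀ i → membersᴺ i ≈ᴺ Aᴺ i
    membersᴺ-≈ i = ≈⇒≈ᴺ (≈-sym (A-≈ i))

    ∈ᴺ-members : ∀ i z → z ∈ᴺ membersᴺ i ⇔ (∃ᶜ[ u ] proj₁ u ∈ members i × z ≈ᴺ u)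
    ∈ᴺ-members i z = ∈ᴺ-set (members-name-HS i) z

    ∈ᴺ-A : ∀ i z → z ∈ᴺ Aᴺ i ⇔ (∃ᶜ[ s ] s ∈ 𝒢 × z ≈ᴺ genᴺ i s)
    ∈ᴺ-A i z =
      (λ h → proj₁ (∈ᴺ-members i z) (∈ᴺ-resp ≈ᴺ-refl (≈ᴺ-sym (membersᴺ-≈ i)) h) >>= λ (u , u∈ , e) →
        members-elim i u∈ >>= λ (s , s∈ , e′) → ∃ᶜ-intro s (s∈ , ≈ᴺ-trans e (≈⇒≈ᴺ e′))) ,
      (λ h → h >>= λ (s , s∈ , e) → ∈ᴺ-resp ≈ᴺ-refl (membersᴺ-≈ i)
        (proj₂ (∈ᴺ-members i z) (∃ᶜ-intro (genᴺ i s) (members-intro i s∈ , e))))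

    familyU : U
    familyU = img I AF

    family-elim : u ∈ familyU → ∃ᶜ[ i ] i ∈ I × u ≈ A i
    family-elim = proj₁ (∈-imgᵉ AF ø)

    family-HS : HS (familyU ×ₛ ℙ)
    family-HS = set-HS (λ u h → family-elim h >>= λ (i , _ , e) → HS-resp (≈-sym e) (A-HS i)) ctbl-∅
      λ t t∈ _ u h → family-elim h >>= λ (i , i∈ , e) → ∈-respˡ (≈-sym (≈-trans (act-cong ≈-refl e) (act-A i t∈))) (img-intro AF i∈)

    familyᴺ : N
    familyᴺ = familyU ×ₛ ℙ , family-HS

    ∈ᴺ-family : ∀ z → z ∈ᴺ familyᴺ ⇔ (∃ᶜ[ i ] i ∈ I × z ≈ᴺ Aᴺ i)
    ∈ᴺ-family z =
      (λ h → proj₁ (∈ᴺ-set family-HS z) h >>= λ (u , u∈ , e) → family-elim u∈ >>= λ (i , i∈ , e′) →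
        ∃ᶜ-intro i (i∈ , ≈ᴺ-trans e (≈⇒≈ᴺ e′))) ,
      (λ h → h >>= λ (i , i∈ , e) → proj₂ (∈ᴺ-set family-HS z) (∃ᶜ-intro (Aᴺ i) (img-intro AF i∈ , e)))

    abstract
      𝒜 : N
      𝒜 = familyᴺ

      ∈ᴺ-𝒜 : ∀ z → z ∈ᴺ 𝒜 ⇔ (∃ᶜ[ i ] i ∈ I × z ≈ᴺ Aᴺ i)
      ∈ᴺ-𝒜 = ∈ᴺ-family

    𝒜-nonempty : ∀ a → a ∈ᴺ 𝒜 → ∃ᶜ[ x ] x ∈ᴺ a
    𝒜-nonempty a h = proj₁ (∈ᴺ-𝒜 a) h >>= λ (i , _ , e) → ∃ᶜ-intro (genᴺ i ∅)
      (𝐍.∈-respʳ (≈ᴺ-sym e) (proj₂ (∈ᴺ-A i (genᴺ i ∅)) (∃ᶜ-intro ∅ (∅∈𝒢 , ≈ᴺ-refl))))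

    SectionP : U → U → Pr 1
    SectionP e i = opT (fstT v0) (opT (con i) (sndT v0)) ∈ᵖ con e

    -- The columns in which `x` meets row `i` form a countable set, so some subset of ω is not among
    -- them.
    outside : ∀ i → Ctbl x → ∃ᶜ[ j ] j ∈ I × ¬ ‹ i , j › ∈ x
    outside {x} i h = h >>= λ (e , f , cov) → uncountable-𝒫ω (sections e f cov) >>= λ (j , j∈ , j∉) →
      ∃ᶜ-intro j (j∈ , λ k → j∉ (proj₂ (∈-sepᵉ InRowP ø) (j∈ , k)))
      where
      InRowP : Pr 1
      InRowP = opT (con i) v0 ∈ᵖ con x
      sections : ∀ e → Functional e → (∀ z → z ∈ x → ∃ᶜ[ n ] n ∈ ω × ‹ n , z › ∈ e) → Ctbl (sep I InRowP)
      sections e f cov = ctbl-intro (sep (ω ×ₛ I) (SectionP e i))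
        (λ n j j′ h h′ → proj₂ (op-inj (f n ‹ i , j › ‹ i , j′ › (value h) (value h′))))
        (λ j h → let j∈ , k = proj₁ (∈-sepᵉ InRowP ø) h in cov _ k >>= λ (n , n∈ , l) → ∃ᶜ-intro n (n∈ ,
          proj₂ (∈-sepᵉ (SectionP e i) ø) (op-∈-prod n∈ j∈ , ∈-respˡ (op-cong (≈-sym fst-op) (op-cong ≈-refl (≈-sym snd-op))) l)))
        where
        value : ∀ {n j} → ‹ n , j › ∈ sep (ω ×ₛ I) (SectionP e i) → ‹ n , ‹ i , j › › ∈ e
        value h = ∈-respˡ (op-cong fst-op (op-cong ≈-refl snd-op)) (proj₂ (proj₁ (∈-sepᵉ (SectionP e i) ø) h))

    functionalφ : Formula 1
    functionalφ = ∀′ ∀′ ∀′ (⟨ 2F , 1F ⟩∈′ 3F ⇒′ ⟨ 2F , 0F ⟩∈′ 3F ⇒′ 1F ≐ 0F)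

    pairφ′ : Formula 3
    pairφ′ = ⟨ 0F , 1F ⟩∈′ 2F

    Holds : U → U → U → U → Set
    Holds q x y c = forces q pairφ′ (x ◂ y ◂ c ◂ ø)

    holds-resp : p ≈ q → x ≈ x′ → y ≈ y′ → a ≈ b → Holds p x y a → Holds q x′ y′ b
    holds-resp {p} {q} {x} {x′} {y} {y′} {a} {b} e e₁ e₂ e₃ = forces-resp pairφ′ {x ◂ y ◂ a ◂ ø} {x′ ◂ y′ ◂ b ◂ ø} e (◂-≋ e₁ (◂-≋ e₂ (◂-≋ e₃ λ ())))

    holds-act : t ∈ 𝒢 → HS x → HS y → HS c → q ∈ ℙ → Holds q x y c → Holds (t · q) (act t x) (act t y) (act t c)
    holds-act {t} {x} {y} {c} t∈ hx hy hc q∈ h = forces-resp pairφ′ {act t ∘ (x ◂ y ◂ c ◂ ø)} {act t x ◂ act t y ◂ act t c ◂ ø}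
      ≈-refl (λ { zero → ≈-refl ; (suc zero) → ≈-refl ; (suc (suc zero)) → ≈-refl })
      (forces-act pairφ′ {x ◂ y ◂ c ◂ ø} t∈ (◂-HS hx (◂-HS hy (◂-HS hc λ ()))) q∈ h)

    single-valued : forces q functionalφ (c ◂ ø) → q ∈ ℙ → HS x → HS y → HS z → Holds q x y c → Holds q x z c → Eq q y z
    single-valued {q} {c} {x} {y} {z} f q∈ hx hy hz h h′ = f x hx y hy z hz q (≤-refl q∈) h q (≤-refl q∈) h′

    module _ (C : N) (i s : U) (i∈ : i ∈ I) (s∈ : Supports s (proj₁ C)) (i∉ : ¬ i ∈ s) where

      no-value-forced : q ∈ ℙ → forces q functionalφ (proj₁ C ◂ ø) → ¬ Holds q (A i) (gen i t) (proj₁ C)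
      no-value-forced {q} {t} q∈ f h = outside i (proj₂ (cond-elim q∈)) λ j (j∈ , k∉) →
        let k = ‹ i , j ›
            -- A single point of row `i` outside the domain of `q`: shifting by it keeps `q` up to
            -- equivalence, keeps `A i` and `C`, and flips `j` in the chosen set.
            t′ = ⁅ k , k ⁆
            t′∈ : t′ ∈ 𝒢
            t′∈ = proj₂ ∈-𝒫 λ z h → ∈-respˡ (≈-sym (∈-sing h)) (op-∈-prod i∈ j∈)
            q≤ : q ≤ t′ · q
            q≤ = proj₂ (·-outside t′∈ q∈ λ z z∈ z∈t → k∉ (∈-respˡ (∈-sing z∈t) z∈))
            fix : act t′ (proj₁ C) ≈ proj₁ C
            fix = s∈ t′ t′∈ λ a b a∈ h → i∉ (∈-respˡ (proj₁ (op-inj (∈-sing h))) a∈)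
            h′ : Holds q (A i) (gen i (t △ t′)) (proj₁ C)
            h′ = forces-mono pairφ′ {A i ◂ gen i (t △ t′) ◂ proj₁ C ◂ ø} q≤
              (holds-resp ≈-refl (act-A i t′∈) (act-gen t′∈) fix (holds-act t′∈ (A-HS i) (gen-HS i t) (proj₂ C) q∈ h))
        in gen-distinct i∈ j∈ (flipped k) (single-valued f q∈ (A-HS i) (gen-HS i t) (gen-HS i (t △ t′)) h h′)
        where
        flipped : ∀ k → Xor (k ∈ t) (k ∈ t △ ⁅ k , k ⁆)
        flipped k (f , g′) = byCases (k ∈ t)
          (λ h → proj₁ (xor-t pair-l) (proj₁ ∈-△ (f h)) h)
          (λ h → h (g′ (proj₂ ∈-△ (proj₂ (xor-t pair-l) h))))

      no-value : 𝐍.Functional C → ∀ y → y ∈ᴺ Aᴺ i → ¬ 𝐍.‹ Aᴺ i , y › ∈ᴺ C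
      no-value fun y y∈ h = proj₁ (∈ᴺ-A i y) y∈ λ t (t∈ , e) →
        truth-lemma functionalφ (C ◂ ø) (𝐍.holds functionalφ (C ◂ ø)
          (𝐍.m∀ λ x → 𝐍.m∀ λ y → 𝐍.m∀ λ z → 𝐍.m⇒ (𝐍.m⟨⟩∈ 2F 1F 3F) (𝐍.m⇒ (𝐍.m⟨⟩∈ 2F 0F 3F) 𝐍.m≐)) fun) λ p (Gp , f) →
        truth-lemma pairφ′ (Aᴺ i ◂ genᴺ i t ◂ C ◂ ø) (𝐍.holds pairφ′ (Aᴺ i ◂ genᴺ i t ◂ C ◂ ø) (𝐍.m⟨⟩∈ 0F 1F 2F)
          (𝐍.∈-respˡ (𝐍.op-cong ≈ᴺ-refl e) h)) λ q (Gq , f′) →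
        G-directed Gp Gq λ r (Gr , l , l′) → no-value-forced (G-∈ℙ Gr)
          (forces-mono functionalφ {proj₁ C ◂ ø} l (forces-resp functionalφ {names (C ◂ ø)} {proj₁ C ◂ ø} ≈-refl (λ { zero → ≈-refl }) f))
          (forces-mono pairφ′ {A i ◂ gen i t ◂ proj₁ C ◂ ø} l′
            (forces-resp pairφ′ {names (Aᴺ i ◂ genᴺ i t ◂ C ◂ ø)} {A i ◂ gen i t ◂ proj₁ C ◂ ø} ≈-refl
              (λ { zero → ≈-refl ; (suc zero) → ≈-refl ; (suc (suc zero)) → ≈-refl }) f′))

    Selection : N → Set
    Selection C = 𝐍.Functional C × (∀ w → w ∈ᴺ C → ∃ᶜ[ a ] ∃ᶜ[ x ] a ∈ᴺ 𝒜 × x ∈ᴺ a × w ≈ᴺ 𝐍.‹ a , x ›)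

    no-full-selection : ∀ C → Selection C → ¬ (∀ a → a ∈ᴺ 𝒜 → ∃ᶜ[ x ] 𝐍.‹ a , x › ∈ᴺ C)
    no-full-selection C (fun , sel) tot = HS-symmetric (proj₂ C) λ s (c , supp) → uncountable-𝒫ω c λ i (i∈ , i∉) →
      tot (Aᴺ i) (proj₂ (∈ᴺ-𝒜 (Aᴺ i)) (∃ᶜ-intro i (i∈ , ≈ᴺ-refl))) λ x h → sel _ h λ a k → k λ x′ (_ , x′∈ , e) →
      let e₁ , e₂ = 𝐍.op-inj e in no-value C i s i∈ supp i∉ fun x (𝐍.∈-resp (≈ᴺ-sym e₂) (≈ᴺ-sym e₁) x′∈) h

    abstract
      -- The sequence that sends `n` to `A` at the n-th row listed by `e`. All its terms have empty
      -- support, so it can be named whatever `e` is.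
      rowT : U → Tm 1
      rowT e = AT (applyF ⟦ con e ∷ v0 ∷ [] ⟧ᵗ)

      rowT-≈ : ∀ e n → val (rowT e) (n ◂ ø) ≈ A (e $ₛ n)
      rowT-≈ e n = ≈-refl

    row-HS : ∀ e n → n ∈ ω → HS (val (rowT e) (n ◂ ø))
    row-HS e n _ = HS-resp (≈-sym (rowT-≈ e n)) (A-HS (e $ₛ n))

    row-supports : ∀ e n → n ∈ ω → Supports ∅ (val (rowT e) (n ◂ ø))
    row-supports e n _ t t∈ _ = ≈-trans (act-cong ≈-refl (rowT-≈ e n)) (≈-trans (act-A (e $ₛ n) t∈) (≈-sym (rowT-≈ e n)))

    PartP : U → Pr 1
    PartP s = v0 ∈ᵖ con (ω ×ₛ s)

    module _ (C : N) (fun : 𝐍.Functional C) (sel : ∀ w → w ∈ᴺ C → ∃ᶜ[ a ] ∃ᶜ[ x ] a ∈ᴺ 𝒜 × x ∈ᴺ a × w ≈ᴺ 𝐍.‹ a , x ›)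
             (s e : U) (supp : Supports s (proj₁ C)) (functional-e : Functional e)
             (covers-e : ∀ i → i ∈ s → ∃ᶜ[ n ] n ∈ ω × ‹ n , i › ∈ e) where
      private
        abstract
          e′ : U
          e′ = sep e (PartP s)

          e′-$ : ∀ {n i} → n ∈ ω → i ∈ s → ‹ n , i › ∈ e → e′ $ₛ n ≈ i
          e′-$ n∈ i∈ k = $-≈ (λ w h → proj₁ ∈-prod (proj₂ (proj₁ (∈-sepᵉ (PartP s) ø) h)) >>= λ (x , l) → l >>= λ (y , _ , _ , e) →
              ∃ᶜ-intro x (∃ᶜ-intro y e))
            (λ x y z h h′ → functional-e x y z (proj₁ (proj₁ (∈-sepᵉ (PartP s) ø) h)) (proj₁ (proj₁ (∈-sepᵉ (PartP s) ø) h′)))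
            (proj₂ (∈-sepᵉ (PartP s) ø) (k , op-∈-prod n∈ i∈))

      open Sequence (rowT e′) ∅ ctbl-∅ (row-HS e′) (row-supports e′)

      row-≈ : ∀ {n i} (n∈ : n ∈ ω) → i ∈ s → ‹ n , i › ∈ e → term n n∈ ≈ᴺ Aᴺ i
      row-≈ {n} {i} n∈ i∈ k = ≈⇒≈ᴺ (≈-trans (rowT-≈ e′ n) (Tm-cong AF {(e′ $ₛ n) ◂ ø} {i ◂ ø} (◂-≋ (e′-$ n∈ i∈ k) λ ())))

      in-support : ∀ a x → 𝐍.‹ a , x › ∈ᴺ C → ∃ᶜ[ i ] i ∈ s × a ≈ᴺ Aᴺ i
      in-support a x h = sel _ h >>= λ (a′ , k) → k >>= λ (x′ , a′∈ , x′∈ , eq) → let e₁ , e₂ = 𝐍.op-inj eq in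
        proj₁ (∈ᴺ-𝒜 a′) a′∈ >>= λ (i , i∈ , e₃) → let a≈ = ≈ᴺ-trans e₁ e₃ in
        ∃ᶜ-intro i (dne (λ i∉ → no-value C i s i∈ supp i∉ fun x (𝐍.∈-resp (≈ᴺ-sym e₂) e₃ x′∈)
          (𝐍.∈-respˡ (𝐍.op-cong a≈ ≈ᴺ-refl) h)) , a≈)

      row-entry : ∀ {n i a} → n ∈ ω → i ∈ s → ‹ n , i › ∈ e → a ≈ᴺ Aᴺ i → 𝐍.‹ checkᴺ n , a › ∈ᴺ seqᴺ
      row-entry {n} n∈ i∈ k a≈ = 𝐍.∈-respˡ (𝐍.op-cong ≈ᴺ-refl (≈ᴺ-trans (row-≈ n∈ i∈ k) (≈ᴺ-sym a≈))) (seq-intro n n∈)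

      Label : N → Set
      Label z = ∃ᶜ[ n ] ∃ᶜ[ a ] ∃ᶜ[ x ] n ∈ᴺ 𝐍.ω × z ≈ᴺ 𝐍.‹ a , x › × 𝐍.‹ n , a › ∈ᴺ seqᴺ

      label-intro : ∀ {z} n a x → n ∈ᴺ 𝐍.ω → z ≈ᴺ 𝐍.‹ a , x › → 𝐍.‹ n , a › ∈ᴺ seqᴺ → Label z
      label-intro n a x i e j = ∃ᶜ-intro n (∃ᶜ-intro a (∃ᶜ-intro x (i , e , j)))

      label-of : ∀ {z} a x i → z ≈ᴺ 𝐍.‹ a , x › → i ∈ s → a ≈ᴺ Aᴺ i → Label z
      label-of a x i eq i∈ a≈ = covers-e i i∈ >>= λ (n , n∈ , k) → label-intro (checkᴺ n) a x (ω-intro n∈) eq (row-entry n∈ i∈ k a≈)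

      labelled : ∀ z → z ∈ᴺ C → Label z
      labelled z h = sel z h >>= λ (a , k) → k >>= λ (x , _ , _ , eq) → in-support a x (𝐍.∈-respˡ eq h) >>= λ (i , i∈ , a≈) →
        label-of a x i eq i∈ a≈

      countable-selection′ : 𝐍.Countable C
      countable-selection′ = 𝐍.countable-graph C seqᴺ fun seq-functional labelled

    -- Every set from which `C` chooses is some `A i` with `i` in a support of `C`. An enumeration
    -- of the support lives in the ground model, and the sequence of the `A i` along it has a
    -- symmetric name, so the pairs in `C` receive labels in the extension.
    countable-selection : ∀ C → Selection C → 𝐍.Countable C
    countable-selection C (fun , sel) = HS-symmetric (proj₂ C) >>= λ (s , c , supp) → c >>= λ (e , f , cov) →
      countable-selection′ C fun sel s e supp f cov

  open Family public

-- From a family 𝒜 whose partial choice functions are countable and never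
-- total: the conditions are ∅ (on top), the pairs ‹ a , x › with x ∈ a ∈ 𝒜, all
-- those with the same a being equivalent, and extra pairwise incompatible
-- elements V.

module BlockForcing (𝓜 : ZFModel) (𝒜 : ZFModel.U 𝓜) where
  open Internal 𝓜

  private
    variable
      a b c w x y z : U

  InBlock : U → U → Set
  InBlock a w = a ∈ 𝒜 × (∃ᶜ[ x ] x ∈ a × w ≈ ‹ a , x ›)

  Chosen : U → Set
  Chosen w = ∃ᶜ[ a ] InBlock a w
  ChosenP : Pr 1
  ChosenP = ∃ᵖ (v0 ∈ᵖ con 𝒜 ∧ᵖ (∃ᵖ (v0 ∈ᵖ v1 ∧ᵖ v2 ≈ᵖ opT v1 v0)))

  Selection : U → Set
  Selection C = Functional C × (∀ w → w ∈ C → Chosen w)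

  SameBlock : U → U → Set
  SameBlock x y = ∃ᶜ[ a ] InBlock a x × InBlock a y
  InBlockP : Tm n → Tm n → Pr n
  InBlockP a w = a ∈ᵖ con 𝒜 ∧ᵖ (∃ᵖ (v0 ∈ᵖ wkT a ∧ᵖ wkT w ≈ᵖ opT (wkT a) v0))

  Below : U → U → Set
  Below x y = y ≈ ∅ ∨ᶜ (x ≈ y ∨ᶜ SameBlock x y)
  BelowP : Pr 1
  BelowP = sndT v0 ≈ᵖ con ∅ ∨ᵖ (fstT v0 ≈ᵖ sndT v0 ∨ᵖ (∃ᵖ (InBlockP v0 (fstT v1) ∧ᵖ InBlockP v0 (sndT v1))))

  block-pair : a ∈ 𝒜 → x ∈ a → InBlock a ‹ a , x ›
  block-pair i j = i , ∃ᶜ-intro _ (j , ≈-refl)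

  block-resp : w ≈ z → InBlock a w → InBlock a z
  block-resp e (i , h) = i , (h >>= λ (x , j , e′) → ∃ᶜ-intro x (j , ≈-trans (≈-sym e) e′))

  block-first : InBlock a ‹ b , y › → b ≈ a × y ∈ b
  block-first (i , h) = h >>= λ (x , j , e) → let e₁ , e₂ = op-inj e in e₁ , ∈-resp (≈-sym e₂) (≈-sym e₁) j

  block-unique : InBlock a w → InBlock b w → a ≈ b
  block-unique (i , h) k = h >>= λ (x , _ , e) → proj₁ (block-first (block-resp e k))

  block-change : a ≈ b → InBlock a w → InBlock b w
  block-change e (i , h) = ∈-respˡ e i , (h >>= λ (x , j , e′) → ∃ᶜ-intro x (∈-respʳ e j , ≈-trans e′ (op-cong e ≈-refl)))

  same-sym : SameBlock x y → SameBlock y x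
  same-sym h = h >>= λ (a , i , j) → ∃ᶜ-intro a (j , i)

  same-trans : SameBlock x y → SameBlock y z → SameBlock x z
  same-trans h h′ = h >>= λ (a , i , j) → h′ >>= λ (b , k , l) → ∃ᶜ-intro a (i , block-change (block-unique k j) l)

  same-respˡ : w ≈ x → SameBlock x y → SameBlock w y
  same-respˡ e h = h >>= λ (a , i , j) → ∃ᶜ-intro a (block-resp (≈-sym e) i , j)

  op-≉∅ : ¬ ‹ x , y › ≈ ∅
  op-≉∅ e = ∉∅ (∈-respʳ e op-l)

  block-≉∅ : InBlock a w → ¬ w ≈ ∅
  block-≉∅ (_ , h) e = h λ x (_ , e′) → op-≉∅ (≈-trans (≈-sym e′) e)

  below-trans : Below x y → Below y z → Below x z
  below-trans h h′ = ∨ᶜ-elim h′ ∨ᶜ-inl λ h′ → ∨ᶜ-elim h′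
    (λ e → ∨ᶜ-elim h (λ e′ → ∨ᶜ-inl (≈-trans (≈-sym e) e′)) λ h → ∨ᶜ-elim h
      (λ e′ → ∨ᶜ-inr (∨ᶜ-inl (≈-trans e′ e)))
      (λ s → ∨ᶜ-inr (∨ᶜ-inr (same-sym (same-respˡ (≈-sym e) (same-sym s))))))
    (λ s → ∨ᶜ-elim h (λ e′ → ⊥-elim (s λ a (i , _) → block-≉∅ i e′)) λ h → ∨ᶜ-inr (∨ᶜ-inr (∨ᶜ-elim h
      (λ e′ → same-respˡ e′ s) (λ s′ → same-trans s′ s))))

  module Order (V : U) (V-outside : ∀ x → x ∈ V → ¬ x ≈ ∅ × ¬ Chosen x) where

    abstract
      Q P L : U
      Q = sep (𝒜 ×ₛ ⋃ 𝒜) ChosenP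
      P = ⁅ ∅ , ∅ ⁆ ∪ₛ (Q ∪ₛ V)
      L = sep (P ×ₛ P) BelowP

      ∈-Q : w ∈ Q ⇔ Chosen w
      ∈-Q = (λ h → proj₂ (proj₁ (∈-sepᵉ ChosenP ø) h)) ,
        (λ h → h >>= λ (a , i , h) → h >>= λ (x , j , e) → proj₂ (∈-sepᵉ ChosenP ø)
          (∈-respˡ (≈-sym e) (op-∈-prod i (⋃-intro i j)) , ∃ᶜ-intro a (i , ∃ᶜ-intro x (j , e))))

      P-∅ : ∅ ∈ P
      P-∅ = ∪-l pair-l

      P-V : x ∈ V → x ∈ P
      P-V i = ∪-r (∪-r i)

      P-Q : Q ⊆ P
      P-Q x i = ∪-r (∪-l i)

      P-elim : {C : Set} {{_ : Stable C}} → x ∈ P → (x ≈ ∅ → C) → (x ∈ Q → C) → (x ∈ V → C) → C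
      P-elim h f g k = ∪-elim h (λ i → f (∈-sing i)) (λ h → ∪-elim h g k)

      ∈-L : ‹ x , y › ∈ L ⇔ (x ∈ P × y ∈ P × Below x y)
      ∈-L = (λ h → let i , b = proj₁ (∈-sepᵉ BelowP ø) h ; j , k = op-∈-prod⁻ i in j , k , below-op b) ,
            (λ (j , k , b) → proj₂ (∈-sepᵉ BelowP ø) (op-∈-prod j k , op-below b))
        where
        below-op : pred BelowP (‹ x , y › ◂ ø) → Below x y
        below-op h = ∨ᶜ-elim h (λ e → ∨ᶜ-inl (≈-trans (≈-sym snd-op) e)) λ h → ∨ᶜ-elim h
          (λ e → ∨ᶜ-inr (∨ᶜ-inl (≈-trans (≈-sym fst-op) (≈-trans e snd-op))))
          (λ h → ∨ᶜ-inr (∨ᶜ-inr (h >>= λ (a , i , j) → ∃ᶜ-intro a (block-resp fst-op i , block-resp snd-op j))))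
        op-below : Below x y → pred BelowP (‹ x , y › ◂ ø)
        op-below h = ∨ᶜ-elim h (λ e → ∨ᶜ-inl (≈-trans snd-op e)) λ h → ∨ᶜ-elim h
          (λ e → ∨ᶜ-inr (∨ᶜ-inl (≈-trans fst-op (≈-trans e (≈-sym snd-op)))))
          (λ h → ∨ᶜ-inr (∨ᶜ-inr (h >>= λ (a , i , j) → ∃ᶜ-intro a (block-resp (≈-sym fst-op) i , block-resp (≈-sym snd-op) j))))

      L-pairs : w ∈ L → ∃ᶜ[ x ] x ∈ P × (∃ᶜ[ y ] y ∈ P × w ≈ ‹ x , y ›)
      L-pairs h = proj₁ ∈-prod (proj₁ (proj₁ (∈-sepᵉ BelowP ø) h)) >>= λ (x , k) → k >>= λ (y , i , j , e) →
        ∃ᶜ-intro x (i , ∃ᶜ-intro y (j , e))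

    forcing : IsPreorder′ P L
    forcing = (λ w → L-pairs) , (λ x i → proj₂ ∈-L (i , i , ∨ᶜ-inr (∨ᶜ-inl ≈-refl))) ,
      (λ x y z (h , h′) → let i , _ , b = proj₁ ∈-L h ; _ , k , b′ = proj₁ ∈-L h′ in proj₂ ∈-L (i , k , below-trans b b′)) ,
      ∃ᶜ-intro ∅ (P-∅ , λ x i → proj₂ ∈-L (i , P-∅ , ∨ᶜ-inl ≈-refl))

    Related : U → U → Set
    Related x y = x ≈ y ∨ᶜ SameBlock x y

    below-proper : ¬ y ≈ ∅ → Below x y → Related x y
    below-proper ne h = h ne

    -- Below the top the order only relates equal elements and elements of one block, so a common
    -- extension links the two.
    compat-related : ¬ x ≈ ∅ → ¬ y ≈ ∅ → Compat P L x y → Related x y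
    compat-related nx ny h = h >>= λ (r , _ , i , j) →
      ∨ᶜ-elim (below-proper nx (proj₂ (proj₂ (proj₁ ∈-L i)))) (λ e → ∨ᶜ-elim (below-proper ny (proj₂ (proj₂ (proj₁ ∈-L j))))
          (λ e′ → ∨ᶜ-inl (≈-trans (≈-sym e) e′)) (λ s → ∨ᶜ-inr (same-respˡ (≈-sym e) s)))
        (λ s → ∨ᶜ-elim (below-proper ny (proj₂ (proj₂ (proj₁ ∈-L j))))
          (λ e′ → ∨ᶜ-inr (same-sym (same-respˡ (≈-sym e′) s))) (λ s′ → ∨ᶜ-inr (same-trans (same-sym s) s′)))

    compat-intro : x ∈ P → y ∈ P → Below x y → Compat P L x y
    compat-intro {x} i j h = ∃ᶜ-intro x (i , proj₂ ∈-L (i , i , ∨ᶜ-inr (∨ᶜ-inl ≈-refl)) , proj₂ ∈-L (i , j , h))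

    module _ (A : U) (anti : Antichain P L A) where

      antichain-≈ : x ∈ A → y ∈ A → Below x y → x ≈ y
      antichain-≈ {x} {y} i j h = dne λ ne → proj₂ anti x i y j ne (compat-intro (proj₁ anti x i) (proj₁ anti y j) h)

      -- Everything is compatible with the top, so such an antichain has no other element.
      top-countable : ∅ ∈ A → Countable A
      top-countable top = countable-labelled A (v0 ≈ᵖ con ∅) (λ z _ → ∃ᶜ-intro ∅ (ω-zero , ≈-refl))
        λ n z z′ i j _ _ → ≈-trans (antichain-≈ i top (∨ᶜ-inl ≈-refl)) (≈-sym (antichain-≈ j top (∨ᶜ-inl ≈-refl)))

      chosen-part : U
      chosen-part = sep A ChosenP

      ∈-chosen-part : w ∈ chosen-part ⇔ (w ∈ A × Chosen w)
      ∈-chosen-part = ∈-sepᵉ ChosenP ø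

      antichain-functional : a ∈ 𝒜 → x ∈ a → y ∈ a → ‹ a , x › ∈ A → ‹ a , y › ∈ A → x ≈ y
      antichain-functional i j k h h′ = proj₂ (op-inj (antichain-≈ h h′
        (∨ᶜ-inr (∨ᶜ-inr (∃ᶜ-intro _ (block-pair i j , block-pair i k))))))

      selection : ∀ C → (∀ w → w ∈ C → w ∈ A × Chosen w) → Selection C
      selection C sub = (λ a x y h h′ → let i , c = sub _ h ; j , d = sub _ h′ in
          c >>= λ (a₁ , k) → d >>= λ (a₂ , l) → let e₁ , x∈ = block-first k ; e₂ , y∈ = block-first l in
          antichain-functional (∈-respˡ (≈-sym e₁) (proj₁ k)) x∈ y∈ i j) ,
        λ w h → proj₂ (sub w h)

    module _ (nonempty : ∀ a → a ∈ 𝒜 → ∃ᶜ[ x ] x ∈ a)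
             (no-full : ∀ C → Selection C → ¬ (∀ a → a ∈ 𝒜 → ∃ᶜ[ x ] ‹ a , x › ∈ C)) where

      -- If `A` missed the block of `a`, a pair from that block could be added to `A`, since it is
      -- compatible only with the top and with its own block.
      maximal-meets : ∀ A → MaximalAntichain P L A → ¬ ∅ ∈ A → ∀ a → a ∈ 𝒜 → ∃ᶜ[ x ] ‹ a , x › ∈ A × x ∈ a
      maximal-meets A (anti , max) top a a∈ k = nonempty a a∈ λ x x∈ →
        let new = ‹ a , x ›
            new∈Q : new ∈ Q
            new∈Q = proj₂ ∈-Q (∃ᶜ-intro a (block-pair a∈ x∈))
        in k x (∈-respʳ (max (A ∪ₛ ⁅ new , new ⁆) (extended x x∈ new∈Q , λ z → ∪-l)) (∪-r pair-l) , x∈)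
        where
        apart : ∀ x → x ∈ a → ∀ z → z ∈ A → ¬ Compat P L z ‹ a , x ›
        apart x x∈ z i c = ∨ᶜ-elim (compat-related (λ e → top (∈-respˡ e i)) op-≉∅ c)
          (λ e → k x (∈-respˡ e i , x∈))
          (λ s → s λ b (j , l) → let e , _ = block-first l in proj₂ (block-change (≈-sym e) j) λ y (y∈ , e′) → k y (∈-respˡ e′ i , y∈))
        compat-sym : ∀ {x y} → Compat P L x y → Compat P L y x
        compat-sym h = h >>= λ (r , i , j , l) → ∃ᶜ-intro r (i , l , j)
        compat-resp : ∀ {x y z} → y ≈ z → Compat P L x y → Compat P L x z
        compat-resp e h = h >>= λ (r , i , j , l) → ∃ᶜ-intro r (i , j , ∈-respˡ (op-cong ≈-refl e) l)
        extended : ∀ x → x ∈ a → ‹ a , x › ∈ Q → Antichain P L (A ∪ₛ ⁅ ‹ a , x › , ‹ a , x › ⁆)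
        extended x x∈ q = (λ z h → ∪-elim h (proj₁ anti z) (λ i → ∈-respˡ (≈-sym (∈-sing i)) (P-Q _ q))) ,
          λ y h z h′ ne c → ∪-elim h
            (λ i → ∪-elim h′ (λ j → proj₂ anti y i z j ne c) (λ j → apart x x∈ y i (compat-resp (∈-sing j) c)))
            (λ i → ∪-elim h′ (λ j → apart x x∈ z j (compat-resp (∈-sing i) (compat-sym c)))
              (λ j → ne (≈-trans (∈-sing i) (≈-sym (∈-sing j)))))

      satisfies-ccc₁ : ccc₁ P L
      satisfies-ccc₁ A h = byCases (∅ ∈ A) (top-countable A (proj₁ h)) λ top → ⊥-elim
        (no-full (chosen-part A (proj₁ h)) (selection A (proj₁ h) _ λ w i → proj₁ (∈-chosen-part A (proj₁ h)) i)
          λ a a∈ → maximal-meets A h top a a∈ >>= λ (x , i , x∈) →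
            ∃ᶜ-intro x (proj₂ (∈-chosen-part A (proj₁ h)) (i , ∃ᶜ-intro a (block-pair a∈ x∈))))

      -- Without pairs the family would be empty, and then the empty set would choose from all its
      -- members.
      Q-inhabited : ∃ᶜ[ q ] q ∈ Q
      Q-inhabited k = no-full ∅ ((λ x y z h → ⊥-elim (∉∅ h)) , λ w h → ⊥-elim (∉∅ h)) λ a a∈ → ⊥-elim
        (nonempty a a∈ λ x x∈ → k ‹ a , x › (proj₂ ∈-Q (∃ᶜ-intro a (block-pair a∈ x∈))))

      Q-predense : (∀ x → ¬ x ∈ V) → Predense P L Q
      Q-predense empty = P-Q , λ x i → P-elim i
        (λ e → Q-inhabited >>= λ (q , q∈) → ∃ᶜ-intro q (q∈ , ∃ᶜ-intro q (P-Q q q∈ ,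
          proj₂ ∈-L (P-Q q q∈ , i , ∨ᶜ-inl e) , proj₂ ∈-L (P-Q q q∈ , P-Q q q∈ , ∨ᶜ-inr (∨ᶜ-inl ≈-refl)))))
        (λ q∈ → ∃ᶜ-intro x (q∈ , compat-intro i i (∨ᶜ-inr (∨ᶜ-inl ≈-refl))))
        (λ v∈ → ⊥-elim (empty x v∈))

      -- Choose in every block the element with the least label.
      module _ (E f : U) (E⊆Q : E ⊆ Q) (inj : Injection f E ω) (pre : Predense P L E) where
        private
          LeastP : Pr 1
          LeastP = ∀ᵖ ∀ᵖ ∀ᵖ (v2 ∈ᵖ con E ⇒ᵖ (∃ᵖ (InBlockP v0 (v 4F) ∧ᵖ InBlockP v0 v3)) ⇒ᵖ
            opT v3 v1 ∈ᵖ con f ⇒ᵖ opT v2 v0 ∈ᵖ con f ⇒ᵖ v0 ∉ᵖ v1)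

          Least : U → Set
          Least w = ∀ w′ n n′ → w′ ∈ E → SameBlock w w′ → ‹ w , n › ∈ f → ‹ w′ , n′ › ∈ f → ¬ n′ ∈ n

          C : U
          C = sep E LeastP

          ∈-C : w ∈ C ⇔ (w ∈ E × Least w)
          ∈-C = ∈-sepᵉ LeastP ø

          label : w ∈ E → ∃ᶜ[ n ] n ∈ ω × ‹ w , n › ∈ f
          label i = proj₁ (proj₂ (proj₁ (proj₁ inj))) _ i >>= λ (n , h) → ∃ᶜ-intro n (proj₂ (proj₁ inj) _ n h , h)

          functional : Functional C
          functional a x y h h′ = let i , l = proj₁ ∈-C h ; j , l′ = proj₁ ∈-C h′ in
            proj₁ ∈-Q (E⊆Q _ i) >>= λ (b , k) → proj₁ ∈-Q (E⊆Q _ j) >>= λ (b′ , k′) →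
            let e , x∈ = block-first k ; e′ , y∈ = block-first k′
                same : SameBlock ‹ a , x › ‹ a , y ›
                same = ∃ᶜ-intro b (k , block-change (≈-trans (≈-sym e′) e) k′)
            in label i >>= λ (n , n∈ , m) → label j >>= λ (n′ , n′∈ , m′) → ∨ᶜ-elim (ω-linear n n∈ n′ n′∈)
              (λ lt → ⊥-elim (l _ n n′ j same m m′ lt)) λ c → ∨ᶜ-elim c
              (λ eq → proj₂ (op-inj (proj₂ inj _ _ n m (∈-respˡ (op-cong ≈-refl eq) m′))))
              (λ lt → ⊥-elim (l′ _ n′ n i (same-sym same) m′ m lt))

          LabelsP : U → Pr 1
          LabelsP a = ∃ᵖ (opT (con a) v0 ∈ᵖ con E ∧ᵖ opT (opT (con a) v0) v1 ∈ᵖ con f)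

          labels : U → U
          labels a = sep ω (LabelsP a)

          ∈-labels : ∀ a {n} → n ∈ labels a ⇔ (n ∈ ω × (∃ᶜ[ x ] ‹ a , x › ∈ E × ‹ ‹ a , x › , n › ∈ f))
          ∈-labels a = ∈-sepᵉ (LabelsP a) ø

          meets : ∀ a → a ∈ 𝒜 → ∃ᶜ[ x ] ‹ a , x › ∈ E
          meets a a∈ = nonempty a a∈ >>= λ (x , x∈) → proj₂ pre ‹ a , x › (P-Q _ (proj₂ ∈-Q (∃ᶜ-intro a (block-pair a∈ x∈)))) >>= λ (d , d∈ , c) →
            proj₁ ∈-Q (E⊆Q d d∈) >>= λ (b , k) → ∨ᶜ-elim (compat-related op-≉∅ (block-≉∅ k) c)
              (λ e → ∃ᶜ-intro x (∈-respˡ (≈-sym e) d∈))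
              (λ s → s >>= λ (b′ , i , j) → proj₂ (block-change (≈-sym (proj₁ (block-first i))) j) >>= λ (y , _ , e) → ∃ᶜ-intro y (∈-respˡ e d∈))

          full : ∀ a → a ∈ 𝒜 → ∃ᶜ[ x ] ‹ a , x › ∈ C
          full a a∈ = meets a a∈ >>= λ (y , h) → label h >>= λ (m , m∈ , l) →
            regular (labels a) (∃ᶜ-intro m (proj₂ (∈-labels a) (m∈ , ∃ᶜ-intro y (h , l)))) >>= λ (n , i , min) →
            let n∈ , k = proj₁ (∈-labels a) i in k >>= λ (x , h′ , l′) → ∃ᶜ-intro x (proj₂ ∈-C (h′ , λ w′ n₁ n′ j s l₁ l₂ lt →
              s λ b (p , q) → let e , _ = block-first p in proj₂ (block-change (≈-sym e) q) λ z (_ , e′) →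
                min n′ (∈-respʳ (proj₂ (proj₂ (proj₁ (proj₁ inj))) _ _ _ l₁ l′) lt)
                  (proj₂ (∈-labels a) (proj₂ (proj₁ inj) _ _ l₂ , ∃ᶜ-intro z (∈-respˡ e′ j , ∈-respˡ (op-cong e′ ≈-refl) l₂)))))

        no-countable-predense : ⊥
        no-countable-predense = no-full C (functional , λ w h → proj₁ ∈-Q (E⊆Q w (proj₁ (proj₁ ∈-C h)))) full

      violates-ccc₃ : (∀ x → ¬ x ∈ V) → ¬ ccc₃ P L
      violates-ccc₃ empty h = h Q (Q-predense empty) λ E (sub , c , pre) → c λ f inj → no-countable-predense E f sub inj pre

    satisfies-ccc₂ : (∀ C → Selection C → Countable C) → (∀ x → ¬ x ∈ V) → ccc₂ P L
    satisfies-ccc₂ countable empty A anti = byCases (∅ ∈ A) (top-countable A anti) λ top → countable A (selection A anti A λ w i → i ,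
      P-elim (proj₁ anti w i) (λ e → ⊥-elim (top (∈-respˡ e i))) (proj₁ ∈-Q) (λ v → ⊥-elim (empty w v)))

    V-antichain : Antichain P L V
    V-antichain = (λ x → P-V) , λ x i y j ne c → ∨ᶜ-elim (compat-related (proj₁ (V-outside x i)) (proj₁ (V-outside y j)) c) ne
      λ s → s λ a (k , _) → proj₂ (V-outside x i) (∃ᶜ-intro a k)

  -- The extra elements of the first example: ‹ ∅ , u › for u ⊆ ω
  subsets : U
  subsets = ⁅ ∅ , ∅ ⁆ ×ₛ 𝒫 ω

  -- Members of the family are nonempty, so ∅ is not one of them and no pair with first component ∅
  -- lies in a block.
  subsets-outside : (∀ a → a ∈ 𝒜 → ∃ᶜ[ x ] x ∈ a) → ∀ x → x ∈ subsets → ¬ x ≈ ∅ × ¬ Chosen x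
  subsets-outside nonempty x h =
    (λ e → proj₁ ∈-prod h λ y k → k λ u (_ , _ , e′) → op-≉∅ (≈-trans (≈-sym e′) e)) ,
    (λ c → proj₁ ∈-prod h λ y k → k λ u (i , _ , e) → c λ a m →
      let e′ , _ = block-first (block-resp e m) in nonempty a (proj₁ m) λ z j → ∉∅ (∈-respʳ (≈-trans (≈-sym e′) (∈-sing i)) j))

  DiagonalP : U → Pr 1
  DiagonalP f = ∃ᵖ (opT (opT (con ∅) v0) v1 ∈ᵖ con f ∧ᵖ v1 ∉ᵖ v0)

  -- Cantor's argument for an injection into ω: the diagonal set consists of the labels of those
  -- sets that do not contain their own label.
  subsets-uncountable : ¬ Countable subsets
  subsets-uncountable h = h λ f ((((_ , tot , fun) , range) , inj)) →
    let d = sep ω (DiagonalP f)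
        d∈ : ‹ ∅ , d › ∈ subsets
        d∈ = op-∈-prod pair-l (proj₂ ∈-𝒫 λ z i → proj₁ (proj₁ (∈-sepᵉ (DiagonalP f) ø) i))
    in tot ‹ ∅ , d › d∈ λ n i → let n∉ : ¬ n ∈ d
                                    n∉ k = proj₂ (proj₁ (∈-sepᵉ (DiagonalP f) ø) k) λ u (j , l) →
                                      l (∈-respʳ (proj₂ (op-inj (inj _ _ n i j))) k)
      in n∉ (proj₂ (∈-sepᵉ (DiagonalP f) ø) (range _ n i , ∃ᶜ-intro d (i , n∉)))

  module _ (nonempty : ∀ a → a ∈ 𝒜 → ∃ᶜ[ x ] x ∈ a)
           (no-full : ∀ C → Selection C → ¬ (∀ a → a ∈ 𝒜 → ∃ᶜ[ x ] ‹ a , x › ∈ C))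
           (countable : ∀ C → Selection C → Countable C) where

    private
      module First = Order subsets (subsets-outside nonempty)
      module Second = Order ∅ (λ x h → ⊥-elim (∉∅ h))

    some-ccc₁-not-ccc₂ : ∀ ρ → sat (SomeForcing (λ P L → CCC₁ P L ∧′ ¬′ CCC₂ P L)) ρ
    some-ccc₁-not-ccc₂ ρ = holds (SomeForcing (λ P L → CCC₁ P L ∧′ ¬′ CCC₂ P L)) ρ
      (m∃ λ P → m∃ λ L → m∧ (mForcing 1F 0F) (m∧ (mCCC₁ 1F 0F) (m¬ (mCCC₂ 1F 0F))))
      (∃ᶜ-intro First.P (∃ᶜ-intro First.L (First.forcing , First.satisfies-ccc₁ nonempty no-full ,
        λ h → subsets-uncountable (h subsets First.V-antichain))))

    some-ccc₂-not-ccc₃ : ∀ ρ → sat (SomeForcing (λ P L → CCC₂ P L ∧′ ¬′ CCC₃ P L)) ρ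
    some-ccc₂-not-ccc₃ ρ = holds (SomeForcing (λ P L → CCC₂ P L ∧′ ¬′ CCC₃ P L)) ρ
      (m∃ λ P → m∃ λ L → m∧ (mForcing 1F 0F) (m∧ (mCCC₂ 1F 0F) (m¬ (mCCC₃ 1F 0F))))
      (∃ᶜ-intro Second.P (∃ᶜ-intro Second.L (Second.forcing , Second.satisfies-ccc₂ countable (λ x → ∉∅) ,
        Second.violates-ccc₃ nonempty no-full (λ x → ∉∅))))

-- Derivations in ZF

module Derivations where
  private
    variable
      Γ : List (Formula n)
      φ ψ χ : Formula n
      x y a : Fin n

  ♯_ : {Γ : List (Formula n)} (i : Fin (length Γ)) → T ∣ Γ ⊢ lookup Γ i
  ♯ i = hyp (∈-lookup i)

  ↑_ : T ∣ Γ ⊢ ψ → T ∣ φ ∷ map weaken Γ ⊢ weaken ψ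
  ↑ d = wk-⊢ (rename-⊢ suc d)

  ∧I : T ∣ Γ ⊢ φ → T ∣ Γ ⊢ ψ → T ∣ Γ ⊢ φ ∧′ ψ
  ∧I d e = ⇒I (⇒E (⇒E (♯ 0F) (wk-⊢ d)) (wk-⊢ e))

  ∧E₁ : T ∣ Γ ⊢ φ ∧′ ψ → T ∣ Γ ⊢ φ
  ∧E₁ d = raa (⇒E (wk-⊢ d) (⇒I (⊥E (⇒E (♯ 1F) (♯ 0F)))))

  ∧E₂ : T ∣ Γ ⊢ φ ∧′ ψ → T ∣ Γ ⊢ ψ
  ∧E₂ d = raa (⇒E (wk-⊢ d) (⇒I (♯ 1F)))

  ∨I₁ : T ∣ Γ ⊢ φ → T ∣ Γ ⊢ φ ∨′ ψ
  ∨I₁ d = ⇒I (⊥E (⇒E (♯ 0F) (wk-⊢ d)))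

  ∨I₂ : T ∣ Γ ⊢ ψ → T ∣ Γ ⊢ φ ∨′ ψ
  ∨I₂ d = ⇒I (wk-⊢ d)

  ∨E : T ∣ Γ ⊢ φ ∨′ ψ → T ∣ φ ∷ Γ ⊢ χ → T ∣ ψ ∷ Γ ⊢ χ → T ∣ Γ ⊢ χ
  ∨E d e f = raa (⇒E (♯ 0F) (⇒E (wk-⊢ (⇒I f)) (⇒E (wk-⊢ d) (⇒I (⇒E (♯ 1F) (⇒E (wk-⊢ (wk-⊢ (⇒I e))) (♯ 0F)))))))

  ∃I : (φ : Formula (suc n)) (x : Fin n) {Γ : List (Formula n)} → T ∣ Γ ⊢ φ [ x ] → T ∣ Γ ⊢ ∃′ φ
  ∃I φ x d = ⇒I (⇒E (∀E (♯ 0F) x) (wk-⊢ d))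

  ∃E : T ∣ Γ ⊢ ∃′ φ → T ∣ φ ∷ map weaken Γ ⊢ weaken ψ → T ∣ Γ ⊢ ψ
  ∃E d e = raa (⇒E (wk-⊢ d) (∀I (⇒I (⇒E (♯ 1F) (⊆-⊢ (∷-⊆ˡ there) e)))))

  ∃∈I : (φ : Formula (suc n)) (x : Fin n) → T ∣ Γ ⊢ x ∈′ a → T ∣ Γ ⊢ φ [ x ] → T ∣ Γ ⊢ ∃′∈[ a ] φ
  ∃∈I φ x d e = ∃I _ x (∧I d e)

  ∃∈E : T ∣ Γ ⊢ ∃′∈[ a ] φ → T ∣ φ ∷ 0F ∈′ suc a ∷ map weaken Γ ⊢ weaken ψ → T ∣ Γ ⊢ ψ
  ∃∈E d e = ∃E d (⇒E (⇒E (wk-⊢ (⇒I (⇒I e))) (∧E₁ (♯ 0F))) (∧E₂ (♯ 0F)))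

  ∀∈I : T ∣ 0F ∈′ suc a ∷ map weaken Γ ⊢ φ → T ∣ Γ ⊢ ∀′∈[ a ] φ
  ∀∈I d = ∀I (⇒I d)

  ∀∈E : T ∣ Γ ⊢ ∀′∈[ a ] φ → (x : Fin n) → T ∣ Γ ⊢ x ∈′ a → T ∣ Γ ⊢ φ [ x ]
  ∀∈E d x e = ⇒E (∀E d x) e

  closureE : ∀ n (φ : Formula n) {m} {Γ : List (Formula m)} → T ∣ Γ ⊢ rename (λ ()) (closure n φ) →
             (f : Fin n → Fin m) → T ∣ Γ ⊢ rename f φ
  closureE zero    φ d f = subst (_ ∣ _ ⊢_) (rename-cong (λ ()) φ) d
  closureE {T} (suc n) φ {Γ = Γ} d f = subst (T ∣ Γ ⊢_)
    (rename-∘ {f = f 0F ◂ id} {g = lift 1 (f ∘ suc)} (λ { zero → refl ; (suc i) → refl }) φ)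
    (∀E (closureE n (∀′ φ) d (f ∘ suc)) (f 0F))

  ∀-map : {φ ψ : Formula (suc n)} {Γ : List (Formula n)} → T ∣ Γ ⊢ ∀′ φ → T ∣ φ ∷ map weaken Γ ⊢ ψ → T ∣ Γ ⊢ ∀′ ψ
  ∀-map {φ = φ} d e = ∀I (⇒E (⇒I e) (subst (_ ∣ _ ⊢_)
    (trans (rename-∘ {h = id} (λ { zero → refl ; (suc i) → refl }) φ) (rename-id (λ _ → refl) φ))
    (∀E (rename-⊢ suc d) 0F)))

  ∃-map : {φ ψ : Formula (suc n)} {Γ : List (Formula n)} → T ∣ Γ ⊢ ∃′ φ → T ∣ φ ∷ map weaken Γ ⊢ ψ → T ∣ Γ ⊢ ∃′ ψ
  ∃-map d e = ⇒I (⇒E (wk-⊢ d) (∀-map (♯ 0F) (⇒I (⇒E (♯ 1F) (⊆-⊢ (∷-⊆ˡ (there ∘ there)) e)))))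

  separate : (φ : Formula (suc n)) (a : Fin n) {Γ : List (Formula n)} → let φ′ = rename (0F ◂ (2 ↑ʳ_)) φ in
             ZF ∣ Γ ⊢ ∃′ ((∀′∈[ 0F ] (0F ∈′ 2 ↑ʳ a ∧′ φ′)) ∧′ (∀′∈[ 1 ↑ʳ a ] (φ′ ⇒′ 0F ∈′ 1F)))
  separate {n} φ a {Γ} =
    ∃-map (subst (λ ψ → ZF ∣ Γ ⊢ ∃′ ∀′ (0F ∈′ 1F ⇔′ 0F ∈′ 2 ↑ʳ a ∧′ ψ)) e
         (∀E (closureE n _ (axiom (separation φ)) id) a))
      (∧I (∀-map (♯ 0F) (⇒I (⇒E (∧E₁ (♯ 1F)) (♯ 0F))))
          (∀-map (♯ 0F) (⇒I (⇒I (⇒E (∧E₂ (♯ 2F)) (∧I (♯ 1F) (♯ 0F)))))))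
    where
    e : rename (lift 1 (lift 1 (a ◂ id))) (rename (lift 1 (lift 1 (lift 1 id))) (rename (0F ◂ (3 ↑ʳ_)) φ)) ≡
        rename (0F ◂ (2 ↑ʳ_)) φ
    e = trans (rename-∘ {h = lift 1 (lift 1 (a ◂ id))} lift-id (rename (0F ◂ (3 ↑ʳ_)) φ))
          (rename-∘ (λ { zero → refl ; (suc i) → refl }) φ)
      where
      lift-id : ∀ i → lift 1 (lift 1 (a ◂ id)) (lift 1 (lift 1 (lift 1 id)) i) ≡ lift 1 (lift 1 (a ◂ id)) i
      lift-id zero                = refl
      lift-id (suc zero)          = refl
      lift-id (suc (suc zero))    = refl
      lift-id (suc (suc (suc i))) = refl

  pair-mono : {f g : Fin n} → T ∣ Γ ⊢ f ⊆′ g → T ∣ Γ ⊢ ⟨ x , y ⟩∈′ f → T ∣ Γ ⊢ ⟨ x , y ⟩∈′ g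
  pair-mono d e = ∃∈E e (∃∈I _ 0F (∀∈E (wk-⊢ (↑ d)) 0F (♯ 1F)) (♯ 0F))

  InDomain : (a : Fin n) → Formula (suc n)
  InDomain a = ∃′∈[ suc a ] ∃′ IsOrderedPair 2F 1F 0F

  -- g is the restriction of f to a.
  module _ {f g a b w : Fin n} {Γ : List (Formula n)} where
    private
      Δ : List (Formula n)
      Δ = IsInjection f b w ∷ a ⊆′ b ∷ (∀′∈[ f ] (InDomain a ⇒′ 0F ∈′ suc g)) ∷ (∀′∈[ g ] (0F ∈′ suc f ∧′ InDomain a)) ∷ Γ

      g⊆f : ZF ∣ Δ ⊢ g ⊆′ f
      g⊆f = ∀∈I (∧E₁ (∀∈E (♯ 4F) 0F (♯ 0F)))

      pairs : ZF ∣ Δ ⊢ ∀′∈[ g ] InDomain a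
      pairs = ∀∈I (∧E₂ (∀∈E (♯ 4F) 0F (♯ 0F)))

      total : ZF ∣ Δ ⊢ ∀′∈[ a ] ∃′ ⟨ 1F , 0F ⟩∈′ 2 ↑ʳ g
      total = ∀∈I (∃E (∀∈E (∧E₁ (∧E₂ (∧E₁ (∧E₁ (♯ 1F))))) 0F (∀∈E (♯ 2F) 0F (♯ 0F)))
        (∃I _ 0F (∃∈E (♯ 0F) (∃∈I _ 0F
          (⇒E (∀∈E (♯ 6F) 0F (♯ 1F)) (∃∈I _ 2F (♯ 3F) (∃I _ 1F (♯ 0F)))) (♯ 0F)))))

      functional : ZF ∣ g ⊆′ f ∷ Δ ⊢ ∀′ ∀′ ∀′ (⟨ 2F , 1F ⟩∈′ 3 ↑ʳ g ∧′ ⟨ 2F , 0F ⟩∈′ 3 ↑ʳ g ⇒′ 1F ≐ 0F)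
      functional = ∀I (∀I (∀I (⇒I (⇒E (∀E (∀E (∀E (∧E₂ (∧E₂ (∧E₁ (∧E₁ (♯ 2F))))) 2F) 1F) 0F)
        (∧I (pair-mono (♯ 1F) (∧E₁ (♯ 0F))) (pair-mono (♯ 1F) (∧E₂ (♯ 0F))))))))

      range : ZF ∣ g ⊆′ f ∷ Δ ⊢ ∀′ ∀′ (⟨ 1F , 0F ⟩∈′ 2 ↑ʳ g ⇒′ 0F ∈′ 2 ↑ʳ w)
      range = ∀I (∀I (⇒I (⇒E (∀E (∀E (∧E₂ (∧E₁ (♯ 2F))) 1F) 0F) (pair-mono (♯ 1F) (♯ 0F)))))

      injective : ZF ∣ g ⊆′ f ∷ Δ ⊢ ∀′ ∀′ ∀′ (⟨ 2F , 0F ⟩∈′ 3 ↑ʳ g ∧′ ⟨ 1F , 0F ⟩∈′ 3 ↑ʳ g ⇒′ 2F ≐ 1F)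
      injective = ∀I (∀I (∀I (⇒I (⇒E (∀E (∀E (∀E (∧E₂ (♯ 2F)) 2F) 1F) 0F)
        (∧I (pair-mono (♯ 1F) (∧E₁ (♯ 0F))) (pair-mono (♯ 1F) (∧E₂ (♯ 0F))))))))

    restricted-injection : ZF ∣ Γ ⊢ (∀′∈[ g ] (0F ∈′ suc f ∧′ InDomain a)) ⇒′ (∀′∈[ f ] (InDomain a ⇒′ 0F ∈′ suc g)) ⇒′
                                    a ⊆′ b ⇒′ IsInjection f b w ⇒′ IsInjection g a w
    restricted-injection = ⇒I (⇒I (⇒I (⇒I
      (∧I (∧I (∧I pairs (∧I total (⇒E (⇒I functional) g⊆f))) (⇒E (⇒I range) g⊆f)) (⇒E (⇒I injective) g⊆f)))))

  countable-subset : (a b : Fin n) {Γ : List (Formula n)} → ZF ∣ Γ ⊢ a ⊆′ b ⇒′ IsCountable b ⇒′ IsCountable a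
  countable-subset a b = ⇒I (⇒I (∃E (♯ 0F) (∃E (♯ 0F) (∃E (separate (InDomain (2 ↑ʳ a)) 0F)
    (∃I _ 2F (∃I _ 0F (∧I (∧E₁ (♯ 1F))
      (⇒E (⇒E (⇒E (⇒E (restricted-injection {f = 1F} {g = 0F} {a = 3 ↑ʳ a} {b = 3 ↑ʳ b} {w = 2F})
        (∧E₁ (♯ 0F))) (∧E₂ (♯ 0F))) (♯ 4F)) (∧E₂ (♯ 1F))))))))))

  Completed : (P L A : Fin n) → Formula (suc n)
  Completed P L A = 0F ∈′ suc A ∨′ (∀′∈[ suc A ] ¬′ Compatible (2 ↑ʳ P) (2 ↑ʳ L) 1F 0F)

  -- D = A ∪ {p ∈ P : p is incompatible with all elements of A}
  module _ (P L A D : Fin n) {Γ : List (Formula n)} where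
    private
      Δ : List (Formula n)
      Δ = (∀′∈[ P ] (Completed P L A ⇒′ 0F ∈′ suc D)) ∷ (∀′∈[ D ] (0F ∈′ suc P ∧′ Completed P L A)) ∷
          IsAntichain P L A ∷ IsForcing P L ∷ Γ

    -- A condition incompatible with all of `A` belongs to `D` itself and is compatible with itself.
    completion-predense : ZF ∣ Γ ⊢ IsForcing P L ⇒′ IsAntichain P L A ⇒′
      (∀′∈[ D ] (0F ∈′ suc P ∧′ Completed P L A)) ⇒′ (∀′∈[ P ] (Completed P L A ⇒′ 0F ∈′ suc D)) ⇒′ IsPredense P L D
    completion-predense = ⇒I (⇒I (⇒I (⇒I (∧I (∀∈I (∧E₁ (∀∈E (♯ 2F) 0F (♯ 0F))))
      (∀∈I (∨E {φ = ∃′∈[ suc A ] Compatible (2 ↑ʳ P) (2 ↑ʳ L) 1F 0F} (⇒I (♯ 0F))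
        (∃∈E (♯ 0F) (∃∈I _ 0F (⇒E (∀∈E (♯ 4F) 0F (∀∈E (∧E₁ (♯ 6F)) 0F (♯ 1F))) (∨I₁ (♯ 1F))) (♯ 0F)))
        (∃∈I _ 0F
          (⇒E (∀∈E (♯ 2F) 0F (♯ 1F)) (∨I₂ (∀∈I (⇒I (⇒E (♯ 2F) (∃∈I _ 0F (♯ 1F) (♯ 0F)))))))
          (∃∈I _ 0F (♯ 1F) (∧I reflexive reflexive)))))))))
      where
      reflexive : ∀ {φ} → ZF ∣ φ ∷ 0F ∈′ suc P ∷ map weaken Δ ⊢ ⟨ 0F , 0F ⟩∈′ suc L
      reflexive = ∀∈E (∧E₁ (∧E₂ (♯ 5F))) 0F (♯ 1F)

    -- An element of `A` is compatible with some e ∈ E ⊆ D. So e is not incompatible with all of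
    -- `A`; hence it lies in `A`, and being compatible with the given element it is equal to it.
    antichain-⊆-predense : (E : Fin n) → ZF ∣ Γ ⊢ IsAntichain P L A ⇒′
      (∀′∈[ D ] (0F ∈′ suc P ∧′ Completed P L A)) ⇒′ E ⊆′ D ⇒′ IsPredense P L E ⇒′ A ⊆′ E
    antichain-⊆-predense E = ⇒I (⇒I (⇒I (⇒I (∀∈I (∃∈E (∀∈E (∧E₂ (♯ 1F)) 0F (∀∈E (∧E₁ (♯ 4F)) 0F (♯ 0F)))
      (∨E (∧E₂ (∀∈E (♯ 5F) 0F (∀∈E (♯ 4F) 0F (♯ 1F))))
        (≐E (0F ∈′ 3 ↑ʳ E) {0F} {1F}
          (raa (⇒E (⇒E (∀∈E (∀∈E (∧E₂ (♯ 8F)) 1F (♯ 4F)) 0F (♯ 1F))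
                       (⇒I (⇒E (♯ 1F) (≐E (0F ≐ 2F) (♯ 0F) ≐I))))
                   (♯ 2F)))
          (♯ 2F))
        (⊥E (⇒E (∀∈E (♯ 0F) 1F (♯ 3F))
                (∃∈E (♯ 1F) (∃∈I _ 0F (♯ 1F) (∧I (∧E₂ (♯ 0F)) (∧E₁ (♯ 0F)))))))))))))

  ccc₃⇒ccc₂ : ZF proves EveryForcing (λ P L → CCC₃ P L ⇒′ CCC₂ P L)
  ccc₃⇒ccc₂ = ∀I (∀I (⇒I (⇒I (∀I (⇒I (∃E (separate (Completed 2F 1F 0F) 2F)
    (∃E (⇒E (∀E (♯ 2F) 0F) (⇒E (⇒E (⇒E (⇒E (completion-predense 3F 2F 1F 0F) (♯ 3F)) (♯ 1F)) (∧E₁ (♯ 0F))) (∧E₂ (♯ 0F))))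
      (⇒E (⇒E (countable-subset 2F 0F)
        (⇒E (⇒E (⇒E (⇒E (antichain-⊆-predense 4F 3F 2F 1F 0F) (♯ 2F)) (∧E₁ (♯ 1F))) (∧E₁ (♯ 0F))) (∧E₂ (∧E₂ (♯ 0F)))))
        (∧E₁ (∧E₂ (♯ 0F)))))))))))

  ccc₂⇒ccc₁ : ZF proves EveryForcing (λ P L → CCC₂ P L ⇒′ CCC₁ P L)
  ccc₂⇒ccc₁ = ∀I (∀I (⇒I (⇒I (∀I (⇒I (⇒E (∀E (♯ 1F) 0F) (∧E₁ (♯ 0F))))))))

-- The two consistency statements

module Models (con : Consistent ZFC) where
  open HenkinZFC con using (zfc)
  open SymmetricExtension zfc
  module 𝐁 = BlockForcing 𝓝-ZF 𝒜

  selection : ∀ C → 𝐁.Selection C → Selection C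
  selection C (fun , sel) = fun , λ w h → sel w h >>= λ (a , i , e) → e >>= λ (x , j , e′) →
    ∃ᶜ-intro a (∃ᶜ-intro x (i , j , e′))

  no-full : ∀ C → 𝐁.Selection C → ¬ (∀ a → a ∈ᴺ 𝒜 → ∃ᶜ[ x ] 𝐍.‹ a , x › ∈ᴺ C)
  no-full C s = no-full-selection C (selection C s)

  countable : ∀ C → 𝐁.Selection C → 𝐍.Countable C
  countable C s = countable-selection C (selection C s)

  extend : ∀ {τ} → (∀ ρ → 𝐍.sat τ ρ) → Consistent (ZF+DC ∪ ｛ τ ｝)
  extend h = 𝐍.consistent λ where
    (inj₁ (inj₁ a))    → 𝐍.sat-ZF a
    (inj₁ (inj₂ refl)) → sat-DC
    (inj₂ refl)        → h

  ccc₁-not-ccc₂ : Consistent (ZF+DC ∪ ｛ SomeForcing (λ P L → CCC₁ P L ∧′ ¬′ CCC₂ P L) ｝)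
  ccc₁-not-ccc₂ = extend (𝐁.some-ccc₁-not-ccc₂ 𝒜-nonempty no-full countable)

  ccc₂-not-ccc₃ : Consistent (ZF+DC ∪ ｛ SomeForcing (λ P L → CCC₂ P L ∧′ ¬′ CCC₃ P L) ｝)
  ccc₂-not-ccc₃ = extend (𝐁.some-ccc₂-not-ccc₃ 𝒜-nonempty no-full countable)

mainTheorem1 : (ZF proves EveryForcing (λ P L → CCC₃ P L ⇒′ CCC₂ P L)) ×
    (ZF proves EveryForcing (λ P L → CCC₂ P L ⇒′ CCC₁ P L)) ×
    (Consistent ZFC →
    Consistent (ZF+DC ∪ ｛ SomeForcing (λ P L → CCC₁ P L ∧′ ¬′ CCC₂ P L) ｝) ×
    Consistent (ZF+DC ∪ ｛ SomeForcing (λ P L → CCC₂ P L ∧′ ¬′ CCC₃ P L) ｝))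
mainTheorem1 = Derivations.ccc₃⇒ccc₂ , Derivations.ccc₂⇒ccc₁ , λ con → Models.ccc₁-not-ccc₂ con , Models.ccc₂-not-ccc₃ con
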